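{- For every positive integer $n$, the Möbius homology associated with $V_n=\mathbb{Z}[\frac1{3n}][x,y]/(x^n,y^3-xy)$ is strictly more powerful, as an invariant of perfect matching graphs, than the $n$-bracket $\langle\cdot\rangle_n$. That is: the graded Poincaré polynomial $Mh_n(\Gamma_M)$ determines $\langle\Gamma_M\rangle_n$ (by setting $t=-1$), and there exist perfect matching graphs $\Gamma_M$ and $\Gamma'_{M'}$ with trivalent underlying graphs such that $\langle\Gamma_M\rangle_n=\langle\Gamma'_{M'}\rangle_n$ but $Mh_n(\Gamma_M)\ne Mh_n(\Gamma'_{M'})$.
   Context: **Ribbon graphs.** Graphs are finite undirected multigraphs, connected with nonempty edge set. An (oriented) ribbon graph is a graph $G$ embedded in an oriented compact surface with boundary that deformation retracts onto $G$; equivalently, $G$ with a cyclic order of the half-edges at each vertex. It is represented by a ribbon diagram: a drawing of $G$ in the plane with vertices as dots and edges as curves that may cross, inducing the given cyclic orders counterclockwise. A perfect matching graph $\Gamma_M$ is a ribbon graph with a perfect matching $M=\{e_1,\dots,e_\ell\}$ of its underlying graph (each vertex is incident to exactly one edge of $M$). **Smoothings, states, $n$-bracket.** Draw a matching edge $e$ of a trivalent perfect matching graph vertically, with the two other half-edges at its top vertex going up-left and up-right, and the two other half-edges at its bottom vertex going down-left and down-right. The 0-smoothing deletes $e$ and its endpoints and joins up-left with down-left and up-right with down-right; the 1-smoothing joins up-left with down-right and up-right with down-left. The $n$-bracket is determined by $\langle\Gamma_M\rangle_n=\langle\text{0-smoothing at }e\rangle_n-\langle\text{1-smoothing at }e\rangle_n$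 for every matching edge $e$, multiplicativity under disjoint union, and $$\langle\text{circle}\rangle_n=\begin{cases}2(2+2q^2+\dots+2q^{n-2}+qb+q^3b+\dots+q^{n-1}b)&n\text{ even},\\3(1+q+\dots+q^{n-1})&n\text{ odd},\end{cases}$$ where $q^n=1$ and (for $n$ even) $b^2=1$. For $\alpha\in\{0,1\}^\ell$, the state $\Gamma_\alpha$ is the collection of circles obtained by applying the $\alpha_i$-smoothing at each $e_i$; $k_\alpha$ is its number of circles, $|\alpha|=\sum\alpha_i$. **Möbius homology.** Let $R=\mathbb{Z}[\frac1{3n}]$, $V=V_n$ with basis $x^iy^j$ ($0\le i\le n-1$, $0\le j\le2$), graded by $\mathcal{G}=\mathbb{Z}/n\mathbb{Z}\times\mathbb{Z}/2\mathbb{Z}$ with $x^iy^j$ in degree $(2i+j,j)$ for $n$ even, and by $\mathcal{G}=\mathbb{Z}/n\mathbb{Z}$ with $x^iy^j$ in degree $2i+j$ for $n$ odd. Let $\mu_V$ be multiplication, $m_V(v)=v\cdot x^{(n-2)/2}y^2$ for $n$ even, $m_V(v)=v\cdot x^{(n-1)/2}y$ for $n$ odd, and $$\Delta_V(v)=-\tfrac1{3n}\sum_{i+j=n,\ i,j>0}(vx^i)\otimes x^j+\tfrac1{3n}\sum_{i+j=n-1}\big((vx^iy^2)\otimes x^j+(vx^iy)\otimes x^jy+(vx^i)\otimes x^jy^2\big).$$ Put $C^{i}(\Gamma_M)=\bigoplus_{|\alpha|=i}V^{\otimes k_\alpha}$, with tensor factors indexed by the circles of $\Gamma_\alpha$.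 If $\alpha'$ arises from $\alpha$ by changing one entry 0 to 1, $\partial_{\alpha\alpha'}$ is $\mu_V$ if two circles merge, $\Delta_V$ if one circle splits into two, $m_V$ if one circle is changed into one circle, on the affected factors, and the identity on the others. The differential is $\partial^i(v)=\sum_{\alpha'}(-1)^{f_{\alpha\alpha'}}\partial_{\alpha\alpha'}(v)$ for $v\in V^{\otimes k_\alpha}$, where $f_{\alpha\alpha'}$ is the number of entries 1 to the left of the changed entry; it preserves the $\mathcal{G}$-grading. The homology is the Möbius homology $MH_n^{i,g}(\Gamma_M;R)$, and $Mh_n(\Gamma_M)=\sum_it^i\,q\mathrm{dim}\,MH_n^{i,*}(\Gamma_M;R)$, where $q\mathrm{dim}$ sums ranks of graded pieces times $q^ab^\epsilon$ in degree $(a,\epsilon)$ ($n$ even), or times $q^a$ in degree $a$ ($n$ odd). -}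

module Defs where

open import Algebra.Bundles using (Ring; CommutativeMonoid; CommutativeRing; RawRing)
open import Algebra.Module.Bundles using (LeftModule)
import Algebra.Module.Morphism.Structures as Morphism
import Algebra.Morphism.RingMonomorphism as RingMono
import Algebra.Properties.AbelianGroup as AbelianGroupProperties
import Algebra.Properties.CommutativeMonoid.Sum as MonoidSum
import Algebra.Properties.CommutativeSemigroup as CommutativeSemigroupProperties
import Algebra.Properties.Semiring.Exp as Exp
import Algebra.Properties.Semiring.Sum as Sum
open import Data.Bool.Base using (Bool; true; false; if_then_else_)
open import Data.Empty using (⊥-elim)
open import Data.Fin.Base as Fin using (Fin; zero; suc; toℕ; combine; remQuot; punchIn; punchOut)
open import Data.Fin.Patterns using (0F; 1F; 2F; 3F)
open import Data.Fin.Permutation using (Permutation′; _⟨$⟩ʳ_; _⟨$⟩ˡ_)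
open import Data.Fin.Properties as Finₚ using (punchOut-cong; punchOut-injective; punchInᵢ≢i; punchOut-punchIn)
open import Data.Fin.Subset using (∣_∣)
open import Data.Integer.Base as ℤ using (ℤ; +_)
import Data.Integer.Properties as ℤₚ
open import Data.List.Base as List using (List; []; _∷_; length; filter; foldr; allFin; cartesianProduct)
open import Data.List.Membership.Propositional using (_∈_)
open import Data.List.Membership.Propositional.Properties using (∈-filter⁺; ∈-filter⁻; ∈-allFin; ∈-cartesianProduct⁺)
open import Data.List.Relation.Unary.Any using (here; there)
open import Data.Nat.Base as ℕ using (ℕ; zero; suc; NonZero; parity; ⌊_/2⌋)
import Data.Nat.Properties as ℕₚ
open import Data.Nat.DivMod using (_mod_)
open import Data.Parity.Base using (Parity; 0ℙ; 1ℙ)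
open import Data.Product.Base using (Σ; ∃; ∃₂; _×_; _,_; proj₁; proj₂)
open import Data.Product using (∃!)
open import Data.Product.Properties using (≡-dec)
open import Data.Rational.Base as ℚ using (ℚ)
import Data.Rational.Properties as ℚₚ
import Data.Rational.Unnormalised.Base as ℚᵘ
import Data.Rational.Unnormalised.Properties as ℚᵘₚ
open import Data.Sum.Base using (_⊎_; inj₁; inj₂)
open import Data.Vec.Base using (Vec; []; _∷_; lookup; tabulate; _[_]≔_)
open import Data.Vec.Properties using (lookup∘tabulate)
open import Function.Base using (_∘_; _on_; id)
open import Level using (0ℓ)
open import Relation.Binary.Construct.Closure.Equivalence as Eq using (EqClosure)
open import Relation.Binary.Construct.Closure.ReflexiveTransitive using (Star)
import Relation.Binary.Construct.On as On
open import Relation.Binary.Core using (Rel)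
open import Relation.Binary.Definitions using (Decidable)
open import Relation.Binary.PropositionalEquality as ≡ using (_≡_; _≢_; refl; sym; trans; cong; cong₂)
open import Relation.Nullary using (¬_; Dec; yes; no; does)
open import Relation.Nullary.Decidable using (_×-dec_; _⊎-dec_; _→-dec_; ¬?)

ℤ⇒ℚ : ℤ → ℚ
ℤ⇒ℚ a = a ℚ./ 1

_∈ℤ[1/_] : ℚ → ℕ → Set
r ∈ℤ[1/ m ] = ∃₂ λ (k : ℕ) (a : ℤ) → r ℚ.* ℤ⇒ℚ (+ (m ℕ.^ k)) ≡ ℤ⇒ℚ a

ℤ⇒ℚ-≃ : ∀ a → ℚ.toℚᵘ (ℤ⇒ℚ a) ℚᵘ.≃ ℚᵘ.mkℚᵘ a 0
ℤ⇒ℚ-≃ a = ℚₚ.toℚᵘ-fromℚᵘ (ℚᵘ.mkℚᵘ a 0)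

ℤ⇒ℚ-+ : ∀ a b → ℤ⇒ℚ a ℚ.+ ℤ⇒ℚ b ≡ ℤ⇒ℚ (a ℤ.+ b)
ℤ⇒ℚ-+ a b = ℚₚ.toℚᵘ-injective (begin
  ℚ.toℚᵘ (ℤ⇒ℚ a ℚ.+ ℤ⇒ℚ b)                 ≈⟨ ℚₚ.toℚᵘ-homo-+ (ℤ⇒ℚ a) (ℤ⇒ℚ b) ⟩
  ℚ.toℚᵘ (ℤ⇒ℚ a) ℚᵘ.+ ℚ.toℚᵘ (ℤ⇒ℚ b)      ≈⟨ ℚᵘₚ.+-cong (ℤ⇒ℚ-≃ a) (ℤ⇒ℚ-≃ b) ⟩
  ℚᵘ.mkℚᵘ a 0 ℚᵘ.+ ℚᵘ.mkℚᵘ b 0            ≈⟨ ℚᵘ.*≡* (cong (ℤ._* + 1) (cong₂ ℤ._+_ (ℤₚ.*-identityʳ a) (ℤₚ.*-identityʳ b))) ⟩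
  ℚᵘ.mkℚᵘ (a ℤ.+ b) 0                     ≈⟨ ℚᵘₚ.≃-sym (ℤ⇒ℚ-≃ (a ℤ.+ b)) ⟩
  ℚ.toℚᵘ (ℤ⇒ℚ (a ℤ.+ b))                  ∎)
  where open ℚᵘₚ.≃-Reasoning

ℤ⇒ℚ-* : ∀ a b → ℤ⇒ℚ a ℚ.* ℤ⇒ℚ b ≡ ℤ⇒ℚ (a ℤ.* b)
ℤ⇒ℚ-* a b = ℚₚ.toℚᵘ-injective (begin
  ℚ.toℚᵘ (ℤ⇒ℚ a ℚ.* ℤ⇒ℚ b)                 ≈⟨ ℚₚ.toℚᵘ-homo-* (ℤ⇒ℚ a) (ℤ⇒ℚ b) ⟩
  ℚ.toℚᵘ (ℤ⇒ℚ a) ℚᵘ.* ℚ.toℚᵘ (ℤ⇒ℚ b)      ≈⟨ ℚᵘₚ.*-cong (ℤ⇒ℚ-≃ a) (ℤ⇒ℚ-≃ b) ⟩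
  ℚᵘ.mkℚᵘ a 0 ℚᵘ.* ℚᵘ.mkℚᵘ b 0            ≈⟨ ℚᵘ.*≡* refl ⟩
  ℚᵘ.mkℚᵘ (a ℤ.* b) 0                     ≈⟨ ℚᵘₚ.≃-sym (ℤ⇒ℚ-≃ (a ℤ.* b)) ⟩
  ℚ.toℚᵘ (ℤ⇒ℚ (a ℤ.* b))                  ∎)
  where open ℚᵘₚ.≃-Reasoning

ℤ⇒ℚ-neg : ∀ a → ℚ.- ℤ⇒ℚ a ≡ ℤ⇒ℚ (ℤ.- a)
ℤ⇒ℚ-neg a = ℚₚ.toℚᵘ-injective (begin
  ℚ.toℚᵘ (ℚ.- ℤ⇒ℚ a)          ≈⟨ ℚₚ.toℚᵘ-homo‿- (ℤ⇒ℚ a) ⟩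
  ℚᵘ.- ℚ.toℚᵘ (ℤ⇒ℚ a)         ≈⟨ ℚᵘₚ.-‿cong (ℤ⇒ℚ-≃ a) ⟩
  ℚᵘ.- ℚᵘ.mkℚᵘ a 0            ≈⟨ ℚᵘₚ.≃-sym (ℤ⇒ℚ-≃ (ℤ.- a)) ⟩
  ℚ.toℚᵘ (ℤ⇒ℚ (ℤ.- a))        ∎)
  where open ℚᵘₚ.≃-Reasoning

ℤ⇒ℚ-^ : ∀ m k l → ℤ⇒ℚ (+ (m ℕ.^ (k ℕ.+ l))) ≡ ℤ⇒ℚ (+ (m ℕ.^ k)) ℚ.* ℤ⇒ℚ (+ (m ℕ.^ l))
ℤ⇒ℚ-^ m k l = trans
  (cong ℤ⇒ℚ (trans (cong +_ (ℕₚ.^-distribˡ-+-* m k l)) (ℤₚ.pos-* (m ℕ.^ k) (m ℕ.^ l))))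
  (sym (ℤ⇒ℚ-* (+ (m ℕ.^ k)) (+ (m ℕ.^ l))))

∈-+ : ∀ m {r s} → r ∈ℤ[1/ m ] → s ∈ℤ[1/ m ] → (r ℚ.+ s) ∈ℤ[1/ m ]
∈-+ m {r} {s} (k , a , p) (l , b , q) = k ℕ.+ l , a ℤ.* + (m ℕ.^ l) ℤ.+ b ℤ.* + (m ℕ.^ k) , (begin
  (r ℚ.+ s) ℚ.* M (k ℕ.+ l)                          ≡⟨ cong ((r ℚ.+ s) ℚ.*_) (ℤ⇒ℚ-^ m k l) ⟩
  (r ℚ.+ s) ℚ.* (M k ℚ.* M l)                        ≡⟨ ℚₚ.*-distribʳ-+ (M k ℚ.* M l) r s ⟩
  r ℚ.* (M k ℚ.* M l) ℚ.+ s ℚ.* (M k ℚ.* M l)        ≡⟨ cong₂ ℚ._+_ (sym (ℚₚ.*-assoc r (M k) (M l))) (trans (cong (s ℚ.*_) (ℚₚ.*-comm (M k) (M l))) (sym (ℚₚ.*-assoc s (M l) (M k)))) ⟩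
  (r ℚ.* M k) ℚ.* M l ℚ.+ (s ℚ.* M l) ℚ.* M k        ≡⟨ cong₂ (λ x y → x ℚ.* M l ℚ.+ y ℚ.* M k) p q ⟩
  ℤ⇒ℚ a ℚ.* M l ℚ.+ ℤ⇒ℚ b ℚ.* M k                    ≡⟨ cong₂ ℚ._+_ (ℤ⇒ℚ-* a (+ (m ℕ.^ l))) (ℤ⇒ℚ-* b (+ (m ℕ.^ k))) ⟩
  ℤ⇒ℚ (a ℤ.* + (m ℕ.^ l)) ℚ.+ ℤ⇒ℚ (b ℤ.* + (m ℕ.^ k)) ≡⟨ ℤ⇒ℚ-+ (a ℤ.* + (m ℕ.^ l)) (b ℤ.* + (m ℕ.^ k)) ⟩
  ℤ⇒ℚ (a ℤ.* + (m ℕ.^ l) ℤ.+ b ℤ.* + (m ℕ.^ k))      ∎)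
  where
  open ≡.≡-Reasoning
  M : ℕ → ℚ
  M j = ℤ⇒ℚ (+ (m ℕ.^ j))

∈-* : ∀ m {r s} → r ∈ℤ[1/ m ] → s ∈ℤ[1/ m ] → (r ℚ.* s) ∈ℤ[1/ m ]
∈-* m {r} {s} (k , a , p) (l , b , q) = k ℕ.+ l , a ℤ.* b , (begin
  (r ℚ.* s) ℚ.* M (k ℕ.+ l)        ≡⟨ cong ((r ℚ.* s) ℚ.*_) (ℤ⇒ℚ-^ m k l) ⟩
  (r ℚ.* s) ℚ.* (M k ℚ.* M l)      ≡⟨ ℚₚ.*-assoc r s (M k ℚ.* M l) ⟩
  r ℚ.* (s ℚ.* (M k ℚ.* M l))      ≡⟨ cong (λ x → r ℚ.* (s ℚ.* x)) (ℚₚ.*-comm (M k) (M l)) ⟩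
  r ℚ.* (s ℚ.* (M l ℚ.* M k))      ≡⟨ cong (r ℚ.*_) (sym (ℚₚ.*-assoc s (M l) (M k))) ⟩
  r ℚ.* ((s ℚ.* M l) ℚ.* M k)      ≡⟨ cong (r ℚ.*_) (ℚₚ.*-comm (s ℚ.* M l) (M k)) ⟩
  r ℚ.* (M k ℚ.* (s ℚ.* M l))      ≡⟨ sym (ℚₚ.*-assoc r (M k) (s ℚ.* M l)) ⟩
  (r ℚ.* M k) ℚ.* (s ℚ.* M l)      ≡⟨ cong₂ ℚ._*_ p q ⟩
  ℤ⇒ℚ a ℚ.* ℤ⇒ℚ b                  ≡⟨ ℤ⇒ℚ-* a b ⟩
  ℤ⇒ℚ (a ℤ.* b)                    ∎)
  where
  open ≡.≡-Reasoning
  M : ℕ → ℚ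
  M j = ℤ⇒ℚ (+ (m ℕ.^ j))

∈-neg : ∀ m {r} → r ∈ℤ[1/ m ] → (ℚ.- r) ∈ℤ[1/ m ]
∈-neg m {r} (k , a , p) = k , ℤ.- a ,
  trans (sym (ℚₚ.neg-distribˡ-* r (ℤ⇒ℚ (+ (m ℕ.^ k))))) (trans (cong ℚ.-_ p) (ℤ⇒ℚ-neg a))

∈-ℤ : ∀ m a → ℤ⇒ℚ a ∈ℤ[1/ m ]
∈-ℤ m a = 0 , a , ℚₚ.*-identityʳ (ℤ⇒ℚ a)

∈-1/ : ∀ m .{{_ : NonZero m}} → (+ 1 ℚ./ m) ∈ℤ[1/ m ]
∈-1/ m@(suc m-1) = 1 , + 1 , ℚₚ.toℚᵘ-injective (begin
  ℚ.toℚᵘ ((+ 1 ℚ./ m) ℚ.* ℤ⇒ℚ (+ (m ℕ.^ 1)))               ≈⟨ ℚₚ.toℚᵘ-homo-* (+ 1 ℚ./ m) (ℤ⇒ℚ (+ (m ℕ.^ 1))) ⟩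
  ℚ.toℚᵘ (+ 1 ℚ./ m) ℚᵘ.* ℚ.toℚᵘ (ℤ⇒ℚ (+ (m ℕ.^ 1)))      ≈⟨ ℚᵘₚ.*-cong (ℚₚ.toℚᵘ-fromℚᵘ (ℚᵘ.mkℚᵘ (+ 1) m-1)) (ℤ⇒ℚ-≃ (+ (m ℕ.^ 1))) ⟩
  ℚᵘ.mkℚᵘ (+ 1) m-1 ℚᵘ.* ℚᵘ.mkℚᵘ (+ (m ℕ.^ 1)) 0          ≈⟨ ℚᵘ.*≡* lemma ⟩
  ℚᵘ.mkℚᵘ (+ 1) 0                                         ≈⟨ ℚᵘₚ.≃-sym (ℤ⇒ℚ-≃ (+ 1)) ⟩
  ℚ.toℚᵘ (ℤ⇒ℚ (+ 1))                                      ∎)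
  where
  open ℚᵘₚ.≃-Reasoning
  lemma : (+ 1 ℤ.* + (m ℕ.^ 1)) ℤ.* + 1 ≡ + 1 ℤ.* (+ m ℤ.* + 1)
  lemma = trans (ℤₚ.*-assoc (+ 1) (+ (m ℕ.^ 1)) (+ 1))
                (cong (λ x → + 1 ℤ.* (+ x ℤ.* + 1)) (ℕₚ.*-identityʳ m))

module _ (m : ℕ) where

  private
    rawRing : RawRing 0ℓ 0ℓ
    rawRing = record
      { Carrier = Σ ℚ _∈ℤ[1/ m ]
      ; _≈_     = _≡_ on proj₁
      ; _+_     = λ (r , p) (s , q) → r ℚ.+ s , ∈-+ m {r} {s} p q
      ; _*_     = λ (r , p) (s , q) → r ℚ.* s , ∈-* m {r} {s} p q
      ; -_      = λ (r , p) → ℚ.- r , ∈-neg m {r} p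
      ; 0#      = ℤ⇒ℚ (+ 0) , ∈-ℤ m (+ 0)
      ; 1#      = ℤ⇒ℚ (+ 1) , ∈-ℤ m (+ 1)
      }

  ℤ[1/_] : .{{NonZero m}} → CommutativeRing 0ℓ 0ℓ
  ℤ[1/_] = record
    { RawRing rawRing
    ; isCommutativeRing = RingMono.isCommutativeRing mono ℚₚ.+-*-isCommutativeRing
    }
    where
    open import Algebra.Morphism.Structures using (module RingMorphisms)
    open RingMorphisms rawRing ℚ.+-*-rawRing
    mono : IsRingMonomorphism proj₁
    mono = record
      { isRingHomomorphism = record
        { isSemiringHomomorphism = record
          { isNearSemiringHomomorphism = record
            { +-isMonoidHomomorphism = record
              { isMagmaHomomorphism = record
                { isRelHomomorphism = record { cong = id }
                ; homo = λ _ _ → refl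
                }
              ; ε-homo = refl
              }
            ; *-homo = λ _ _ → refl
            }
          ; 1#-homo = refl
          }
        ; -‿homo = λ _ → refl
        }
      ; injective = id
      }

  reciprocal : .{{_ : NonZero m}} → CommutativeRing.Carrier ℤ[1/_]
  reciprocal = + 1 ℚ./ m , ∈-1/ m

module _ {ring : Ring 0ℓ 0ℓ} (M : LeftModule ring 0ℓ 0ℓ) where

  open Ring ring using (Carrier; _≈_; 0#)
  open LeftModule M
  open MonoidSum +ᴹ-commutativeMonoid using (sum)

  LinearlyIndependent : ∀ {r} → (Fin r → Carrierᴹ) → Set
  LinearlyIndependent {r} v =
    ∀ (c : Fin r → Carrier) → sum (λ i → c i *ₗ v i) ≈ᴹ 0ᴹ → ∀ i → c i ≈ 0#

  -- r is the largest size of a linearly independent family.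
  HasRank : ℕ → Set
  HasRank r = ∃ (LinearlyIndependent {r}) ×
              (∀ {s} (v : Fin s → Carrierᴹ) → LinearlyIndependent v → s ℕ.≤ r)

  rank-unique : ∀ {r s} → HasRank r → HasRank s → r ≡ s
  rank-unique ((v , v-li) , r-max) ((w , w-li) , s-max) =
    ℕₚ.≤-antisym (s-max v v-li) (r-max w w-li)

  record Submodule : Set₁ where
    field
      Member : Carrierᴹ → Set
      0-mem  : Member 0ᴹ
      +-mem  : ∀ {v w} → Member v → Member w → Member (v +ᴹ w)
      neg-mem : ∀ {v} → Member v → Member (-ᴹ v)
      *-mem  : ∀ c {v} → Member v → Member (c *ₗ v)

  IsLinear : (Carrierᴹ → Carrierᴹ) → Set
  IsLinear = Morphism.LeftModuleMorphisms.IsLeftModuleHomomorphism rawLeftModule rawLeftModule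

  isLinear : ∀ {f} → (∀ {v w} → v ≈ᴹ w → f v ≈ᴹ f w) →
             (∀ v w → f (v +ᴹ w) ≈ᴹ f v +ᴹ f w) →
             (∀ c v → f (c *ₗ v) ≈ᴹ c *ₗ f v) → IsLinear f
  isLinear {f} f-cong f-+ f-* = record
    { +ᴹ-isGroupHomomorphism = record
      { isMonoidHomomorphism = record
        { isMagmaHomomorphism = record
          { isRelHomomorphism = record { cong = f-cong }
          ; homo = f-+
          }
        ; ε-homo = f-0
        }
      ; ⁻¹-homo = λ v → inverseˡ-unique (f (-ᴹ v)) (f v)
          (≈ᴹ-trans (≈ᴹ-sym (f-+ (-ᴹ v) v)) (≈ᴹ-trans (f-cong (-ᴹ‿inverseˡ v)) f-0))
      }
    ; *ₗ-homo = f-*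
    }
    where
    open AbelianGroupProperties +ᴹ-abelianGroup using (inverseˡ-unique)
    f-0 : f 0ᴹ ≈ᴹ 0ᴹ
    f-0 = ≈ᴹ-trans (f-cong (≈ᴹ-sym (*ₗ-zeroˡ 0ᴹ))) (≈ᴹ-trans (f-* 0# 0ᴹ) (*ₗ-zeroˡ (f 0ᴹ)))

  -- (Z ∩ ker ∂) / ∂ B.  Nothing is assumed about ∂ ∘ ∂: two cycles are
  -- identified when they differ by an element of ∂ B.
  module _ (Z B : Submodule) {∂ : Carrierᴹ → Carrierᴹ} (∂-linear : IsLinear ∂) where

    open Morphism.LeftModuleMorphisms.IsLeftModuleHomomorphism ∂-linear
    private
      module Z = Submodule Z
      module B = Submodule B
    open AbelianGroupProperties +ᴹ-abelianGroup using (⁻¹-∙-comm; ε⁻¹≈ε)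
    open CommutativeSemigroupProperties
      (CommutativeMonoid.commutativeSemigroup +ᴹ-commutativeMonoid)
      using (interchange)
    open import Relation.Binary.Reasoning.Setoid ≈ᴹ-setoid

    record Cycle : Set where
      constructor cycle
      field
        chain  : Carrierᴹ
        member : Z.Member chain
        closed : ∂ chain ≈ᴹ 0ᴹ
    open Cycle

    record _Homologous_ (v w : Cycle) : Set where
      constructor by
      field
        bounding   : Carrierᴹ
        member     : B.Member bounding
        difference : chain v ≈ᴹ chain w +ᴹ ∂ bounding

    private
      equal : ∀ {v w} → chain v ≈ᴹ chain w → v Homologous w
      equal {w = w} v≈w = by 0ᴹ B.0-mem (≈ᴹ-trans v≈w
        (≈ᴹ-sym (≈ᴹ-trans (+ᴹ-congˡ 0ᴹ-homo) (+ᴹ-identityʳ (chain w)))))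

      flipped : ∀ {v w} → v Homologous w → w Homologous v
      flipped {v} {w} (by u m d) = by (-ᴹ u) (B.neg-mem m) (begin
        chain w                             ≈⟨ +ᴹ-identityʳ (chain w) ⟨
        chain w +ᴹ 0ᴹ                       ≈⟨ +ᴹ-congˡ (-ᴹ‿inverseʳ (∂ u)) ⟨
        chain w +ᴹ (∂ u +ᴹ -ᴹ ∂ u)          ≈⟨ +ᴹ-assoc (chain w) (∂ u) (-ᴹ ∂ u) ⟨
        (chain w +ᴹ ∂ u) +ᴹ -ᴹ ∂ u          ≈⟨ +ᴹ-cong d (-ᴹ-homo u) ⟨
        chain v +ᴹ ∂ (-ᴹ u)                 ∎)

      composed : ∀ {v w x} → v Homologous w → w Homologous x → v Homologous x
      composed {v} {w} {x} (by u m d) (by u′ m′ d′) = by (u′ +ᴹ u) (B.+-mem m′ m) (begin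
        chain v                      ≈⟨ d ⟩
        chain w +ᴹ ∂ u               ≈⟨ +ᴹ-congʳ d′ ⟩
        (chain x +ᴹ ∂ u′) +ᴹ ∂ u     ≈⟨ +ᴹ-assoc (chain x) (∂ u′) (∂ u) ⟩
        chain x +ᴹ (∂ u′ +ᴹ ∂ u)     ≈⟨ +ᴹ-congˡ (+ᴹ-homo u′ u) ⟨
        chain x +ᴹ ∂ (u′ +ᴹ u)       ∎)

      _⊞_ : Cycle → Cycle → Cycle
      cycle v m c ⊞ cycle w m′ c′ = cycle (v +ᴹ w) (Z.+-mem m m′)
        (≈ᴹ-trans (+ᴹ-homo v w) (≈ᴹ-trans (+ᴹ-cong c c′) (+ᴹ-identityˡ 0ᴹ)))

      ⊟_ : Cycle → Cycle
      ⊟ cycle v m c = cycle (-ᴹ v) (Z.neg-mem m)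
        (≈ᴹ-trans (-ᴹ-homo v) (≈ᴹ-trans (-ᴹ‿cong c) ε⁻¹≈ε))

      _⊡_ : Carrier → Cycle → Cycle
      a ⊡ cycle v m c = cycle (a *ₗ v) (Z.*-mem a m)
        (≈ᴹ-trans (*ₗ-homo a v) (≈ᴹ-trans (*ₗ-congˡ c) (*ₗ-zeroʳ a)))

      ⊞-cong : ∀ {v v′ w w′} → v Homologous v′ → w Homologous w′ → (v ⊞ w) Homologous (v′ ⊞ w′)
      ⊞-cong {v} {v′} {w} {w′} (by u m d) (by u′ m′ d′) = by (u +ᴹ u′) (B.+-mem m m′) (begin
        chain v +ᴹ chain w                              ≈⟨ +ᴹ-cong d d′ ⟩
        (chain v′ +ᴹ ∂ u) +ᴹ (chain w′ +ᴹ ∂ u′)         ≈⟨ interchange _ _ _ _ ⟩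
        (chain v′ +ᴹ chain w′) +ᴹ (∂ u +ᴹ ∂ u′)         ≈⟨ +ᴹ-congˡ (+ᴹ-homo u u′) ⟨
        (chain v′ +ᴹ chain w′) +ᴹ ∂ (u +ᴹ u′)           ∎)

      ⊟-cong : ∀ {v w} → v Homologous w → (⊟ v) Homologous (⊟ w)
      ⊟-cong {v} {w} (by u m d) = by (-ᴹ u) (B.neg-mem m) (begin
        -ᴹ chain v                     ≈⟨ -ᴹ‿cong d ⟩
        -ᴹ (chain w +ᴹ ∂ u)            ≈⟨ ⁻¹-∙-comm (chain w) (∂ u) ⟨
        -ᴹ chain w +ᴹ -ᴹ ∂ u           ≈⟨ +ᴹ-congˡ (-ᴹ-homo u) ⟨
        -ᴹ chain w +ᴹ ∂ (-ᴹ u)         ∎)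

      ⊡-cong : ∀ {a b v w} → a ≈ b → v Homologous w → (a ⊡ v) Homologous (b ⊡ w)
      ⊡-cong {a} {b} {v} {w} a≈b (by u m d) = by (b *ₗ u) (B.*-mem b m) (begin
        a *ₗ chain v                     ≈⟨ *ₗ-cong a≈b d ⟩
        b *ₗ (chain w +ᴹ ∂ u)            ≈⟨ *ₗ-distribˡ b (chain w) (∂ u) ⟩
        b *ₗ chain w +ᴹ b *ₗ ∂ u         ≈⟨ +ᴹ-congˡ (*ₗ-homo b u) ⟨
        b *ₗ chain w +ᴹ ∂ (b *ₗ u)       ∎)

    homology : LeftModule ring 0ℓ 0ℓ
    homology = record
      { Carrierᴹ = Cycle
      ; _≈ᴹ_ = _Homologous_
      ; _+ᴹ_ = _⊞_
      ; _*ₗ_ = _⊡_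
      ; 0ᴹ   = cycle 0ᴹ Z.0-mem 0ᴹ-homo
      ; -ᴹ_  = ⊟_
      ; isLeftModule = record
        { isLeftSemimodule = record
          { +ᴹ-isCommutativeMonoid = record
            { isMonoid = record
              { isSemigroup = record
                { isMagma = record
                  { isEquivalence = record { refl = equal ≈ᴹ-refl ; sym = flipped ; trans = composed }
                  ; ∙-cong = ⊞-cong
                  }
                ; assoc = λ u v w → equal (+ᴹ-assoc (chain u) (chain v) (chain w))
                }
              ; identity = (λ v → equal (+ᴹ-identityˡ (chain v))) , (λ v → equal (+ᴹ-identityʳ (chain v)))
              }
            ; comm = λ v w → equal (+ᴹ-comm (chain v) (chain w))
            }
          ; isPreleftSemimodule = record
            { *ₗ-cong      = ⊡-cong
            ; *ₗ-zeroˡ     = λ v → equal (*ₗ-zeroˡ (chain v))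
            ; *ₗ-distribʳ  = λ v a b → equal (*ₗ-distribʳ (chain v) a b)
            ; *ₗ-identityˡ = λ v → equal (*ₗ-identityˡ (chain v))
            ; *ₗ-assoc     = λ a b v → equal (*ₗ-assoc a b (chain v))
            ; *ₗ-zeroʳ     = λ a → equal (*ₗ-zeroʳ a)
            ; *ₗ-distribˡ  = λ a v w → equal (*ₗ-distribˡ a (chain v) (chain w))
            }
          }
        ; -ᴹ‿cong = ⊟-cong
        ; -ᴹ‿inverse = (λ v → equal (-ᴹ‿inverseˡ (chain v))) , (λ v → equal (-ᴹ‿inverseʳ (chain v)))
        }
      }

-- Quotients of Fin m by the equivalence relation generated by a
-- decidable relation
record Quotient {m : ℕ} (_~_ : Rel (Fin m) 0ℓ) : Set where
  field
    size       : ℕ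
    class      : Fin m → Fin size
    surjective : ∀ c → ∃ λ p → class p ≡ c
    sound      : ∀ {p q} → EqClosure _~_ p q → class p ≡ class q
    complete   : ∀ {p q} → class p ≡ class q → EqClosure _~_ p q

private
  module _ {m : ℕ} where

    Listed : List (Fin m × Fin m) → Rel (Fin m) 0ℓ
    Listed ps p q = (p , q) ∈ ps

    generators-sound : ∀ {k} {_~_ : Rel (Fin m) 0ℓ} (f : Fin m → Fin k) →
      (∀ {p q} → p ~ q → f p ≡ f q) → ∀ {p q} → EqClosure _~_ p q → f p ≡ f q
    generators-sound f = Eq.fold (On.isEquivalence f ≡.isEquivalence)

    tabulated : ∀ {ps k} (f : Fin m → Fin k) → (∀ c → ∃ λ p → f p ≡ c) →
      (∀ {p q} → Listed ps p q → f p ≡ f q) →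
      (∀ {p q} → f p ≡ f q → EqClosure (Listed ps) p q) → Quotient (Listed ps)
    tabulated {k = k} f f-surj f-sound f-complete = record
      { size       = k
      ; class      = lookup table
      ; surjective = λ c → let (p , e) = f-surj c in p , trans (look p) e
      ; sound      = λ {p} {q} r → trans (look p) (trans (generators-sound f f-sound r) (sym (look q)))
      ; complete   = λ {p} {q} e → f-complete (trans (sym (look p)) (trans e (look q)))
      }
      where
      table : Vec (Fin k) m
      table = tabulate f
      look : ∀ p → lookup table p ≡ f p
      look = lookup∘tabulate f

    merge : ∀ {k} {a b : Fin (suc k)} → b ≢ a → Fin (suc k) → Fin k
    merge {a = a} {b} b≢a x with b Finₚ.≟ x
    ... | yes _  = punchOut b≢a
    ... | no b≢x = punchOut b≢x

    merge-other : ∀ {k} {a b : Fin (suc k)} (b≢a : b ≢ a) {x} (b≢x : b ≢ x) → merge b≢a x ≡ punchOut b≢x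
    merge-other {b = b} b≢a {x} b≢x with b Finₚ.≟ x
    ... | yes e = ⊥-elim (b≢x e)
    ... | no _  = punchOut-cong b refl

    merge-same : ∀ {k} {a b : Fin (suc k)} (b≢a : b ≢ a) → merge b≢a a ≡ merge b≢a b
    merge-same {a = a} {b} b≢a with b Finₚ.≟ b
    ... | yes _ = merge-other b≢a b≢a
    ... | no ¬e = ⊥-elim (¬e refl)

    merge-fibre : ∀ {k} {a b : Fin (suc k)} (b≢a : b ≢ a) {x y} → merge b≢a x ≡ merge b≢a y →
      x ≡ y ⊎ (x ≡ a × y ≡ b) ⊎ (x ≡ b × y ≡ a)
    merge-fibre {a = a} {b} b≢a {x} {y} e with b Finₚ.≟ x | b Finₚ.≟ y
    ... | yes p | yes q = inj₁ (trans (sym p) q)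
    ... | yes p | no q  = inj₂ (inj₂ (sym p , sym (punchOut-injective b≢a q e)))
    ... | no p  | yes q = inj₂ (inj₁ (punchOut-injective p b≢a e , sym q))
    ... | no p  | no q  = inj₁ (punchOut-injective p q e)

    weaken : ∀ {ps pq p q} → EqClosure (Listed ps) p q → EqClosure (Listed (pq ∷ ps)) p q
    weaken = Eq.map there

    link : ∀ {ps} ((a , b) : Fin m × Fin m) → (Q : Quotient (Listed ps)) → Quotient (Listed ((a , b) ∷ ps))
    link (a , b) record { size = zero ; class = class } with class a
    ... | ()
    link {ps} (a , b) record { size = suc k ; class = class ; surjective = surjective ; sound = sound ; complete = complete }
      with class b Finₚ.≟ class a
    ... | yes e = tabulated class surjective
      (λ { (here refl) → sym e ; (there r) → sound (Eq.return r) })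
      (weaken ∘ complete)
    ... | no b≢a = tabulated (merge b≢a ∘ class)
      (λ c → let (p , e) = surjective (punchIn (class b) c) in
        p , trans (cong (merge b≢a) e)
              (trans (merge-other b≢a (punchInᵢ≢i (class b) c ∘ sym)) (punchOut-punchIn (class b))))
      (λ { (here refl) → merge-same b≢a ; (there r) → cong (merge b≢a) (sound (Eq.return r)) })
      joined
      where
      a~b : EqClosure (Listed ((a , b) ∷ ps)) a b
      a~b = Eq.return (here refl)
      joined : ∀ {p q} → merge b≢a (class p) ≡ merge b≢a (class q) → EqClosure (Listed ((a , b) ∷ ps)) p q
      joined e with merge-fibre b≢a e
      ... | inj₁ p≡q = weaken (complete p≡q)
      ... | inj₂ (inj₁ (p≡a , q≡b)) = Eq.transitive _ (weaken (complete p≡a))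
              (Eq.transitive _ a~b (weaken (complete (sym q≡b))))
      ... | inj₂ (inj₂ (p≡b , q≡a)) = Eq.transitive _ (weaken (complete p≡b))
              (Eq.transitive _ (Eq.symmetric _ a~b) (weaken (complete (sym q≡a))))

    discrete : Quotient (Listed [])
    discrete = tabulated id (λ c → c , refl) (λ ()) (λ { refl → Eq.reflexive _ })

    quotientByPairs : ∀ ps → Quotient (Listed ps)
    quotientByPairs []       = discrete
    quotientByPairs (p ∷ ps) = link p (quotientByPairs ps)

quotient : ∀ {m} {_~_ : Rel (Fin m) 0ℓ} → Decidable _~_ → Quotient _~_
quotient {m} {_~_} _~?_ = record
  { size = size ; class = class ; surjective = surjective
  ; sound    = λ {p} {q} r → sound (Eq.map {R = _~_} (λ {x} {y} x~y →
      ∈-filter⁺ P? (∈-cartesianProduct⁺ (∈-allFin x) (∈-allFin y)) x~y) r)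
  ; complete = λ e → Eq.map (λ xy∈ → proj₂ (∈-filter⁻ P? {xs = all} xy∈)) (complete e)
  }
  where
  all : List (Fin m × Fin m)
  all = cartesianProduct (allFin m) (allFin m)
  P? : (pq : Fin m × Fin m) → Dec (proj₁ pq ~ proj₂ pq)
  P? (p , q) = p ~? q
  open Quotient (quotientByPairs (filter P? all))

record RibbonGraph : Set where
  field
    #vertices #half-edges : ℕ

  Vertex : Set
  Vertex = Fin #vertices

  HalfEdge : Set
  HalfEdge = Fin #half-edges

  field
    vertex   : HalfEdge → Vertex
    opposite : HalfEdge → HalfEdge
    -- sends each half-edge to the next one counterclockwise around its vertex
    rotation : Permutation′ #half-edges

  next : HalfEdge → HalfEdge
  next = rotation ⟨$⟩ʳ_

  prev : HalfEdge → HalfEdge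
  prev = rotation ⟨$⟩ˡ_

  field
    opposite-involutive : ∀ h → opposite (opposite h) ≡ h
    opposite-distinct   : ∀ h → opposite h ≢ h
    next-vertex         : ∀ h → vertex (next h) ≡ vertex h
    next-transitive     : ∀ h h′ → vertex h ≡ vertex h′ → Star (λ a b → next a ≡ b) h h′
    nonempty            : HalfEdge
    connected           : ∀ v w → Star (λ a b → ∃ λ h → vertex h ≡ a × vertex (opposite h) ≡ b) v w

  degree : Vertex → ℕ
  degree v = length (filter (λ h → vertex h Finₚ.≟ v) (allFin #half-edges))

record PerfectMatchingGraph : Set where
  field
    ribbonGraph : RibbonGraph

  open RibbonGraph ribbonGraph public

  -- The matching edges are e₀ , … , e_{ℓ-1}; drawing eᵢ vertically amounts to
  -- choosing which of its half-edges is at the top.  Both smoothings are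
  -- unchanged by a half-turn, so the choice is immaterial.
  field
    ℓ   : ℕ
    top : Fin ℓ → HalfEdge

  bottom : Fin ℓ → HalfEdge
  bottom i = opposite (top i)

  end : Fin ℓ × Bool → HalfEdge
  end e = if proj₂ e then top (proj₁ e) else bottom (proj₁ e)

  field
    perfect : ∀ v → ∃! _≡_ λ e → vertex (end e) ≡ v

  Trivalent : Set
  Trivalent = ∀ v → degree v ≡ 3

State : ℕ → Set
State = Vec Bool

Corner : Set
Corner = Fin 4

pattern UL = 0F
pattern UR = 1F
pattern DL = 2F
pattern DR = 3F

smoothing : Bool → Corner → Corner
smoothing false UL = DL
smoothing false UR = DR
smoothing false DL = UL
smoothing false DR = UR
smoothing true  UL = DR
smoothing true  UR = DL
smoothing true  DL = UR
smoothing true  DR = UL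

module _ (Γ : PerfectMatchingGraph) where

  open PerfectMatchingGraph Γ

  -- In a trivalent graph every half-edge outside the matching is the half-edge
  -- at exactly one corner.
  corner : Fin ℓ → Corner → HalfEdge
  corner i UL = prev (top i)
  corner i UR = next (top i)
  corner i DL = next (bottom i)
  corner i DR = prev (bottom i)

  Joined : State ℓ → Rel (Fin ℓ × Corner) 0ℓ
  Joined α (i , c) (j , d) =
    opposite (corner i c) ≡ corner j d ⊎ (j ≡ i × d ≡ smoothing (lookup α i) c)

  joined? : ∀ α → Decidable (Joined α)
  joined? α (i , c) (j , d) =
    (opposite (corner i c) Finₚ.≟ corner j d) ⊎-dec
    ((j Finₚ.≟ i) ×-dec (d Finₚ.≟ smoothing (lookup α i) c))

  circles : ∀ α → Quotient (Joined α on remQuot {ℓ} 4)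
  circles α = quotient (λ p q → joined? α (remQuot {ℓ} 4 p) (remQuot {ℓ} 4 q))

  #circles : State ℓ → ℕ
  #circles α = Quotient.size (circles α)

  Circle : State ℓ → Set
  Circle α = Fin (#circles α)

  circleAt : ∀ α → Fin ℓ → Corner → Circle α
  circleAt α i c = Quotient.class (circles α) (combine i c)

if-even_then_else_ : {A : Set} → ℕ → A → A → A
if-even n then x else y with parity n
... | 0ℙ = x
... | 1ℙ = y

infix 0 if-even_then_else_

-- The order of b: 2 when n is even; when n is odd there is no b, and the
-- second factor of 𝒢 is the trivial group.
bOrder : Parity → ℕ
bOrder 0ℙ = 2
bOrder 1ℙ = 1

instance
  bOrder-nonZero : ∀ {p} → NonZero (bOrder p)
  bOrder-nonZero {0ℙ} = _
  bOrder-nonZero {1ℙ} = _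

Degree : ℕ → Set
Degree n = Fin n × Fin (bOrder (parity n))

module _ {n : ℕ} .{{_ : NonZero n}} where

  degree : ℕ → ℕ → Degree n
  degree a ε = a mod n , ε mod bOrder (parity n)

  _⊕_ : Degree n → Degree n → Degree n
  (a , ε) ⊕ (a′ , ε′) = degree (toℕ a ℕ.+ toℕ a′) (toℕ ε ℕ.+ toℕ ε′)

  _≟ᵈ_ : Decidable {A = Degree n} _≡_
  _≟ᵈ_ = ≡-dec Finₚ._≟_ Finₚ._≟_

-- g ↦ the coefficient of q^a b^ε, where g = (a , ε)
ℤ[𝒢] : ℕ → Set
ℤ[𝒢] n = Degree n → ℤ

_≐_ : ∀ {n} → ℤ[𝒢] n → ℤ[𝒢] n → Set
f ≐ f′ = ∀ g → f g ≡ f′ g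

module _ {n : ℕ} .{{_ : NonZero n}} where

  open MonoidSum ℤₚ.+-0-commutativeMonoid using (sum; sum-syntax)

  q^_b^_ : ℕ → ℕ → ℤ[𝒢] n
  (q^ a b^ ε) g = if does (degree a ε ≟ᵈ g) then + 1 else + 0

  _⊛_ : ℤ[𝒢] n → ℤ[𝒢] n → ℤ[𝒢] n
  (f ⊛ f′) g =
    ∑[ a < n ] ∑[ ε < bOrder (parity n) ] ∑[ a′ < n ] ∑[ ε′ < bOrder (parity n) ]
      (if does (((a , ε) ⊕ (a′ , ε′)) ≟ᵈ g) then f (a , ε) ℤ.* f′ (a′ , ε′) else + 0)

  _^⊛_ : ℤ[𝒢] n → ℕ → ℤ[𝒢] n
  f ^⊛ zero  = q^ 0 b^ 0
  f ^⊛ suc k = f ⊛ (f ^⊛ k)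

  circleValue : ℤ[𝒢] n
  circleValue g = if-even n
    then + 2 ℤ.* (∑[ i < ⌊ n /2⌋ ] (+ 2 ℤ.* (q^ 2 ℕ.* toℕ i b^ 0) g ℤ.+ (q^ suc (2 ℕ.* toℕ i) b^ 1) g))
    else + 3 ℤ.* (∑[ i < n ] (q^ toℕ i b^ 0) g)

module _ (n : ℕ) .{{_ : NonZero n}} where

  -- The skein relation, applied to the matching edges one after another.
  resolve : ∀ ℓ → (State ℓ → ℤ[𝒢] n) → ℤ[𝒢] n
  resolve zero    value = value []
  resolve (suc ℓ) value g =
    resolve ℓ (λ α → value (false ∷ α)) g ℤ.- resolve ℓ (λ α → value (true ∷ α)) g

  bracket : PerfectMatchingGraph → ℤ[𝒢] n
  bracket Γ = resolve (PerfectMatchingGraph.ℓ Γ) (λ α → circleValue ^⊛ #circles Γ α)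

onesBefore : ∀ {ℓ} → State ℓ → Fin ℓ → ℕ
onesBefore (_ ∷ _)     zero    = 0
onesBefore (false ∷ α) (suc i) = onesBefore α i
onesBefore (true ∷ α)  (suc i) = suc (onesBefore α i)

-- R = ℤ[1/3n] is substituted below.
module Complex (n : ℕ) .{{_ : NonZero n}} (R : CommutativeRing 0ℓ 0ℓ) (1/3n : CommutativeRing.Carrier R) where

  open CommutativeRing R renaming (Carrier to ∣R∣; refl to ≈-refl; sym to ≈-sym; trans to ≈-trans)
  open Exp semiring using (_^_)
  open Sum semiring using (sum-syntax; sum-cong-≋; ∑-distrib-+; *-distribˡ-sum)
  open CommutativeSemigroupProperties *-commutativeSemigroup using (x∙yz≈y∙xz)

  -- (i , j) is the monomial xⁱyʲ.
  Basis : Set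
  Basis = Fin n × Fin 3

  -- y³ = xy
  reduce : ℕ → ℕ → ℕ × Fin 3
  reduce a 0 = a , 0F
  reduce a 1 = a , 1F
  reduce a 2 = a , 2F
  reduce a (suc (suc (suc b))) = reduce (suc a) (suc b)

  -- The coordinates of x^a y^b; they all vanish when the reduced exponent of x
  -- is at least n.
  x^_y^_ : ℕ → ℕ → Basis → ∣R∣
  (x^ a y^ b) (i , j) =
    if does (≡-dec ℕₚ._≟_ Finₚ._≟_ (reduce a b) (toℕ i , j)) then 1# else 0#

  -- Coordinates of the values of the structure maps on basis vectors.

  μ : Basis → Basis → Basis → ∣R∣
  μ (p , r) (p′ , r′) = x^ toℕ p ℕ.+ toℕ p′ y^ (toℕ r ℕ.+ toℕ r′)

  m : Basis → Basis → ∣R∣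
  m (p , r) = if-even n
    then (x^ toℕ p ℕ.+ ⌊ n ℕ.∸ 2 /2⌋ y^ (toℕ r ℕ.+ 2))
    else (x^ toℕ p ℕ.+ ⌊ n ℕ.∸ 1 /2⌋ y^ (toℕ r ℕ.+ 1))

  Δ : Basis → Basis → Basis → ∣R∣
  Δ (p , r) c c′ =
    - 1/3n * (∑[ k < n ℕ.∸ 1 ]
      let i = suc (toℕ k) ; j = n ℕ.∸ i in
      (x^ toℕ p ℕ.+ i y^ toℕ r) c * (x^ j y^ 0) c′)
    + 1/3n * (∑[ k < n ]
      let i = toℕ k ; j = n ℕ.∸ 1 ℕ.∸ i in
      ( (x^ toℕ p ℕ.+ i y^ (toℕ r ℕ.+ 2)) c * (x^ j y^ 0) c′
      + (x^ toℕ p ℕ.+ i y^ (toℕ r ℕ.+ 1)) c * (x^ j y^ 1) c′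
      + (x^ toℕ p ℕ.+ i y^ toℕ r) c         * (x^ j y^ 2) c′))

  -- Indexes the monomial basis of V^⊗k.
  Tensor : ℕ → Set
  Tensor k = Vec Basis k

  tensorDegree : ∀ {k} → Tensor k → Degree n
  tensorDegree []            = degree 0 0
  tensorDegree ((i , j) ∷ s) = degree (2 ℕ.* toℕ i ℕ.+ toℕ j) (toℕ j) ⊕ tensorDegree s

  ∑⊗ : ∀ k → (Tensor k → ∣R∣) → ∣R∣
  ∑⊗ zero    f = f []
  ∑⊗ (suc k) f = ∑[ i < n ] ∑[ j < 3 ] ∑⊗ k (λ s → f ((i , j) ∷ s))

  ∑⊗-cong : ∀ k {f f′} → (∀ s → f s ≈ f′ s) → ∑⊗ k f ≈ ∑⊗ k f′
  ∑⊗-cong zero    e = e []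
  ∑⊗-cong (suc k) e = sum-cong-≋ λ i → sum-cong-≋ λ j → ∑⊗-cong k λ s → e ((i , j) ∷ s)

  ∑⊗-+ : ∀ k f f′ → ∑⊗ k (λ s → f s + f′ s) ≈ ∑⊗ k f + ∑⊗ k f′
  ∑⊗-+ zero    f f′ = ≈-refl
  ∑⊗-+ (suc k) f f′ = ≈-trans
    (sum-cong-≋ λ i → ≈-trans
      (sum-cong-≋ λ j → ∑⊗-+ k (λ s → f ((i , j) ∷ s)) (λ s → f′ ((i , j) ∷ s)))
      (∑-distrib-+ (λ j → ∑⊗ k (λ s → f ((i , j) ∷ s))) (λ j → ∑⊗ k (λ s → f′ ((i , j) ∷ s)))))
    (∑-distrib-+ (λ i → ∑[ j < 3 ] ∑⊗ k (λ s → f ((i , j) ∷ s)))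
                 (λ i → ∑[ j < 3 ] ∑⊗ k (λ s → f′ ((i , j) ∷ s))))

  ∑⊗-* : ∀ k c f → ∑⊗ k (λ s → c * f s) ≈ c * ∑⊗ k f
  ∑⊗-* zero    c f = ≈-refl
  ∑⊗-* (suc k) c f = ≈-trans
    (sum-cong-≋ λ i → ≈-trans
      (sum-cong-≋ λ j → ∑⊗-* k c (λ s → f ((i , j) ∷ s)))
      (≈-sym (*-distribˡ-sum c (λ j → ∑⊗ k (λ s → f ((i , j) ∷ s))))))
    (≈-sym (*-distribˡ-sum c (λ i → ∑[ j < 3 ] ∑⊗ k (λ s → f ((i , j) ∷ s)))))

  private
    term : Bool → ∣R∣ → ∀ k → (Tensor k → ∣R∣) → (Tensor k → ∣R∣) → ∣R∣
    term b σ k r v = if b then σ * ∑⊗ k (λ s → r s * v s) else 0#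

    term-cong : ∀ b σ k r v w → (∀ s → v s ≈ w s) → term b σ k r v ≈ term b σ k r w
    term-cong true  σ k r v w e = *-cong ≈-refl (∑⊗-cong k λ s → *-cong ≈-refl (e s))
    term-cong false σ k r v w e = ≈-refl

    term-+ : ∀ b σ k r v w → term b σ k r (λ s → v s + w s) ≈ term b σ k r v + term b σ k r w
    term-+ true  σ k r v w = ≈-trans
      (*-cong ≈-refl (≈-trans (∑⊗-cong k λ s → distribˡ (r s) (v s) (w s))
        (∑⊗-+ k (λ s → r s * v s) (λ s → r s * w s))))
      (distribˡ σ _ _)
    term-+ false σ k r v w = ≈-sym (+-identityˡ 0#)

    term-* : ∀ b σ k r c v → term b σ k r (λ s → c * v s) ≈ c * term b σ k r v
    term-* true  σ k r c v = ≈-trans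
      (*-cong ≈-refl (≈-trans (∑⊗-cong k λ s → x∙yz≈y∙xz (r s) c (v s))
        (∑⊗-* k c (λ s → r s * v s))))
      (x∙yz≈y∙xz σ c _)
    term-* false σ k r c v = ≈-sym (zeroʳ c)

  module _ (Γ : PerfectMatchingGraph) where

    open PerfectMatchingGraph Γ using (ℓ)

    -- An element of ⨁_α V^⊗k_α
    Chain : Set
    Chain = (α : State ℓ) → Tensor (#circles Γ α) → ∣R∣

    module _ (α α′ : State ℓ) (i : Fin ℓ)
             (s : Tensor (#circles Γ α)) (t : Tensor (#circles Γ α′)) where

      private
        a b : Circle Γ α
        a = circleAt Γ α i UL
        b = circleAt Γ α i UR
        a′ b′ : Circle Γ α′
        a′ = circleAt Γ α′ i UL
        b′ = circleAt Γ α′ i UR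

      -- Circles of Γ_α away from eᵢ pass through the same corners as circles
      -- of Γ_α′.
      AgreeElsewhere : Set
      AgreeElsewhere = ∀ j c → circleAt Γ α j c ≢ a × circleAt Γ α j c ≢ b →
        lookup s (circleAt Γ α j c) ≡ lookup t (circleAt Γ α′ j c)

      agreeElsewhere? : Dec AgreeElsewhere
      agreeElsewhere? = Finₚ.all? λ j → Finₚ.all? λ c →
        (¬? (circleAt Γ α j c Finₚ.≟ a) ×-dec ¬? (circleAt Γ α j c Finₚ.≟ b)) →-dec
        ≡-dec Finₚ._≟_ Finₚ._≟_ (lookup s (circleAt Γ α j c)) (lookup t (circleAt Γ α′ j c))

      -- The circles through eᵢ are a and b in Γ_α (the 0-smoothing), and a′
      -- and b′ in Γ_α′ (the 1-smoothing).  The order of the two new factors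
      -- is immaterial because Δ is cocommutative.
      local : ∣R∣
      local with a Finₚ.≟ b | a′ Finₚ.≟ b′
      ... | no _  | yes _ = μ (lookup s a) (lookup s b) (lookup t a′)
      ... | yes _ | no _  = Δ (lookup s a) (lookup t a′) (lookup t b′)
      ... | yes _ | yes _ = m (lookup s a) (lookup t a′)
      ... | no _  | no _  = 0#  -- impossible

      -- The coefficient of t in ∂_αα′ (s), where α′ changes the i-th entry of
      -- α from 0 to 1.
      coefficient : ∣R∣
      coefficient = if does agreeElsewhere? then local else 0#

    ∂-edge : ∀ α α′ → Fin ℓ → (Tensor (#circles Γ α) → ∣R∣) → (Tensor (#circles Γ α′) → ∣R∣)
    ∂-edge α α′ i v t = ∑⊗ (#circles Γ α) λ s → coefficient α α′ i s t * v s

    -- The component of ∂ v at α′ is gathered from the states α that differ from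
    -- α′ by having one entry 0 instead of 1.
    ∂-summand : Chain → ∀ α′ → Tensor (#circles Γ α′) → Fin ℓ → ∣R∣
    ∂-summand v α′ t i = if lookup α′ i
      then (let α = α′ [ i ]≔ false in (- 1#) ^ onesBefore α i * ∂-edge α α′ i (v α) t)
      else 0#

    ∂ : Chain → Chain
    ∂ v α′ t = ∑[ i < ℓ ] ∂-summand v α′ t i

    chains : LeftModule ring 0ℓ 0ℓ
    chains = record
      { Carrierᴹ = Chain
      ; _≈ᴹ_ = λ v w → ∀ α s → v α s ≈ w α s
      ; _+ᴹ_ = λ v w α s → v α s + w α s
      ; _*ₗ_ = λ c v α s → c * v α s
      ; 0ᴹ   = λ _ _ → 0#
      ; -ᴹ_  = λ v α s → - v α s
      ; isLeftModule = record
        { isLeftSemimodule = record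
          { +ᴹ-isCommutativeMonoid = record
            { isMonoid = record
              { isSemigroup = record
                { isMagma = record
                  { isEquivalence = record
                    { refl  = λ _ _ → ≈-refl
                    ; sym   = λ e α s → ≈-sym (e α s)
                    ; trans = λ e e′ α s → ≈-trans (e α s) (e′ α s)
                    }
                  ; ∙-cong = λ e e′ α s → +-cong (e α s) (e′ α s)
                  }
                ; assoc = λ u v w α s → +-assoc (u α s) (v α s) (w α s)
                }
              ; identity = (λ v α s → +-identityˡ (v α s)) , (λ v α s → +-identityʳ (v α s))
              }
            ; comm = λ v w α s → +-comm (v α s) (w α s)
            }
          ; isPreleftSemimodule = record
            { *ₗ-cong      = λ c≈d e α s → *-cong c≈d (e α s)
            ; *ₗ-zeroˡ     = λ v α s → zeroˡ (v α s)
            ; *ₗ-distribʳ  = λ v c d α s → distribʳ (v α s) c d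
            ; *ₗ-identityˡ = λ v α s → *-identityˡ (v α s)
            ; *ₗ-assoc     = λ c d v α s → *-assoc c d (v α s)
            ; *ₗ-zeroʳ     = λ c _ _ → zeroʳ c
            ; *ₗ-distribˡ  = λ c v w α s → distribˡ c (v α s) (w α s)
            }
          }
        ; -ᴹ‿cong    = λ e α s → -‿cong (e α s)
        ; -ᴹ‿inverse = (λ v α s → -‿inverseˡ (v α s)) , (λ v α s → -‿inverseʳ (v α s))
        }
      }

    ∂-linear : IsLinear chains ∂
    ∂-linear = isLinear chains ∂-cong ∂-+ ∂-*
      where
      open LeftModule chains using (_≈ᴹ_; _+ᴹ_; _*ₗ_)

      sign : State ℓ → Fin ℓ → ∣R∣
      sign α i = (- 1#) ^ onesBefore α i

      summand-cong : ∀ {v w} → v ≈ᴹ w → ∀ α′ t i → ∂-summand v α′ t i ≈ ∂-summand w α′ t i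
      summand-cong {v} {w} e α′ t i = let α = α′ [ i ]≔ false in
        term-cong (lookup α′ i) (sign α i) (#circles Γ α) (λ s → coefficient α α′ i s t) (v α) (w α) (e α)

      summand-+ : ∀ v w α′ t i → ∂-summand (v +ᴹ w) α′ t i ≈ ∂-summand v α′ t i + ∂-summand w α′ t i
      summand-+ v w α′ t i = let α = α′ [ i ]≔ false in
        term-+ (lookup α′ i) (sign α i) (#circles Γ α) (λ s → coefficient α α′ i s t) (v α) (w α)

      summand-* : ∀ c v α′ t i → ∂-summand (c *ₗ v) α′ t i ≈ c * ∂-summand v α′ t i
      summand-* c v α′ t i = let α = α′ [ i ]≔ false in
        term-* (lookup α′ i) (sign α i) (#circles Γ α) (λ s → coefficient α α′ i s t) c (v α)

      ∂-cong : ∀ {v w} → v ≈ᴹ w → ∂ v ≈ᴹ ∂ w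
      ∂-cong {v} {w} e α′ t =
        sum-cong-≋ {ℓ} {∂-summand v α′ t} {∂-summand w α′ t} (summand-cong {v} {w} e α′ t)

      ∂-+ : ∀ v w → ∂ (v +ᴹ w) ≈ᴹ ∂ v +ᴹ ∂ w
      ∂-+ v w α′ t = ≈-trans
        (sum-cong-≋ {ℓ} {∂-summand (v +ᴹ w) α′ t} {λ i → ∂-summand v α′ t i + ∂-summand w α′ t i}
          (summand-+ v w α′ t))
        (∑-distrib-+ (∂-summand v α′ t) (∂-summand w α′ t))

      ∂-* : ∀ c v → ∂ (c *ₗ v) ≈ᴹ c *ₗ ∂ v
      ∂-* c v α′ t = ≈-trans
        (sum-cong-≋ {ℓ} {∂-summand (c *ₗ v) α′ t} {λ i → c * ∂-summand v α′ t i} (summand-* c v α′ t))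
        (≈-sym (*-distribˡ-sum c (∂-summand v α′ t)))

    -- The chains in the summands V^⊗k_α with P α that are homogeneous of
    -- degree g
    homogeneous : (State ℓ → Set) → Degree n → Submodule chains
    homogeneous P g = record
      { Member  = λ v → ∀ α s → ¬ (P α × tensorDegree s ≡ g) → v α s ≈ 0#
      ; 0-mem   = λ _ _ _ → ≈-refl
      ; +-mem   = λ v∈ w∈ α s ∉ → ≈-trans (+-cong (v∈ α s ∉) (w∈ α s ∉)) (+-identityˡ 0#)
      ; neg-mem = λ v∈ α s ∉ → ≈-trans (-‿cong (v∈ α s ∉)) -0#≈0#
      ; *-mem   = λ c v∈ α s ∉ → ≈-trans (*-cong ≈-refl (v∈ α s ∉)) (zeroʳ c)
      }
      where open import Algebra.Properties.Ring ring using (-0#≈0#)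

    MH : ℕ → Degree n → LeftModule ring 0ℓ 0ℓ
    MH i g = homology chains
      (homogeneous (λ α → ∣ α ∣ ≡ i) g)
      (homogeneous (λ α → suc ∣ α ∣ ≡ i) g)
      ∂-linear

module _ (n : ℕ) .{{_ : NonZero n}} where

  private instance
    3n-nonZero : NonZero (3 ℕ.* n)
    3n-nonZero = ℕₚ.m*n≢0 3 n

  module Möbius = Complex n ℤ[1/ 3 ℕ.* n ] (reciprocal (3 ℕ.* n))

-- Polynomials in t with coefficients in ℕ[𝒢], listed by increasing powers
-- of t
Poly : ℕ → Set
Poly n = List (Degree n → ℕ)

coeff : ∀ {n} → Poly n → ℕ → Degree n → ℕ
coeff []      _       _ = 0
coeff (c ∷ _) zero    g = c g
coeff (_ ∷ P) (suc i) g = coeff P i g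

_≋_ : ∀ {n} → Poly n → Poly n → Set
P ≋ P′ = ∀ i g → coeff P i g ≡ coeff P′ i g

_[t=-1] : ∀ {n} → Poly n → ℤ[𝒢] n
(P [t=-1]) g = foldr (λ c rest → + c g ℤ.- rest) (+ 0) P

module _ (n : ℕ) .{{_ : NonZero n}} where

  -- P is Mh_n(Γ); by rank-unique it is determined up to _≋_.
  IsMh : PerfectMatchingGraph → Poly n → Set
  IsMh Γ P = ∀ i g → HasRank (Möbius.MH n Γ i g) (coeff P i g)

-- Words of monomials xᵃyᵇ placed at the corners of the ribbon graph act on
-- V^⊗k, and every edge map is, up to relabelling of the circles, multiplication
-- of such words by the image of 1: by 1 for a merge, by the sum in Δ(1) for a
-- split, and by θ for a twist, θ being the multiplier in m_V. Multiplying the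
-- two factors of Δ(1) gives θ², so a square of the cube commutes as soon as its
-- two paths have the same kinds of edge maps, up to this relation. This is a
-- finite check of the ways in which the eight corners at two matching edges are
-- connected away from these edges; the classes have even size, which excludes the
-- configurations where the check would fail.
--
-- Over the domain ℤ[1/3n] every graded piece of the homology has a rank, the
-- ranks of the differentials telescope in the Euler characteristic, and the
-- graded rank of V is the value of a circle.
--
-- If every state of Γ is a single circle, the bracket vanishes, while 1 in the
-- last summand of the complex is no boundary, because θV does not contain 1. So
-- two such graphs with different numbers of matching edges have the same
-- bracket and different homology.

module Submission where

-- The obstacle is that a square of the cube involves tensor powers indexed by the circles of four
-- different states. Words avoid matching these indices: letters sit at corners, which all states
-- share, and each state reads a word through its own map from corners to circles. A split then
-- raises the question how the monomials on a circle are divided between its two halves. By the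
-- Casimir identity (z ⊗ 1)Δ(1) = (1 ⊗ z)Δ(1) the letters may stay where they are. The negative sum
-- in Δ(1) is what makes this identity hold for z = y: it cancels the terms produced by y³ = xy. The
-- constant 1/3n normalises the product of the two factors, whose nonzero terms are 3n equal
-- monomials.
--
-- Ranks are taken over a ring that is not a field, and the homology module is defined whether or
-- not ∂ ∘ ∂ vanishes. So the linear algebra is done up to nonzero multiples with explicit families
-- of chains, and ∂ ∘ ∂ = 0 enters when the rank of the homology is computed from the ranks of the
-- differentials.

-- Finite sums in a commutative monoid

module Sums where

  open import Algebra.Bundles using (CommutativeMonoid)
  import Algebra.Properties.CommutativeMonoid.Sum as MonoidSum
  open import Data.Bool.Base using (Bool; true; false; if_then_else_)
  open import Data.Fin.Base using (Fin; zero; suc; combine; _↑ˡ_; _↑ʳ_)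
  import Data.Fin.Properties as Finₚ
  open import Data.Nat.Base as ℕ using (ℕ; zero; suc)
  open import Function.Base using (_∘_)
  open import Level using (0ℓ)
  open import Relation.Binary.PropositionalEquality as ≡ using (_≡_; _≢_)
  open import Relation.Nullary using (does)
  open import Relation.Nullary.Decidable using (dec-true; dec-false)

  -- One theory serves sums and products of scalars, sums of integers, of module elements and of
  -- degrees, and parities under `xor`.
  module FiniteSums (M : CommutativeMonoid 0ℓ 0ℓ) where

    open CommutativeMonoid M
    open MonoidSum M public

    open import Relation.Binary.Reasoning.Setoid setoid

    sum-↑ : ∀ m {n} (f : Fin (m ℕ.+ n) → Carrier) → sum f ≈ sum (f ∘ (_↑ˡ n)) ∙ sum (f ∘ (m ↑ʳ_))
    sum-↑ zero    f = sym (identityˡ _)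
    sum-↑ (suc m) f = trans (∙-congˡ (sum-↑ m (f ∘ suc))) (sym (assoc _ _ _))

    sum-combine : ∀ m n (f : Fin (m ℕ.* n) → Carrier) → sum f ≈ sum λ k → sum λ c → f (combine {m} {n} k c)
    sum-combine zero    n f = refl
    sum-combine (suc m) n f = trans (sum-↑ n f) (∙-congˡ (sum-combine m n (f ∘ (n ↑ʳ_))))

    sum-ε : ∀ {n} {f : Fin n → Carrier} → (∀ k → f k ≈ ε) → sum f ≈ ε
    sum-ε {n} e = trans (sum-cong-≋ e) (sum-replicate-zero n)

    sum-single : ∀ {n} {f : Fin n → Carrier} i → (∀ k → k ≢ i → f k ≈ ε) → sum f ≈ f i
    sum-single zero    e = trans (∙-congˡ (sum-ε λ k → e (suc k) λ ())) (identityʳ _)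
    sum-single (suc i) e = trans (∙-cong (e zero λ ()) (sum-single i λ k k≢i → e (suc k) (k≢i ∘ Finₚ.suc-injective)))
      (identityˡ _)

    only except : ∀ {n} → Fin n → (Fin n → Carrier) → Fin n → Carrier
    only   i f k = if does (k Finₚ.≟ i) then f k else ε
    except i f k = if does (k Finₚ.≟ i) then ε else f k

    only-at : ∀ {n} (i : Fin n) f → only i f i ≡ f i
    only-at i f rewrite dec-true (i Finₚ.≟ i) ≡.refl = ≡.refl

    only-off : ∀ {n} {i k : Fin n} f → k ≢ i → only i f k ≡ ε
    only-off {i = i} {k} f k≢i rewrite dec-false (k Finₚ.≟ i) k≢i = ≡.refl

    except-off : ∀ {n} {i k : Fin n} f → k ≢ i → except i f k ≡ f k
    except-off {i = i} {k} f k≢i rewrite dec-false (k Finₚ.≟ i) k≢i = ≡.refl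

    sum-only : ∀ {n} (i : Fin n) f → sum (only i f) ≈ f i
    sum-only i f = trans (sum-single i λ k k≢i → reflexive (only-off f k≢i)) (reflexive (only-at i f))

    sum-except : ∀ {n} (i : Fin n) (f : Fin n → Carrier) → sum f ≈ f i ∙ sum (except i f)
    sum-except i f = begin
      sum f                                ≈⟨ sum-cong-≋ split ⟩
      sum (λ k → only i f k ∙ except i f k) ≈⟨ ∑-distrib-+ (only i f) (except i f) ⟩
      sum (only i f) ∙ sum (except i f)    ≈⟨ ∙-congʳ (sum-only i f) ⟩
      f i ∙ sum (except i f)               ∎
      where
      split : ∀ k → f k ≈ only i f k ∙ except i f k
      split k with does (k Finₚ.≟ i)
      ... | true  = sym (identityʳ (f k))
      ... | false = sym (identityˡ (f k))

-- Two matching edges: a finite check over partitions of eight corners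

module Face where

  open import Algebra.Bundles using (CommutativeRing)
  import Algebra.Properties.CommutativeMonoid.Sum as MonoidSum
  open import Data.Bool.Base using (Bool; true; false; if_then_else_; T)
  import Data.Bool.Properties as Boolₚ
  open import Data.Fin.Base using (Fin; zero; suc)
  open import Data.Fin.Patterns
  import Data.Fin.Properties as Finₚ
  open import Data.List.Base as List using (List; []; _∷_)
  open import Data.List.Membership.Propositional using (_∈_)
  open import Data.List.Membership.Propositional.Properties using (∈-concatMap⁺; ∈-map⁺; ∈-upTo⁺)
  open import Data.List.Relation.Unary.All as All using (All; []; _∷_)
  open import Data.List.Relation.Unary.Any as Any using (here; there)
  open import Data.Maybe.Base as Maybe using (Maybe; just; nothing; is-just)
  open import Data.Nat.Base using (ℕ; zero; suc; _≡ᵇ_; _<_)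
  import Data.Nat.Properties as ℕₚ
  open import Data.Product.Base using (∃₂; _×_; _,_; uncurry)
  open import Data.Vec.Base as Vec using (Vec; []; _∷_; lookup)
  open import Data.Vec.Properties using (lookup-map)
  open import Function.Base using (_∘_)
  open import Function.Bundles using (_⇔_; mk⇔; Equivalence)
  open import Level using (0ℓ)
  open import Relation.Binary.Core using (Rel)
  open import Relation.Binary.Definitions using (Decidable)
  open import Relation.Binary.Structures using (IsEquivalence)
  open import Relation.Binary.PropositionalEquality as ≡ using (_≡_; refl; sym; trans; cong; cong₂)
  open import Relation.Nullary using (Dec; yes; no; does; contradiction)
  open import Relation.Nullary.Decidable using (does-⇔; dec-true; dec-false)

  xor-commutativeMonoid = CommutativeRing.+-commutativeMonoid Boolₚ.xor-∧-commutativeRing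

  open MonoidSum xor-commutativeMonoid using () renaming (sum to xorSum; sum-cong-≗ to xorSum-cong)

  data Kind : Set where
    merging splitting twisting impossible : Kind

  -- The arguments tell whether the two upper corners lie on one circle before and after the change.
  -- Either smoothing joins each upper corner to a lower one, so the upper corners meet every circle
  -- through the edge.
  kind : Bool → Bool → Kind
  kind false true  = merging
  kind true  false = splitting
  kind true  true  = twisting
  kind false false = impossible

  -- A partition of the eight corners at two edges; equal labels stand for corners that are
  -- connected away from these edges.
  Labelling : Set
  Labelling = Vec ℕ 8

  relabel : ℕ → ℕ → ℕ → ℕ
  relabel x y z = if z ≡ᵇ x then y else z

  identify : Fin 8 × Fin 8 → Labelling → Labelling
  identify (a , b) V = Vec.map (relabel (lookup V a) (lookup V b)) V

  identifyAll : List (Fin 8 × Fin 8) → Labelling → Labelling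
  identifyAll ps V = List.foldr identify V ps

  -- The corners UL, UR, DL, DR of the first edge are 0 , … , 3, those of the
  -- second edge 4 , … , 7.
  gluings : Bool → Bool → List (Fin 8 × Fin 8)
  gluings x y = arcs 0F 1F 2F 3F x List.++ arcs 4F 5F 6F 7F y
    where
    arcs : Fin 8 → Fin 8 → Fin 8 → Fin 8 → Bool → List (Fin 8 × Fin 8)
    arcs ul ur dl dr false = (ul , dl) ∷ (ur , dr) ∷ []
    arcs ul ur dl dr true  = (ul , dr) ∷ (ur , dl) ∷ []

  -- The kinds are those of the first and the second edge along the path that
  -- changes the first edge first, then along the other path.
  data Compatible (_~_ : Rel (Fin 8) 0ℓ) : Kind → Kind → Kind → Kind → Set where
    unchanged        : ∀ {k l} → Compatible _~_ k l k l
    merging-twisting : 0F ~ 4F → Compatible _~_ merging twisting twisting merging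
    twisting-splitting  : 0F ~ 4F → 1F ~ 5F → Compatible _~_ twisting splitting splitting twisting
    twisting-splitting′ : 0F ~ 5F → 1F ~ 4F → Compatible _~_ twisting splitting splitting twisting
    twisting-genus   : 0F ~ 4F → 4F ~ 5F → Compatible _~_ twisting twisting merging splitting
    genus-twisting   : 0F ~ 4F → 0F ~ 1F → Compatible _~_ splitting merging twisting twisting
    merging-splitting   : 0F ~ 4F → 1F ~ 5F → Compatible _~_ merging splitting splitting merging
    merging-splitting′  : 0F ~ 5F → 1F ~ 4F → Compatible _~_ merging splitting splitting merging
    splitting-merging   : 0F ~ 4F → 1F ~ 5F → Compatible _~_ splitting merging merging splitting
    splitting-merging′  : 0F ~ 5F → 1F ~ 4F → Compatible _~_ splitting merging merging splitting

  mapCompatible : ∀ {_~_ _≈_ : Rel (Fin 8) 0ℓ} → (∀ {a b} → a ~ b → a ≈ b) →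
    ∀ {k l k′ l′} → Compatible _~_ k l k′ l′ → Compatible _≈_ k l k′ l′
  mapCompatible f unchanged = unchanged
  mapCompatible f (merging-twisting p) = merging-twisting (f p)
  mapCompatible f (twisting-splitting p q) = twisting-splitting (f p) (f q)
  mapCompatible f (twisting-splitting′ p q) = twisting-splitting′ (f p) (f q)
  mapCompatible f (twisting-genus p q) = twisting-genus (f p) (f q)
  mapCompatible f (genus-twisting p q) = genus-twisting (f p) (f q)
  mapCompatible f (merging-splitting p q) = merging-splitting (f p) (f q)
  mapCompatible f (merging-splitting′ p q) = merging-splitting′ (f p) (f q)
  mapCompatible f (splitting-merging p q) = splitting-merging (f p) (f q)
  mapCompatible f (splitting-merging′ p q) = splitting-merging′ (f p) (f q)

  module _ {_~_ : Rel (Fin 8) 0ℓ} (_~?_ : Decidable _~_) where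

    both : ∀ {A B C : Set} → Dec A → Dec B → (A → B → C) → Maybe C
    both (yes a) (yes b) f = just (f a b)
    both _       _       f = nothing

    -- The edge maps insert monomials at the upper corners `0F`, `1F`, `4F`, `5F`, so the conditions
    -- are coincidences among these four; `word-compatible` turns them into identities. The result
    -- lies in `Maybe` so that evaluation decides it.
    compatible? : ∀ k l k′ l′ → Maybe (Compatible _~_ k l k′ l′)
    compatible? merging   merging   merging   merging   = just unchanged
    compatible? merging   splitting merging   splitting = just unchanged
    compatible? merging   twisting  merging   twisting  = just unchanged
    compatible? splitting merging   splitting merging   = just unchanged
    compatible? splitting splitting splitting splitting = just unchanged
    compatible? splitting twisting  splitting twisting  = just unchanged
    compatible? twisting  merging   twisting  merging   = just unchanged
    compatible? twisting  splitting twisting  splitting = just unchanged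
    compatible? twisting  twisting  twisting  twisting  = just unchanged
    compatible? merging   twisting  twisting  merging   = both (0F ~? 4F) (0F ~? 4F) λ p _ → merging-twisting p
    compatible? twisting  splitting splitting twisting  =
      both (0F ~? 4F) (1F ~? 5F) twisting-splitting Maybe.<∣> both (0F ~? 5F) (1F ~? 4F) twisting-splitting′
    compatible? twisting  twisting  merging   splitting = both (0F ~? 4F) (4F ~? 5F) twisting-genus
    compatible? splitting merging   twisting  twisting  = both (0F ~? 4F) (0F ~? 1F) genus-twisting
    compatible? merging   splitting splitting merging   =
      both (0F ~? 4F) (1F ~? 5F) merging-splitting Maybe.<∣> both (0F ~? 5F) (1F ~? 4F) merging-splitting′
    compatible? splitting merging   merging   splitting =
      both (0F ~? 4F) (1F ~? 5F) splitting-merging Maybe.<∣> both (0F ~? 5F) (1F ~? 4F) splitting-merging′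
    compatible? _ _ _ _ = nothing

  -- The kinds come from all four states, but the coincidences are required in the state
  -- `true true`, where both composites take their values. In `i x y` and `j x y` the first edge is
  -- smoothed by `x` and the second by `y`.
  SquareCompatible : (_~_ : Bool → Bool → Rel (Fin 8) 0ℓ) → (∀ x y → Decidable (_~_ x y)) → Set
  SquareCompatible _~_ _~?_ = Compatible (_~_ true true)
    (kind (i false false) (i true false)) (kind (j true false) (j true true))
    (kind (i false true) (i true true))   (kind (j false false) (j false true))
    where
    i j : Bool → Bool → Bool
    i x y = does (_~?_ x y 0F 1F)
    j x y = does (_~?_ x y 4F 5F)

  SameLabel : Labelling → Rel (Fin 8) 0ℓ
  SameLabel V a b = lookup V a ≡ lookup V b

  sameLabel? : ∀ V → Decidable (SameLabel V)
  sameLabel? V a b = lookup V a ℕₚ.≟ lookup V b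

  Glued : Labelling → Bool → Bool → Rel (Fin 8) 0ℓ
  Glued V x y = SameLabel (identifyAll (gluings x y) V)

  glued? : ∀ V x y → Decidable (Glued V x y)
  glued? V x y = sameLabel? (identifyAll (gluings x y) V)

  oddBlock : Labelling → Fin 8 → Bool
  oddBlock V a = xorSum λ b → does (sameLabel? V b a)

  -- Restricted growth strings: a new entry repeats one of the `m` labels in use or is the next
  -- label `m`. Each partition thus occurs once, which gives 4140 cases for eight corners.
  labellings : ∀ k → List (ℕ × Vec ℕ k)
  labellings zero    = (0 , []) ∷ []
  labellings (suc k) = List.concatMap
    (λ (m , V) → (suc m , m ∷ V) ∷ List.map (λ v → m , v ∷ V) (List.upTo m)) (labellings k)

  check : ∀ V → Maybe (SquareCompatible (Glued V) (glued? V))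
  check V = compatible? (glued? V true true) _ _ _ _

  hasOddBlock : ∀ {k} → Vec (Fin 8) k → Labelling → Bool
  hasOddBlock []      V = false
  hasOddBlock (a ∷ U) V = if oddBlock V a then true else hasOddBlock U V

  -- A Boolean condition, to be established by computation. The test for an odd block comes first,
  -- so that the square is examined only for partitions into even blocks.
  Valid : Labelling → Set
  Valid V = T (if hasOddBlock (Vec.allFin 8) V then true else is-just (check V))

  valid? : ∀ V → Dec (Valid V)
  valid? V = Boolₚ.T? _

  all-valid : All (λ (_ , V) → Valid V) (labellings 8)
  all-valid = from-yes (All.all? (λ (_ , V) → valid? V) (labellings 8))
    where open import Relation.Nullary.Decidable using (from-yes)

  -- If the value at `zero` occurs again, its label is reused, otherwise the label `m` is taken. The
  -- bound `lookup V a < m` is carried along for both cases: it places the reused label in `upTo m`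
  -- and makes `m` fresh.
  labelling : ∀ {N k} (f : Fin k → Fin N) → ∃₂ λ m V → (m , V) ∈ labellings k ×
    (∀ a → lookup V a < m) × (∀ a b → lookup V a ≡ lookup V b ⇔ f a ≡ f b)
  labelling {k = zero} f = 0 , [] , here refl , (λ ()) , λ ()
  labelling {k = suc k} f with labelling (f ∘ suc)
  ... | m , V , V∈ , V<m , V⇔f with Finₚ.any? (λ a → f zero Finₚ.≟ f (suc a))
  ... | yes (a , e) = m , lookup V a ∷ V ,
    ∈-concatMap⁺ _ (Any.map (λ { refl → there (∈-map⁺ _ (∈-upTo⁺ (V<m a))) }) V∈) ,
    (λ { zero → V<m a ; (suc b) → V<m b }) ,
    λ { zero    zero    → mk⇔ (λ _ → refl) (λ _ → refl)
      ; zero    (suc b) → mk⇔ (λ p → trans e (Equivalence.to (V⇔f a b) p))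
                              (λ p → Equivalence.from (V⇔f a b) (trans (sym e) p))
      ; (suc b) zero    → mk⇔ (λ p → trans (Equivalence.to (V⇔f b a) p) (sym e))
                              (λ p → Equivalence.from (V⇔f b a) (trans p e))
      ; (suc b) (suc c) → V⇔f b c }
  ... | no ¬e = suc m , m ∷ V ,
    ∈-concatMap⁺ _ (Any.map (λ { refl → here refl }) V∈) ,
    (λ { zero → ℕₚ.≤-refl ; (suc b) → ℕₚ.m<n⇒m<1+n (V<m b) }) ,
    λ { zero    zero    → mk⇔ (λ _ → refl) (λ _ → refl)
      ; zero    (suc b) → mk⇔ (λ p → contradiction (sym p) (ℕₚ.<⇒≢ (V<m b)))
                              (λ p → contradiction (b , p) ¬e)
      ; (suc b) zero    → mk⇔ (λ p → contradiction p (ℕₚ.<⇒≢ (V<m b)))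
                              (λ p → contradiction (b , sym p) ¬e)
      ; (suc b) (suc c) → V⇔f b c }

  identify-lookup : ∀ a b V x →
    lookup (identify (a , b) V) x ≡ relabel (lookup V a) (lookup V b) (lookup V x)
  identify-lookup a b V x = lookup-map x _ V

  identify-coarser : ∀ p V {x y} → SameLabel V x y → SameLabel (identify p V) x y
  identify-coarser (a , b) V {x} {y} e = trans (identify-lookup a b V x)
    (trans (cong (relabel (lookup V a) (lookup V b)) e) (sym (identify-lookup a b V y)))

  relabel-at : ∀ x y → relabel x y x ≡ y
  relabel-at x y rewrite dec-true (x ℕₚ.≟ x) refl = refl

  relabel-to : ∀ x y → relabel x y y ≡ y
  relabel-to x y with does (y ℕₚ.≟ x)
  ... | true  = refl
  ... | false = refl

  identify-joins : ∀ a b V → SameLabel (identify (a , b) V) a b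
  identify-joins a b V = trans (identify-lookup a b V a) (trans (relabel-at (lookup V a) (lookup V b))
    (trans (sym (relabel-to (lookup V a) (lookup V b))) (sym (identify-lookup a b V b))))

  module _ {_~_ : Rel (Fin 8) 0ℓ} (~-equivalence : IsEquivalence _~_) where

    open IsEquivalence ~-equivalence renaming (refl to ~-refl; sym to ~-sym; trans to ~-trans)

    -- Only labels equal to that of `a` change, so a new coincidence passes through `a ~ b`.
    identify-least : ∀ {a b} V → (∀ {x y} → SameLabel V x y → x ~ y) → a ~ b →
      ∀ {x y} → SameLabel (identify (a , b) V) x y → x ~ y
    identify-least {a} {b} V V⊆~ a~b {x} {y} e
      with lookup V x ℕₚ.≟ lookup V a | lookup V y ℕₚ.≟ lookup V a
         | trans (sym (identify-lookup a b V x)) (trans e (identify-lookup a b V y))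
    ... | yes p | yes q | _ = V⊆~ (trans p (sym q))
    ... | yes p | no ¬q | e′ rewrite dec-true (lookup V x ℕₚ.≟ lookup V a) p
                                   | dec-false (lookup V y ℕₚ.≟ lookup V a) ¬q
                             = ~-trans (V⊆~ p) (~-trans a~b (V⊆~ e′))
    ... | no ¬p | yes q | e′ rewrite dec-false (lookup V x ℕₚ.≟ lookup V a) ¬p
                                   | dec-true (lookup V y ℕₚ.≟ lookup V a) q
                             = ~-trans (V⊆~ e′) (~-trans (~-sym a~b) (~-sym (V⊆~ q)))
    ... | no ¬p | no ¬q | e′ rewrite dec-false (lookup V x ℕₚ.≟ lookup V a) ¬p
                                   | dec-false (lookup V y ℕₚ.≟ lookup V a) ¬q = V⊆~ e′

    identifyAll-least : ∀ {ps} V → (∀ {x y} → SameLabel V x y → x ~ y) → All (uncurry _~_) ps →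
      ∀ {x y} → SameLabel (identifyAll ps V) x y → x ~ y
    identifyAll-least V V⊆~ []                   = V⊆~
    identifyAll-least V V⊆~ (_∷_ {x = _} {xs = ps} p qs) =
      identify-least (identifyAll ps V) (identifyAll-least V V⊆~ qs) p

  identifyAll-coarser : ∀ ps V {x y} → SameLabel V x y → SameLabel (identifyAll ps V) x y
  identifyAll-coarser []       V e = e
  identifyAll-coarser (p ∷ ps) V e = identify-coarser p (identifyAll ps V) (identifyAll-coarser ps V e)

  identifyAll-joins : ∀ ps V → All (uncurry (SameLabel (identifyAll ps V))) ps
  identifyAll-joins []             V = []
  identifyAll-joins (p@(a , b) ∷ ps) V = identify-joins a b (identifyAll ps V) ∷
    All.map (identify-coarser p (identifyAll ps V)) (identifyAll-joins ps V)

  noOddBlock : ∀ {k} (U : Vec (Fin 8) k) V → (∀ a → oddBlock V a ≡ false) → hasOddBlock U V ≡ false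
  noOddBlock []      V even = refl
  noOddBlock (a ∷ U) V even rewrite even a = noOddBlock U V even

  fromCheck : ∀ {b} {A : Set} → b ≡ false → (c : Maybe A) → T (if b then true else is-just c) → A
  fromCheck refl (just a) _ = a

  recast : ∀ {_~_ : Rel (Fin 8) 0ℓ} {k l k′ l′ k₁ l₁ k₁′ l₁′} → k ≡ k₁ → l ≡ l₁ → k′ ≡ k₁′ → l′ ≡ l₁′ →
    Compatible _~_ k l k′ l′ → Compatible _~_ k₁ l₁ k₁′ l₁′
  recast refl refl refl refl c = c

  -- A kind is a function of two truth values, so equivalent relations produce equal kinds.
  transfer : ∀ {_~_ _≈_ : Bool → Bool → Rel (Fin 8) 0ℓ}
    (_~?_ : ∀ x y → Decidable (_~_ x y)) (_≈?_ : ∀ x y → Decidable (_≈_ x y)) →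
    (∀ x y a b → _~_ x y a b ⇔ _≈_ x y a b) → SquareCompatible _~_ _~?_ → SquareCompatible _≈_ _≈?_
  transfer _~?_ _≈?_ ~⇔≈ c = recast
    (sameKind false false true false 0F 1F) (sameKind true false true true 4F 5F)
    (sameKind false true true true 0F 1F) (sameKind false false false true 4F 5F)
    (mapCompatible (Equivalence.to (~⇔≈ true true _ _)) c)
    where
    sameKind : ∀ x y x′ y′ a b →
      kind (does (_~?_ x y a b)) (does (_~?_ x′ y′ a b)) ≡
      kind (does (_≈?_ x y a b)) (does (_≈?_ x′ y′ a b))
    sameKind x y x′ y′ a b = cong₂ kind (does-⇔ (~⇔≈ x y a b) (_~?_ x y a b) (_≈?_ x y a b))
      (does-⇔ (~⇔≈ x′ y′ a b) (_~?_ x′ y′ a b) (_≈?_ x′ y′ a b))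

  -- _~_ x y is the equivalence relation generated by f and the gluings.
  record Generated {N} (f : Fin 8 → Fin N) (x y : Bool) (_~_ : Rel (Fin 8) 0ℓ) : Set₁ where
    field
      isEquivalence : IsEquivalence _~_
      extends       : ∀ {a b} → f a ≡ f b → a ~ b
      glues         : All (uncurry _~_) (gluings x y)
      least         : ∀ {_≈_ : Rel (Fin 8) 0ℓ} → IsEquivalence _≈_ → (∀ {a b} → f a ≡ f b → a ≈ b) →
                      All (uncurry _≈_) (gluings x y) → ∀ {a b} → a ~ b → a ≈ b

  -- Only the partition induced by `f` matters, so `f` may be replaced by an enumerated labelling.
  -- Minimality on both sides identifies the glued labelling with `_~_`, and the evaluated check is
  -- transferred.
  squareCompatible : ∀ {N} (f : Fin 8 → Fin N) → (∀ a → xorSum (λ b → does (f b Finₚ.≟ f a)) ≡ false) →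
    ∀ {_~_ : Bool → Bool → Rel (Fin 8) 0ℓ} (_~?_ : ∀ x y → Decidable (_~_ x y)) →
    (∀ x y → Generated f x y (_~_ x y)) → SquareCompatible _~_ _~?_
  squareCompatible {N} f even {_~_} _~?_ gen =
    let (_ , V , V∈ , _ , V⇔f) = labelling f in fromLabelling V (All.lookup all-valid V∈) V⇔f
    where
    fromLabelling : ∀ V → Valid V → (∀ a b → lookup V a ≡ lookup V b ⇔ f a ≡ f b) →
      SquareCompatible _~_ _~?_
    fromLabelling V valid V⇔f = transfer (glued? V) _~?_ glued⇔~
      (fromCheck (noOddBlock (Vec.allFin 8) V evenV) (check V) valid)
      where
      evenV : ∀ a → oddBlock V a ≡ false
      evenV a = trans (xorSum-cong λ b → does-⇔ (V⇔f b a) (sameLabel? V b a) (f b Finₚ.≟ f a)) (even a)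

      glued⇔~ : ∀ x y a b → Glued V x y a b ⇔ _~_ x y a b
      glued⇔~ x y a b = mk⇔
        (identifyAll-least isEquivalence V (λ e → extends (Equivalence.to (V⇔f _ _) e)) glues)
        (least (record { refl = refl ; sym = sym ; trans = trans })
          (λ e → identifyAll-coarser (gluings x y) V (Equivalence.from (V⇔f _ _) e))
          (identifyAll-joins (gluings x y) V))
        where open Generated (gen x y)

-- Corners of a trivalent perfect matching graph

module Corners where

  open import Data.Bool.Base using (Bool; true; false; not)
  open import Data.Fin.Base as Fin using (Fin; zero; suc; combine; remQuot)
  open import Data.Fin.Patterns
  import Data.Fin.Permutation as Perm
  import Data.Fin.Properties as Finₚ
  open import Data.List.Base as List using (List; []; _∷_; length; filter; allFin)
  open import Data.List.Membership.Propositional using (_∈_)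
  open import Data.List.Membership.Propositional.Properties using (∈-filter⁺; ∈-filter⁻; ∈-allFin; ∈-lookup)
  open import Data.List.Relation.Unary.All as All using ([]; _∷_)
  open import Data.List.Relation.Unary.AllPairs using ([]; _∷_)
  open import Data.List.Relation.Unary.Any as Any using (here; there)
  open import Data.List.Relation.Unary.Any.Properties using (lookup-index)
  open import Data.List.Relation.Unary.Unique.Propositional using (Unique)
  open import Data.List.Relation.Unary.Unique.Propositional.Properties using (allFin⁺; filter⁺)
  open import Data.Nat.Base as ℕ using (ℕ; zero; suc; s≤s; z≤n)
  import Data.Nat.Properties as ℕₚ
  open import Data.Product.Base using (∃₂; _×_; _,_; proj₁; proj₂)
  open import Data.Product.Properties using (,-injectiveˡ; ,-injectiveʳ)
  open import Data.Sum.Base using (_⊎_; inj₁; inj₂)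
  open import Function.Base using (_∘_)
  open import Relation.Binary.Construct.Closure.ReflexiveTransitive using (Star; ε; _◅_)
  open import Relation.Binary.PropositionalEquality as ≡ using (_≡_; _≢_; refl; sym; trans; cong; subst)
  open import Relation.Nullary using (¬_; contradiction)
  open import Defs hiding (degree)

  module _ {A : Set} where

    pigeonhole-∈ : ∀ {n} (xs : List A) → length xs ℕ.< n → (f : Fin n → A) → (∀ k → f k ∈ xs) →
      ∃₂ λ k l → k Fin.< l × f k ≡ f l
    pigeonhole-∈ xs xs<n f f∈ =
      let (k , l , k<l , e) = Finₚ.pigeonhole xs<n (Any.index ∘ f∈)
      in k , l , k<l , trans (lookup-index (f∈ k)) (trans (cong (List.lookup xs) e) (sym (lookup-index (f∈ l))))

    unique-lookup : ∀ {xs : List A} → Unique xs → ∀ {k l} → k Fin.< l → List.lookup xs k ≢ List.lookup xs l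
    unique-lookup {xs = x ∷ xs} (x∉ ∷ _) {zero}  {suc l} _         e = All.lookup x∉ (∈-lookup l) e
    unique-lookup (_ ∷ u)  {suc k} {suc l} (s≤s k<l) e = unique-lookup u k<l e

    unique-length : ∀ {xs ys : List A} → Unique xs → (∀ {x} → x ∈ xs → x ∈ ys) → length xs ℕ.≤ length ys
    unique-length {xs} {ys} u xs⊆ys = ℕₚ.≮⇒≥ λ ys<xs →
      let (k , l , k<l , e) = pigeonhole-∈ ys ys<xs (List.lookup xs) (λ k → xs⊆ys (∈-lookup k))
      in unique-lookup u k<l e

  module Rotation (G : RibbonGraph) where

    open RibbonGraph G

    prev-vertex : ∀ h → vertex (prev h) ≡ vertex h
    prev-vertex h = trans (sym (next-vertex (prev h))) (cong vertex (Perm.inverseʳ rotation))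

    around : Vertex → List HalfEdge
    around v = filter (λ h → vertex h Finₚ.≟ v) (allFin #half-edges)

    around⁺ : ∀ {h v} → vertex h ≡ v → h ∈ around v
    around⁺ {h} = ∈-filter⁺ (λ h → vertex h Finₚ.≟ _) (∈-allFin h)

    around⁻ : ∀ {h v} → h ∈ around v → vertex h ≡ v
    around⁻ {v = v} h∈ = proj₂ (∈-filter⁻ (λ h → vertex h Finₚ.≟ v) {xs = allFin #half-edges} h∈)

    around-unique : ∀ v → Unique (around v)
    around-unique v = filter⁺ (λ h → vertex h Finₚ.≟ v) (allFin⁺ #half-edges)

    -- `next` acts transitively at each vertex, so a list closed under it cannot miss a half-edge
    -- there. Exhibiting short closed lists therefore bounds the degree.
    orbit-closed : ∀ {h} (hs : List HalfEdge) → h ∈ hs → (∀ {k} → k ∈ hs → next k ∈ hs) →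
      ∀ {k} → k ∈ around (vertex h) → k ∈ hs
    orbit-closed {h} hs h∈ closed {k} k∈ = go (next-transitive h k (sym (around⁻ k∈))) h∈
      where
      go : ∀ {a b} → Star (λ a b → next a ≡ b) a b → a ∈ hs → b ∈ hs
      go ε          a∈ = a∈
      go (refl ◅ r) a∈ = go r (closed a∈)

    orbit-length : ∀ {h} (hs : List HalfEdge) → h ∈ hs → (∀ {k} → k ∈ hs → next k ∈ hs) →
      degree (vertex h) ℕ.≤ length hs
    orbit-length {h} hs h∈ closed = unique-length (around-unique (vertex h)) (orbit-closed hs h∈ closed)

    module Cubic (cubic : ∀ v → degree v ≡ 3) where

      private
        too-short : ∀ {h} (hs : List HalfEdge) → length hs ℕ.< 3 → h ∈ hs → ¬ (∀ {k} → k ∈ hs → next k ∈ hs)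
        too-short {h} hs hs<3 h∈ closed =
          ℕₚ.<⇒≱ hs<3 (subst (ℕ._≤ length hs) (cubic (vertex h)) (orbit-length hs h∈ closed))

      next≢ : ∀ h → next h ≢ h
      next≢ h e = too-short (h ∷ []) (s≤s (s≤s z≤n)) (here refl) λ { (here refl) → here e }

      next²≢ : ∀ h → next (next h) ≢ h
      next²≢ h e = too-short (h ∷ next h ∷ []) ℕₚ.≤-refl (here refl)
        λ { (here refl) → there (here refl) ; (there (here refl)) → here e }

      -- Four successive half-edges lie among the three at the vertex, so two coincide. Every
      -- coincidence except the one between the first and the last would give a closed list with
      -- fewer than three members.
      next³ : ∀ h → next (next (next h)) ≡ h
      next³ h with pigeonhole-∈ (around (vertex h)) (ℕₚ.≤-reflexive (cong suc (cubic (vertex h)))) entry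
                     (λ k → around⁺ (entry-vertex k))
        where
        entry : Fin 4 → HalfEdge
        entry 0F = h
        entry 1F = next h
        entry 2F = next (next h)
        entry 3F = next (next (next h))
        entry-vertex : ∀ k → vertex (entry k) ≡ vertex h
        entry-vertex 0F = refl
        entry-vertex 1F = next-vertex h
        entry-vertex 2F = trans (next-vertex (next h)) (next-vertex h)
        entry-vertex 3F = trans (next-vertex (next (next h))) (entry-vertex 2F)
      ... | 0F , 1F , _ , e = contradiction (sym e) (next≢ h)
      ... | 0F , 2F , _ , e = contradiction (sym e) (next²≢ h)
      ... | 0F , 3F , _ , e = sym e
      ... | 1F , 2F , _ , e = contradiction (sym e) (next≢ (next h))
      ... | 1F , 3F , _ , e = contradiction (sym e) (next²≢ (next h))
      ... | 2F , 3F , _ , e = contradiction (sym e) (next≢ (next (next h)))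
      ... | 1F , 1F , s≤s () , _
      ... | 2F , 1F , s≤s () , _
      ... | 2F , 2F , s≤s (s≤s ()) , _
      ... | 3F , 1F , s≤s () , _
      ... | 3F , 2F , s≤s (s≤s ()) , _
      ... | 3F , 3F , s≤s (s≤s (s≤s ())) , _

      prev≡next² : ∀ h → prev h ≡ next (next h)
      prev≡next² h = trans (cong prev (sym (next³ h))) (Perm.inverseˡ rotation)

      next≢prev : ∀ h → next h ≢ prev h
      next≢prev h e = next≢ (next h) (trans (sym (prev≡next² h)) (sym e))

      prev≢ : ∀ h → prev h ≢ h
      prev≢ h e = next²≢ h (trans (sym (prev≡next² h)) e)

      same-vertex : ∀ h k → vertex k ≡ vertex h → k ≡ h ⊎ k ≡ next h ⊎ k ≡ prev h
      same-vertex h k e with orbit-closed (h ∷ next h ∷ prev h ∷ []) (here refl) closed (around⁺ e)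
        where
        closed : ∀ {k} → k ∈ h ∷ next h ∷ prev h ∷ [] → next k ∈ h ∷ next h ∷ prev h ∷ []
        closed (here refl)                 = there (here refl)
        closed (there (here refl))         = there (there (here (sym (prev≡next² h))))
        closed (there (there (here refl))) = here (Perm.inverseʳ rotation)
      ... | here p                 = inj₁ p
      ... | there (here p)         = inj₂ (inj₁ p)
      ... | there (there (here p)) = inj₂ (inj₂ p)

  module Partners (Γ : PerfectMatchingGraph) (trivalent : PerfectMatchingGraph.Trivalent Γ) where

    open PerfectMatchingGraph Γ
    open Rotation ribbonGraph
    open Cubic trivalent

    isTop : Corner → Bool
    isTop UL = true
    isTop UR = true
    isTop DL = false
    isTop DR = false

    side : Fin ℓ → Corner → HalfEdge
    side i c = end (i , isTop c)

    corner-vertex : ∀ i c → vertex (corner Γ i c) ≡ vertex (side i c)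
    corner-vertex i UL = prev-vertex (top i)
    corner-vertex i UR = next-vertex (top i)
    corner-vertex i DL = next-vertex (bottom i)
    corner-vertex i DR = prev-vertex (bottom i)

    corner≢side : ∀ i c → corner Γ i c ≢ side i c
    corner≢side i UL = prev≢ (top i)
    corner≢side i UR = next≢ (top i)
    corner≢side i DL = next≢ (bottom i)
    corner≢side i DR = prev≢ (bottom i)

    end-unique : ∀ {e e′} → vertex (end e) ≡ vertex (end e′) → e ≡ e′
    end-unique {e} {e′} p = let (_ , _ , unique) = perfect (vertex (end e′)) in trans (sym (unique p)) (unique refl)

    -- A corner lies at the vertex of its own side. That vertex meets the matching in one end only,
    -- so a corner equal to some end would equal its side, and rotation by one step has no fixed
    -- point.
    corner≢end : ∀ i c e → corner Γ i c ≢ end e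
    corner≢end i c e p = corner≢side i c (trans p (cong end (end-unique
      (trans (cong vertex (sym p)) (corner-vertex i c)))))

    opposite-end : ∀ i b → opposite (end (i , b)) ≡ end (i , not b)
    opposite-end i true  = refl
    opposite-end i false = opposite-involutive (top i)

    same-side : ∀ i c d → isTop c ≡ isTop d → corner Γ i c ≡ corner Γ i d → c ≡ d
    same-side i UL UL _ e = refl
    same-side i UL UR _ e = contradiction (sym e) (next≢prev (top i))
    same-side i UR UL _ e = contradiction e (next≢prev (top i))
    same-side i UR UR _ e = refl
    same-side i DL DL _ e = refl
    same-side i DL DR _ e = contradiction e (next≢prev (bottom i))
    same-side i DR DL _ e = contradiction (sym e) (next≢prev (bottom i))
    same-side i DR DR _ e = refl
    same-side i UL DL ()
    same-side i UL DR ()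
    same-side i UR DL ()
    same-side i UR DR ()
    same-side i DL UL ()
    same-side i DL UR ()
    same-side i DR UL ()
    same-side i DR UR ()

    corner-injective : ∀ i c j d → corner Γ i c ≡ corner Γ j d → i ≡ j × c ≡ d
    corner-injective i c j d e with end-unique {i , isTop c} {j , isTop d}
      (trans (sym (corner-vertex i c)) (trans (cong vertex e) (corner-vertex j d)))
    ... | p with ,-injectiveˡ p
    ... | refl = refl , same-side i c d (,-injectiveʳ p) e

    -- The vertex reached carries one end of a matching edge and two corners. The end is excluded,
    -- because the opposite of an end is again an end and no corner is one.
    opposite-corner : ∀ i c → ∃₂ λ j d → opposite (corner Γ i c) ≡ corner Γ j d
    opposite-corner i c with perfect (vertex (opposite (corner Γ i c)))
    ... | (j , b) , at , _ with same-vertex (end (j , b)) (opposite (corner Γ i c)) (sym at)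
    ... | inj₁ p = contradiction
      (trans (sym (opposite-involutive (corner Γ i c))) (trans (cong opposite p) (opposite-end j b)))
      (corner≢end i c (j , not b))
    opposite-corner i c | (j , true)  , at , _ | inj₂ (inj₁ p) = j , UR , p
    opposite-corner i c | (j , false) , at , _ | inj₂ (inj₁ p) = j , DL , p
    opposite-corner i c | (j , true)  , at , _ | inj₂ (inj₂ p) = j , UL , p
    opposite-corner i c | (j , false) , at , _ | inj₂ (inj₂ p) = j , DR , p

    cornerAt : Fin (ℓ ℕ.* 4) → HalfEdge
    cornerAt p = let (i , c) = remQuot {ℓ} 4 p in corner Γ i c

    cornerAt-injective : ∀ {p q} → cornerAt p ≡ cornerAt q → p ≡ q
    cornerAt-injective {p} {q} e = let (i≡j , c≡d) = corner-injective _ _ _ _ e in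
      trans (sym (Finₚ.combine-remQuot {ℓ} 4 p))
        (trans (≡.cong₂ combine i≡j c≡d) (Finₚ.combine-remQuot {ℓ} 4 q))

    -- The edges outside the matching pair off the corners. The parity argument rests on this
    -- involution without fixed points.
    partner : Fin (ℓ ℕ.* 4) → Fin (ℓ ℕ.* 4)
    partner p = let (i , c) = remQuot {ℓ} 4 p ; (j , d , _) = opposite-corner i c in combine j d

    partner-corner : ∀ p → cornerAt (partner p) ≡ opposite (cornerAt p)
    partner-corner p = let (i , c) = remQuot {ℓ} 4 p ; (j , d , e) = opposite-corner i c in
      trans (cong (λ x → corner Γ (proj₁ x) (proj₂ x)) (Finₚ.remQuot-combine {ℓ} {4} j d)) (sym e)

    partner-involutive : ∀ p → partner (partner p) ≡ p
    partner-involutive p = cornerAt-injective (trans (partner-corner (partner p))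
      (trans (cong opposite (partner-corner p)) (opposite-involutive (cornerAt p))))

    partner≢ : ∀ p → partner p ≢ p
    partner≢ p e = opposite-distinct (cornerAt p) (trans (sym (partner-corner p)) (cong cornerAt e))

-- Circles under changes of smoothing

module Topology where

  open import Data.Bool.Base using (Bool; true; false; _xor_)
  import Data.Bool.Properties as Boolₚ
  open import Data.Fin.Base as Fin using (Fin; zero; suc; combine; remQuot; splitAt; _↑ˡ_; _↑ʳ_)
  open import Data.Fin.Patterns
  import Data.Fin.Permutation as Perm
  import Data.Fin.Properties as Finₚ
  open import Data.List.Base using (List; []; _∷_)
  open import Data.List.Relation.Unary.All as All using (All; []; _∷_)
  open import Data.Nat.Base as ℕ using (ℕ; zero; suc)
  import Data.Nat.Properties as ℕₚ
  open import Data.Product.Base using (∃; ∃₂; _×_; _,_; proj₁; proj₂; uncurry)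
  open import Data.Sum.Base as Sum using (_⊎_; inj₁; inj₂; [_,_]′)
  open import Data.Vec.Base using (lookup)
  open import Function.Base using (_∘_; _on_)
  open import Function.Bundles using (_⇔_; mk⇔; Equivalence)
  open import Level using (0ℓ)
  open import Relation.Binary.Construct.Closure.Equivalence as Eq using (EqClosure)
  import Relation.Binary.Construct.On as On
  open import Relation.Binary.Core using (Rel)
  open import Relation.Binary.Definitions using (Decidable)
  open import Relation.Binary.Structures using (IsEquivalence)
  open import Relation.Binary.PropositionalEquality as ≡ using (_≡_; _≢_; refl; sym; trans; cong; cong₂; subst; subst₂; ≢-sym)
  open import Relation.Nullary using (Dec; yes; no; does; ¬_; contradiction)
  open import Relation.Nullary.Decidable using (_×-dec_; _⊎-dec_; ¬?)
  open import Defs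
  open Sums
  open Face
  open Corners

  open FiniteSums xor-commutativeMonoid

  -- `lower` keeps the smaller member of each orbit of σ. Then `f` is the sum of `lower` and its
  -- translate by σ, and these have the same total.
  sum-invariant : ∀ {n} (σ : Fin n → Fin n) → (∀ p → σ (σ p) ≡ p) → (∀ p → σ p ≢ p) →
    (f : Fin n → Bool) → (∀ p → f (σ p) ≡ f p) → sum f ≡ false
  sum-invariant {n} σ σσ σ≢ f f-inv = begin
    sum f                                     ≡⟨ sum-cong-≗ split ⟩
    sum (λ p → lower p xor lower (σ p))       ≡⟨ ∑-distrib-+ lower (lower ∘ σ) ⟩
    sum lower xor sum (lower ∘ σ)             ≡⟨ cong (sum lower xor_) (sum-permute lower π) ⟨
    sum lower xor sum lower                   ≡⟨ Boolₚ.xor-same (sum lower) ⟩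
    false                                     ∎
    where
    open ≡.≡-Reasoning
    π : Perm.Permutation′ n
    π = Perm.permutation σ σ σσ σσ
    lower : Fin n → Bool
    lower p with p Finₚ.<? σ p
    ... | yes _ = f p
    ... | no _  = false
    split : ∀ p → f p ≡ lower p xor lower (σ p)
    split p with p Finₚ.<? σ p | σ p Finₚ.<? σ (σ p)
    ... | yes a | yes b = contradiction (subst (σ p Fin.<_) (σσ p) b) (Finₚ.<-asym a)
    ... | yes a | no _  = sym (Boolₚ.xor-identityʳ (f p))
    ... | no _  | yes _ = sym (f-inv p)
    ... | no ¬a | no ¬b = contradiction (Finₚ.≤-antisym (ℕₚ.≮⇒≥ ¬a)
                            (subst (Fin._≤ σ p) (σσ p) (ℕₚ.≮⇒≥ ¬b))) (σ≢ p)

  module _ (Γ : PerfectMatchingGraph) where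

    open PerfectMatchingGraph Γ using (ℓ)

    Point : Set
    Point = Fin (ℓ ℕ.* 4)

    At : State ℓ → Rel Point 0ℓ
    At α = Joined Γ α on remQuot {ℓ} 4

    circle : ∀ α → Point → Circle Γ α
    circle α = Quotient.class (circles Γ α)

    circle-complete : ∀ α {p q} → circle α p ≡ circle α q → EqClosure (At α) p q
    circle-complete α = Quotient.complete (circles Γ α)

    circle-sound : ∀ α {p q} → EqClosure (At α) p q → circle α p ≡ circle α q
    circle-sound α = Quotient.sound (circles Γ α)

    At-smoothing : ∀ α i c → At α (combine i c) (combine i (smoothing (lookup α i) c))
    At-smoothing α i c = subst₂ (Joined Γ α) (sym (Finₚ.remQuot-combine {ℓ} {4} i c))
      (sym (Finₚ.remQuot-combine {ℓ} {4} i (smoothing (lookup α i) c))) (inj₂ (refl , refl))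

    circle-smoothing : ∀ α i {b} → lookup α i ≡ b → ∀ c →
      circle α (combine i c) ≡ circle α (combine i (smoothing b c))
    circle-smoothing α i refl c = circle-sound α (Eq.return (At-smoothing α i c))

    Agree : (Fin ℓ → Set) → State ℓ → State ℓ → Set
    Agree K α β = ∀ k → ¬ K k → lookup α k ≡ lookup β k

    module Away {K : Fin ℓ → Set} (K? : ∀ k → Dec (K k)) (α : State ℓ) where

      -- `Joined` without the smoothing arcs at the edges in `K`, hence common to all states that
      -- agree outside `K`.
      JoinedAway : Rel (Fin ℓ × Corner) 0ℓ
      JoinedAway (i , c) (j , d) =
        PerfectMatchingGraph.opposite Γ (corner Γ i c) ≡ corner Γ j d ⊎
        ((j ≡ i × d ≡ smoothing (lookup α i) c) × ¬ K i)

      joinedAway? : Decidable JoinedAway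
      joinedAway? (i , c) (j , d) =
        (PerfectMatchingGraph.opposite Γ (corner Γ i c) Finₚ.≟ corner Γ j d) ⊎-dec
        (((j Finₚ.≟ i) ×-dec (d Finₚ.≟ smoothing (lookup α i) c)) ×-dec ¬? (K? i))

      AtAway : Rel Point 0ℓ
      AtAway = JoinedAway on remQuot {ℓ} 4

      _~₀_ : Rel Point 0ℓ
      _~₀_ = EqClosure AtAway

      away⊆ : ∀ {β} → Agree K α β → ∀ {p q} → p ~₀ q → EqClosure (At β) p q
      away⊆ {β} agree = Eq.map λ
        { (inj₁ e) → inj₁ e
        ; (inj₂ ((i≡j , e) , ¬k)) → inj₂ (i≡j , trans e (cong (λ b → smoothing b _) (agree _ ¬k))) }

      away-or-K : ∀ {β} → Agree K α β → ∀ {p q} → At β p q → p ~₀ q ⊎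
        (∃₂ λ k c → K k × p ≡ combine k c × q ≡ combine k (smoothing (lookup β k) c))
      away-or-K {β} agree {p} {q} (inj₁ e) = inj₁ (Eq.return (inj₁ e))
      away-or-K {β} agree {p} {q} (inj₂ (j≡i , e)) with K? (proj₁ (remQuot {ℓ} 4 p))
      ... | yes k = inj₂ (_ , _ , k , sym (Finₚ.combine-remQuot {ℓ} 4 p) ,
              trans (sym (Finₚ.combine-remQuot {ℓ} 4 q)) (cong₂ combine j≡i e))
      ... | no ¬k = inj₁ (Eq.return (inj₂ ((j≡i , trans e (cong (λ b → smoothing b _) (sym (agree _ ¬k)))) , ¬k)))

    module EdgeChange (α α′ : State ℓ) (i : Fin ℓ) (agree : Agree (_≡ i) α α′) where

      open Away {_≡ i} (Finₚ._≟ i) α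

      Touches : Point → Set
      Touches p = ∃ λ c → p ~₀ combine i c

      -- All points that reach the edge are lumped together. This makes the relation independent of
      -- how the edge is smoothed, while circles that avoid the edge remain separated.
      Related : Rel Point 0ℓ
      Related p q = p ~₀ q ⊎ (Touches p × Touches q)

      touches-~ : ∀ {p q} → p ~₀ q → Touches q → Touches p
      touches-~ p~q (c , q~c) = c , Eq.transitive AtAway p~q q~c

      related-equivalence : IsEquivalence Related
      related-equivalence = record
        { refl  = inj₁ (Eq.reflexive AtAway)
        ; sym   = λ { (inj₁ r) → inj₁ (Eq.symmetric AtAway r) ; (inj₂ (s , t)) → inj₂ (t , s) }
        ; trans = λ
          { (inj₁ r)       (inj₁ r′)        → inj₁ (Eq.transitive AtAway r r′)
          ; (inj₁ r)       (inj₂ (s , t))   → inj₂ (touches-~ r s , t)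
          ; (inj₂ (s , t)) (inj₁ r)         → inj₂ (s , touches-~ (Eq.symmetric AtAway r) t)
          ; (inj₂ (s , _)) (inj₂ (_ , t))   → inj₂ (s , t) }
        }

      related : ∀ {β} → Agree (_≡ i) α β → ∀ {p q} → EqClosure (At β) p q → Related p q
      related {β} a = Eq.fold related-equivalence λ r → Sum.map₂
        (λ { (_ , c , refl , refl , refl) → (c , Eq.reflexive AtAway) , (_ , Eq.reflexive AtAway) })
        (away-or-K {β} a r)

      OnEdge : State ℓ → Point → Set
      OnEdge β p = circle β p ≡ circle β (combine i UL) ⊎ circle β p ≡ circle β (combine i UR)

      -- `Touches` speaks of arcs away from the edge and therefore carries `OnEdge` from one
      -- smoothing to the other. The lower corners are covered because each smoothing joins them to
      -- upper ones.
      onEdge⇔touches : ∀ {β} → Agree (_≡ i) α β → ∀ {p} → OnEdge β p ⇔ Touches p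
      onEdge⇔touches {β} a {p} = mk⇔
        [ touches , touches ]′
        (λ (c , r) → Sum.map (trans (circle-sound β (away⊆ {β} a r))) (trans (circle-sound β (away⊆ {β} a r)))
          (through (lookup β i) refl c))
        where
        touches : ∀ {c} → circle β p ≡ circle β (combine i c) → Touches p
        touches {c} e with related {β} a (circle-complete β e)
        ... | inj₁ r       = _ , r
        ... | inj₂ (t , _) = t
        through : ∀ b → lookup β i ≡ b → ∀ c → OnEdge β (combine i c)
        through b     e UL = inj₁ refl
        through b     e UR = inj₂ refl
        through false e DL = inj₁ (circle-smoothing β i e DL)
        through true  e DL = inj₂ (circle-smoothing β i e DL)
        through false e DR = inj₂ (circle-smoothing β i e DR)
        through true  e DR = inj₁ (circle-smoothing β i e DR)

      private
        agree₀ : Agree (_≡ i) α α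
        agree₀ _ _ = refl

      onEdge⇔ : ∀ {p} → OnEdge α p ⇔ OnEdge α′ p
      onEdge⇔ = mk⇔
        (Equivalence.from (onEdge⇔touches {α′} agree) ∘ Equivalence.to (onEdge⇔touches {α} agree₀))
        (Equivalence.from (onEdge⇔touches {α} agree₀) ∘ Equivalence.to (onEdge⇔touches {α′} agree))

      private
        away : ∀ β β′ → Agree (_≡ i) α β → Agree (_≡ i) α β′ → ∀ {p q} → ¬ OnEdge β p →
          circle β p ≡ circle β q → circle β′ p ≡ circle β′ q
        away β β′ a a′ ¬on e with related {β} a (circle-complete β e)
        ... | inj₁ r       = circle-sound β′ (away⊆ {β′} a′ r)
        ... | inj₂ (t , _) = contradiction (Equivalence.from (onEdge⇔touches {β} a) t) ¬on

      -- A circle that avoids the edge consists of arcs shared by both states.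
      circle⇔ : ∀ {p q} → ¬ OnEdge α p → circle α p ≡ circle α q ⇔ circle α′ p ≡ circle α′ q
      circle⇔ ¬on = mk⇔ (away α α′ agree₀ agree ¬on)
                        (away α′ α agree agree₀ (¬on ∘ Equivalence.from onEdge⇔))

    module SquareChange (trivalent : PerfectMatchingGraph.Trivalent Γ)
      (state : Bool → Bool → State ℓ) (i j : Fin ℓ) (i≢j : i ≢ j)
      (at-i : ∀ x y → lookup (state x y) i ≡ x) (at-j : ∀ x y → lookup (state x y) j ≡ y)
      (agree : ∀ x y → Agree (λ k → k ≡ i ⊎ k ≡ j) (state false false) (state x y)) where

      K : Fin ℓ → Set
      K k = k ≡ i ⊎ k ≡ j

      K? : ∀ k → Dec (K k)
      K? k = (k Finₚ.≟ i) ⊎-dec (k Finₚ.≟ j)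

      open Away {K} K? (state false false)
      open Partners Γ trivalent

      ι : Fin 8 → Point
      ι a = [ combine i , combine j ]′ (splitAt 4 a)

      open Quotient (quotient (λ p q → joinedAway? (remQuot {ℓ} 4 p) (remQuot {ℓ} 4 q)))

      class-smoothing : ∀ k → ¬ K k → ∀ c →
        class (combine k c) ≡ class (combine k (smoothing (lookup (state false false) k) c))
      class-smoothing k ¬k c = sound (Eq.return step)
        where
        step : AtAway (combine k c) (combine k (smoothing (lookup (state false false) k) c))
        step = subst₂ JoinedAway (sym (Finₚ.remQuot-combine {ℓ} {4} k c))
          (sym (Finₚ.remQuot-combine {ℓ} {4} k (smoothing (lookup (state false false) k) c)))
          (inj₂ ((refl , refl) , ¬k))

      -- Within a class `partner` makes the number of all corners even. An edge other than `i` and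
      -- `j` contributes an even number, since its smoothing arcs pair its four corners within
      -- classes. What remains are the eight corners at `i` and `j`.
      even : ∀ a → sum (λ b → does (class (ι b) Finₚ.≟ class (ι a))) ≡ false
      even a = begin
        sum (h ∘ ι)                                ≡⟨ sum-↑ 4 (h ∘ ι) ⟩
        row i xor row j                            ≡⟨ cong (row i xor_) (except-off row (≢-sym i≢j)) ⟨
        row i xor except i row j                   ≡⟨ cong (row i xor_) (sum-single j rest) ⟨
        row i xor sum (except i row)               ≡⟨ sum-except i row ⟨
        sum row                                    ≡⟨ sum-combine ℓ 4 h ⟨
        sum h                                      ≡⟨ sum-invariant partner partner-involutive partner≢ h h-partner ⟩
        false                                      ∎
        where
        open ≡.≡-Reasoning
        h : Point → Bool
        h p = does (class p Finₚ.≟ class (ι a))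
        row : Fin ℓ → Bool
        row k = sum λ c → h (combine k c)
        h-cong : ∀ {p q} → class p ≡ class q → h p ≡ h q
        h-cong e = cong (λ c → does (c Finₚ.≟ class (ι a))) e
        h-partner : ∀ p → h (partner p) ≡ h p
        h-partner p = h-cong (sym (sound {p} {partner p} (Eq.return (inj₁ (sym (partner-corner p))))))
        pairs : ∀ k → (b : Bool) → (∀ c → h (combine k c) ≡ h (combine k (smoothing b c))) → row k ≡ false
        pairs k false e rewrite e UL | e UR = lemma (h (combine k DL)) (h (combine k DR))
          where
          lemma : ∀ x y → x xor (y xor (x xor (y xor false))) ≡ false
          lemma false false = refl
          lemma false true = refl
          lemma true false = refl
          lemma true true = refl
        pairs k true e rewrite e UL | e UR = lemma (h (combine k DL)) (h (combine k DR))
          where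
          lemma : ∀ x y → y xor (x xor (x xor (y xor false))) ≡ false
          lemma false false = refl
          lemma false true = refl
          lemma true false = refl
          lemma true true = refl
        rest : ∀ k → k ≢ j → except i row k ≡ false
        rest k k≢j with k Finₚ.≟ i
        ... | yes _  = refl
        ... | no k≢i = pairs k _ λ c → h-cong (class-smoothing k [ k≢i , k≢j ]′ c)

      _≈[_,_]_ : Fin 8 → Bool → Bool → Fin 8 → Set
      a ≈[ x , y ] b = circle (state x y) (ι a) ≡ circle (state x y) (ι b)

      generated : ∀ x y → Generated (class ∘ ι) x y (λ a b → a ≈[ x , y ] b)
      generated x y = record
        { isEquivalence = On.isEquivalence (circle (state x y) ∘ ι) ≡.isEquivalence
        ; extends       = λ e → circle-sound (state x y) (away⊆ {state x y} (agree x y) (complete e))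
        ; glues         = glued x y {state x y} (at-i x y) (at-j x y)
        ; least         = λ {_≈_} → least {_≈_}
        }
        where
        glued : ∀ x y {β : State ℓ} → lookup β i ≡ x → lookup β j ≡ y →
          All (uncurry λ a b → circle β (ι a) ≡ circle β (ι b)) (gluings x y)
        glued false false {β} p q = circle-smoothing β i p UL ∷ circle-smoothing β i p UR ∷
                                    circle-smoothing β j q UL ∷ circle-smoothing β j q UR ∷ []
        glued false true  {β} p q = circle-smoothing β i p UL ∷ circle-smoothing β i p UR ∷
                                    circle-smoothing β j q UL ∷ circle-smoothing β j q UR ∷ []
        glued true  false {β} p q = circle-smoothing β i p UL ∷ circle-smoothing β i p UR ∷
                                    circle-smoothing β j q UL ∷ circle-smoothing β j q UR ∷ []
        glued true  true  {β} p q = circle-smoothing β i p UL ∷ circle-smoothing β i p UR ∷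
                                    circle-smoothing β j q UL ∷ circle-smoothing β j q UR ∷ []

        module _ {_≈_ : Rel (Fin 8) 0ℓ} (≈-equivalence : IsEquivalence _≈_)
          (class⊆≈ : ∀ {a b} → class (ι a) ≡ class (ι b) → a ≈ b) (glue : All (uncurry _≈_) (gluings x y)) where

          open IsEquivalence ≈-equivalence renaming (refl to ≈-refl; sym to ≈-sym; trans to ≈-trans)

          -- An explicit form of the relation generated by the arcs away from the two edges and by
          -- `_≈_` on the eight corners. One passage through `_≈_` suffices: between two passages
          -- lies a path away from the edges, which `class⊆≈` absorbs.
          Linked : Rel Point 0ℓ
          Linked p q = p ~₀ q ⊎ (∃₂ λ a b → p ~₀ ι a × a ≈ b × ι b ~₀ q)

          ~⊆≈ : ∀ {a b} → ι a ~₀ ι b → a ≈ b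
          ~⊆≈ r = class⊆≈ (sound r)

          infixr 5 _∙_
          _∙_ : ∀ {p q r} → p ~₀ q → q ~₀ r → p ~₀ r
          _∙_ = Eq.transitive AtAway

          linked-equivalence : IsEquivalence Linked
          linked-equivalence = record
            { refl  = inj₁ (Eq.reflexive AtAway)
            ; sym   = λ { (inj₁ r) → inj₁ (Eq.symmetric AtAway r)
                        ; (inj₂ (a , b , r , e , s)) →
                            inj₂ (b , a , Eq.symmetric AtAway s , ≈-sym e , Eq.symmetric AtAway r) }
            ; trans = λ
              { (inj₁ r) (inj₁ r′) → inj₁ (r ∙ r′)
              ; (inj₁ r) (inj₂ (a , b , r′ , e , s)) → inj₂ (a , b , (r ∙ r′) , e , s)
              ; (inj₂ (a , b , r , e , s)) (inj₁ r′) → inj₂ (a , b , r , e , (s ∙ r′))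
              ; (inj₂ (a , b , r , e , s)) (inj₂ (a′ , b′ , r′ , e′ , s′)) →
                  inj₂ (a , b′ , r , ≈-trans e (≈-trans (~⊆≈ (s ∙ r′)) e′) , s′) }
            }

          smooth : ∀ x′ y′ → All (uncurry _≈_) (gluings x′ y′) → ∀ c →
            (c ↑ˡ 4) ≈ (smoothing x′ c ↑ˡ 4) × (4 ↑ʳ c) ≈ (4 ↑ʳ smoothing y′ c)
          smooth false false (p ∷ q ∷ r ∷ s ∷ []) UL = p , r
          smooth false false (p ∷ q ∷ r ∷ s ∷ []) UR = q , s
          smooth false false (p ∷ q ∷ r ∷ s ∷ []) DL = ≈-sym p , ≈-sym r
          smooth false false (p ∷ q ∷ r ∷ s ∷ []) DR = ≈-sym q , ≈-sym s
          smooth false true  (p ∷ q ∷ r ∷ s ∷ []) UL = p , r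
          smooth false true  (p ∷ q ∷ r ∷ s ∷ []) UR = q , s
          smooth false true  (p ∷ q ∷ r ∷ s ∷ []) DL = ≈-sym p , ≈-sym s
          smooth false true  (p ∷ q ∷ r ∷ s ∷ []) DR = ≈-sym q , ≈-sym r
          smooth true  false (p ∷ q ∷ r ∷ s ∷ []) UL = p , r
          smooth true  false (p ∷ q ∷ r ∷ s ∷ []) UR = q , s
          smooth true  false (p ∷ q ∷ r ∷ s ∷ []) DL = ≈-sym q , ≈-sym r
          smooth true  false (p ∷ q ∷ r ∷ s ∷ []) DR = ≈-sym p , ≈-sym s
          smooth true  true  (p ∷ q ∷ r ∷ s ∷ []) UL = p , r
          smooth true  true  (p ∷ q ∷ r ∷ s ∷ []) UR = q , s
          smooth true  true  (p ∷ q ∷ r ∷ s ∷ []) DL = ≈-sym q , ≈-sym s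
          smooth true  true  (p ∷ q ∷ r ∷ s ∷ []) DR = ≈-sym p , ≈-sym r

          ι-left : ∀ c → ι (c ↑ˡ 4) ≡ combine i c
          ι-left c = cong [ combine i , combine j ]′ (Finₚ.splitAt-↑ˡ 4 c 4)

          ι-right : ∀ c → ι (4 ↑ʳ c) ≡ combine j c
          ι-right c = cong [ combine i , combine j ]′ (Finₚ.splitAt-↑ʳ 4 4 c)

          ~-reflexive : ∀ {p q} → p ≡ q → p ~₀ q
          ~-reflexive refl = Eq.reflexive AtAway

          step : ∀ {p q} → At (state x y) p q → Linked p q
          step r with away-or-K {state x y} (agree x y) r
          ... | inj₁ r′ = inj₁ r′
          ... | inj₂ (k , c , inj₁ refl , refl , refl) rewrite at-i x y =
            inj₂ (_ , _ , ~-reflexive (sym (ι-left c)) , proj₁ (smooth x y glue c) , ~-reflexive (ι-left _))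
          ... | inj₂ (k , c , inj₂ refl , refl , refl) rewrite at-j x y =
            inj₂ (_ , _ , ~-reflexive (sym (ι-right c)) , proj₂ (smooth x y glue c) , ~-reflexive (ι-right _))

          least : ∀ {a b} → a ≈[ x , y ] b → a ≈ b
          least e with Eq.fold linked-equivalence step (circle-complete (state x y) e)
          ... | inj₁ r = ~⊆≈ r
          ... | inj₂ (a , b , r , e′ , s) = ≈-trans (~⊆≈ r) (≈-trans e′ (~⊆≈ s))

      _≈?[_,_]_ : ∀ a x y b → Dec (a ≈[ x , y ] b)
      a ≈?[ x , y ] b = circle (state x y) (ι a) Finₚ.≟ circle (state x y) (ι b)

      square : SquareCompatible (λ x y a b → a ≈[ x , y ] b) (λ x y a b → a ≈?[ x , y ] b)
      square = squareCompatible (class ∘ ι) even (λ x y a b → a ≈?[ x , y ] b) generated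

-- The algebra V and the element Δ(1)

module Tensor where

  open import Algebra.Bundles using (CommutativeRing; CommutativeMonoid)
  open import Data.Bool.Base using (Bool; if_then_else_)
  open import Data.Fin.Base as Fin using (Fin; zero; suc; toℕ; opposite)
  open import Data.Fin.Patterns
  import Data.Fin.Permutation as Perm
  import Data.Fin.Properties as Finₚ
  open import Data.List.Base using (List; []; _∷_)
  open import Data.Nat.Base as ℕ using (ℕ; zero; suc; NonZero; parity; ⌊_/2⌋)
  import Data.Nat.Properties as ℕₚ
  open import Data.Parity.Base using (0ℙ; 1ℙ)
  open import Data.Product.Base using (_×_; _,_; proj₁; proj₂)
  open import Data.Product.Properties using (≡-dec)
  open import Data.Vec.Base using ([]; _∷_)
  open import Function.Base using (_∘_)
  open import Level using (0ℓ)
  open import Relation.Binary.PropositionalEquality as ≡ using (_≡_; _≢_; refl; cong; cong₂)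
  open import Relation.Nullary using (does)
  open import Relation.Nullary.Decidable using (dec-true; dec-false)
  open import Defs
  open Sums

  if-even-elim : ∀ {A : Set} (P : A → Set) n {x y} → (parity n ≡ 0ℙ → P x) → (parity n ≡ 1ℙ → P y) →
    P (if-even n then x else y)
  if-even-elim P n px py with parity n
  ... | 0ℙ = px refl
  ... | 1ℙ = py refl

  double-half : ∀ k → parity k ≡ 0ℙ → ⌊ k /2⌋ ℕ.+ ⌊ k /2⌋ ≡ k
  double-half zero          _ = refl
  double-half (suc (suc k)) e =
    cong suc (≡.trans (ℕₚ.+-suc ⌊ k /2⌋ ⌊ k /2⌋) (cong suc (double-half k e)))

  parity-pred : ∀ k → parity (suc k) ≡ 1ℙ → parity k ≡ 0ℙ
  parity-pred zero          _ = refl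
  parity-pred (suc (suc k)) e = parity-pred k e

  half-even : ∀ n .{{_ : NonZero n}} → parity n ≡ 0ℙ → suc (⌊ n ℕ.∸ 2 /2⌋ ℕ.+ ⌊ n ℕ.∸ 2 /2⌋) ≡ n ℕ.∸ 1
  half-even (suc (suc k)) e = cong suc (double-half k e)

  half-odd : ∀ n .{{_ : NonZero n}} → parity n ≡ 1ℙ → ⌊ n ℕ.∸ 1 /2⌋ ℕ.+ ⌊ n ℕ.∸ 1 /2⌋ ≡ n ℕ.∸ 1
  half-odd (suc k) e = double-half k (parity-pred k e)

  -- (a , b) stands for xᵃyᵇ.
  Monomial : Set
  Monomial = ℕ × ℕ

  infixr 6 _⊹_
  _⊹_ : Monomial → Monomial → Monomial
  (a , b) ⊹ (a′ , b′) = a ℕ.+ a′ , b ℕ.+ b′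

  ⊹-comm : ∀ z z′ → z ⊹ z′ ≡ z′ ⊹ z
  ⊹-comm (a , b) (a′ , b′) = cong₂ _,_ (ℕₚ.+-comm a a′) (ℕₚ.+-comm b b′)

  ⊹-assoc : ∀ z z′ z″ → (z ⊹ z′) ⊹ z″ ≡ z ⊹ z′ ⊹ z″
  ⊹-assoc (a , b) (a′ , b′) (a″ , b″) = cong₂ _,_ (ℕₚ.+-assoc a a′ a″) (ℕₚ.+-assoc b b′ b″)

  ⊹-identityʳ : ∀ z → z ⊹ (0 , 0) ≡ z
  ⊹-identityʳ (a , b) = cong₂ _,_ (ℕₚ.+-identityʳ a) (ℕₚ.+-identityʳ b)

  ⊹-swap : ∀ z z′ z″ → z ⊹ z′ ⊹ z″ ≡ z′ ⊹ z ⊹ z″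
  ⊹-swap z z′ z″ = ≡.trans (≡.sym (⊹-assoc z z′ z″)) (≡.trans (cong (_⊹ z″) (⊹-comm z z′)) (⊹-assoc z′ z z″))

  module Calculus (n : ℕ) .{{_ : NonZero n}} (R : CommutativeRing 0ℓ 0ℓ) (1/3n : CommutativeRing.Carrier R) where

    open CommutativeRing R hiding (zero) renaming (Carrier to ∣R∣; refl to ≈-refl; sym to ≈-sym; trans to ≈-trans)
    open Complex n R 1/3n
    open FiniteSums +-commutativeMonoid
      renaming (sum-ε to sum-0)
    open import Algebra.Properties.Semiring.Sum semiring using (*-distribʳ-sum)
    open import Algebra.Properties.Ring ring using (-‿distribˡ-*)
    open import Relation.Binary.Reasoning.Setoid setoid

    θ : Monomial
    θ = if-even n then (⌊ n ℕ.∸ 2 /2⌋ , 2) else (⌊ n ℕ.∸ 1 /2⌋ , 1)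

    X : Monomial → Basis → ∣R∣
    X (a , b) = x^ a y^ b

    expo : Basis → Monomial
    expo (i , j) = toℕ i , toℕ j

    reduce-+ : ∀ a b z → reduce (a ℕ.+ proj₁ z) (b ℕ.+ proj₂ z) ≡
      reduce (proj₁ (reduce a b) ℕ.+ proj₁ z) (toℕ (proj₂ (reduce a b)) ℕ.+ proj₂ z)
    reduce-+ a 0 z = refl
    reduce-+ a 1 z = refl
    reduce-+ a 2 z = refl
    reduce-+ a (suc (suc (suc b))) z = reduce-+ (suc a) (suc b) z

    reduce-≥ : ∀ a b → a ℕ.≤ proj₁ (reduce a b)
    reduce-≥ a 0 = ℕₚ.≤-refl
    reduce-≥ a 1 = ℕₚ.≤-refl
    reduce-≥ a 2 = ℕₚ.≤-refl
    reduce-≥ a (suc (suc (suc b))) = ℕₚ.<⇒≤ (reduce-≥ (suc a) (suc b))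

    reduce-expo : ∀ (v : Basis) → reduce (proj₁ (expo v)) (proj₂ (expo v)) ≡ (toℕ (proj₁ v) , proj₂ v)
    reduce-expo (i , 0F) = refl
    reduce-expo (i , 1F) = refl
    reduce-expo (i , 2F) = refl

    X-≡ : ∀ z {v : Basis} → reduce (proj₁ z) (proj₂ z) ≡ (toℕ (proj₁ v) , proj₂ v) → X z v ≡ 1#
    X-≡ (a , b) {v} e rewrite dec-true (≡-dec ℕₚ._≟_ Finₚ._≟_ (reduce a b) (toℕ (proj₁ v) , proj₂ v)) e = refl

    X-≢ : ∀ z {v : Basis} → reduce (proj₁ z) (proj₂ z) ≢ (toℕ (proj₁ v) , proj₂ v) → X z v ≡ 0#
    X-≢ (a , b) {v} e rewrite dec-false (≡-dec ℕₚ._≟_ Finₚ._≟_ (reduce a b) (toℕ (proj₁ v) , proj₂ v)) e = refl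

    X-reduce : ∀ z z′ → reduce (proj₁ z) (proj₂ z) ≡ reduce (proj₁ z′) (proj₂ z′) → ∀ v → X z v ≡ X z′ v
    X-reduce z z′ e (i , j) = cong (λ r → if does (≡-dec ℕₚ._≟_ Finₚ._≟_ r (toℕ i , j)) then 1# else 0#) e

    X-zero : ∀ {z} → n ℕ.≤ proj₁ z → ∀ v → X z v ≡ 0#
    X-zero {a , b} n≤a (i , j) = X-≢ (a , b) λ e →
      ℕₚ.<⇒≱ (Finₚ.toℕ<n i) (ℕₚ.≤-trans n≤a (ℕₚ.≤-trans (reduce-≥ a b) (ℕₚ.≤-reflexive (cong proj₁ e))))

    X-y³ : ∀ z {a b} v → X (z ⊹ (a , 3 ℕ.+ b)) v ≡ X (z ⊹ (suc a , suc b)) v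
    X-y³ (c , d) {a} {b} v = X-reduce ((c , d) ⊹ (a , 3 ℕ.+ b)) ((c , d) ⊹ (suc a , suc b))
      (≡.trans (cong (reduce (c ℕ.+ a)) 3+) (≡.sym (cong₂ reduce (ℕₚ.+-suc c a) (ℕₚ.+-suc d b)))) v
      where
      3+ : d ℕ.+ (3 ℕ.+ b) ≡ 3 ℕ.+ (d ℕ.+ b)
      3+ = ≡.trans (ℕₚ.+-suc d (2 ℕ.+ b)) (cong suc (≡.trans (ℕₚ.+-suc d (suc b)) (cong suc (ℕₚ.+-suc d b))))

    ∑-cong : ∀ k {f g : Fin k → ∣R∣} → (∀ i → f i ≈ g i) → ∑[ i < k ] f i ≈ ∑[ i < k ] g i
    ∑-cong k e = sum-cong-≋ {k} e

    -- Linear functionals on families over any index type. Evaluations, sums and edge maps all have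
    -- this form, so a few general lemmas let any two of them be interchanged.
    record Linear {I : Set} (T : (I → ∣R∣) → ∣R∣) : Set where
      field
        T-cong : ∀ {f g} → (∀ x → f x ≈ g x) → T f ≈ T g
        T-+    : ∀ f g → T (λ x → f x + g x) ≈ T f + T g
        T-*    : ∀ c f → T (λ x → c * f x) ≈ c * T f

      T-0 : ∀ {f} → (∀ x → f x ≈ 0#) → T f ≈ 0#
      T-0 {f} e = ≈-trans (T-cong λ x → ≈-trans (e x) (≈-sym (zeroˡ (f x)))) (≈-trans (T-* 0# f) (zeroˡ (T f)))

      T-∑ : ∀ k (f : Fin k → I → ∣R∣) → T (λ x → ∑[ i < k ] f i x) ≈ ∑[ i < k ] T (f i)
      T-∑ zero    f = T-0 λ _ → ≈-refl
      T-∑ (suc k) f = ≈-trans (T-+ (f zero) _) (+-congˡ (T-∑ k (f ∘ suc)))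

    open Linear

    linear-∘ : ∀ {I J : Set} {T : (I → ∣R∣) → ∣R∣} → Linear T → (e : I → J) → Linear {J} (λ f → T (f ∘ e))
    linear-∘ T e = record
      { T-cong = λ p → T-cong T (p ∘ e) ; T-+ = λ f g → T-+ T (f ∘ e) (g ∘ e) ; T-* = λ c f → T-* T c (f ∘ e) }

    linear-at : ∀ {I : Set} (x : I) → Linear λ f → f x
    linear-at x = record { T-cong = λ p → p x ; T-+ = λ _ _ → ≈-refl ; T-* = λ _ _ → ≈-refl }

    linear-scale : ∀ {I : Set} {T : (I → ∣R∣) → ∣R∣} → Linear T → ∀ c → Linear λ f → c * T f
    linear-scale {T = T} L c = record
      { T-cong = λ p → *-congˡ (T-cong L p)
      ; T-+    = λ f g → ≈-trans (*-congˡ (T-+ L f g)) (distribˡ c (T f) (T g))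
      ; T-*    = λ d f → ≈-trans (*-congˡ (T-* L d f)) (x∙yz≈y∙xz c d (T f))
      }
      where open import Algebra.Properties.CommutativeSemigroup *-commutativeSemigroup using (x∙yz≈y∙xz)

    linear-+ : ∀ {I : Set} {T U : (I → ∣R∣) → ∣R∣} → Linear T → Linear U → Linear λ f → T f + U f
    linear-+ {T = T} {U} L M = record
      { T-cong = λ p → +-cong (T-cong L p) (T-cong M p)
      ; T-+    = λ f g → ≈-trans (+-cong (T-+ L f g) (T-+ M f g)) (interchange (T f) (T g) (U f) (U g))
      ; T-*    = λ c f → ≈-trans (+-cong (T-* L c f) (T-* M c f)) (≈-sym (distribˡ c (T f) (U f)))
      }
      where open import Algebra.Properties.CommutativeSemigroup
                  (CommutativeMonoid.commutativeSemigroup +-commutativeMonoid) using (interchange)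

    linear-∑ : ∀ {I : Set} k {T : Fin k → (I → ∣R∣) → ∣R∣} → (∀ i → Linear (T i)) → Linear λ f → ∑[ i < k ] T i f
    linear-∑ zero    L = record
      { T-cong = λ _ → ≈-refl ; T-+ = λ _ _ → ≈-sym (+-identityˡ 0#) ; T-* = λ c _ → ≈-sym (zeroʳ c) }
    linear-∑ (suc k) L = linear-+ (L zero) (linear-∑ k (L ∘ suc))

    linear-∑⊗ : ∀ {I : Set} k {T : Tensor k → (I → ∣R∣) → ∣R∣} → (∀ s → Linear (T s)) → Linear λ f → ∑⊗ k λ s → T s f
    linear-∑⊗ k {T} L = record
      { T-cong = λ p → ∑⊗-cong k λ s → T-cong (L s) p
      ; T-+    = λ f g → ≈-trans (∑⊗-cong k λ s → T-+ (L s) f g) (∑⊗-+ k _ _)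
      ; T-*    = λ c f → ≈-trans (∑⊗-cong k λ s → T-* (L s) c f) (∑⊗-* k c _)
      }

    -- The exponent `m` is a separate parameter so that proofs can match on `suc N` while the
    -- surrounding `n` stays fixed. The coefficient `1/3n` still refers to `n`; symmetry and the
    -- Casimir identity hold for any coefficient.
    module Pairing (m : ℕ) where

      opaque

        -- The pairing of G with Δ(1), that is, Σ c G(d , e) where Δ(1) = Σ c d ⊗ e,
        -- for xᵐ = 0.
        pairing : (Monomial → Monomial → ∣R∣) → ∣R∣
        pairing G =
          - 1/3n * (∑[ k < m ℕ.∸ 1 ] G (suc (toℕ k) , 0) (m ℕ.∸ suc (toℕ k) , 0))
          + 1/3n * (∑[ k < m ]
            ( G (toℕ k , 2) (m ℕ.∸ 1 ℕ.∸ toℕ k , 0)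
            + G (toℕ k , 1) (m ℕ.∸ 1 ℕ.∸ toℕ k , 1)
            + G (toℕ k , 0) (m ℕ.∸ 1 ℕ.∸ toℕ k , 2)))

      -- G vanishes where xᵐ = 0 says so and respects y³ = xy in both arguments.
      record Admissible (G : Monomial → Monomial → ∣R∣) : Set where
        field
          zeroₗ : ∀ {a b z} → m ℕ.≤ a → G (a , b) z ≈ 0#
          zeroᵣ : ∀ {z a b} → m ℕ.≤ a → G z (a , b) ≈ 0#
          y³ₗ   : ∀ {a b z} → G (a , 3 ℕ.+ b) z ≈ G (suc a , suc b) z
          y³ᵣ   : ∀ {z a b} → G z (a , 3 ℕ.+ b) ≈ G z (suc a , suc b)

      opaque
        unfolding pairing

        pairing-cong : ∀ {G H} → (∀ z z′ → G z z′ ≈ H z z′) → pairing G ≈ pairing H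
        pairing-cong e = +-cong (*-congˡ (∑-cong (m ℕ.∸ 1) λ k → e _ _))
          (*-congˡ (∑-cong m λ k → +-cong (+-cong (e _ _) (e _ _)) (e _ _)))

        pairing-linear : Linear {Monomial × Monomial} λ f → pairing λ z z′ → f (z , z′)
        pairing-linear = linear-+
          (linear-scale (linear-∑ (m ℕ.∸ 1) λ k → linear-at _) (- 1/3n))
          (linear-scale (linear-∑ m λ k → linear-+ (linear-+ (linear-at _) (linear-at _)) (linear-at _)) 1/3n)

        pairing-commute : ∀ {I : Set} {T : (I → ∣R∣) → ∣R∣} → Linear T → (H : I → Monomial → Monomial → ∣R∣) →
          T (λ x → pairing (H x)) ≈ pairing λ z z′ → T λ x → H x z z′
        pairing-commute L H = ≈-trans (T-+ L _ _) (+-cong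
          (≈-trans (T-* L _ _) (*-congˡ (T-∑ L (m ℕ.∸ 1) _)))
          (≈-trans (T-* L _ _) (*-congˡ (≈-trans (T-∑ L m _) (∑-cong m λ k →
            ≈-trans (T-+ L _ _) (+-congʳ (T-+ L _ _)))))))

    sum-last : ∀ k (f : ℕ → ∣R∣) → ∑[ i < suc k ] f (toℕ i) ≈ (∑[ i < k ] f (toℕ i)) + f k
    sum-last zero    f = +-comm (f 0) 0#
    sum-last (suc k) f = ≈-trans (+-congˡ (sum-last k (f ∘ suc))) (≈-sym (+-assoc _ _ _))

    module _ (N : ℕ) (g : ℕ → ℕ → ∣R∣) where

      shift-left : g 0 (suc N) ≈ 0# → ∑[ k < suc N ] g (suc (toℕ k)) (N ℕ.∸ toℕ k) ≈
        ∑[ k < suc (suc N) ] g (toℕ k) (suc N ℕ.∸ toℕ k)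
      shift-left e = ≈-sym (≈-trans (+-congʳ e) (+-identityˡ _))

      shift-right : g (suc N) 0 ≈ 0# → ∑[ k < suc N ] g (toℕ k) (suc (N ℕ.∸ toℕ k)) ≈
        ∑[ k < suc (suc N) ] g (toℕ k) (suc N ℕ.∸ toℕ k)
      shift-right e = begin
        ∑[ k < suc N ] g (toℕ k) (suc (N ℕ.∸ toℕ k))  ≈⟨ sum-cong-≋ (λ k → reflexive (cong (g (toℕ k)) (step k))) ⟩
        ∑[ k < suc N ] g (toℕ k) (suc N ℕ.∸ toℕ k)    ≈⟨ +-identityʳ _ ⟨
        (∑[ k < suc N ] g (toℕ k) (suc N ℕ.∸ toℕ k)) + 0# ≈⟨ +-congˡ e ⟨
        (∑[ k < suc N ] g (toℕ k) (suc N ℕ.∸ toℕ k)) + g (suc N) 0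
          ≈⟨ +-congˡ (reflexive (cong (g (suc N)) (ℕₚ.n∸n≡0 N))) ⟨
        (∑[ k < suc N ] g (toℕ k) (suc N ℕ.∸ toℕ k)) + g (suc N) (N ℕ.∸ N)
          ≈⟨ sum-last (suc N) (λ k → g k (suc N ℕ.∸ k)) ⟨
        ∑[ k < suc (suc N) ] g (toℕ k) (suc N ℕ.∸ toℕ k) ∎
        where
        step : (k : Fin (suc N)) → suc (N ℕ.∸ toℕ k) ≡ suc N ℕ.∸ toℕ k
        step k = ≡.sym (ℕₚ.+-∸-assoc 1 (Finₚ.toℕ≤pred[n] k))

      -- Both sides are the sum over the whole antidiagonal i + j = N + 1, each with one vanishing
      -- end term left out.
      shift : g 0 (suc N) ≈ 0# → g (suc N) 0 ≈ 0# →
        ∑[ k < suc N ] g (suc (toℕ k)) (N ℕ.∸ toℕ k) ≈ ∑[ k < suc N ] g (toℕ k) (suc (N ℕ.∸ toℕ k))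
      shift e e′ = ≈-trans (shift-left e) (≈-sym (shift-right e′))

    module _ (N : ℕ) where

      open Pairing (suc N)
      open Admissible

      opaque
        unfolding pairing

        -- Multiplying either factor by x moves every term to the next antidiagonal. The two results
        -- differ at the ends, where xᵐ appears and `G` vanishes.
        casimir-x : ∀ {G} → Admissible G →
          pairing (λ (a , b) z → G (suc a , b) z) ≈ pairing λ z (a , b) → G z (suc a , b)
        casimir-x {G} adm = +-cong (*-congˡ first) (*-congˡ (begin
          ∑[ k < suc N ] (second-l 2 0 k + second-l 1 1 k + second-l 0 2 k)
            ≈⟨ ≈-trans (∑-distrib-+ (λ k → second-l 2 0 k + second-l 1 1 k) (second-l 0 2))
                 (+-congʳ (∑-distrib-+ (second-l 2 0) (second-l 1 1))) ⟩
          sum (second-l 2 0) + sum (second-l 1 1) + sum (second-l 0 2)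
            ≈⟨ +-cong (+-cong (second 2 0) (second 1 1)) (second 0 2) ⟩
          sum (second-r 2 0) + sum (second-r 1 1) + sum (second-r 0 2)
            ≈⟨ ≈-trans (∑-distrib-+ (λ k → second-r 2 0 k + second-r 1 1 k) (second-r 0 2))
                 (+-congʳ (∑-distrib-+ (second-r 2 0) (second-r 1 1))) ⟨
          ∑[ k < suc N ] (second-r 2 0 k + second-r 1 1 k + second-r 0 2 k) ∎))
          where
          second-l second-r : ℕ → ℕ → Fin (suc N) → ∣R∣
          second-l b b′ k = G (suc (toℕ k) , b) (N ℕ.∸ toℕ k , b′)
          second-r b b′ k = G (toℕ k , b) (suc (N ℕ.∸ toℕ k) , b′)
          second : ∀ b b′ → sum (second-l b b′) ≈ sum (second-r b b′)
          second b b′ = shift N (λ i j → G (i , b) (j , b′)) (zeroᵣ adm ℕₚ.≤-refl) (zeroₗ adm ℕₚ.≤-refl)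
          first : ∑[ k < N ] G (suc (suc (toℕ k)) , 0) (N ℕ.∸ toℕ k , 0) ≈
                  ∑[ k < N ] G (suc (toℕ k) , 0) (suc (N ℕ.∸ toℕ k) , 0)
          first = begin
            ∑[ k < N ] G (suc (suc (toℕ k)) , 0) (N ℕ.∸ toℕ k , 0)
              ≈⟨ +-identityˡ _ ⟨
            0# + ∑[ k < N ] G (suc (suc (toℕ k)) , 0) (N ℕ.∸ toℕ k , 0)
              ≈⟨ +-congʳ (zeroᵣ adm ℕₚ.≤-refl) ⟨
            ∑[ k < suc N ] G (suc (toℕ k) , 0) (suc N ℕ.∸ toℕ k , 0)
              ≈⟨ sum-last N (λ k → G (suc k , 0) (suc N ℕ.∸ k , 0)) ⟩
            (∑[ k < N ] G (suc (toℕ k) , 0) (suc N ℕ.∸ toℕ k , 0)) + G (suc N , 0) (suc N ℕ.∸ N , 0)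
              ≈⟨ +-congˡ (zeroₗ adm ℕₚ.≤-refl) ⟩
            (∑[ k < N ] G (suc (toℕ k) , 0) (suc N ℕ.∸ toℕ k , 0)) + 0#
              ≈⟨ +-identityʳ _ ⟩
            ∑[ k < N ] G (suc (toℕ k) , 0) (suc N ℕ.∸ toℕ k , 0)
              ≈⟨ ∑-cong N (λ k → reflexive (cong (λ j → G (suc (toℕ k) , 0) (j , 0))
                   (ℕₚ.+-∸-assoc 1 (ℕₚ.<⇒≤ (Finₚ.toℕ<n k))))) ⟩
            ∑[ k < N ] G (suc (toℕ k) , 0) (suc (N ℕ.∸ toℕ k) , 0) ∎

        private
          cancel : ∀ c S T U → T ≈ S → - c * S + c * (T + U) ≈ c * U
          cancel c S T U e = begin
            - c * S + c * (T + U)        ≈⟨ +-congˡ (distribˡ c T U) ⟩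
            - c * S + (c * T + c * U)    ≈⟨ +-assoc (- c * S) (c * T) (c * U) ⟨
            (- c * S + c * T) + c * U    ≈⟨ +-congʳ (+-cong (≈-sym (-‿distribˡ-* c S)) (*-congˡ e)) ⟩
            (- (c * S) + c * S) + c * U  ≈⟨ +-congʳ (-‿inverseˡ (c * S)) ⟩
            0# + c * U                   ≈⟨ +-identityˡ (c * U) ⟩
            c * U                        ∎

        -- Multiplying the left factor by y turns its y² into y³ = xy, and these terms cancel the
        -- negative sum of Δ(1). On the right the same happens to the terms with y² there. Both
        -- sides leave the terms y² ⊗ y and y ⊗ y².
        casimir-y : ∀ {G} → Admissible G →
          pairing (λ (a , b) z → G (a , suc b) z) ≈ pairing λ z (a , b) → G z (a , suc b)
        casimir-y {G} adm = begin
          pairing (λ (a , b) z → G (a , suc b) z)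
            ≈⟨ +-congˡ (*-congˡ (≈-trans (∑-cong (suc N) λ k → +-assoc (t 3 0 k) (t 2 1 k) (t 1 2 k))
                 (∑-distrib-+ (t 3 0) (λ k → t 2 1 k + t 1 2 k)))) ⟩
          - 1/3n * sum l + 1/3n * (sum (t 3 0) + sum (λ k → t 2 1 k + t 1 2 k))
            ≈⟨ cancel 1/3n (sum l) (sum (t 3 0)) _ left ⟩
          1/3n * sum (λ k → t 2 1 k + t 1 2 k)
            ≈⟨ cancel 1/3n (sum r) (sum (t 0 3)) _ right ⟨
          - 1/3n * sum r + 1/3n * (sum (t 0 3) + sum (λ k → t 2 1 k + t 1 2 k))
            ≈⟨ +-congˡ (*-congˡ (≈-trans (+-comm (sum (t 0 3)) (sum (λ k → t 2 1 k + t 1 2 k)))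
                 (≈-sym (∑-distrib-+ (λ k → t 2 1 k + t 1 2 k) (t 0 3))))) ⟩
          pairing (λ z (a , b) → G z (a , suc b)) ∎
          where
          t : ℕ → ℕ → Fin (suc N) → ∣R∣
          t b b′ k = G (toℕ k , b) (N ℕ.∸ toℕ k , b′)
          l r : Fin N → ∣R∣
          l k = G (suc (toℕ k) , 1) (N ℕ.∸ toℕ k , 0)
          r k = G (suc (toℕ k) , 0) (N ℕ.∸ toℕ k , 1)
          left : sum (t 3 0) ≈ sum l
          left = begin
            sum (t 3 0)
              ≈⟨ ∑-cong (suc N) (λ k → y³ₗ adm {toℕ k} {0} {N ℕ.∸ toℕ k , 0}) ⟩
            ∑[ k < suc N ] G (suc (toℕ k) , 1) (N ℕ.∸ toℕ k , 0)
              ≈⟨ sum-last N (λ k → G (suc k , 1) (N ℕ.∸ k , 0)) ⟩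
            sum l + G (suc N , 1) (N ℕ.∸ N , 0)
              ≈⟨ +-congˡ (zeroₗ adm ℕₚ.≤-refl) ⟩
            sum l + 0#
              ≈⟨ +-identityʳ (sum l) ⟩
            sum l ∎
          right : sum (t 0 3) ≈ sum r
          right = begin
            sum (t 0 3)
              ≈⟨ ∑-cong (suc N) (λ k → y³ᵣ adm {toℕ k , 0} {N ℕ.∸ toℕ k} {0}) ⟩
            ∑[ k < suc N ] G (toℕ k , 0) (suc (N ℕ.∸ toℕ k) , 1)
              ≈⟨ +-congʳ (zeroᵣ adm ℕₚ.≤-refl) ⟩
            0# + ∑[ k < N ] G (suc (toℕ k) , 0) (suc (N ℕ.∸ suc (toℕ k)) , 1)
              ≈⟨ +-identityˡ _ ⟩
            ∑[ k < N ] G (suc (toℕ k) , 0) (suc (N ℕ.∸ suc (toℕ k)) , 1)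
              ≈⟨ ∑-cong N (λ k → reflexive (cong (λ j → G (suc (toℕ k) , 0) (j , 1))
                   (≡.sym (ℕₚ.+-∸-assoc 1 (Finₚ.toℕ<n k))))) ⟩
            sum r ∎

        -- Reversing the order of summation exchanges the two exponents of x, and the three summands
        -- in y are permuted: Δ is cocommutative.
        pairing-sym : ∀ G → pairing (λ z z′ → G z′ z) ≈ pairing G
        pairing-sym G = +-cong (*-congˡ first) (*-congˡ (begin
          ∑[ k < suc N ] (u 0 2 k + u 1 1 k + u 2 0 k)
            ≈⟨ ∑-cong (suc N) (λ k → reorder (u 0 2 k) (u 1 1 k) (u 2 0 k)) ⟩
          ∑[ k < suc N ] (u 2 0 k + u 1 1 k + u 0 2 k)
            ≈⟨ ∑-permute (λ k → u 2 0 k + u 1 1 k + u 0 2 k) Perm.reverse ⟩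
          ∑[ k < suc N ] (u 2 0 (opposite k) + u 1 1 (opposite k) + u 0 2 (opposite k))
            ≈⟨ ∑-cong (suc N) (λ k → +-cong (+-cong (flip 2 0 k) (flip 1 1 k)) (flip 0 2 k)) ⟩
          ∑[ k < suc N ] (t 2 0 k + t 1 1 k + t 0 2 k) ∎))
          where
          t u : ℕ → ℕ → Fin (suc N) → ∣R∣
          t b b′ k = G (toℕ k , b) (N ℕ.∸ toℕ k , b′)
          u b b′ k = G (N ℕ.∸ toℕ k , b) (toℕ k , b′)
          reorder : ∀ x y z → x + y + z ≈ z + y + x
          reorder x y z = ≈-trans (+-comm (x + y) z) (≈-trans (+-congˡ (+-comm x y)) (≈-sym (+-assoc z y x)))
          flip : ∀ b b′ k → u b b′ (opposite k) ≈ t b b′ k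
          flip b b′ k rewrite Finₚ.opposite-prop k = reflexive
            (cong (λ j → G (j , b) (N ℕ.∸ toℕ k , b′)) (ℕₚ.m∸[m∸n]≡n (Finₚ.toℕ≤pred[n] k)))
          first : ∑[ k < N ] G (N ℕ.∸ toℕ k , 0) (suc (toℕ k) , 0) ≈ ∑[ k < N ] G (suc (toℕ k) , 0) (N ℕ.∸ toℕ k , 0)
          first = ≈-trans (∑-permute (λ k → G (N ℕ.∸ toℕ k , 0) (suc (toℕ k) , 0)) (Perm.reverse {N}))
            (∑-cong N λ k → reflexive (cong₂ (λ i j → G (i , 0) (j , 0))
              (≡.trans (cong (N ℕ.∸_) (Finₚ.opposite-prop k)) (ℕₚ.m∸[m∸n]≡n (Finₚ.toℕ<n k)))
              (≡.trans (cong suc (Finₚ.opposite-prop k)) (≡.sym (ℕₚ.+-∸-assoc 1 (Finₚ.toℕ<n k))))))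

    module _ (m : ℕ) where

      open Pairing m
      open Admissible

      admissible-⊹ : ∀ {G} → Admissible G → ∀ z w → Admissible λ u v → G (z ⊹ u) (w ⊹ v)
      admissible-⊹ {G} adm (c , d) (c′ , d′) = record
        { zeroₗ = λ m≤a → zeroₗ adm (ℕₚ.≤-trans m≤a (ℕₚ.m≤n+m _ c))
        ; zeroᵣ = λ m≤a → zeroᵣ adm (ℕₚ.≤-trans m≤a (ℕₚ.m≤n+m _ c′))
        ; y³ₗ   = λ {a} {b} {z} → ≈-trans (reflexive (cong (λ k → G (c ℕ.+ a , k) ((c′ , d′) ⊹ z)) (3+ d b)))
                    (≈-trans (y³ₗ adm) (reflexive (cong₂ (λ k l → G (k , l) ((c′ , d′) ⊹ z))
                      (≡.sym (ℕₚ.+-suc c a)) (≡.sym (ℕₚ.+-suc d b)))))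
        ; y³ᵣ   = λ {z} {a} {b} → ≈-trans (reflexive (cong (λ k → G ((c , d) ⊹ z) (c′ ℕ.+ a , k)) (3+ d′ b)))
                    (≈-trans (y³ᵣ adm) (reflexive (cong₂ (λ k l → G ((c , d) ⊹ z) (k , l))
                      (≡.sym (ℕₚ.+-suc c′ a)) (≡.sym (ℕₚ.+-suc d′ b)))))
        }
        where
        3+ : ∀ d b → d ℕ.+ (3 ℕ.+ b) ≡ 3 ℕ.+ (d ℕ.+ b)
        3+ d b = ≡.trans (ℕₚ.+-suc d (2 ℕ.+ b)) (cong suc (≡.trans (ℕₚ.+-suc d (suc b)) (cong suc (ℕₚ.+-suc d b))))

    pairing-symmetric : ∀ m .{{_ : NonZero m}} → let open Pairing m in
      ∀ G → pairing (λ z z′ → G z′ z) ≈ pairing G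
    pairing-symmetric (suc N) = pairing-sym N

    private
      step-x : ∀ m .{{_ : NonZero m}} → let open Pairing m in ∀ {G} → Admissible G →
        pairing (λ z w → G ((1 , 0) ⊹ z) w) ≈ pairing λ z w → G z ((1 , 0) ⊹ w)
      step-x (suc N) = casimir-x N

      step-y : ∀ m .{{_ : NonZero m}} → let open Pairing m in ∀ {G} → Admissible G →
        pairing (λ z w → G ((0 , 1) ⊹ z) w) ≈ pairing λ z w → G z ((0 , 1) ⊹ w)
      step-y (suc N) = casimir-y N

    module _ (m : ℕ) .{{_ : NonZero m}} where

      open Pairing m

      -- The letters of `z` cross one at a time. At each stage `G` is translated by the letters on
      -- either side, and a translate stays admissible.
      casimir : ∀ {G} → Admissible G → ∀ z → pairing (λ u v → G (z ⊹ u) v) ≈ pairing λ u v → G u (z ⊹ v)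
      casimir {G} adm (zero , zero) = ≈-refl
      casimir {G} adm (zero , suc b) = begin
        pairing (λ u v → G ((0 , 1) ⊹ ((0 , b) ⊹ u)) v)
          ≈⟨ casimir (admissible-⊹ m adm (0 , 1) (0 , 0)) (0 , b) ⟩
        pairing (λ u v → G ((0 , 1) ⊹ u) ((0 , b) ⊹ v))
          ≈⟨ step-y m (admissible-⊹ m adm (0 , 0) (0 , b)) ⟩
        pairing (λ u v → G u ((0 , b) ⊹ ((0 , 1) ⊹ v)))
          ≈⟨ pairing-cong (λ u v → reflexive (cong (G u) (⊹-swap (0 , b) (0 , 1) v))) ⟩
        pairing (λ u v → G u ((0 , suc b) ⊹ v)) ∎
      casimir {G} adm (suc a , b) = begin
        pairing (λ u v → G ((1 , 0) ⊹ ((a , b) ⊹ u)) v)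
          ≈⟨ casimir (admissible-⊹ m adm (1 , 0) (0 , 0)) (a , b) ⟩
        pairing (λ u v → G ((1 , 0) ⊹ u) ((a , b) ⊹ v))
          ≈⟨ step-x m (admissible-⊹ m adm (0 , 0) (a , b)) ⟩
        pairing (λ u v → G u ((a , b) ⊹ ((1 , 0) ⊹ v)))
          ≈⟨ pairing-cong (λ u v → reflexive (cong (G u) (⊹-swap (a , b) (1 , 0) v))) ⟩
        pairing (λ u v → G u ((suc a , b) ⊹ v)) ∎

    open Pairing n public

    -- Invertibility of 3n in an abstract ring, with 3n written as it arises from the 3n terms in
    -- `pairing-genus`.
    Inverse : Set
    Inverse = 1/3n * (∑[ k < n ] (1# + 1# + 1#)) ≈ 1#

    opaque
      unfolding Pairing.pairing

      -- Multiplying the factors gives xⁿ in every term of the negative sum and xⁿ⁻¹y² in each of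
      -- the other 3n terms, so 1/3n leaves one copy of xⁿ⁻¹y². This is θ², for even n after y⁴ =
      -- xy².
      pairing-genus : Inverse → ∀ (g : Monomial → ∣R∣) → (∀ {a b} → n ℕ.≤ a → g (a , b) ≈ 0#) →
        (∀ {a b} → g (a , 3 ℕ.+ b) ≈ g (suc a , suc b)) → pairing (λ z z′ → g (z ⊹ z′)) ≈ g (θ ⊹ θ)
      pairing-genus inverse g g-zero g-y³ = begin
        pairing (λ z z′ → g (z ⊹ z′))
          ≈⟨ +-cong (*-congˡ (sum-0 λ k → g-zero (first k))) (*-congˡ (∑-cong n second)) ⟩
        - 1/3n * 0# + 1/3n * (∑[ k < n ] ((1# + 1# + 1#) * g w))
          ≈⟨ +-cong (zeroʳ (- 1/3n)) (*-congˡ (≈-sym (*-distribʳ-sum {n} (g w) λ _ → 1# + 1# + 1#))) ⟩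
        0# + 1/3n * ((∑[ k < n ] (1# + 1# + 1#)) * g w)
          ≈⟨ +-identityˡ _ ⟩
        1/3n * ((∑[ k < n ] (1# + 1# + 1#)) * g w)
          ≈⟨ *-assoc _ _ _ ⟨
        (1/3n * (∑[ k < n ] (1# + 1# + 1#))) * g w
          ≈⟨ *-congʳ inverse ⟩
        1# * g w
          ≈⟨ *-identityˡ (g w) ⟩
        g w
          ≈⟨ if-even-elim (λ θ → g w ≈ g (θ ⊹ θ)) n even odd ⟩
        g (θ ⊹ θ) ∎
        where
        w : Monomial
        w = n ℕ.∸ 1 , 2
        first : (k : Fin (n ℕ.∸ 1)) → n ℕ.≤ suc (toℕ k) ℕ.+ (n ℕ.∸ suc (toℕ k))
        first k = ℕₚ.m≤n+m∸n n (suc (toℕ k))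
        second : ∀ (k : Fin n) → g (toℕ k ℕ.+ (n ℕ.∸ 1 ℕ.∸ toℕ k) , 2) + g (toℕ k ℕ.+ (n ℕ.∸ 1 ℕ.∸ toℕ k) , 2) +
          g (toℕ k ℕ.+ (n ℕ.∸ 1 ℕ.∸ toℕ k) , 2) ≈ (1# + 1# + 1#) * g w
        second k rewrite ℕₚ.m+[n∸m]≡n (ℕₚ.∸-monoˡ-≤ 1 (Finₚ.toℕ<n k)) = begin
          g w + g w + g w                 ≈⟨ +-cong (+-cong (*-identityˡ _) (*-identityˡ _)) (*-identityˡ _) ⟨
          1# * g w + 1# * g w + 1# * g w  ≈⟨ +-congʳ (distribʳ _ _ _) ⟨
          (1# + 1#) * g w + 1# * g w      ≈⟨ distribʳ _ _ _ ⟨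
          (1# + 1# + 1#) * g w            ∎
        even : parity n ≡ 0ℙ → g w ≈ g (⌊ n ℕ.∸ 2 /2⌋ ℕ.+ ⌊ n ℕ.∸ 2 /2⌋ , 4)
        even e = ≈-trans (reflexive (cong (λ a → g (a , 2)) (≡.sym (half-even n e)))) (≈-sym g-y³)
        odd : parity n ≡ 1ℙ → g w ≈ g (⌊ n ℕ.∸ 1 /2⌋ ℕ.+ ⌊ n ℕ.∸ 1 /2⌋ , 2)
        odd e = reflexive (cong (λ a → g (a , 2)) (≡.sym (half-odd n e)))

-- Edge maps as multiplication by words

module Edge where

  open import Algebra.Bundles using (CommutativeRing)
  open import Data.Bool.Base using (Bool; true; false; if_then_else_)
  open import Data.Fin.Base as Fin using (Fin; zero; suc; toℕ)
  open import Data.Fin.Patterns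
  import Data.Fin.Properties as Finₚ
  open import Data.List.Base as List using (List; []; _∷_; _++_)
  open import Data.Nat.Base as ℕ using (ℕ; zero; suc; NonZero; parity)
  import Data.Nat.Properties as ℕₚ
  open import Data.Parity.Base using (0ℙ; 1ℙ)
  open import Data.Product.Base using (∃; _×_; _,_; proj₁; proj₂)
  open import Data.Product.Properties using (≡-dec)
  open import Data.Sum.Base using (_⊎_; inj₁; inj₂; [_,_]′)
  open import Data.Vec.Base using ([]; _∷_; lookup)
  open import Function.Base using (_∘_)
  open import Function.Bundles using (_⇔_; mk⇔; Equivalence)
  open import Level using (0ℓ)
  open import Relation.Binary.PropositionalEquality as ≡ using (_≡_; _≢_; refl; cong; cong₂; subst)
  open import Relation.Nullary using (Dec; yes; no; does; ¬_; contradiction)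
  open import Relation.Nullary.Decidable using (dec-true; dec-false; _→-dec_; ¬?)
  open import Defs
  open Sums
  open Face using (Kind; kind; merging; splitting; twisting; impossible)
  open Tensor

  module EdgeMaps (n : ℕ) .{{_ : NonZero n}} (R : CommutativeRing 0ℓ 0ℓ) (1/3n : CommutativeRing.Carrier R) where

    open CommutativeRing R hiding (zero) renaming (Carrier to ∣R∣; refl to ≈-refl; sym to ≈-sym; trans to ≈-trans)
    open Complex n R 1/3n
    open Calculus n R 1/3n
    open FiniteSums +-commutativeMonoid using (sum; sum-syntax)
      renaming (sum-ε to sum-0; sum-single to sum-single₊)
    open FiniteSums *-commutativeMonoid
      using (only; except; only-at; only-off; except-off)
      renaming (sum to prod; sum-cong-≋ to prod-cong; sum-ε to prod-1; sum-single to prod-single;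
                sum-except to prod-except; sum-only to prod-only; ∑-comm to ∏-comm)
    open import Relation.Binary.Reasoning.Setoid setoid
    open Linear

    _≟ᵇ_ : (v w : Basis) → Dec (v ≡ w)
    _≟ᵇ_ = ≡-dec Finₚ._≟_ Finₚ._≟_

    -- Opaque because the inner sum would otherwise unfold to its three terms.
    opaque

      ∑V : (Basis → ∣R∣) → ∣R∣
      ∑V f = ∑[ i < n ] ∑[ j < 3 ] f (i , j)

      ∑⊗-suc : ∀ k f → ∑⊗ (suc k) f ≈ ∑V λ v → ∑⊗ k λ s → f (v ∷ s)
      ∑⊗-suc k f = ≈-refl

      ∑V-cong : ∀ {f g} → (∀ v → f v ≈ g v) → ∑V f ≈ ∑V g
      ∑V-cong e = ∑-cong n λ i → ∑-cong 3 λ j → e (i , j)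

      ∑V-single : ∀ v {f} → (∀ w → w ≢ v → f w ≈ 0#) → ∑V f ≈ f v
      ∑V-single (i , j) e = ≈-trans
        (sum-single₊ i λ k k≢i → sum-0 λ l → e (k , l) (k≢i ∘ cong proj₁))
        (sum-single₊ j λ l l≢j → e (i , l) (l≢j ∘ cong proj₂))

      ∑V-0 : ∀ {f} → (∀ v → f v ≈ 0#) → ∑V f ≈ 0#
      ∑V-0 {f} e = sum-0 {n} λ i → sum-0 {3} λ j → e (i , j)

      ∑V-linear : ∀ {I : Set} {T : Basis → (I → ∣R∣) → ∣R∣} → (∀ v → Linear (T v)) → Linear λ f → ∑V λ v → T v f
      ∑V-linear L = linear-∑ n λ i → linear-∑ 3 λ j → L (i , j)

      ∑V-commute : ∀ {I : Set} {T : (I → ∣R∣) → ∣R∣} → Linear T → (f : Basis → I → ∣R∣) →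
        T (λ x → ∑V λ v → f v x) ≈ ∑V λ v → T (f v)
      ∑V-commute L f = ≈-trans (T-∑ L n λ i x → ∑[ j < 3 ] f (i , j) x) (∑-cong n λ i → T-∑ L 3 λ j → f (i , j))

    ∑V-* : ∀ c f → ∑V (λ v → c * f v) ≈ c * ∑V f
    ∑V-* c f = T-* (∑V-linear λ v → linear-at v) c f

    ∑V-*ʳ : ∀ c f → ∑V (λ v → f v * c) ≈ ∑V f * c
    ∑V-*ʳ c f = ≈-trans (∑V-cong λ v → *-comm (f v) c) (≈-trans (∑V-* c f) (*-comm c (∑V f)))

    ∑⊗-linear : ∀ k → Linear (∑⊗ k)
    ∑⊗-linear k = linear-∑⊗ k λ s → linear-at s

    ∑⊗-prod : ∀ k (F : Fin k → Basis → ∣R∣) →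
      ∑⊗ k (λ s → prod λ C → F C (lookup s C)) ≈ prod λ C → ∑V (F C)
    ∑⊗-prod zero    F = ≈-refl
    ∑⊗-prod (suc k) F = begin
      ∑⊗ (suc k) (λ s → prod λ C → F C (lookup s C))
        ≈⟨ ∑⊗-suc k (λ s → prod λ C → F C (lookup s C)) ⟩
      ∑V (λ v → ∑⊗ k λ s → F zero v * prod λ C → F (suc C) (lookup s C))
        ≈⟨ ∑V-cong (λ v → ∑⊗-* k (F zero v) λ s → prod λ C → F (suc C) (lookup s C)) ⟩
      ∑V (λ v → F zero v * ∑⊗ k λ s → prod λ C → F (suc C) (lookup s C))
        ≈⟨ ∑V-*ʳ _ (F zero) ⟩
      ∑V (F zero) * ∑⊗ k (λ s → prod λ C → F (suc C) (lookup s C))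
        ≈⟨ *-congˡ (∑⊗-prod k (F ∘ suc)) ⟩
      ∑V (F zero) * prod (λ C → ∑V (F (suc C))) ∎

    prod-zero : ∀ {k} {f : Fin k → ∣R∣} i → f i ≈ 0# → prod f ≈ 0#
    prod-zero {f = f} i e = ≈-trans (prod-except i f) (≈-trans (*-congʳ e) (zeroˡ _))

    X-expo : ∀ v w → X (expo v) w ≡ (if does (w ≟ᵇ v) then 1# else 0#)
    X-expo v w with w ≟ᵇ v
    ... | yes refl = X-≡ (expo v) (reduce-expo v)
    ... | no w≢v   = X-≢ (expo v) λ e → w≢v (cong₂ _,_
      (Finₚ.toℕ-injective (cong proj₁ (≡.trans (≡.sym e) (reduce-expo v))))
      (cong proj₂ (≡.trans (≡.sym e) (reduce-expo v))))

    -- At most one basis vector, the reduced form of `z`, has a nonzero coordinate. If the reduced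
    -- exponent of x is at least `n` there is none, and the right side vanishes as well.
    X-* : ∀ z z′ c → ∑V (λ v → X z v * X (expo v ⊹ z′) c) ≈ X (z ⊹ z′) c
    X-* z@(a , b) z′ c with proj₁ (reduce a b) ℕₚ.<? n
    ... | yes p<n = begin
      ∑V (λ v → X z v * X (expo v ⊹ z′) c)   ≈⟨ ∑V-single v₀ {λ v → X z v * X (expo v ⊹ z′) c} (λ w w≢ → ≈-trans
        (*-congʳ (reflexive (X-≢ z {w} λ e → w≢ (cong₂ _,_
          (Finₚ.toℕ-injective (≡.trans (cong proj₁ (≡.sym e)) (≡.sym toℕ-v₀))) (cong proj₂ (≡.sym e))))))
        (zeroˡ _)) ⟩
      X z v₀ * X (expo v₀ ⊹ z′) c            ≈⟨ *-congʳ (reflexive (X-≡ z {v₀} (cong₂ _,_ (≡.sym toℕ-v₀) refl))) ⟩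
      1# * X (expo v₀ ⊹ z′) c                ≈⟨ *-identityˡ _ ⟩
      X (expo v₀ ⊹ z′) c                     ≈⟨ reflexive (X-reduce (expo v₀ ⊹ z′) (z ⊹ z′)
        (≡.sym (≡.trans (reduce-+ a b z′) (cong (λ p → reduce (p ℕ.+ proj₁ z′) (toℕ (proj₂ (reduce a b)) ℕ.+ proj₂ z′))
          (≡.sym toℕ-v₀)))) c) ⟩
      X (z ⊹ z′) c                           ∎
      where
      v₀ : Basis
      v₀ = Fin.fromℕ< p<n , proj₂ (reduce a b)
      toℕ-v₀ : toℕ (proj₁ v₀) ≡ proj₁ (reduce a b)
      toℕ-v₀ = Finₚ.toℕ-fromℕ< p<n
    ... | no p≮n = ≈-trans
      (∑V-0 {λ v → X z v * X (expo v ⊹ z′) c} λ v → ≈-trans (*-congʳ (reflexive (X-≢ z {v} λ e →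
        p≮n (ℕₚ.≤-trans (ℕₚ.≤-reflexive (cong suc (cong proj₁ e))) (Finₚ.toℕ<n (proj₁ v)))))) (zeroˡ _))
      (≈-sym (≈-trans (reflexive (X-reduce (z ⊹ z′) (p ℕ.+ proj₁ z′ , r ℕ.+ proj₂ z′) (reduce-+ a b z′) c))
        (reflexive (X-zero {p ℕ.+ proj₁ z′ , r ℕ.+ proj₂ z′} (ℕₚ.≤-trans (ℕₚ.≮⇒≥ p≮n) (ℕₚ.m≤m+n p (proj₁ z′))) c))))
      where
      p r : ℕ
      p = proj₁ (reduce a b)
      r = toℕ (proj₂ (reduce a b))

    module _ {N : ℕ} where

      -- A product of monomials sitting at points.
      Word : Set
      Word = List (Fin N × Monomial)

      total : ∀ {k} → (Fin N → Fin k) → Word → Fin k → Monomial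
      total cl []            C = 0 , 0
      total cl ((p , z) ∷ L) C = if does (cl p Finₚ.≟ C) then z ⊹ total cl L C else total cl L C

      -- The coordinates of the image of a word in V^⊗k, when the points are
      -- distributed over the k factors by cl.
      Π : ∀ {k} → (Fin N → Fin k) → Word → Tensor k → ∣R∣
      Π cl L t = prod λ C → X (total cl L C) (lookup t C)

      -- Opaque in order to be injective for unification
      opaque

        P : ∀ {k} → (Fin N → Fin k) → Word → Tensor k → ∣R∣
        P = Π

        P-def : ∀ {k} (cl : Fin N → Fin k) L t → P cl L t ≈ Π cl L t
        P-def cl L t = ≈-refl

      -- The image of 1 under the edge map of the given kind at p and q
      act : Kind → Fin N → Fin N → (Word → ∣R∣) → ∣R∣
      act merging    p q F = F []
      act twisting   p q F = F ((p , θ) ∷ [])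
      act splitting  p q F = pairing λ z z′ → F ((p , z) ∷ (q , z′) ∷ [])
      act impossible p q F = 0#

      act-linear : ∀ κ p q → Linear (act κ p q)
      act-linear merging    p q = linear-at []
      act-linear twisting   p q = linear-at ((p , θ) ∷ [])
      act-linear splitting  p q = linear-∘ pairing-linear λ (z , z′) → (p , z) ∷ (q , z′) ∷ []
      act-linear impossible p q = record
        { T-cong = λ _ → ≈-refl ; T-+ = λ _ _ → ≈-sym (+-identityˡ 0#) ; T-* = λ c _ → ≈-sym (zeroʳ c) }

      act-commute : ∀ κ p q {I : Set} {T : (I → ∣R∣) → ∣R∣} → Linear T → (H : I → Word → ∣R∣) →
        T (λ x → act κ p q (H x)) ≈ act κ p q λ A → T λ x → H x A
      act-commute merging    p q L H = ≈-refl
      act-commute twisting   p q L H = ≈-refl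
      act-commute splitting  p q L H = pairing-commute L λ x z z′ → H x ((p , z) ∷ (q , z′) ∷ [])
      act-commute impossible p q L H = T-0 L λ _ → ≈-refl

      total-++ : ∀ {k} (cl : Fin N → Fin k) A L C → total cl (A ++ L) C ≡ total cl A C ⊹ total cl L C
      total-++ cl []            L C = refl
      total-++ cl ((p , z) ∷ A) L C with does (cl p Finₚ.≟ C)
      ... | true  = ≡.trans (cong (z ⊹_) (total-++ cl A L C)) (≡.sym (⊹-assoc z (total cl A C) (total cl L C)))
      ... | false = total-++ cl A L C

      total-at : ∀ {k} (cl : Fin N → Fin k) {p C} z L → cl p ≡ C → total cl ((p , z) ∷ L) C ≡ z ⊹ total cl L C
      total-at cl {p} {C} z L e rewrite dec-true (cl p Finₚ.≟ C) e = refl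

      total-off : ∀ {k} (cl : Fin N → Fin k) {p C} z L → cl p ≢ C → total cl ((p , z) ∷ L) C ≡ total cl L C
      total-off cl {p} {C} z L ¬e rewrite dec-false (cl p Finₚ.≟ C) ¬e = refl

      P-total : ∀ {k} (cl : Fin N → Fin k) {L M} → (∀ C → total cl L C ≡ total cl M C) → ∀ t → P cl L t ≈ P cl M t
      P-total cl {L} {M} e t = ≈-trans (P-def cl L t) (≈-trans (prod-cong λ C → reflexive (cong (λ z → X z (lookup t C)) (e C)))
        (≈-sym (P-def cl M t)))

      module _ {k k′ : ℕ} {cl : Fin N → Fin k} {cl′ : Fin N → Fin k′} where

        -- Used for merges and, with the roles of the two states exchanged, for splits.
        total-⊎ : ∀ {x y z} → x ≢ y → (∀ {q} → cl′ q ≡ z ⇔ (cl q ≡ x ⊎ cl q ≡ y)) →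
          ∀ L → total cl′ L z ≡ total cl L x ⊹ total cl L y
        total-⊎ x≢y e [] = refl
        total-⊎ {x} {y} {z} x≢y e ((q , v) ∷ L) with cl′ q Finₚ.≟ z | cl q Finₚ.≟ x | cl q Finₚ.≟ y | total-⊎ x≢y e L
        ... | yes _ | yes p | yes p′ | _  = contradiction (≡.trans (≡.sym p) p′) x≢y
        ... | yes _ | yes _ | no _   | ih = ≡.trans (cong (v ⊹_) ih) (≡.sym (⊹-assoc v (total cl L x) (total cl L y)))
        ... | yes _ | no _  | yes _  | ih = ≡.trans (cong (v ⊹_) ih) (⊹-swap v (total cl L x) (total cl L y))
        ... | yes p | no ¬x | no ¬y  | _  = contradiction (Equivalence.to e p) [ ¬x , ¬y ]′
        ... | no ¬z | yes p | _      | _  = contradiction (Equivalence.from e (inj₁ p)) ¬z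
        ... | no ¬z | no _  | yes p  | _  = contradiction (Equivalence.from e (inj₂ p)) ¬z
        ... | no _  | no _  | no _   | ih = ih

        total-⇔ : ∀ {x z} → (∀ {q} → cl q ≡ x ⇔ cl′ q ≡ z) → ∀ L → total cl L x ≡ total cl′ L z
        total-⇔ e [] = refl
        total-⇔ {x} {z} e ((q , v) ∷ L) with cl q Finₚ.≟ x | cl′ q Finₚ.≟ z
        ... | yes _ | yes _ = cong (v ⊹_) (total-⇔ e L)
        ... | no _  | no _  = total-⇔ e L
        ... | yes p | no ¬p = contradiction (Equivalence.to e p) ¬p
        ... | no ¬p | yes p = contradiction (Equivalence.from e p) ¬p

    if-even-∘ : ∀ {A B : Set} (f : A → B) {x y} → f (if-even n then x else y) ≡ (if-even n then f x else f y)
    if-even-∘ f with parity n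
    ... | 0ℙ = refl
    ... | 1ℙ = refl

    m-θ : ∀ v c → m v c ≡ X (expo v ⊹ θ) c
    m-θ v c = cong (λ f → f c) (≡.sym (if-even-∘ (λ z → X (expo v ⊹ z))))

    opaque
      unfolding Pairing.pairing

      -- Δ is determined by Δ(1): the argument is multiplied into the left factor.
      Δ-pairing : ∀ v c c′ → Δ v c c′ ≈ pairing λ z z′ → X (expo v ⊹ z) c * X z′ c′
      Δ-pairing (p , r) c c′ = +-cong
        (*-congˡ (∑-cong (n ℕ.∸ 1) λ k → y⁰ (suc (toℕ k)) (n ℕ.∸ suc (toℕ k) , 0)))
        (*-congˡ (∑-cong n λ k → +-congˡ (y⁰ (toℕ k) (n ℕ.∸ 1 ℕ.∸ toℕ k , 2))))
        where
        y⁰ : ∀ i z → X (toℕ p ℕ.+ i , toℕ r) c * X z c′ ≈ X (toℕ p ℕ.+ i , toℕ r ℕ.+ 0) c * X z c′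
        y⁰ i z = *-congʳ (reflexive (cong (λ e → X (toℕ p ℕ.+ i , e) c) (≡.sym (ℕₚ.+-identityʳ (toℕ r)))))

    X-admissible : ∀ A c c′ → Admissible λ z z′ → X (A ⊹ z) c * X z′ c′
    X-admissible A c c′ = record
      { zeroₗ = λ {a} {b} {z} n≤a → ≈-trans (*-congʳ (reflexive
          (X-zero {A ⊹ (a , b)} (ℕₚ.≤-trans n≤a (ℕₚ.m≤n+m a (proj₁ A))) c))) (zeroˡ (X z c′))
      ; zeroᵣ = λ {z} {a} {b} n≤a → ≈-trans (*-congˡ (reflexive (X-zero {a , b} n≤a c′))) (zeroʳ (X (A ⊹ z) c))
      ; y³ₗ   = λ {a} {b} {z} → *-congʳ (reflexive (X-y³ A {a} {b} c))
      ; y³ᵣ   = λ {z} {a} {b} → *-congˡ (reflexive (X-y³ (0 , 0) {a} {b} c′))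
      }

    -- The circles at the edge against all others. When `a` and `b` coincide the second branch is
    -- never reached, so one and two circles share the same formulas.
    module Choose {k : ℕ} (a b : Fin k) where

      opaque

        choose : {A : Set} → Fin k → A → A → A → A
        choose C x y z = if does (C Finₚ.≟ a) then x else if does (C Finₚ.≟ b) then y else z

        choose-a : ∀ {A : Set} {C} {x y z : A} → C ≡ a → choose C x y z ≡ x
        choose-a {C = C} e rewrite dec-true (C Finₚ.≟ a) e = refl

        choose-b : ∀ {A : Set} {C} {x y z : A} → C ≢ a → C ≡ b → choose C x y z ≡ y
        choose-b {C = C} ¬e e rewrite dec-false (C Finₚ.≟ a) ¬e | dec-true (C Finₚ.≟ b) e = refl

        choose-off : ∀ {A : Set} {C} {x y z : A} → C ≢ a → C ≢ b → choose C x y z ≡ z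
        choose-off {C = C} C≢a C≢b rewrite dec-false (C Finₚ.≟ a) C≢a | dec-false (C Finₚ.≟ b) C≢b = refl

        choose-ind : ∀ C {x y z x′ y′ z′} → (C ≡ a → x ≈ x′) → (C ≡ b → y ≈ y′) → (C ≢ a → C ≢ b → z ≈ z′) →
          choose C x y z ≈ choose C x′ y′ z′
        choose-ind C p q r with C Finₚ.≟ a | C Finₚ.≟ b
        ... | yes e | _     = p e
        ... | no _  | yes e = q e
        ... | no ¬e | no ¬f = r ¬e ¬f

        except-one : a ≡ b → ∀ f C → except a f C ≈ choose C 1# 1# (f C)
        except-one refl f C with does (C Finₚ.≟ a)
        ... | true  = ≈-refl
        ... | false = ≈-refl

        except-two : ∀ f C → except b (except a f) C ≈ choose C 1# 1# (f C)
        except-two f C with does (C Finₚ.≟ a) | does (C Finₚ.≟ b)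
        ... | true  | true  = ≈-refl
        ... | true  | false = ≈-refl
        ... | false | true  = ≈-refl
        ... | false | false = ≈-refl

      elsewhere : (Fin k → ∣R∣) → ∣R∣
      elsewhere f = prod λ C → choose C 1# 1# (f C)

      prod-one : a ≡ b → ∀ f → prod f ≈ f a * elsewhere f
      prod-one a≡b f = ≈-trans (prod-except a f) (*-congˡ (prod-cong (except-one a≡b f)))

      prod-two : a ≢ b → ∀ f → prod f ≈ f a * (f b * elsewhere f)
      prod-two a≢b f = ≈-trans (prod-except a f) (*-congˡ (≈-trans (prod-except b (except a f))
        (*-cong (reflexive (except-off f (a≢b ∘ ≡.sym))) (prod-cong (except-two f)))))

      elsewhere-cong : ∀ {f g} → (∀ C → C ≢ a → C ≢ b → f C ≈ g C) → elsewhere f ≈ elsewhere g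
      elsewhere-cong e = prod-cong λ C → choose-ind C (λ _ → ≈-refl) (λ _ → ≈-refl) (e C)

    module Gather {k : ℕ} (a b : Fin k) (target : Fin k → Basis) where

      open Choose a b

      Agrees : Tensor k → Set
      Agrees s = ∀ C → C ≢ a → C ≢ b → lookup s C ≡ target C

      δ : Basis → Basis → ∣R∣
      δ v w = if does (w ≟ᵇ v) then 1# else 0#

      δ-≢ : ∀ {v w} → w ≢ v → δ v w ≡ 0#
      δ-≢ {v} {w} w≢v rewrite dec-false (w ≟ᵇ v) w≢v = refl

      δ-≡ : ∀ v → δ v v ≡ 1#
      δ-≡ v rewrite dec-true (v ≟ᵇ v) refl = refl

      ∑V-δ : ∀ v (f : Basis → ∣R∣) → ∑V (λ w → δ v w * f w) ≈ f v
      ∑V-δ v f = ≈-trans (∑V-single v {λ w → δ v w * f w} λ w w≢v → ≈-trans (*-congʳ (reflexive (δ-≢ w≢v))) (zeroˡ _))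
        (≈-trans (*-congʳ (reflexive (δ-≡ v))) (*-identityˡ (f v)))

      ∑V-δ′ : ∀ v (f : Basis → ∣R∣) → ∑V (λ w → δ w v * f w) ≈ f v
      ∑V-δ′ v f = ≈-trans (∑V-single v {λ w → δ w v * f w} λ w w≢v → ≈-trans (*-congʳ (reflexive (δ-≢ (w≢v ∘ ≡.sym)))) (zeroˡ _))
        (≈-trans (*-congʳ (reflexive (δ-≡ v))) (*-identityˡ (f v)))

      module _ (agrees? : ∀ s → Dec (Agrees s)) where

        agreement : ∀ s → ∣R∣
        agreement s = if does (agrees? s) then 1# else 0#

        -- Agreement fixes every factor except those at `a` and `b`. As a product of Kronecker
        -- deltas it can be absorbed into the product; the sum over tensors then becomes a product
        -- of sums, which collapse away from the edge.
        gather : ∀ (F : Fin k → Basis → ∣R∣) → ∑⊗ k (λ s → agreement s * prod λ C → F C (lookup s C)) ≈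
          prod λ C → choose C (∑V (F C)) (∑V (F C)) (F C (target C))
        gather F = begin
          ∑⊗ k (λ s → agreement s * prod λ C → F C (lookup s C))   ≈⟨ ∑⊗-cong k spread ⟩
          ∑⊗ k (λ s → prod λ C → J C (lookup s C))                 ≈⟨ ∑⊗-prod k J ⟩
          prod (λ C → ∑V (J C))                                    ≈⟨ prod-cong collect ⟩
          prod (λ C → choose C (∑V (F C)) (∑V (F C)) (F C (target C))) ∎
          where
          J : Fin k → Basis → ∣R∣
          J C v = choose C (F C v) (F C v) (δ (target C) v * F C v)
          spread : ∀ s → agreement s * prod (λ C → F C (lookup s C)) ≈ prod λ C → J C (lookup s C)
          spread s with agrees? s
          ... | yes agree = ≈-trans (*-identityˡ _) (prod-cong same)
            where
            same : ∀ C → F C (lookup s C) ≈ J C (lookup s C)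
            same C with C Finₚ.≟ a | C Finₚ.≟ b
            ... | yes e | _     = reflexive (≡.sym (choose-a e))
            ... | no ¬e | yes f = reflexive (≡.sym (choose-b ¬e f))
            ... | no ¬e | no ¬f = ≈-sym (≈-trans (reflexive (choose-off ¬e ¬f))
              (≈-trans (*-congʳ (reflexive (≡.trans (cong (δ (target C)) (agree C ¬e ¬f)) (δ-≡ (target C))))) (*-identityˡ _)))
          ... | no ¬agree with Finₚ.¬∀⟶∃¬ k _ (λ C → ¬? (C Finₚ.≟ a) →-dec (¬? (C Finₚ.≟ b) →-dec (lookup s C ≟ᵇ target C))) ¬agree
          ... | C , ¬p = ≈-trans (zeroˡ _) (≈-sym (prod-zero C (≈-trans
            (reflexive (choose-off (λ e → ¬p λ ¬e → contradiction e ¬e) (λ e → ¬p λ _ ¬e → contradiction e ¬e)))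
            (≈-trans (*-congʳ (reflexive (δ-≢ λ e → ¬p λ _ _ → e))) (zeroˡ _)))))
          collect : ∀ C → ∑V (J C) ≈ choose C (∑V (F C)) (∑V (F C)) (F C (target C))
          collect C with C Finₚ.≟ a | C Finₚ.≟ b
          ... | yes e | _     = ≈-trans (∑V-cong λ v → reflexive (choose-a e)) (reflexive (≡.sym (choose-a e)))
          ... | no ¬e | yes f = ≈-trans (∑V-cong λ v → reflexive (choose-b ¬e f)) (reflexive (≡.sym (choose-b ¬e f)))
          ... | no ¬e | no ¬f = ≈-trans (∑V-cong λ v → reflexive (choose-off ¬e ¬f))
            (≈-trans (∑V-δ (target C) (F C)) (reflexive (≡.sym (choose-off ¬e ¬f))))

        gather-one : a ≡ b → ∀ (φ : Basis → ∣R∣) (F : Fin k → Basis → ∣R∣) →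
          ∑⊗ k (λ s → agreement s * (φ (lookup s a) * prod λ C → F C (lookup s C))) ≈
          ∑V (λ v → φ v * F a v) * elsewhere λ C → F C (target C)
        gather-one a≡b φ F = begin
          ∑⊗ k (λ s → agreement s * (φ (lookup s a) * prod λ C → F C (lookup s C)))
            ≈⟨ ∑⊗-cong k (λ s → *-congˡ (absorb s)) ⟩
          ∑⊗ k (λ s → agreement s * prod λ C → F′ C (lookup s C))
            ≈⟨ gather F′ ⟩
          prod H
            ≈⟨ prod-one a≡b H ⟩
          H a * elsewhere H
            ≈⟨ *-cong (≈-trans (reflexive (choose-a refl)) (∑V-cong λ v → reflexive (choose-a refl)))
                 (elsewhere-cong λ C ¬e ¬f → reflexive (≡.trans (choose-off ¬e ¬f) (choose-off ¬e ¬f))) ⟩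
          ∑V (λ v → φ v * F a v) * elsewhere (λ C → F C (target C)) ∎
          where
          F′ : Fin k → Basis → ∣R∣
          F′ C v = choose C (φ v * F C v) (F C v) (F C v)
          H : Fin k → ∣R∣
          H C = choose C (∑V (F′ C)) (∑V (F′ C)) (F′ C (target C))
          absorb : ∀ s → φ (lookup s a) * prod (λ C → F C (lookup s C)) ≈ prod λ C → F′ C (lookup s C)
          absorb s = begin
            φ (lookup s a) * prod (λ C → F C (lookup s C))
              ≈⟨ *-congˡ (prod-one a≡b _) ⟩
            φ (lookup s a) * (F a (lookup s a) * elsewhere λ C → F C (lookup s C))
              ≈⟨ *-assoc _ _ _ ⟨
            (φ (lookup s a) * F a (lookup s a)) * elsewhere (λ C → F C (lookup s C))
              ≈⟨ *-cong (reflexive (choose-a refl)) (elsewhere-cong λ C ¬e ¬f → reflexive (choose-off ¬e ¬f)) ⟨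
            F′ a (lookup s a) * elsewhere (λ C → F′ C (lookup s C))
              ≈⟨ prod-one a≡b (λ C → F′ C (lookup s C)) ⟨
            prod (λ C → F′ C (lookup s C)) ∎

        -- `φ` couples the factors at `a` and `b` and so does not have the product form that
        -- `gather` needs. Summing over `u` with a delta that pins the factor at `a` to `u`
        -- separates them.
        gather-two : a ≢ b → ∀ (φ : Basis → Basis → ∣R∣) (F : Fin k → Basis → ∣R∣) →
          ∑⊗ k (λ s → agreement s * (φ (lookup s a) (lookup s b) * prod λ C → F C (lookup s C))) ≈
          ∑V (λ u → F a u * ∑V λ v → φ u v * F b v) * elsewhere λ C → F C (target C)
        gather-two a≢b φ F = begin
          ∑⊗ k (λ s → agreement s * (φ (lookup s a) (lookup s b) * prod λ C → F C (lookup s C)))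
            ≈⟨ ∑⊗-cong k (λ s → ≈-trans (*-congˡ (absorb s)) (≈-sym (∑V-* (agreement s) _))) ⟩
          ∑⊗ k (λ s → ∑V λ u → agreement s * prod λ C → F′ u C (lookup s C))
            ≈⟨ ∑V-commute (∑⊗-linear k) (λ u s → agreement s * prod λ C → F′ u C (lookup s C)) ⟩
          ∑V (λ u → ∑⊗ k λ s → agreement s * prod λ C → F′ u C (lookup s C))
            ≈⟨ ∑V-cong (λ u → gather (F′ u)) ⟩
          ∑V (λ u → prod (H u))
            ≈⟨ ∑V-cong (λ u → ≈-trans (prod-two a≢b (H u)) (factor u)) ⟩
          ∑V (λ u → (F a u * ∑V (λ v → φ u v * F b v)) * elsewhere (λ C → F C (target C)))
            ≈⟨ ∑V-*ʳ _ _ ⟩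
          ∑V (λ u → F a u * ∑V (λ v → φ u v * F b v)) * elsewhere (λ C → F C (target C)) ∎
          where
          F′ : Basis → Fin k → Basis → ∣R∣
          F′ u C v = choose C (δ u v * F C v) (φ u v * F C v) (F C v)
          H : Basis → Fin k → ∣R∣
          H u C = choose C (∑V (F′ u C)) (∑V (F′ u C)) (F′ u C (target C))
          b≢a : b ≢ a
          b≢a = a≢b ∘ ≡.sym
          factor : ∀ u → H u a * (H u b * elsewhere (H u)) ≈
            (F a u * ∑V (λ v → φ u v * F b v)) * elsewhere (λ C → F C (target C))
          factor u = ≈-trans (≈-sym (*-assoc _ _ _)) (*-cong (*-cong
            (≈-trans (reflexive (choose-a refl)) (≈-trans (∑V-cong λ v → reflexive (choose-a refl)) (∑V-δ u (F a))))
            (≈-trans (reflexive (choose-b b≢a refl)) (∑V-cong λ v → reflexive (choose-b b≢a refl))))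
            (elsewhere-cong λ C ¬e ¬f → reflexive (≡.trans (choose-off ¬e ¬f) (choose-off ¬e ¬f))))
          expand : ∀ u s → prod (λ C → F′ u C (lookup s C)) ≈ δ u (lookup s a) *
            (φ u (lookup s b) * (F a (lookup s a) * (F b (lookup s b) * elsewhere λ C → F C (lookup s C))))
          expand u s = ≈-trans (prod-two a≢b λ C → F′ u C (lookup s C)) (≈-trans
            (*-cong (reflexive (choose-a refl)) (*-cong (reflexive (choose-b b≢a refl))
              (elsewhere-cong λ C ¬e ¬f → reflexive (choose-off ¬e ¬f))))
            (≈-trans (*-assoc _ _ _) (*-congˡ (≈-trans (*-congˡ (*-assoc _ _ _)) (x∙yz≈y∙xz _ _ _)))))
            where open import Algebra.Properties.CommutativeSemigroup *-commutativeSemigroup using (x∙yz≈y∙xz)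
          absorb : ∀ s → φ (lookup s a) (lookup s b) * prod (λ C → F C (lookup s C)) ≈
            ∑V λ u → prod λ C → F′ u C (lookup s C)
          absorb s = begin
            φ (lookup s a) (lookup s b) * prod (λ C → F C (lookup s C))
              ≈⟨ *-congˡ (prod-two a≢b _) ⟩
            φ (lookup s a) (lookup s b) * (F a (lookup s a) * (F b (lookup s b) * elsewhere λ C → F C (lookup s C)))
              ≈⟨ ∑V-δ′ (lookup s a) (λ u → φ u (lookup s b) *
                   (F a (lookup s a) * (F b (lookup s b) * elsewhere λ C → F C (lookup s C)))) ⟨
            ∑V (λ u → δ u (lookup s a) * (φ u (lookup s b) *
                   (F a (lookup s a) * (F b (lookup s b) * elsewhere λ C → F C (lookup s C)))))
              ≈⟨ ∑V-cong (λ u → expand u s) ⟨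
            ∑V (λ u → prod λ C → F′ u C (lookup s C)) ∎

    module _ {N k k′ : ℕ} (cl : Fin N → Fin k) (cl′ : Fin N → Fin k′)
      (surjective : ∀ C → ∃ λ p → cl p ≡ C) (surjective′ : ∀ C → ∃ λ p → cl′ p ≡ C) (u w : Fin N) where

      On On′ : Fin N → Set
      On  p = cl p ≡ cl u ⊎ cl p ≡ cl w
      On′ p = cl′ p ≡ cl′ u ⊎ cl′ p ≡ cl′ w

      module EdgeChain (on⇔ : ∀ {p} → On p ⇔ On′ p)
        (off⇔ : ∀ {p q} → ¬ On p → cl p ≡ cl q ⇔ cl′ p ≡ cl′ q) where

        private
          σ : Fin k → Fin k′
          σ C = cl′ (proj₁ (surjective C))
          module S = Choose (cl u) (cl w)
          module T = Choose (cl′ u) (cl′ w)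

        off-≡ : ∀ {C p} → C ≢ cl u → C ≢ cl w → cl p ≡ C → ¬ On p
        off-≡ ¬e ¬f refl = [ ¬e , ¬f ]′

        σ-≡ : ∀ {C p} → C ≢ cl u → C ≢ cl w → cl p ≡ C → σ C ≡ cl′ p
        σ-≡ {C} {p} ¬e ¬f e = let (r , e′) = surjective C in
          Equivalence.to (off⇔ (off-≡ ¬e ¬f e′)) (≡.trans e′ (≡.sym e))

        -- Away from the edge the map σ is a bijection.
        elsewhere-σ : ∀ f f′ → (∀ p → ¬ On p → f (cl p) ≈ f′ (cl′ p)) → S.elsewhere f ≈ T.elsewhere f′
        elsewhere-σ f f′ f≈f′ = begin
          S.elsewhere f                      ≈⟨ prod-cong row ⟨
          prod (λ C → prod λ D → entry C D)  ≈⟨ ∏-comm entry ⟩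
          prod (λ D → prod λ C → entry C D)  ≈⟨ prod-cong column ⟩
          T.elsewhere f′                     ∎
          where
          -- A matrix that is 1 except at the places `(C , σ C)` for circles `C` off the edge. Its
          -- product by rows is the left side and by columns the right side, so no inverse of `σ`
          -- has to be constructed.
          entry : Fin k → Fin k′ → ∣R∣
          entry C D = S.choose C 1# 1# (only (σ C) (λ _ → f C) D)
          entry-off : ∀ {C D} → (C ≢ cl u → C ≢ cl w → D ≢ σ C) → entry C D ≈ 1#
          entry-off {C} {D} off with C Finₚ.≟ cl u | C Finₚ.≟ cl w
          ... | yes e | _     = reflexive (S.choose-a e)
          ... | no ¬e | yes f = reflexive (S.choose-b ¬e f)
          ... | no ¬e | no ¬f = ≈-trans (reflexive (S.choose-off ¬e ¬f))
                                        (reflexive (only-off (λ _ → f C) (off ¬e ¬f)))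
          row : ∀ C → prod (entry C) ≈ S.choose C 1# 1# (f C)
          row C with C Finₚ.≟ cl u | C Finₚ.≟ cl w
          ... | yes e | _     = ≈-trans (prod-1 {k′} {entry C} λ D → entry-off {C} {D} λ ¬e _ → contradiction e ¬e) (reflexive (≡.sym (S.choose-a e)))
          ... | no ¬e | yes f = ≈-trans (prod-1 {k′} {entry C} λ D → entry-off {C} {D} λ _ ¬f → contradiction f ¬f) (reflexive (≡.sym (S.choose-b ¬e f)))
          ... | no ¬e | no ¬f = ≈-trans (prod-cong {k′} {entry C} λ D → reflexive (S.choose-off ¬e ¬f))
            (≈-trans (prod-only (σ C) (λ _ → f C)) (reflexive (≡.sym (S.choose-off ¬e ¬f))))
          σ-off : ∀ {C D} → C ≢ cl u → C ≢ cl w → D ≡ σ C → D ≢ cl′ u × D ≢ cl′ w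
          σ-off {C} ¬e ¬f refl = let (r , e′) = surjective C in
            (λ e → off-≡ ¬e ¬f e′ (Equivalence.from on⇔ (inj₁ e))) ,
            (λ e → off-≡ ¬e ¬f e′ (Equivalence.from on⇔ (inj₂ e)))
          column : ∀ D → prod (λ C → entry C D) ≈ T.choose D 1# 1# (f′ D)
          column D with D Finₚ.≟ cl′ u | D Finₚ.≟ cl′ w
          ... | yes e | _     = ≈-trans (prod-1 {k} {λ C → entry C D} λ C → entry-off λ ¬e ¬f e′ → proj₁ (σ-off ¬e ¬f e′) e)
                                  (reflexive (≡.sym (T.choose-a e)))
          ... | no ¬e | yes f = ≈-trans (prod-1 {k} {λ C → entry C D} λ C → entry-off λ ¬e ¬f e′ → proj₂ (σ-off ¬e ¬f e′) f)
                                  (reflexive (≡.sym (T.choose-b ¬e f)))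
          ... | no ¬e | no ¬f with surjective′ D
          ... | p , refl = begin
            prod (λ C → entry C (cl′ p))      ≈⟨ prod-single (cl p) others ⟩
            entry (cl p) (cl′ p)              ≈⟨ reflexive (S.choose-off (¬on ∘ inj₁) (¬on ∘ inj₂)) ⟩
            only (σ (cl p)) (λ _ → f (cl p)) (cl′ p)
              ≈⟨ reflexive (cong (λ i → only i (λ _ → f (cl p)) (cl′ p)) (σ-≡ (¬on ∘ inj₁) (¬on ∘ inj₂) refl)) ⟩
            only (cl′ p) (λ _ → f (cl p)) (cl′ p) ≈⟨ reflexive (only-at (cl′ p) (λ _ → f (cl p))) ⟩
            f (cl p)                          ≈⟨ f≈f′ p ¬on ⟩
            f′ (cl′ p)                        ≈⟨ reflexive (T.choose-off ¬e ¬f) ⟨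
            T.choose (cl′ p) 1# 1# (f′ (cl′ p)) ∎
            where
            ¬on : ¬ On p
            ¬on on = [ ¬e , ¬f ]′ (Equivalence.to on⇔ on)
            others : ∀ C → C ≢ cl p → entry C (cl′ p) ≈ 1#
            others C C≢ = entry-off λ ¬e ¬f e → C≢ (let (r , e′) = surjective C in
              ≡.trans (≡.sym e′) (Equivalence.from (off⇔ (off-≡ ¬e ¬f e′)) (≡.sym e)))

        total-off-edge : ∀ L p → ¬ On p → total cl L (cl p) ≡ total cl′ L (cl′ p)
        total-off-edge L p ¬on = total-⇔ (λ {q} → mk⇔
          (λ e → ≡.sym (Equivalence.to (off⇔ ¬on) (≡.sym e)))
          (λ e → ≡.sym (Equivalence.from (off⇔ ¬on) (≡.sym e)))) L

        module _ (t : Tensor k′) (L : Word {N}) where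

          private
            a b : Fin k
            a = cl u
            b = cl w
            a′ b′ : Fin k′
            a′ = cl′ u
            b′ = cl′ w
            rest : ∣R∣
            rest = T.elsewhere λ D → X (total cl′ L D) (lookup t D)

          target : Fin k → Basis
          target C = lookup t (σ C)

          open Gather a b target using (Agrees)

          elsewhere-rest : S.elsewhere (λ C → X (total cl L C) (target C)) ≈ rest
          elsewhere-rest = elsewhere-σ _ _ λ p ¬on → reflexive (cong₂ (λ z D → X z (lookup t D))
            (total-off-edge L p ¬on) (σ-≡ (¬on ∘ inj₁) (¬on ∘ inj₂) refl))

          P-rest : ∀ A → (∀ D → D ≢ a′ → D ≢ b′ → total cl′ (A ++ L) D ≡ total cl′ L D) →
            T.elsewhere (λ D → X (total cl′ (A ++ L) D) (lookup t D)) ≈ rest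
          P-rest A e = T.elsewhere-cong λ D ¬e ¬f → reflexive (cong (λ z → X z (lookup t D)) (e D ¬e ¬f))

          module _ (agrees? : ∀ s → Dec (Agrees s)) where

            open Gather a b target using (gather-one; gather-two)

            private
              agreement : Tensor k → ∣R∣
              agreement = Gather.agreement a b target agrees?

            -- The letters on the new circle are those of the two old ones, so multiplication is
            -- already performed by reading the same word in the new state.
            merge-chain : a ≢ b → a′ ≡ b′ →
              ∑⊗ k (λ s → agreement s * (μ (lookup s a) (lookup s b) (lookup t a′) * Π cl L s)) ≈ Π cl′ L t
            merge-chain a≢b a′≡b′ = begin
              ∑⊗ k (λ s → agreement s * (μ (lookup s a) (lookup s b) c * Π cl L s))
                ≈⟨ gather-two agrees? a≢b (λ v v′ → μ v v′ c) (λ C → X (total cl L C)) ⟩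
              ∑V (λ v → X A v * ∑V λ v′ → X (expo v ⊹ expo v′) c * X B v′) *
                S.elsewhere (λ C → X (total cl L C) (target C))
                ≈⟨ *-cong multiply elsewhere-rest ⟩
              X (A ⊹ B) c * rest
                ≈⟨ *-congʳ (reflexive (cong (λ z → X z c) (total-⊎ a≢b on L))) ⟨
              X (total cl′ L a′) c * rest
                ≈⟨ T.prod-one a′≡b′ (λ D → X (total cl′ L D) (lookup t D)) ⟨
              Π cl′ L t ∎
              where
              c = lookup t a′
              A = total cl L a
              B = total cl L b
              on : ∀ {q} → cl′ q ≡ a′ ⇔ On q
              on = mk⇔ (λ e → Equivalence.from on⇔ (inj₁ e))
                (λ o → [ (λ e → e) , (λ e → ≡.trans e (≡.sym a′≡b′)) ]′ (Equivalence.to on⇔ o))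
              multiply : ∑V (λ v → X A v * ∑V λ v′ → X (expo v ⊹ expo v′) c * X B v′) ≈ X (A ⊹ B) c
              multiply = begin
                ∑V (λ v → X A v * ∑V λ v′ → X (expo v ⊹ expo v′) c * X B v′)
                  ≈⟨ ∑V-cong (λ v → *-congˡ (∑V-cong λ v′ → ≈-trans (*-comm _ (X B v′))
                       (*-congˡ (reflexive (cong (λ z → X z c) (⊹-comm (expo v) (expo v′))))))) ⟩
                ∑V (λ v → X A v * ∑V λ v′ → X B v′ * X (expo v′ ⊹ expo v) c)
                  ≈⟨ ∑V-cong (λ v → *-congˡ (≈-trans (X-* B (expo v) c)
                       (reflexive (cong (λ z → X z c) (⊹-comm B (expo v)))))) ⟩
                ∑V (λ v → X A v * X (expo v ⊹ B) c)
                  ≈⟨ X-* A B c ⟩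
                X (A ⊹ B) c ∎

            twist-chain : a ≡ b → a′ ≡ b′ →
              ∑⊗ k (λ s → agreement s * (m (lookup s a) (lookup t a′) * Π cl L s)) ≈ Π cl′ ((u , θ) ∷ L) t
            twist-chain a≡b a′≡b′ = begin
              ∑⊗ k (λ s → agreement s * (m (lookup s a) c * Π cl L s))
                ≈⟨ gather-one agrees? a≡b (λ v → m v c) (λ C → X (total cl L C)) ⟩
              ∑V (λ v → m v c * X A v) * S.elsewhere (λ C → X (total cl L C) (target C))
                ≈⟨ *-cong multiply elsewhere-rest ⟩
              X (A ⊹ θ) c * rest
                ≈⟨ *-cong (reflexive (cong (λ z → X z c) total-a′)) (P-rest ((u , θ) ∷ []) λ D D≢a′ _ →
                     total-off cl′ θ L (D≢a′ ∘ ≡.sym)) ⟨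
              X (total cl′ ((u , θ) ∷ L) a′) c * T.elsewhere (λ D → X (total cl′ ((u , θ) ∷ L) D) (lookup t D))
                ≈⟨ T.prod-one a′≡b′ (λ D → X (total cl′ ((u , θ) ∷ L) D) (lookup t D)) ⟨
              Π cl′ ((u , θ) ∷ L) t ∎
              where
              c = lookup t a′
              A = total cl L a
              on : ∀ {q} → cl q ≡ a ⇔ cl′ q ≡ a′
              on = mk⇔
                (λ e → [ (λ e → e) , (λ e → ≡.trans e (≡.sym a′≡b′)) ]′ (Equivalence.to on⇔ (inj₁ e)))
                (λ e → [ (λ e → e) , (λ e → ≡.trans e (≡.sym a≡b)) ]′ (Equivalence.from on⇔ (inj₁ e)))
              total-a′ : total cl′ ((u , θ) ∷ L) a′ ≡ A ⊹ θ
              total-a′ = ≡.trans (total-at cl′ θ L refl)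
                (≡.trans (cong (θ ⊹_) (≡.sym (total-⇔ on L))) (⊹-comm θ A))
              multiply : ∑V (λ v → m v c * X A v) ≈ X (A ⊹ θ) c
              multiply = ≈-trans
                (∑V-cong λ v → ≈-trans (*-comm (m v c) (X A v)) (*-congˡ (reflexive (m-θ v c))))
                (X-* A θ c)

            -- Δ multiplies all letters of the old circle into the left factor, whereas the new
            -- state reads some of them on the second circle. Their product `B′` is carried across
            -- by `casimir`.
            split-chain : a ≡ b → a′ ≢ b′ →
              ∑⊗ k (λ s → agreement s * (Δ (lookup s a) (lookup t a′) (lookup t b′) * Π cl L s)) ≈
              pairing λ z z′ → Π cl′ ((u , z) ∷ (w , z′) ∷ L) t
            split-chain a≡b a′≢b′ = begin
              ∑⊗ k (λ s → agreement s * (Δ (lookup s a) c c′ * Π cl L s))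
                ≈⟨ gather-one agrees? a≡b (λ v → Δ v c c′) (λ C → X (total cl L C)) ⟩
              ∑V (λ v → Δ v c c′ * X A v) * S.elsewhere (λ C → X (total cl L C) (target C))
                ≈⟨ *-cong multiply elsewhere-rest ⟩
              pairing (λ z z′ → X (A′ ⊹ z) c * X (B′ ⊹ z′) c′) * rest
                ≈⟨ *-comm _ rest ⟩
              rest * pairing (λ z z′ → X (A′ ⊹ z) c * X (B′ ⊹ z′) c′)
                ≈⟨ Linear.T-* pairing-linear rest (λ (z , z′) → X (A′ ⊹ z) c * X (B′ ⊹ z′) c′) ⟨
              pairing (λ z z′ → rest * (X (A′ ⊹ z) c * X (B′ ⊹ z′) c′))
                ≈⟨ pairing-cong (λ z z′ → ≈-trans (*-comm rest _)
                     (*-assoc (X (A′ ⊹ z) c) (X (B′ ⊹ z′) c′) rest)) ⟩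
              pairing (λ z z′ → X (A′ ⊹ z) c * (X (B′ ⊹ z′) c′ * rest))
                ≈⟨ pairing-cong (λ z z′ → word z z′) ⟨
              pairing (λ z z′ → Π cl′ ((u , z) ∷ (w , z′) ∷ L) t) ∎
              where
              c = lookup t a′
              c′ = lookup t b′
              A = total cl L a
              A′ = total cl′ L a′
              B′ = total cl′ L b′
              on : ∀ {q} → cl q ≡ a ⇔ On′ q
              on = mk⇔ (λ e → Equivalence.to on⇔ (inj₁ e))
                (λ o → [ (λ e → e) , (λ e → ≡.trans e (≡.sym a≡b)) ]′ (Equivalence.from on⇔ o))
              G : Monomial → Monomial → ∣R∣
              G z z′ = X (A′ ⊹ z) c * X z′ c′
              multiply : ∑V (λ v → Δ v c c′ * X A v) ≈ pairing λ z z′ → X (A′ ⊹ z) c * X (B′ ⊹ z′) c′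
              multiply = begin
                ∑V (λ v → Δ v c c′ * X A v)
                  ≈⟨ ∑V-cong (λ v → ≈-trans (*-comm (Δ v c c′) (X A v)) (*-congˡ (Δ-pairing v c c′))) ⟩
                ∑V (λ v → X A v * pairing λ z z′ → X (expo v ⊹ z) c * X z′ c′)
                  ≈⟨ pairing-commute (∑V-linear λ v → linear-scale (linear-at v) (X A v))
                       (λ v z z′ → X (expo v ⊹ z) c * X z′ c′) ⟩
                pairing (λ z z′ → ∑V λ v → X A v * (X (expo v ⊹ z) c * X z′ c′))
                  ≈⟨ pairing-cong (λ z z′ → ≈-trans (∑V-cong λ v → ≈-sym (*-assoc (X A v) (X (expo v ⊹ z) c) (X z′ c′)))
                       (≈-trans (∑V-*ʳ (X z′ c′) (λ v → X A v * X (expo v ⊹ z) c)) (*-congʳ (X-* A z c)))) ⟩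
                pairing (λ z z′ → X (A ⊹ z) c * X z′ c′)
                  ≈⟨ pairing-cong (λ z z′ → *-congʳ {X z′ c′} (reflexive (cong (λ x → X x c) (shuffle z)))) ⟩
                pairing (λ z z′ → G (B′ ⊹ z) z′)
                  ≈⟨ casimir n {G} (X-admissible A′ c c′) B′ ⟩
                pairing (λ z z′ → X (A′ ⊹ z) c * X (B′ ⊹ z′) c′) ∎
                where
                shuffle : ∀ z → A ⊹ z ≡ A′ ⊹ B′ ⊹ z
                shuffle z = ≡.trans (cong (_⊹ z) (total-⊎ a′≢b′ on L)) (⊹-assoc A′ B′ z)
              word : ∀ z z′ → Π cl′ ((u , z) ∷ (w , z′) ∷ L) t ≈ X (A′ ⊹ z) c * (X (B′ ⊹ z′) c′ * rest)
              word z z′ = ≈-trans (T.prod-two a′≢b′ _) (*-cong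
                (reflexive (cong (λ x → X x c) (≡.trans (total-at cl′ z ((w , z′) ∷ L) refl)
                  (≡.trans (cong (z ⊹_) (total-off cl′ z′ L (a′≢b′ ∘ ≡.sym))) (⊹-comm z A′)))))
                (*-cong (reflexive (cong (λ x → X x c′) (≡.trans (total-off cl′ z ((w , z′) ∷ L) a′≢b′)
                  (≡.trans (total-at cl′ z′ L refl) (⊹-comm z′ B′)))))
                  (P-rest ((u , z) ∷ (w , z′) ∷ []) λ D ¬e ¬f → ≡.trans
                    (total-off cl′ z ((w , z′) ∷ L) (¬e ∘ ≡.sym)) (total-off cl′ z′ L (¬f ∘ ≡.sym)))))

    module _ (Γ : PerfectMatchingGraph) where

      open PerfectMatchingGraph Γ using (ℓ)
      open Topology
      open import Data.Fin.Base using (combine)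
      open import Relation.Nullary.Decidable using (map′)
      open Quotient using () renaming (surjective to class-surjective)

      edgeKind : State ℓ → State ℓ → Fin ℓ → Kind
      edgeKind α α′ i = kind
        (does (circle Γ α (combine i UL) Finₚ.≟ circle Γ α (combine i UR)))
        (does (circle Γ α′ (combine i UL) Finₚ.≟ circle Γ α′ (combine i UR)))

      module _ (α α′ : State ℓ) (i : Fin ℓ) (agree : Agree Γ (_≡ i) α α′) where

        private
          module C = EdgeChange Γ α α′ i agree
          cl = circle Γ α
          cl′ = circle Γ α′
          u w : Point Γ
          u = combine i UL
          w = combine i UR
          module E = EdgeChain cl cl′ (class-surjective (circles Γ α)) (class-surjective (circles Γ α′)) u w
            C.onEdge⇔ C.circle⇔

        module _ (t : Tensor (#circles Γ α′)) (L : Word {ℓ ℕ.* 4}) where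

          private
            Agrees : Tensor (#circles Γ α) → Set
            Agrees = Gather.Agrees (cl u) (cl w) (E.target t L)

            agrees? : ∀ s → Dec (Agrees s)
            agrees? s = map′ to from (agreeElsewhere? Γ α α′ i s t)
              where
              to : AgreeElsewhere Γ α α′ i s t → Agrees s
              to f C ¬e ¬f = let (r , e) = class-surjective (circles Γ α) C in
                ≡.trans (cong (lookup s) (≡.sym e)) (≡.subst
                  (λ p → cl p ≢ cl u × cl p ≢ cl w → lookup s (cl p) ≡ lookup t (cl′ p))
                  (Finₚ.combine-remQuot {ℓ} 4 r)
                  (f (proj₁ (Fin.remQuot {ℓ} 4 r)) (proj₂ (Fin.remQuot {ℓ} 4 r)))
                  ((λ e′ → ¬e (≡.trans (≡.sym e) e′)) , (λ e′ → ¬f (≡.trans (≡.sym e) e′))))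
              from : Agrees s → AgreeElsewhere Γ α α′ i s t
              from g j c (¬e , ¬f) = ≡.trans (g _ ¬e ¬f) (cong (lookup t) (E.σ-≡ ¬e ¬f refl))

            agreement : Tensor (#circles Γ α) → ∣R∣
            agreement = Gather.agreement (cl u) (cl w) (E.target t L) agrees?

            coefficient-local : ∀ s {c} → local Γ α α′ i s t ≡ c → ∀ x →
              coefficient Γ α α′ i s t * x ≈ agreement s * (c * x)
            coefficient-local s refl x with does (agreeElsewhere? Γ α α′ i s t)
            ... | true  = ≈-sym (*-identityˡ _)
            ... | false = ≈-trans (zeroˡ x) (≈-sym (zeroˡ _))

          local-merging : ∀ s → cl u ≢ cl w → cl′ u ≡ cl′ w →
            local Γ α α′ i s t ≡ μ (lookup s (cl u)) (lookup s (cl w)) (lookup t (cl′ u))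
          local-merging s p q with cl u Finₚ.≟ cl w | cl′ u Finₚ.≟ cl′ w
          ... | no _  | yes _ = refl
          ... | yes p′ | _    = contradiction p′ p
          ... | no _  | no q′ = contradiction q q′

          local-twisting : ∀ s → cl u ≡ cl w → cl′ u ≡ cl′ w →
            local Γ α α′ i s t ≡ m (lookup s (cl u)) (lookup t (cl′ u))
          local-twisting s p q with cl u Finₚ.≟ cl w | cl′ u Finₚ.≟ cl′ w
          ... | yes _ | yes _ = refl
          ... | no p′ | _     = contradiction p p′
          ... | yes _ | no q′ = contradiction q q′

          local-splitting : ∀ s → cl u ≡ cl w → cl′ u ≢ cl′ w →
            local Γ α α′ i s t ≡ Δ (lookup s (cl u)) (lookup t (cl′ u)) (lookup t (cl′ w))
          local-splitting s p q with cl u Finₚ.≟ cl w | cl′ u Finₚ.≟ cl′ w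
          ... | yes _ | no _   = refl
          ... | no p′ | _      = contradiction p p′
          ... | yes _ | yes q′ = contradiction q′ q

          local-impossible : ∀ s → cl u ≢ cl w → cl′ u ≢ cl′ w → local Γ α α′ i s t ≡ 0#
          local-impossible s p q with cl u Finₚ.≟ cl w | cl′ u Finₚ.≟ cl′ w
          ... | no _   | no _   = refl
          ... | yes p′ | _      = contradiction p′ p
          ... | no _   | yes q′ = contradiction q′ q

          -- `local` and `edgeKind` branch on the same two decisions; taking these as arguments of
          -- `cases` lets `kind` compute.
          ∂-edge-P : ∂-edge Γ α α′ i (P cl L) t ≈ act (edgeKind α α′ i) u w λ A → P cl′ (A ++ L) t
          ∂-edge-P = ≈-trans (cases (cl u Finₚ.≟ cl w) (cl′ u Finₚ.≟ cl′ w))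
            (Linear.T-cong (act-linear (edgeKind α α′ i) u w) λ A → ≈-sym (P-def cl′ (A ++ L) t))
            where
            expand : ∀ {f : Tensor (#circles Γ α) → ∣R∣} → (∀ s → local Γ α α′ i s t ≡ f s) →
              ∂-edge Γ α α′ i (P cl L) t ≈ ∑⊗ (#circles Γ α) λ s → agreement s * (f s * Π cl L s)
            expand e = ∑⊗-cong (#circles Γ α) λ s →
              ≈-trans (coefficient-local s (e s) (P cl L s)) (*-congˡ (*-congˡ (P-def cl L s)))
            cases : (p? : Dec (cl u ≡ cl w)) (q? : Dec (cl′ u ≡ cl′ w)) →
              ∂-edge Γ α α′ i (P cl L) t ≈ act (kind (does p?) (does q?)) u w λ A → Π cl′ (A ++ L) t
            cases (no p)  (yes q) = ≈-trans (expand λ s → local-merging s p q) (E.merge-chain t L agrees? p q)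
            cases (yes p) (yes q) = ≈-trans (expand λ s → local-twisting s p q) (E.twist-chain t L agrees? p q)
            cases (yes p) (no q)  = ≈-trans (expand λ s → local-splitting s p q) (E.split-chain t L agrees? p q)
            cases (no p)  (no q)  = ≈-trans (expand λ s → local-impossible s p q)
              (Linear.T-0 (∑⊗-linear (#circles Γ α)) λ s → ≈-trans (*-congˡ (zeroˡ _)) (zeroʳ _))

-- Commuting squares and the vanishing of ∂ ∘ ∂

module Square where

  open import Algebra.Bundles using (CommutativeRing)
  open import Data.Bool.Base using (Bool; true; false; if_then_else_)
  open import Data.Fin.Base as Fin using (Fin; zero; suc; combine)
  open import Data.Fin.Patterns
  import Data.Fin.Properties as Finₚ
  open import Data.List.Base as List using (List; []; _∷_; _++_; allFin)
  open import Data.List.Membership.Propositional using (_∈_)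
  open import Data.List.Membership.Propositional.Properties using (∈-allFin)
  open import Data.List.Relation.Unary.All as All using (All; []; _∷_)
  open import Data.List.Relation.Unary.AllPairs using ([]; _∷_)
  open import Data.List.Relation.Unary.Any using (here; there)
  open import Data.List.Relation.Unary.Unique.Propositional using (Unique)
  open import Data.List.Relation.Unary.Unique.Propositional.Properties using (allFin⁺)
  open import Data.Nat.Base as ℕ using (ℕ; zero; suc; NonZero)
  import Data.Nat.Properties as ℕₚ
  open import Data.Product.Base using (∃; _,_; proj₁; proj₂)
  open import Data.Sum.Base using (_⊎_; inj₁; inj₂; [_,_]′)
  open import Data.Vec.Base as Vec using ([]; _∷_; lookup; _[_]≔_)
  import Data.Vec.Properties as Vecₚ
  open import Function.Base using (_∘_)
  open import Level using (0ℓ)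
  open import Relation.Binary.PropositionalEquality as ≡ using (_≡_; _≢_; refl; cong)
  open import Relation.Nullary using (yes; no; does; contradiction)
  open import Relation.Nullary.Decidable using (dec-true; dec-false)
  open import Defs
  open Sums
  open Face
  open Topology
  open Tensor
  open Edge

  module Squares (n : ℕ) .{{_ : NonZero n}} (R : CommutativeRing 0ℓ 0ℓ) (1/3n : CommutativeRing.Carrier R)
    (inverse : Calculus.Inverse n R 1/3n) where

    open CommutativeRing R hiding (zero) renaming (Carrier to ∣R∣; refl to ≈-refl; sym to ≈-sym; trans to ≈-trans)
    open Complex n R 1/3n
    open Calculus n R 1/3n
    open EdgeMaps n R 1/3n
    open FiniteSums +-commutativeMonoid using (sum; ∑-distrib-+) renaming (sum-ε to sum-0)
    open FiniteSums *-commutativeMonoid using ()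
      renaming (sum to prod; sum-cong-≋ to prod-cong; sum-ε to prod-1)
    open import Relation.Binary.Reasoning.Setoid setoid
    open Linear

    module _ {N k : ℕ} (cl : Fin N → Fin k) where

      infix 4 _≅_
      -- Words that represent the same monomial on every circle. A record keeps `L` and `M`
      -- inferable, which the bare family of equations between totals would not.
      record _≅_ (L M : Word) : Set where
        constructor same
        field at : ∀ C → total cl L C ≡ total cl M C
      open _≅_

      ≅-sym : ∀ {L M} → L ≅ M → M ≅ L
      ≅-sym e = same λ C → ≡.sym (at e C)

      infixr 5 _⟫_
      _⟫_ : ∀ {L M O} → L ≅ M → M ≅ O → L ≅ O
      e ⟫ f = same λ C → ≡.trans (at e C) (at f C)

      ≅-class : ∀ {p q} → cl p ≡ cl q → ∀ z L → (p , z) ∷ L ≅ (q , z) ∷ L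
      ≅-class e z L = same λ C → cong (λ D → if does (D Finₚ.≟ C) then z ⊹ total cl L C else total cl L C) e

      ≅-∷ : ∀ x {L M} → L ≅ M → x ∷ L ≅ x ∷ M
      ≅-∷ (p , z) e = same λ C → cong (λ y → if does (cl p Finₚ.≟ C) then z ⊹ y else y) (at e C)

      ≅-swap : ∀ x y L → x ∷ y ∷ L ≅ y ∷ x ∷ L
      ≅-swap (p , z) (q , z′) L = same swapped
        where
        swapped : ∀ C → total cl ((p , z) ∷ (q , z′) ∷ L) C ≡ total cl ((q , z′) ∷ (p , z) ∷ L) C
        swapped C with does (cl p Finₚ.≟ C) | does (cl q Finₚ.≟ C)
        ... | true  | true  = ⊹-swap z z′ (total cl L C)
        ... | true  | false = refl
        ... | false | true  = refl
        ... | false | false = refl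

      ≅-fuse : ∀ p z z′ L → (p , z ⊹ z′) ∷ L ≅ (p , z) ∷ (p , z′) ∷ L
      ≅-fuse p z z′ L = same fused
        where
        fused : ∀ C → total cl ((p , z ⊹ z′) ∷ L) C ≡ total cl ((p , z) ∷ (p , z′) ∷ L) C
        fused C with does (cl p Finₚ.≟ C)
        ... | true  = ⊹-assoc z z′ (total cl L C)
        ... | false = refl

      ≅-++-swap : ∀ A B L → A ++ B ++ L ≅ B ++ A ++ L
      ≅-++-swap A B L = same λ C → ≡.trans (split A B C)
        (≡.trans (⊹-swap (total cl A C) (total cl B C) (total cl L C)) (≡.sym (split B A C)))
        where
        split : ∀ A B C → total cl (A ++ B ++ L) C ≡ total cl A C ⊹ total cl B C ⊹ total cl L C
        split A B C = ≡.trans (total-++ cl A (B ++ L) C) (cong (total cl A C ⊹_) (total-++ cl B L C))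

      module _ (t : Tensor k) where

        P-zero : ∀ {p a b} L → n ℕ.≤ a → P cl ((p , a , b) ∷ L) t ≈ 0#
        P-zero {p} {a} {b} L n≤a = ≈-trans (P-def cl ((p , a , b) ∷ L) t) (prod-zero (cl p) (reflexive (≡.trans
          (cong (λ z → X z (lookup t (cl p))) (total-at cl (a , b) L refl))
          (X-zero {(a , b) ⊹ total cl L (cl p)} (ℕₚ.≤-trans n≤a (ℕₚ.m≤m+n a _)) (lookup t (cl p))))))

        P-y³ : ∀ {p a b} L → P cl ((p , a , 3 ℕ.+ b) ∷ L) t ≈ P cl ((p , suc a , suc b) ∷ L) t
        P-y³ {p} {a} {b} L = ≈-trans (P-def cl ((p , a , 3 ℕ.+ b) ∷ L) t)
          (≈-trans (prod-cong factor) (≈-sym (P-def cl ((p , suc a , suc b) ∷ L) t)))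
          where
          y³ : ∀ z v → X ((a , 3 ℕ.+ b) ⊹ z) v ≡ X ((suc a , suc b) ⊹ z) v
          y³ z v = ≡.trans (cong (λ x → X x v) (⊹-comm (a , 3 ℕ.+ b) z))
            (≡.trans (X-y³ z v) (cong (λ x → X x v) (⊹-comm z (suc a , suc b))))
          factor : ∀ C → X (total cl ((p , a , 3 ℕ.+ b) ∷ L) C) (lookup t C) ≈
            X (total cl ((p , suc a , suc b) ∷ L) C) (lookup t C)
          factor C with does (cl p Finₚ.≟ C)
          ... | true  = reflexive (y³ (total cl L C) (lookup t C))
          ... | false = ≈-refl

        P-≡ : ∀ {L M : Word} → L ≅ M → P cl L t ≈ P cl M t
        P-≡ e = P-total cl (at e) t

        P-admissible : ∀ p q L → Admissible λ z z′ → P cl ((p , z) ∷ (q , z′) ∷ L) t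
        P-admissible p q L = record
          { zeroₗ = λ {a} {b} {z} n≤a → P-zero {b = b} ((q , z) ∷ L) n≤a
          ; zeroᵣ = λ {z} {a} {b} n≤a → ≈-trans (P-≡ (≅-swap (p , z) (q , a , b) L)) (P-zero {b = b} ((p , z) ∷ L) n≤a)
          ; y³ₗ   = λ {a} {b} {z} → P-y³ ((q , z) ∷ L)
          ; y³ᵣ   = λ {z} {a} {b} → ≈-trans (P-≡ (≅-swap (p , z) (q , a , 3 ℕ.+ b) L))
              (≈-trans (P-y³ ((p , z) ∷ L)) (P-≡ (≅-swap (q , suc a , suc b) (p , z) L)))
          }

        genus : ∀ p L → pairing (λ z z′ → P cl ((p , z) ∷ (p , z′) ∷ L) t) ≈ P cl ((p , θ) ∷ (p , θ) ∷ L) t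
        genus p L = ≈-trans (pairing-cong λ z z′ → P-≡ (≅-sym (≅-fuse p z z′ L)))
          (≈-trans (pairing-genus inverse (λ z → P cl ((p , z) ∷ L) t) (λ {a} {b} → P-zero {b = b} L) (P-y³ L))
            (P-≡ (≅-fuse p θ θ L)))

        -- The Casimir identity for words: a letter beside one factor of Δ(1) may be moved beside
        -- the other.
        slide : ∀ p q z L → pairing (λ u v → P cl ((p , z) ∷ (p , u) ∷ (q , v) ∷ L) t) ≈
          pairing λ u v → P cl ((q , z) ∷ (p , u) ∷ (q , v) ∷ L) t
        slide p q z L = begin
          pairing (λ u v → P cl ((p , z) ∷ (p , u) ∷ (q , v) ∷ L) t)
            ≈⟨ pairing-cong (λ u v → P-≡ (≅-sym (≅-fuse p z u ((q , v) ∷ L)))) ⟩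
          pairing (λ u v → P cl ((p , z ⊹ u) ∷ (q , v) ∷ L) t)
            ≈⟨ casimir n (P-admissible p q L) z ⟩
          pairing (λ u v → P cl ((p , u) ∷ (q , z ⊹ v) ∷ L) t)
            ≈⟨ pairing-cong (λ u v → P-≡ (≅-∷ (p , u) (≅-fuse q z v L) ⟫ ≅-swap (p , u) (q , z) ((q , v) ∷ L))) ⟩
          pairing (λ u v → P cl ((q , z) ∷ (p , u) ∷ (q , v) ∷ L) t) ∎

        module _ (point : Fin 8 → Fin N) (L : Word {N}) where

          private
            u₁ w₁ u₂ w₂ : Fin N
            u₁ = point 0F
            w₁ = point 1F
            u₂ = point 4F
            w₂ = point 5F

            Φ : Word → ∣R∣
            Φ A = P cl A t

          -- Multiplications commute, so a composite depends on its two kinds and no longer on the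
          -- order in which the edges are changed. A square thus becomes an identity in the tensor
          -- power of its last state.
          word : Kind → Kind → ∣R∣
          word κ κ′ = act κ u₁ w₁ λ A → act κ′ u₂ w₂ λ B → Φ (A ++ B ++ L)

          first-then-second : ∀ κ κ′ → act κ u₁ w₁ (λ A → act κ′ u₂ w₂ λ B → Φ (B ++ A ++ L)) ≈ word κ κ′
          first-then-second κ κ′ = T-cong (act-linear κ u₁ w₁) λ A → T-cong (act-linear κ′ u₂ w₂) λ B →
            P-≡ (≅-++-swap B A L)

          second-then-first : ∀ κ κ′ → act κ′ u₂ w₂ (λ A → act κ u₁ w₁ λ B → Φ (B ++ A ++ L)) ≈ word κ κ′
          second-then-first κ κ′ = act-commute κ u₁ w₁ (act-linear κ′ u₂ w₂) λ A B → Φ (B ++ A ++ L)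

          private
            to₂ : ∀ {p q p′ q′} → cl p ≡ cl p′ → cl q ≡ cl q′ → ∀ z z′ M →
              (p , z) ∷ (q , z′) ∷ M ≅ (p′ , z) ∷ (q′ , z′) ∷ M
            to₂ {p} {q} {p′} {q′} e e′ z z′ M = ≅-class e z ((q , z′) ∷ M) ⟫ ≅-∷ (p′ , z) (≅-class e′ z′ M)

            move : ∀ {p q p′ q′} → cl p ≡ cl p′ → cl q ≡ cl q′ → ∀ M →
              pairing (λ z z′ → Φ ((p , z) ∷ (q , z′) ∷ M)) ≈ pairing λ z z′ → Φ ((p′ , z) ∷ (q′ , z′) ∷ M)
            move e e′ M = pairing-cong λ z z′ → P-≡ (to₂ e e′ z z′ M)

            flip : ∀ p q M → pairing (λ z z′ → Φ ((p , z) ∷ (q , z′) ∷ M)) ≈ pairing λ z z′ → Φ ((q , z) ∷ (p , z′) ∷ M)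
            flip p q M = ≈-trans (pairing-cong λ z z′ → P-≡ (≅-swap (p , z) (q , z′) M))
              (pairing-symmetric n λ z z′ → Φ ((q , z) ∷ (p , z′) ∷ M))

            last : ∀ p q x M → pairing (λ z z′ → Φ ((p , z) ∷ (q , z′) ∷ x ∷ M)) ≈
              pairing λ z z′ → Φ (x ∷ (p , z) ∷ (q , z′) ∷ M)
            last p q x M = pairing-cong λ z z′ → P-≡
              (≅-∷ (p , z) (≅-swap (q , z′) x M) ⟫ ≅-swap (p , z) x ((q , z′) ∷ M))

          -- Four rules suffice: letters move freely along a circle, Δ(1) is symmetric, a letter
          -- slides between its factors, and both factors on one circle amount to two letters θ.
          word-compatible : ∀ {κ κ′ λ′ λ″} → Compatible (λ a b → cl (point a) ≡ cl (point b)) κ κ′ λ′ λ″ →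
            word κ κ′ ≈ word λ′ λ″
          word-compatible unchanged = ≈-refl
          word-compatible (merging-twisting e) = ≈-sym (P-≡ (≅-class e θ L))
          word-compatible (twisting-splitting e e′) = begin
            pairing (λ z z′ → Φ ((u₁ , θ) ∷ (u₂ , z) ∷ (w₂ , z′) ∷ L))
              ≈⟨ pairing-cong (λ z z′ → P-≡ (≅-class e θ ((u₂ , z) ∷ (w₂ , z′) ∷ L))) ⟩
            pairing (λ z z′ → Φ ((u₂ , θ) ∷ (u₂ , z) ∷ (w₂ , z′) ∷ L))
              ≈⟨ last u₂ w₂ (u₂ , θ) L ⟨
            pairing (λ z z′ → Φ ((u₂ , z) ∷ (w₂ , z′) ∷ (u₂ , θ) ∷ L))
              ≈⟨ move (≡.sym e) (≡.sym e′) ((u₂ , θ) ∷ L) ⟩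
            pairing (λ z z′ → Φ ((u₁ , z) ∷ (w₁ , z′) ∷ (u₂ , θ) ∷ L)) ∎
          -- Here the upper corners of the two edges are matched crosswise. The letter θ slides to
          -- the other factor of Δ(1), and symmetry uncrosses the factors.
          word-compatible (twisting-splitting′ e e′) = begin
            pairing (λ z z′ → Φ ((u₁ , θ) ∷ (u₂ , z) ∷ (w₂ , z′) ∷ L))
              ≈⟨ pairing-cong (λ z z′ → P-≡ (≅-class e θ ((u₂ , z) ∷ (w₂ , z′) ∷ L))) ⟩
            pairing (λ z z′ → Φ ((w₂ , θ) ∷ (u₂ , z) ∷ (w₂ , z′) ∷ L))
              ≈⟨ slide u₂ w₂ θ L ⟨
            pairing (λ z z′ → Φ ((u₂ , θ) ∷ (u₂ , z) ∷ (w₂ , z′) ∷ L))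
              ≈⟨ last u₂ w₂ (u₂ , θ) L ⟨
            pairing (λ z z′ → Φ ((u₂ , z) ∷ (w₂ , z′) ∷ (u₂ , θ) ∷ L))
              ≈⟨ flip u₂ w₂ ((u₂ , θ) ∷ L) ⟩
            pairing (λ z z′ → Φ ((w₂ , z) ∷ (u₂ , z′) ∷ (u₂ , θ) ∷ L))
              ≈⟨ move (≡.sym e) (≡.sym e′) ((u₂ , θ) ∷ L) ⟩
            pairing (λ z z′ → Φ ((u₁ , z) ∷ (w₁ , z′) ∷ (u₂ , θ) ∷ L)) ∎
          word-compatible (twisting-genus e e′) = begin
            Φ ((u₁ , θ) ∷ (u₂ , θ) ∷ L)                        ≈⟨ P-≡ (≅-class e θ ((u₂ , θ) ∷ L)) ⟩
            Φ ((u₂ , θ) ∷ (u₂ , θ) ∷ L)                        ≈⟨ genus u₂ L ⟨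
            pairing (λ z z′ → Φ ((u₂ , z) ∷ (u₂ , z′) ∷ L))    ≈⟨ move refl e′ L ⟩
            pairing (λ z z′ → Φ ((u₂ , z) ∷ (w₂ , z′) ∷ L))    ∎
          word-compatible (genus-twisting e e′) = begin
            pairing (λ z z′ → Φ ((u₁ , z) ∷ (w₁ , z′) ∷ L))    ≈⟨ move refl e′ L ⟨
            pairing (λ z z′ → Φ ((u₁ , z) ∷ (u₁ , z′) ∷ L))    ≈⟨ genus u₁ L ⟩
            Φ ((u₁ , θ) ∷ (u₁ , θ) ∷ L)                        ≈⟨ P-≡ (≅-∷ (u₁ , θ) (≅-class e θ L)) ⟩
            Φ ((u₁ , θ) ∷ (u₂ , θ) ∷ L)                        ∎
          word-compatible (merging-splitting e e′) = move (≡.sym e) (≡.sym e′) L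
          word-compatible (merging-splitting′ e e′) = ≈-trans (flip u₂ w₂ L) (move (≡.sym e) (≡.sym e′) L)
          word-compatible (splitting-merging e e′) = move e e′ L
          word-compatible (splitting-merging′ e e′) = ≈-trans (move e e′ L) (flip w₂ u₂ L)

    T-∑⊗ : ∀ {I : Set} {T : (I → ∣R∣) → ∣R∣} → Linear T → ∀ k (f : Tensor k → I → ∣R∣) →
      T (λ x → ∑⊗ k λ s → f s x) ≈ ∑⊗ k λ s → T (f s)
    T-∑⊗ L zero f = ≈-refl
    T-∑⊗ {T = T} L (suc k) f = ≈-trans (T-cong L λ x → ∑⊗-suc k (λ s → f s x)) (≈-trans
      (∑V-commute L λ v x → ∑⊗ k λ s → f (v ∷ s) x)
      (≈-trans (∑V-cong λ v → T-∑⊗ L k (f ∘ (v ∷_))) (≈-sym (∑⊗-suc k λ s → T (f s)))))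

    ∑⊗-single : ∀ k s {f : Tensor k → ∣R∣} → (∀ s′ → s′ ≢ s → f s′ ≈ 0#) → ∑⊗ k f ≈ f s
    ∑⊗-single zero    []      e = ≈-refl
    ∑⊗-single (suc k) (v ∷ s) {f} e = ≈-trans (∑⊗-suc k f) (≈-trans
      (∑V-single v λ w w≢v → T-0 (∑⊗-linear k) λ s′ → e (w ∷ s′) (w≢v ∘ cong Vec.head))
      (∑⊗-single k s λ s′ s′≢s → e (v ∷ s′) (s′≢s ∘ cong Vec.tail)))

    module _ {N k : ℕ} (cl : Fin N → Fin k) (surjective : ∀ C → ∃ λ p → cl p ≡ C) where

      -- Every circle passes through some corner, so a basis tensor can be written as a word by
      -- placing each factor at a chosen point of its circle.
      basisWord : Tensor k → Word {N}
      basisWord s = List.map (λ C → proj₁ (surjective C) , expo (lookup s C)) (allFin k)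

      total-basisWord : ∀ s C → total cl (basisWord s) C ≡ expo (lookup s C)
      total-basisWord s C = present (allFin k) (allFin⁺ k) (∈-allFin C)
        where
        letters : List (Fin k) → Word {N}
        letters = List.map λ D → proj₁ (surjective D) , expo (lookup s D)
        absent : ∀ Ds → All (C ≢_) Ds → total cl (letters Ds) C ≡ (0 , 0)
        absent []       []         = refl
        absent (D ∷ Ds) (C≢D ∷ C∉) = ≡.trans
          (total-off cl (expo (lookup s D)) (letters Ds) λ e → C≢D (≡.trans (≡.sym e) (proj₂ (surjective D))))
          (absent Ds C∉)
        present : ∀ Ds → Unique Ds → C ∈ Ds → total cl (letters Ds) C ≡ expo (lookup s C)
        present (D ∷ Ds) (D∉ ∷ _) (here refl) = ≡.trans
          (total-at cl (expo (lookup s D)) (letters Ds) (proj₂ (surjective D)))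
          (≡.trans (cong (expo (lookup s D) ⊹_) (absent Ds D∉)) (⊹-identityʳ (expo (lookup s D))))
        present (D ∷ Ds) (D∉ ∷ u) (there C∈)  = ≡.trans
          (total-off cl (expo (lookup s D)) (letters Ds)
            λ e → All.lookup D∉ C∈ (≡.trans (≡.sym (proj₂ (surjective D))) e))
          (present Ds u C∈)

      P-basisWord : ∀ s t → P cl (basisWord s) t ≈ prod λ C → if does (lookup t C ≟ᵇ lookup s C) then 1# else 0#
      P-basisWord s t = ≈-trans (P-def cl (basisWord s) t) (prod-cong λ C → reflexive (≡.trans
        (cong (λ z → X z (lookup t C)) (total-basisWord s C)) (X-expo (lookup s C) (lookup t C))))

      P-basisWord-≡ : ∀ s → P cl (basisWord s) s ≈ 1#
      P-basisWord-≡ s = ≈-trans (P-basisWord s s) (prod-1 λ C → reflexive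
        (cong (λ b → if b then 1# else 0#) (dec-true (lookup s C ≟ᵇ lookup s C) refl)))

      P-basisWord-≢ : ∀ s t → t ≢ s → P cl (basisWord s) t ≈ 0#
      P-basisWord-≢ s t t≢s with Finₚ.any? (λ C → ¬? (lookup t C ≟ᵇ lookup s C))
        where open import Relation.Nullary.Decidable using (¬?)
      ... | yes (C , ≢) = ≈-trans (P-basisWord s t) (prod-zero C (reflexive
        (cong (λ b → if b then 1# else 0#) (dec-false (lookup t C ≟ᵇ lookup s C) ≢))))
      ... | no none = contradiction
        (≡.trans (≡.sym (Vecₚ.tabulate∘lookup t)) (≡.trans
          (Vecₚ.tabulate-cong λ C → decidable-stable (lookup t C ≟ᵇ lookup s C) λ ≢ → none (C , ≢))
          (Vecₚ.tabulate∘lookup s))) t≢s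
        where open import Relation.Nullary.Decidable using (decidable-stable)

      expand : ∀ (v : Tensor k → ∣R∣) s → ∑⊗ k (λ s′ → v s′ * P cl (basisWord s′) s) ≈ v s
      expand v s = ≈-trans
        (∑⊗-single k s λ s′ s′≢s → ≈-trans (*-congˡ (P-basisWord-≢ s′ s (s′≢s ∘ ≡.sym))) (zeroʳ (v s′)))
        (≈-trans (*-congˡ (P-basisWord-≡ s)) (*-identityʳ (v s)))

      -- Basis tensors are images of words, so words span the tensor power and determine a linear
      -- functional on it.
      linear-ext : ∀ {T U : (Tensor k → ∣R∣) → ∣R∣} → Linear T → Linear U →
        (∀ L → T (P cl L) ≈ U (P cl L)) → ∀ v → T v ≈ U v
      linear-ext {T} {U} LT LU e v = begin
        T v                                                  ≈⟨ onBasis LT ⟩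
        ∑⊗ k (λ s → v s * T (P cl (basisWord s)))            ≈⟨ ∑⊗-cong k (λ s → *-congˡ (e (basisWord s))) ⟩
        ∑⊗ k (λ s → v s * U (P cl (basisWord s)))            ≈⟨ onBasis LU ⟨
        U v                                                  ∎
        where
        onBasis : ∀ {T} → Linear T → T v ≈ ∑⊗ k (λ s → v s * T (P cl (basisWord s)))
        onBasis L = ≈-trans (T-cong L λ s → ≈-sym (expand v s)) (≈-trans
          (T-∑⊗ L k λ s s′ → v s * P cl (basisWord s) s′)
          (∑⊗-cong k λ s → T-* L (v s) (P cl (basisWord s))))

    -- Removing the first row together with the first column pairs each of their entries with its
    -- transpose.
    antisymmetric-sum : ∀ k (A : Fin k → Fin k → ∣R∣) → (∀ i → A i i ≈ 0#) →
      (∀ i j → i ≢ j → A i j + A j i ≈ 0#) → sum (λ i → sum (A i)) ≈ 0#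
    antisymmetric-sum zero    A diagonal anti = ≈-refl
    antisymmetric-sum (suc k) A diagonal anti = begin
      (A zero zero + sum row) + sum (λ i → column i + sum (λ j → A (suc i) (suc j)))
        ≈⟨ +-cong (≈-trans (+-congʳ (diagonal zero)) (+-identityˡ _)) (∑-distrib-+ column (λ i → sum λ j → A (suc i) (suc j))) ⟩
      sum row + (sum column + sum (λ i → sum λ j → A (suc i) (suc j)))
        ≈⟨ +-congˡ (≈-trans (+-congˡ (antisymmetric-sum k (λ i j → A (suc i) (suc j)) (diagonal ∘ suc)
             λ i j i≢j → anti (suc i) (suc j) (i≢j ∘ Finₚ.suc-injective))) (+-identityʳ _)) ⟩
      sum row + sum column
        ≈⟨ ∑-distrib-+ row column ⟨
      sum (λ j → row j + column j)
        ≈⟨ sum-0 (λ j → anti zero (suc j) λ ()) ⟩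
      0# ∎
      where
      row column : Fin k → ∣R∣
      row j = A zero (suc j)
      column i = A (suc i) zero

    open import Algebra.Properties.Semiring.Exp semiring using (_^_; ^-homo-*)

    -- Lowering the earlier entry first removes one 1 in front of the later entry and changes no
    -- other count. So the sign exponents of the two orders differ by one.
    onesBefore-swap : ∀ {ℓ} (γ : State ℓ) i j → i ≢ j → lookup γ i ≡ true → lookup γ j ≡ true →
      let p = onesBefore (γ [ i ]≔ false) i ℕ.+ onesBefore (γ [ i ]≔ false [ j ]≔ false) j
          q = onesBefore (γ [ j ]≔ false) j ℕ.+ onesBefore (γ [ j ]≔ false [ i ]≔ false) i
      in q ≡ suc p ⊎ p ≡ suc q
    onesBefore-swap (b ∷ γ) zero zero i≢j _ _ = contradiction refl i≢j
    onesBefore-swap (true ∷ γ) zero (suc j) _ refl _ = inj₁ (ℕₚ.+-identityʳ _)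
    onesBefore-swap (true ∷ γ) (suc i) zero _ _ refl = inj₂ (ℕₚ.+-identityʳ _)
    onesBefore-swap (false ∷ γ) (suc i) (suc j) i≢j p q = onesBefore-swap γ i j (i≢j ∘ cong suc) p q
    onesBefore-swap (true ∷ γ) (suc i) (suc j) i≢j p q =
      [ (λ e → inj₁ (raise e)) , (λ e → inj₂ (raise e)) ]′ (onesBefore-swap γ i j (i≢j ∘ cong suc) p q)
      where
      raise : ∀ {a b c d} → a ℕ.+ b ≡ suc (c ℕ.+ d) → suc a ℕ.+ suc b ≡ suc (suc c ℕ.+ suc d)
      raise {a} {b} {c} {d} e = cong suc (≡.trans (ℕₚ.+-suc a b) (≡.trans (cong suc e) (cong suc (≡.sym (ℕₚ.+-suc c d)))))

    alternate-suc : ∀ p → (- 1#) ^ p + (- 1#) ^ suc p ≈ 0#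
    alternate-suc p = begin
      (- 1#) ^ p + - 1# * (- 1#) ^ p         ≈⟨ +-cong (≈-sym (*-identityˡ _)) (≈-sym (-‿distribˡ-* _ _)) ⟩
      1# * (- 1#) ^ p + - (1# * (- 1#) ^ p)  ≈⟨ -‿inverseʳ _ ⟩
      0#                                     ∎
      where open import Algebra.Properties.Ring ring using (-‿distribˡ-*)

    alternate : ∀ p q → q ≡ suc p ⊎ p ≡ suc q → (- 1#) ^ p + (- 1#) ^ q ≈ 0#
    alternate p q (inj₁ refl) = alternate-suc p
    alternate p q (inj₂ refl) = ≈-trans (+-comm _ _) (alternate-suc q)

    module _ (Γ : PerfectMatchingGraph) (trivalent : PerfectMatchingGraph.Trivalent Γ) where

      open PerfectMatchingGraph Γ using (ℓ)
      open Quotient using () renaming (surjective to class-surjective)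

      ∂-edge-linear : ∀ α β i t → Linear λ v → ∂-edge Γ α β i v t
      ∂-edge-linear α β i t = linear-∑⊗ (#circles Γ α) λ s → linear-scale (linear-at s) (coefficient Γ α β i s t)

      ∂-edges : ∀ α β γ → Fin ℓ → Fin ℓ → Tensor (#circles Γ γ) → (Tensor (#circles Γ α) → ∣R∣) → ∣R∣
      ∂-edges α β γ j i t v = ∂-edge Γ β γ i (∂-edge Γ α β j v) t

      ∂-edges-linear : ∀ α β γ j i t → Linear (∂-edges α β γ j i t)
      ∂-edges-linear α β γ j i t = linear-∑⊗ (#circles Γ β) λ s →
        linear-scale (∂-edge-linear α β j s) (coefficient Γ β γ i s t)

      ∂-edges-P : ∀ α β γ j i → Agree Γ (_≡ j) α β → Agree Γ (_≡ i) β γ → ∀ t L →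
        ∂-edges α β γ j i t (P (circle Γ α) L) ≈
        act (edgeKind Γ α β j) (combine j UL) (combine j UR) λ A →
        act (edgeKind Γ β γ i) (combine i UL) (combine i UR) λ B → P (circle Γ γ) (B ++ A ++ L) t
      ∂-edges-P α β γ j i a a′ t L = begin
        ∂-edges α β γ j i t (P (circle Γ α) L)
          ≈⟨ T-cong (∂-edge-linear β γ i t) (λ s → ∂-edge-P Γ α β j a s L) ⟩
        ∂-edge Γ β γ i (λ s → act (edgeKind Γ α β j) (combine j UL) (combine j UR) λ A → P (circle Γ β) (A ++ L) s) t
          ≈⟨ act-commute (edgeKind Γ α β j) (combine j UL) (combine j UR) (∂-edge-linear β γ i t)
               (λ s A → P (circle Γ β) (A ++ L) s) ⟩
        act (edgeKind Γ α β j) (combine j UL) (combine j UR) (λ A → ∂-edge Γ β γ i (P (circle Γ β) (A ++ L)) t)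
          ≈⟨ T-cong (act-linear (edgeKind Γ α β j) (combine j UL) (combine j UR))
               (λ A → ∂-edge-P Γ β γ i a′ t (A ++ L)) ⟩
        act (edgeKind Γ α β j) (combine j UL) (combine j UR) (λ A →
          act (edgeKind Γ β γ i) (combine i UL) (combine i UR) λ B → P (circle Γ γ) (B ++ A ++ L) t) ∎

      module _ (ξ : State ℓ) (i j : Fin ℓ) (i≢j : i ≢ j) where

        state : Bool → Bool → State ℓ
        state x y = ξ [ i ]≔ x [ j ]≔ y

        at-i : ∀ x y → lookup (state x y) i ≡ x
        at-i x y = ≡.trans (Vecₚ.lookup∘update′ i≢j (ξ [ i ]≔ x) y) (Vecₚ.lookup∘update i ξ x)

        at-j : ∀ x y → lookup (state x y) j ≡ y
        at-j x y = Vecₚ.lookup∘update j (ξ [ i ]≔ x) y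

        away : ∀ x y {k} → k ≢ i → k ≢ j → lookup (state x y) k ≡ lookup ξ k
        away x y k≢i k≢j = ≡.trans (Vecₚ.lookup∘update′ k≢j (ξ [ i ]≔ x) y) (Vecₚ.lookup∘update′ k≢i ξ x)

        agree : ∀ x y → Agree Γ (λ k → k ≡ i ⊎ k ≡ j) (state false false) (state x y)
        agree x y k ¬k = ≡.trans (away false false (¬k ∘ inj₁) (¬k ∘ inj₂))
          (≡.sym (away x y (¬k ∘ inj₁) (¬k ∘ inj₂)))

        agree-i : ∀ x x′ y → Agree Γ (_≡ i) (state x y) (state x′ y)
        agree-i x x′ y k k≢i with k Finₚ.≟ j
        ... | yes refl = ≡.trans (at-j x y) (≡.sym (at-j x′ y))
        ... | no k≢j   = ≡.trans (away x y k≢i k≢j) (≡.sym (away x′ y k≢i k≢j))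

        agree-j : ∀ x y y′ → Agree Γ (_≡ j) (state x y) (state x y′)
        agree-j x y y′ k k≢j with k Finₚ.≟ i
        ... | yes refl = ≡.trans (at-i x y) (≡.sym (at-i x y′))
        ... | no k≢i   = ≡.trans (away x y k≢i k≢j) (≡.sym (away x y′ k≢i k≢j))

        private
          s₀₀ s₁₀ s₀₁ s₁₁ : State ℓ
          s₀₀ = state false false
          s₁₀ = state true false
          s₀₁ = state false true
          s₁₁ = state true true
          module Sq = SquareChange Γ trivalent state i j i≢j at-i at-j agree

        square-commutes-P : ∀ t L → ∂-edges s₀₀ s₀₁ s₁₁ j i t (P (circle Γ s₀₀) L) ≈ ∂-edges s₀₀ s₁₀ s₁₁ i j t (P (circle Γ s₀₀) L)
        square-commutes-P t L = ≈-trans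
          (≈-trans (∂-edges-P s₀₀ s₀₁ s₁₁ j i (agree-j false false true) (agree-i false true true) t L)
            (second-then-first cl t Sq.ι L (edgeKind Γ s₀₁ s₁₁ i) (edgeKind Γ s₀₀ s₀₁ j)))
          (≈-trans (≈-sym (word-compatible cl t Sq.ι L Sq.square))
            (≈-sym (≈-trans (∂-edges-P s₀₀ s₁₀ s₁₁ i j (agree-i false true false) (agree-j true false true) t L)
              (first-then-second cl t Sq.ι L (edgeKind Γ s₀₀ s₁₀ i) (edgeKind Γ s₁₀ s₁₁ j)))))
          where
          cl = circle Γ s₁₁

        square-commutes : ∀ t v → ∂-edges s₀₀ s₀₁ s₁₁ j i t v ≈ ∂-edges s₀₀ s₁₀ s₁₁ i j t v
        square-commutes t = linear-ext (circle Γ s₀₀) (class-surjective (circles Γ s₀₀))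
          (∂-edges-linear s₀₀ s₀₁ s₁₁ j i t) (∂-edges-linear s₀₀ s₁₀ s₁₁ i j t) (square-commutes-P t)

      -- The states met in ∂ ∘ ∂ equal those of the square only propositionally, and the types of
      -- tensors depend on them. Taking them as variables with equations removes the transports.
      square-commutes′ : ∀ (v : Chain Γ) ξ i j → i ≢ j → ∀ {α α′ β β′ γ} →
        ξ [ i ]≔ false [ j ]≔ false ≡ α → ξ [ i ]≔ false [ j ]≔ false ≡ α′ →
        ξ [ i ]≔ false [ j ]≔ true ≡ β → ξ [ i ]≔ true [ j ]≔ false ≡ β′ → ξ [ i ]≔ true [ j ]≔ true ≡ γ →
        ∀ t → ∂-edges α β γ j i t (v α) ≈ ∂-edges α′ β′ γ i j t (v α′)
      square-commutes′ v ξ i j i≢j refl refl refl refl refl t = square-commutes ξ i j i≢j t (v (ξ [ i ]≔ false [ j ]≔ false))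

      private
        guard-sum : ∀ b {x} {f : Fin ℓ → ∣R∣} → x ≈ sum f → (if b then x else 0#) ≈ sum λ j → if b then f j else 0#
        guard-sum true  e = e
        guard-sum false e = ≈-sym (sum-0 {ℓ} λ _ → ≈-refl)

        guard-T : ∀ b {I : Set} {T : (I → ∣R∣) → ∣R∣} → Linear T → ∀ f →
          T (λ x → if b then f x else 0#) ≈ (if b then T f else 0#)
        guard-T true  L f = ≈-refl
        guard-T false L f = T-0 L λ _ → ≈-refl

        guard-cong : ∀ b {x y} → x ≈ y → (if b then x else 0#) ≈ (if b then y else 0#)
        guard-cong true  e = e
        guard-cong false e = ≈-refl

        guard-off : ∀ b c {x} → c ≡ false → (if b then (if c then x else 0#) else 0#) ≈ 0#
        guard-off true  _ refl = ≈-refl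
        guard-off false _ refl = ≈-refl

        guard-cancel : ∀ b c {b′ c′} → b′ ≡ b → c′ ≡ c → ∀ {x y} → (b ≡ true → c ≡ true → x + y ≈ 0#) →
          (if b then (if c′ then x else 0#) else 0#) + (if c then (if b′ then y else 0#) else 0#) ≈ 0#
        guard-cancel true  true  refl refl e = e refl refl
        guard-cancel true  false refl refl e = +-identityˡ 0#
        guard-cancel false true  refl refl e = +-identityˡ 0#
        guard-cancel false false refl refl e = +-identityˡ 0#

        cancel-terms : ∀ a b c d x y → x ≈ y → (- 1#) ^ (a ℕ.+ b) + (- 1#) ^ (c ℕ.+ d) ≈ 0# →
          (- 1#) ^ a * ((- 1#) ^ b * x) + (- 1#) ^ c * ((- 1#) ^ d * y) ≈ 0#
        cancel-terms a b c d x y x≈y e = begin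
          (- 1#) ^ a * ((- 1#) ^ b * x) + (- 1#) ^ c * ((- 1#) ^ d * y)
            ≈⟨ +-cong (collect a b x) (≈-trans (collect c d y) (*-congˡ (≈-sym x≈y))) ⟩
          (- 1#) ^ (a ℕ.+ b) * x + (- 1#) ^ (c ℕ.+ d) * x
            ≈⟨ distribʳ x _ _ ⟨
          ((- 1#) ^ (a ℕ.+ b) + (- 1#) ^ (c ℕ.+ d)) * x
            ≈⟨ *-congʳ e ⟩
          0# * x
            ≈⟨ zeroˡ x ⟩
          0# ∎
          where
          collect : ∀ a b x → (- 1#) ^ a * ((- 1#) ^ b * x) ≈ (- 1#) ^ (a ℕ.+ b) * x
          collect a b x = ≈-trans (≈-sym (*-assoc _ _ x)) (*-congʳ (≈-sym (^-homo-* (- 1#) a b)))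

        restore : ∀ (α : State ℓ) k → lookup α k ≡ true → α [ k ]≔ true ≡ α
        restore α k e = ≡.trans (cong (α [ k ]≔_) (≡.sym e)) (Vecₚ.[]≔-lookup α k)

      module _ (v : Chain Γ) (γ : State ℓ) (t : Tensor (#circles Γ γ)) where

        private
          sign : State ℓ → Fin ℓ → ∣R∣
          sign α i = (- 1#) ^ onesBefore α i

          down : Fin ℓ → State ℓ
          down i = γ [ i ]≔ false

          down² : Fin ℓ → Fin ℓ → State ℓ
          down² i j = γ [ i ]≔ false [ j ]≔ false

          term : Fin ℓ → Fin ℓ → ∣R∣
          term i j = ∂-edges (down² i j) (down i) γ j i t (v (down² i j))

          A : Fin ℓ → Fin ℓ → ∣R∣
          A i j = if lookup γ i then (if lookup (down i) j
            then sign (down i) i * (sign (down² i j) j * term i j) else 0#) else 0#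

        ∂∂-expand : ∂ Γ (∂ Γ v) γ t ≈ sum λ i → sum λ j → A i j
        ∂∂-expand = ∑-cong ℓ λ i → guard-sum (lookup γ i)
          (≈-trans (T-∑ (outer i) ℓ (λ j s → ∂-summand Γ v (down i) s j)) (∑-cong ℓ (piece i)))
          where
          outer : ∀ i → Linear λ w → sign (down i) i * ∂-edge Γ (down i) γ i w t
          outer i = linear-scale (∂-edge-linear (down i) γ i t) (sign (down i) i)
          piece : ∀ i j → sign (down i) i * ∂-edge Γ (down i) γ i (λ s → ∂-summand Γ v (down i) s j) t ≈
            (if lookup (down i) j then sign (down i) i * (sign (down² i j) j * term i j) else 0#)
          piece i j = ≈-trans
            (guard-T (lookup (down i) j) (outer i)
              (λ s → sign (down² i j) j * ∂-edge Γ (down² i j) (down i) j (v (down² i j)) s))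
            (guard-cong (lookup (down i) j) (*-congˡ (T-* (∂-edge-linear (down i) γ i t) (sign (down² i j) j)
              (∂-edge Γ (down² i j) (down i) j (v (down² i j))))))

        term-swap : ∀ i j → i ≢ j → lookup γ i ≡ true → lookup γ j ≡ true → term i j ≈ term j i
        term-swap i j i≢j p q = square-commutes′ v γ i j i≢j refl
          (Vecₚ.[]≔-commutes γ i j i≢j)
          (restore (down i) j (≡.trans (Vecₚ.lookup∘update′ (i≢j ∘ ≡.sym) γ false) q))
          (cong (_[ j ]≔ false) (restore γ i p))
          (≡.trans (cong (_[ j ]≔ true) (restore γ i p)) (restore γ j q)) t

        -- The summands for `(i , j)` and `(j , i)` run along the two paths of one square and carry
        -- opposite signs. A diagonal summand vanishes because its entry is already 0 after the
        -- first lowering.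
        ∂∂≈0 : ∂ Γ (∂ Γ v) γ t ≈ 0#
        ∂∂≈0 = ≈-trans ∂∂-expand (antisymmetric-sum ℓ A
          (λ i → guard-off (lookup γ i) (lookup (down i) i) (Vecₚ.lookup∘update i γ false))
          (λ i j i≢j → guard-cancel (lookup γ i) (lookup γ j)
            (Vecₚ.lookup∘update′ i≢j γ false) (Vecₚ.lookup∘update′ (i≢j ∘ ≡.sym) γ false)
            λ p q → cancel-terms (onesBefore (down i) i) (onesBefore (down² i j) j)
              (onesBefore (down j) j) (onesBefore (down² j i) i) (term i j) (term j i)
              (term-swap i j i≢j p q)
              (alternate _ _ (onesBefore-swap γ i j i≢j p q))))

-- The edge maps preserve the grading

module Grading where

  open import Algebra.Bundles using (CommutativeRing; CommutativeMonoid)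
  open import Data.Bool.Base using (Bool)
  open import Data.Fin.Base as Fin using (Fin; zero; suc; toℕ; combine)
  open import Data.Fin.Patterns
  import Data.Fin.Properties as Finₚ
  open import Data.List.Base using (List; []; _∷_; _++_)
  open import Data.Nat.Base as ℕ using (ℕ; zero; suc; NonZero; parity; ⌊_/2⌋)
  open import Data.Nat.DivMod
  import Data.Nat.Properties as ℕₚ
  open import Data.Nat.Tactic.RingSolver using (solve-∀)
  open import Data.Parity.Base using (Parity; 0ℙ; 1ℙ)
  open import Data.Product.Base using (∃; _,_; proj₁; proj₂)
  open import Data.Product.Properties using (≡-dec)
  open import Data.Vec.Base using ([]; _∷_; lookup)
  open import Level using (0ℓ)
  open import Relation.Binary.PropositionalEquality as ≡ using (_≡_; _≢_; refl; sym; trans; cong; cong₂)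
  open import Relation.Nullary using (Dec; yes; no; contradiction)
  open import Relation.Nullary.Decidable using (¬?; decidable-stable)
  open import Defs
  open Sums
  open Face using (merging; splitting; twisting; impossible)
  open Topology using (Agree; circle)
  open Tensor
  open Edge
  open Square

  toℕ-mod : ∀ a d .{{_ : NonZero d}} → toℕ (a mod d) ≡ a % d
  toℕ-mod a d = Finₚ.toℕ-fromℕ< (m%n<n a d)

  mod-cong : ∀ {a b} d .{{_ : NonZero d}} → a % d ≡ b % d → a mod d ≡ b mod d
  mod-cong {a} {b} d e = Finₚ.toℕ-injective (trans (toℕ-mod a d) (trans e (sym (toℕ-mod b d))))

  mod-+ : ∀ a b d .{{_ : NonZero d}} → (toℕ (a mod d) ℕ.+ toℕ (b mod d)) mod d ≡ (a ℕ.+ b) mod d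
  mod-+ a b d = mod-cong d (trans (cong₂ (λ x y → (x ℕ.+ y) % d) (toℕ-mod a d) (toℕ-mod b d))
    (sym (%-distribˡ-+ a b d)))

  mod-toℕ : ∀ {d} .{{_ : NonZero d}} (i : Fin d) → toℕ i mod d ≡ i
  mod-toℕ {d} i = Finₚ.toℕ-injective (trans (toℕ-mod (toℕ i) d) (m<n⇒m%n≡m (Finₚ.toℕ<n i)))

  mod-shift : ∀ k a d .{{_ : NonZero d}} → (a ℕ.+ k ℕ.* d) mod d ≡ a mod d
  mod-shift k a d = mod-cong d ([m+kn]%n≡m%n a k d)

  bOrder-2 : ∀ p b → (2 ℕ.+ b) mod bOrder p ≡ b mod bOrder p
  bOrder-2 0ℙ b = trans (cong (_mod 2) (ℕₚ.+-comm 2 b)) (mod-shift 1 b 2)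
  bOrder-2 1ℙ b = mod-cong {2 ℕ.+ b} {b} 1 (trans (n%1≡0 (2 ℕ.+ b)) (sym (n%1≡0 b)))

  bOrder-1 : ∀ {p} → p ≡ 1ℙ → 1 mod bOrder p ≡ 0 mod bOrder p
  bOrder-1 refl = refl

  module Degrees (n : ℕ) .{{_ : NonZero n}} where

    ⊕-degree : ∀ a ε a′ ε′ → degree {n} a ε ⊕ degree a′ ε′ ≡ degree (a ℕ.+ a′) (ε ℕ.+ ε′)
    ⊕-degree a ε a′ ε′ = cong₂ _,_ (mod-+ a a′ n) (mod-+ ε ε′ (bOrder (parity n)))

    degree-toℕ : ∀ (g : Degree n) → degree (toℕ (proj₁ g)) (toℕ (proj₂ g)) ≡ g
    degree-toℕ (a , ε) = cong₂ _,_ (mod-toℕ a) (mod-toℕ ε)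

    ⊕-comm : ∀ (g h : Degree n) → g ⊕ h ≡ h ⊕ g
    ⊕-comm (a , ε) (a′ , ε′) = cong₂ degree (ℕₚ.+-comm (toℕ a) (toℕ a′)) (ℕₚ.+-comm (toℕ ε) (toℕ ε′))

    ⊕-assoc : ∀ (g h k : Degree n) → (g ⊕ h) ⊕ k ≡ g ⊕ (h ⊕ k)
    ⊕-assoc g@(a , ε) h@(b , δ) k@(c , ζ) = begin
      (g ⊕ h) ⊕ k                                       ≡⟨ cong ((g ⊕ h) ⊕_) (degree-toℕ k) ⟨
      (g ⊕ h) ⊕ degree (toℕ c) (toℕ ζ)                  ≡⟨ ⊕-degree (toℕ a ℕ.+ toℕ b) (toℕ ε ℕ.+ toℕ δ) (toℕ c) (toℕ ζ) ⟩
      degree (toℕ a ℕ.+ toℕ b ℕ.+ toℕ c) (toℕ ε ℕ.+ toℕ δ ℕ.+ toℕ ζ)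
        ≡⟨ cong₂ degree (ℕₚ.+-assoc (toℕ a) (toℕ b) (toℕ c)) (ℕₚ.+-assoc (toℕ ε) (toℕ δ) (toℕ ζ)) ⟩
      degree (toℕ a ℕ.+ (toℕ b ℕ.+ toℕ c)) (toℕ ε ℕ.+ (toℕ δ ℕ.+ toℕ ζ))
        ≡⟨ ⊕-degree (toℕ a) (toℕ ε) (toℕ b ℕ.+ toℕ c) (toℕ δ ℕ.+ toℕ ζ) ⟨
      degree (toℕ a) (toℕ ε) ⊕ (h ⊕ k)                  ≡⟨ cong (_⊕ (h ⊕ k)) (degree-toℕ g) ⟩
      g ⊕ (h ⊕ k)                                       ∎
      where open ≡.≡-Reasoning

    ⊕-identityˡ : ∀ (g : Degree n) → degree 0 0 ⊕ g ≡ g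
    ⊕-identityˡ g@(a , ε) = trans (cong (degree 0 0 ⊕_) (sym (degree-toℕ g)))
      (trans (⊕-degree 0 0 (toℕ a) (toℕ ε)) (degree-toℕ g))

    ⊕-commutativeMonoid : CommutativeMonoid 0ℓ 0ℓ
    ⊕-commutativeMonoid = record
      { Carrier = Degree n
      ; _≈_ = _≡_
      ; _∙_ = _⊕_
      ; ε = degree 0 0
      ; isCommutativeMonoid = record
        { isMonoid = record
          { isSemigroup = record
            { isMagma = record { isEquivalence = ≡.isEquivalence ; ∙-cong = cong₂ _⊕_ }
            ; assoc = ⊕-assoc
            }
          ; identity = ⊕-identityˡ , λ g → trans (⊕-comm g (degree 0 0)) (⊕-identityˡ g)
          }
        ; comm = ⊕-comm
        }
      }

    deg : Monomial → Degree n
    deg (a , b) = degree (2 ℕ.* a ℕ.+ b) b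

    deg-⊹ : ∀ z z′ → deg (z ⊹ z′) ≡ deg z ⊕ deg z′
    deg-⊹ (a , b) (a′ , b′) = trans (cong (λ x → degree x (b ℕ.+ b′)) (double a b a′ b′))
      (sym (⊕-degree (2 ℕ.* a ℕ.+ b) b (2 ℕ.* a′ ℕ.+ b′) b′))
      where
      double : ∀ a b a′ b′ → 2 ℕ.* (a ℕ.+ a′) ℕ.+ (b ℕ.+ b′) ≡ (2 ℕ.* a ℕ.+ b) ℕ.+ (2 ℕ.* a′ ℕ.+ b′)
      double = solve-∀

    deg-y³ : ∀ a b → deg (a , 3 ℕ.+ b) ≡ deg (suc a , suc b)
    deg-y³ a b = cong₂ _,_ (cong (_mod n) (shift a b)) (bOrder-2 (parity n) (suc b))
      where
      shift : ∀ a b → 2 ℕ.* a ℕ.+ (3 ℕ.+ b) ≡ 2 ℕ.* suc a ℕ.+ suc b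
      shift = solve-∀

    -- The exponent 2a + b is n for θ and 2n for the product of the factors in each term of Δ(1), so
    -- this is used with `k` equal to 1 and 2. Hence edge maps multiply by elements of degree zero.
    deg-0 : ∀ k a b → 2 ℕ.* a ℕ.+ b ≡ k ℕ.* n → b mod bOrder (parity n) ≡ 0 mod bOrder (parity n) →
      deg (a , b) ≡ degree 0 0
    deg-0 k a b e f = cong₂ _,_ (trans (cong (_mod n) e) (mod-shift k 0 n)) f

    deg-θ : deg (if-even n then (⌊ n ℕ.∸ 2 /2⌋ , 2) else (⌊ n ℕ.∸ 1 /2⌋ , 1)) ≡ degree 0 0
    deg-θ = if-even-elim (λ z → deg z ≡ degree 0 0) n even odd
      where
      n≡1+ : n ≡ suc (n ℕ.∸ 1)
      n≡1+ = sym (ℕₚ.m+[n∸m]≡n (ℕ.>-nonZero⁻¹ n))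
      even : parity n ≡ 0ℙ → deg (⌊ n ℕ.∸ 2 /2⌋ , 2) ≡ degree 0 0
      even e = deg-0 1 ⌊ n ℕ.∸ 2 /2⌋ 2 (trans (double ⌊ n ℕ.∸ 2 /2⌋) (trans (cong suc (half-even n e))
        (trans (sym n≡1+) (sym (ℕₚ.*-identityˡ n))))) (bOrder-2 (parity n) 0)
        where
        double : ∀ h → 2 ℕ.* h ℕ.+ 2 ≡ suc (suc (h ℕ.+ h))
        double = solve-∀
      odd : parity n ≡ 1ℙ → deg (⌊ n ℕ.∸ 1 /2⌋ , 1) ≡ degree 0 0
      odd e = deg-0 1 ⌊ n ℕ.∸ 1 /2⌋ 1 (trans (double ⌊ n ℕ.∸ 1 /2⌋) (trans (cong suc (half-odd n e))
        (trans (sym n≡1+) (sym (ℕₚ.*-identityˡ n))))) (bOrder-1 e)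
        where
        double : ∀ h → 2 ℕ.* h ℕ.+ 1 ≡ suc (h ℕ.+ h)
        double = solve-∀

    deg-middle : (k : Fin n) → deg (toℕ k ℕ.+ (n ℕ.∸ 1 ℕ.∸ toℕ k) , 2) ≡ degree 0 0
    deg-middle k = deg-0 2 (toℕ k ℕ.+ (n ℕ.∸ 1 ℕ.∸ toℕ k)) 2 (trans (cong (λ a → 2 ℕ.* a ℕ.+ 2) (ℕₚ.m+[n∸m]≡n (ℕₚ.∸-monoˡ-≤ 1 (Finₚ.toℕ<n k))))
      (trans (double (n ℕ.∸ 1)) (cong (2 ℕ.*_) (ℕₚ.m+[n∸m]≡n (ℕ.>-nonZero⁻¹ n))))) (bOrder-2 (parity n) 0)
      where
      double : ∀ a → 2 ℕ.* a ℕ.+ 2 ≡ 2 ℕ.* (1 ℕ.+ a)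
      double = solve-∀

    deg-outer : (k : Fin (n ℕ.∸ 1)) → deg (suc (toℕ k) ℕ.+ (n ℕ.∸ suc (toℕ k)) , 0) ≡ degree 0 0
    deg-outer k = deg-0 2 (suc (toℕ k) ℕ.+ (n ℕ.∸ suc (toℕ k))) 0
      (trans (ℕₚ.+-identityʳ (2 ℕ.* (suc (toℕ k) ℕ.+ (n ℕ.∸ suc (toℕ k))))) (cong (2 ℕ.*_) (ℕₚ.m+[n∸m]≡n
      (ℕₚ.≤-trans (Finₚ.toℕ<n k) (ℕₚ.m∸n≤m n 1))))) refl

  module GradedMaps (n : ℕ) .{{_ : NonZero n}} (R : CommutativeRing 0ℓ 0ℓ) (1/3n : CommutativeRing.Carrier R)
    (inverse : Calculus.Inverse n R 1/3n) where

    open CommutativeRing R hiding (zero) renaming (Carrier to ∣R∣; refl to ≈-refl; sym to ≈-sym; trans to ≈-trans)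
    open Complex n R 1/3n
    open Calculus n R 1/3n
    open EdgeMaps n R 1/3n
    open Squares n R 1/3n inverse
    open Degrees n
    open FiniteSums +-commutativeMonoid using (sum; ∑-distrib-+) renaming (sum-ε to sum-0)
    open FiniteSums ⊕-commutativeMonoid using (only)
      renaming (sum to ∑ᵈ; sum-cong-≗ to ∑ᵈ-cong; sum-only to ∑ᵈ-only; ∑-distrib-+ to ∑ᵈ-⊕; sum-ε to ∑ᵈ-0)
    open Linear

    opaque
      unfolding Pairing.pairing

      pairing-support : ∀ {G} → (∀ z z′ → deg (z ⊹ z′) ≡ degree 0 0 → G z z′ ≈ 0#) → pairing G ≈ 0#
      pairing-support e = ≈-trans (+-cong
        (≈-trans (*-congˡ (sum-0 {n ℕ.∸ 1} λ k → e _ _ (deg-outer k))) (zeroʳ _))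
        (≈-trans (*-congˡ (sum-0 {n} λ k → ≈-trans (+-cong (≈-trans (+-cong
          (e _ _ (deg-middle k)) (e _ _ (deg-middle k))) (+-identityˡ 0#)) (e _ _ (deg-middle k))) (+-identityˡ 0#)))
          (zeroʳ _)))
        (+-identityˡ 0#)

    tensorDegree-∑ : ∀ {k} (s : Tensor k) → tensorDegree s ≡ ∑ᵈ λ C → deg (expo (lookup s C))
    tensorDegree-∑ []            = refl
    tensorDegree-∑ ((i , j) ∷ s) = cong (deg (expo (i , j)) ⊕_) (tensorDegree-∑ s)

    deg-reduce : ∀ a b → deg (proj₁ (reduce a b) , toℕ (proj₂ (reduce a b))) ≡ deg (a , b)
    deg-reduce a 0 = refl
    deg-reduce a 1 = refl
    deg-reduce a 2 = refl
    deg-reduce a (suc (suc (suc b))) = trans (deg-reduce (suc a) (suc b)) (sym (deg-y³ a b))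

    module _ {N : ℕ} where

      wordDegree : Word {N} → Degree n
      wordDegree []            = degree 0 0
      wordDegree ((p , z) ∷ L) = deg z ⊕ wordDegree L

      wordDegree-++ : ∀ A L → wordDegree (A ++ L) ≡ wordDegree A ⊕ wordDegree L
      wordDegree-++ []            L = sym (⊕-identityˡ (wordDegree L))
      wordDegree-++ ((p , z) ∷ A) L = trans (cong (deg z ⊕_) (wordDegree-++ A L))
        (sym (⊕-assoc (deg z) (wordDegree A) (wordDegree L)))

      act-degree : ∀ κ p q {F} → (∀ A → wordDegree A ≡ degree 0 0 → F A ≈ 0#) → act κ p q F ≈ 0#
      act-degree merging    p q e = e [] refl
      act-degree twisting   p q e = e ((p , θ) ∷ []) (trans (⊕-comm (deg θ) (degree 0 0)) (trans (⊕-identityˡ (deg θ)) deg-θ))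
      act-degree splitting  p q e = pairing-support λ z z′ d → e ((p , z) ∷ (q , z′) ∷ [])
        (trans (cong (deg z ⊕_) (trans (⊕-comm (deg z′) (degree 0 0)) (⊕-identityˡ (deg z′)))) (trans (sym (deg-⊹ z z′)) d))
      act-degree impossible p q e = ≈-refl

      module _ {k : ℕ} (cl : Fin N → Fin k) where

        ∑ᵈ-total : ∀ L → ∑ᵈ (λ C → deg (total cl L C)) ≡ wordDegree L
        ∑ᵈ-total []            = ∑ᵈ-0 {k} λ _ → refl
        ∑ᵈ-total ((p , z) ∷ L) = trans (∑ᵈ-cong {k} split) (trans
          (∑ᵈ-⊕ (only (cl p) λ _ → deg z) (λ C → deg (total cl L C)))
          (cong₂ _⊕_ (∑ᵈ-only (cl p) λ _ → deg z) (∑ᵈ-total L)))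
          where
          split : ∀ C → deg (total cl ((p , z) ∷ L) C) ≡ only (cl p) (λ _ → deg z) C ⊕ deg (total cl L C)
          split C with cl p Finₚ.≟ C | C Finₚ.≟ cl p
          ... | yes _ | yes _ = deg-⊹ z (total cl L C)
          ... | no _  | no _  = sym (⊕-identityˡ _)
          ... | yes e | no ¬e = contradiction (sym e) ¬e
          ... | no ¬e | yes e = contradiction (sym e) ¬e

        -- If every factor of `t` were the reduced monomial of its circle, the degrees would add up
        -- to that of the word, since y³ = xy is homogeneous. So some factor differs, and its
        -- coordinate is zero.
        P-degree : ∀ L t → tensorDegree t ≢ wordDegree L → P cl L t ≈ 0#
        P-degree L t ≢ with Finₚ.any? (λ C → ¬? (reduced? C))
          where
          reduced? : ∀ C → Dec (reduce (proj₁ (total cl L C)) (proj₂ (total cl L C)) ≡ (toℕ (proj₁ (lookup t C)) , proj₂ (lookup t C)))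
          reduced? C = ≡-dec ℕₚ._≟_ Finₚ._≟_ _ _
        ... | yes (C , ¬e) = ≈-trans (P-def cl L t) (prod-zero C (reflexive (X-≢ (total cl L C) ¬e)))
        ... | no none = contradiction (trans (tensorDegree-∑ t) (trans (∑ᵈ-cong {k} equal) (∑ᵈ-total L))) ≢
          where
          equal : ∀ C → deg (expo (lookup t C)) ≡ deg (total cl L C)
          equal C = trans (cong (λ x → deg (proj₁ x , toℕ (proj₂ x))) (sym (decidable-stable
            (≡-dec ℕₚ._≟_ Finₚ._≟_ _ _) λ ¬e → none (C , ¬e))))
            (deg-reduce (proj₁ (total cl L C)) (proj₂ (total cl L C)))

        wordDegree-basisWord : ∀ (surjective : ∀ C → ∃ λ p → cl p ≡ C) s →
          wordDegree (basisWord cl surjective s) ≡ tensorDegree s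
        wordDegree-basisWord surjective s = trans (sym (∑ᵈ-total (basisWord cl surjective s)))
          (trans (∑ᵈ-cong {k} λ C → cong deg (total-basisWord cl surjective s C)) (sym (tensorDegree-∑ s)))

    module _ (Γ : PerfectMatchingGraph) (α β : State (PerfectMatchingGraph.ℓ Γ)) (i : Fin (PerfectMatchingGraph.ℓ Γ))
      (agree : Agree Γ (_≡ i) α β) where

      -- A matrix entry is the value of the edge map at a basis tensor. With that tensor written as
      -- a word, the map inserts letters of total degree zero.
      coefficient-degree : ∀ s t → tensorDegree s ≢ tensorDegree t → coefficient Γ α β i s t ≈ 0#
      coefficient-degree s t ≢ = begin
        coefficient Γ α β i s t
          ≈⟨ ≈-trans (*-congˡ (P-basisWord-≡ cl surjective s)) (*-identityʳ _) ⟨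
        coefficient Γ α β i s t * P cl L s
          ≈⟨ ∑⊗-single (#circles Γ α) s (λ s′ s′≢s → ≈-trans
               (*-congˡ (P-basisWord-≢ cl surjective s s′ s′≢s)) (zeroʳ (coefficient Γ α β i s′ t))) ⟨
        ∂-edge Γ α β i (P cl L) t
          ≈⟨ ∂-edge-P Γ α β i agree t L ⟩
        act (edgeKind Γ α β i) (combine i UL) (combine i UR) (λ A → P (circle Γ β) (A ++ L) t)
          ≈⟨ act-degree (edgeKind Γ α β i) (combine i UL) (combine i UR) (λ A d → P-degree (circle Γ β) (A ++ L) t
               λ e → ≢ (sym (trans e (trans (wordDegree-++ A L) (trans (cong (_⊕ wordDegree L) d)
                 (trans (⊕-identityˡ (wordDegree L)) (wordDegree-basisWord cl surjective s))))))) ⟩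
        0# ∎
        where
        open import Relation.Binary.Reasoning.Setoid setoid
        cl = circle Γ α
        surjective : ∀ C → ∃ λ p → cl p ≡ C
        surjective = Quotient.surjective (circles Γ α)
        L = basisWord cl surjective s

-- Ranks of homology over a domain

module LinearAlgebra where

  open import Algebra.Bundles using (CommutativeRing; CommutativeMonoid)
  open import Algebra.Module.Bundles using (LeftModule)
  import Algebra.Module.Morphism.Structures as Morphism
  import Algebra.Properties.CommutativeMonoid.Sum as MonoidSum
  open import Data.Fin.Base as Fin using (Fin; zero; suc; punchIn; punchOut; _↑ˡ_; _↑ʳ_; splitAt)
  import Data.Fin.Properties as Finₚ
  open import Data.Nat.Base as ℕ using (ℕ; zero; suc; z≤n; s≤s)
  import Data.Nat.Properties as ℕₚ
  open import Data.Product.Base using (∃; ∃₂; _×_; _,_; proj₁; proj₂)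
  open import Data.Sum.Base using (_⊎_; inj₁; inj₂; [_,_]′)
  open import Data.Vec.Functional using (insertAt; removeAt; _++_) renaming (_∷_ to _◃_)
  open import Data.Vec.Functional.Properties using (insertAt-lookup; insertAt-punchIn; lookup-++ˡ; lookup-++ʳ)
  open import Function.Base using (_∘_)
  open import Level using (0ℓ)
  open import Relation.Binary.PropositionalEquality as ≡ using (_≡_; _≢_; refl; cong; subst)
  open import Relation.Nullary using (Dec; yes; no; ¬_; contradiction)
  open import Relation.Nullary.Decidable using (¬?; decidable-stable)
  open import Defs
  open Sums

  module OverDomain (K : CommutativeRing 0ℓ 0ℓ)
    (zero? : ∀ x → Dec (CommutativeRing._≈_ K x (CommutativeRing.0# K)))
    (integral : ∀ x y → CommutativeRing._≈_ K (CommutativeRing._*_ K x y) (CommutativeRing.0# K) →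
      CommutativeRing._≈_ K x (CommutativeRing.0# K) ⊎ CommutativeRing._≈_ K y (CommutativeRing.0# K))
    (1≉0 : ¬ CommutativeRing._≈_ K (CommutativeRing.1# K) (CommutativeRing.0# K)) where

    open CommutativeRing K hiding (zero) renaming (Carrier to ∣K∣; refl to ≈-refl; sym to ≈-sym; trans to ≈-trans)
    open FiniteSums +-commutativeMonoid renaming (sum-ε to sum-0) using (sum; sum-remove; sum-cong-≋; ∑-distrib-+)
    open import Algebra.Properties.Semiring.Sum semiring using (*-distribˡ-sum; *-distribʳ-sum)
    open import Algebra.Properties.Ring ring using (-‿distribˡ-*; -‿distribʳ-*; -‿involutive)
    open import Algebra.Properties.Group +-group using (inverseʳ-unique)
    open import Algebra.Properties.CommutativeSemigroup *-commutativeSemigroup using (x∙yz≈y∙xz)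

    nonzero-* : ∀ {x y} → ¬ x ≈ 0# → ¬ y ≈ 0# → ¬ x * y ≈ 0#
    nonzero-* {x} {y} x≉0 y≉0 e = [ x≉0 , y≉0 ]′ (integral x y e)

    cancelˡ : ∀ {x y} → ¬ x ≈ 0# → x * y ≈ 0# → y ≈ 0#
    cancelˡ {x} {y} x≉0 e = [ (λ x≈0 → contradiction x≈0 x≉0) , (λ y≈0 → y≈0) ]′ (integral x y e)

    module _ {s N : ℕ} (A : Fin s → Fin N → ∣K∣) where

      Relation : (Fin s → ∣K∣) → Set
      Relation c = ∀ j → sum (λ i → c i * A i j) ≈ 0#

      RowsIndependent RowsDependent : Set
      RowsIndependent = ∀ c → Relation c → ∀ i → c i ≈ 0#
      RowsDependent   = ∃ λ c → (∃ λ i → ¬ c i ≈ 0#) × Relation c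

    module Pivot {s N : ℕ} (A : Fin (suc s) → Fin (suc N) → ∣K∣) (k : Fin (suc s)) where

      open import Relation.Binary.Reasoning.Setoid setoid

      p : ∣K∣
      p = A k zero

      -- Row reduction without division: each other row is scaled by the pivot `p` before the
      -- multiple of row `k` that clears column `zero` is subtracted.
      A′ : Fin s → Fin N → ∣K∣
      A′ i j = p * A (punchIn k i) (suc j) + - A (punchIn k i) zero * A k (suc j)

      module _ (c : Fin s → ∣K∣) where

        S : Fin (suc N) → ∣K∣
        S j = sum λ i → c i * A (punchIn k i) j

        reduced : ∀ j → sum (λ i → c i * A′ i j) ≈ p * S (suc j) + - S zero * A k (suc j)
        reduced j = begin
          sum (λ i → c i * A′ i j)
            ≈⟨ sum-cong-≋ (λ i → ≈-trans (distribˡ (c i) _ _) (+-cong (x∙yz≈y∙xz (c i) p _) (move i))) ⟩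
          sum (λ i → p * (c i * A (punchIn k i) (suc j)) + (c i * A (punchIn k i) zero) * - A k (suc j))
            ≈⟨ ∑-distrib-+ (λ i → p * (c i * A (punchIn k i) (suc j))) _ ⟩
          sum (λ i → p * (c i * A (punchIn k i) (suc j))) + sum (λ i → (c i * A (punchIn k i) zero) * - A k (suc j))
            ≈⟨ +-cong (*-distribˡ-sum p (λ i → c i * A (punchIn k i) (suc j)))
                 (*-distribʳ-sum (- A k (suc j)) (λ i → c i * A (punchIn k i) zero)) ⟨
          p * S (suc j) + S zero * - A k (suc j)
            ≈⟨ +-congˡ (≈-trans (≈-sym (-‿distribʳ-* (S zero) _)) (-‿distribˡ-* (S zero) _)) ⟩
          p * S (suc j) + - S zero * A k (suc j) ∎
          where
          move : ∀ i → c i * (- A (punchIn k i) zero * A k (suc j)) ≈ (c i * A (punchIn k i) zero) * - A k (suc j)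
          move i = begin
            c i * (- A (punchIn k i) zero * A k (suc j))
              ≈⟨ *-congˡ (≈-trans (≈-sym (-‿distribˡ-* _ _)) (-‿distribʳ-* _ _)) ⟩
            c i * (A (punchIn k i) zero * - A k (suc j))
              ≈⟨ *-assoc _ _ _ ⟨
            (c i * A (punchIn k i) zero) * - A k (suc j) ∎

      independent : ¬ p ≈ 0# → RowsIndependent A′ → RowsIndependent A
      independent p≉0 ind c rel = λ i → at i
        where
        c′ : Fin s → ∣K∣
        c′ = removeAt c k
        split : ∀ j → c k * A k j + S c′ j ≈ 0#
        split j = ≈-trans (≈-sym (sum-remove {i = k} λ i → c i * A i j)) (rel j)
        S≈ : ∀ j → S c′ j ≈ - (c k * A k j)
        S≈ j = inverseʳ-unique (c k * A k j) (S c′ j) (split j)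
        rel′ : Relation A′ c′
        rel′ j = begin
          sum (λ i → c′ i * A′ i j)
            ≈⟨ reduced c′ j ⟩
          p * S c′ (suc j) + - S c′ zero * A k (suc j)
            ≈⟨ +-cong (*-congˡ (S≈ (suc j))) (*-congʳ (-‿cong (S≈ zero))) ⟩
          p * - (c k * A k (suc j)) + - - (c k * p) * A k (suc j)
            ≈⟨ +-cong (≈-sym (-‿distribʳ-* p _)) (*-congʳ (-‿involutive (c k * p))) ⟩
          - (p * (c k * A k (suc j))) + (c k * p) * A k (suc j)
            ≈⟨ +-congˡ (≈-trans (*-congʳ (*-comm (c k) p)) (*-assoc p (c k) _)) ⟩
          - (p * (c k * A k (suc j))) + p * (c k * A k (suc j))
            ≈⟨ -‿inverseˡ _ ⟩
          0# ∎
        c′≈0 : ∀ i → c′ i ≈ 0#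
        c′≈0 = ind c′ rel′
        ck≈0 : c k ≈ 0#
        ck≈0 = cancelˡ p≉0 (begin
          p * c k                ≈⟨ *-comm p (c k) ⟩
          c k * p                ≈⟨ +-identityʳ _ ⟨
          c k * p + 0#           ≈⟨ +-congˡ (sum-0 λ i → ≈-trans (*-congʳ (c′≈0 i)) (zeroˡ _)) ⟨
          c k * p + S c′ zero    ≈⟨ split zero ⟩
          0#                     ∎)
        at : ∀ i → c i ≈ 0#
        at i with k Finₚ.≟ i
        ... | yes refl = ck≈0
        ... | no k≢i   = subst (λ x → c x ≈ 0#) (Finₚ.punchIn-punchOut k≢i) (c′≈0 (punchOut k≢i))

      dependent : ¬ p ≈ 0# → RowsDependent A′ → RowsDependent A
      dependent p≉0 (c′ , (i , ci≉0) , rel′) = c , (punchIn k i , nonzero) , rel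
        where
        c : Fin (suc s) → ∣K∣
        -- The entry at the pivot row is chosen so that column `zero` cancels once the other entries
        -- are scaled by `p`.
        c = insertAt (λ i → p * c′ i) k (- S c′ zero)
        c-other : ∀ i → c (punchIn k i) ≡ p * c′ i
        c-other i = insertAt-punchIn (λ i → p * c′ i) k (- S c′ zero) i
        nonzero : ¬ c (punchIn k i) ≈ 0#
        nonzero e = nonzero-* p≉0 ci≉0 (≈-trans (reflexive (≡.sym (c-other i))) e)
        total : ∀ j → sum (λ i → c i * A i j) ≈ p * S c′ j + - S c′ zero * A k j
        total j = begin
          sum (λ i → c i * A i j)
            ≈⟨ sum-remove {i = k} (λ i → c i * A i j) ⟩
          c k * A k j + sum (λ i → c (punchIn k i) * A (punchIn k i) j)
            ≈⟨ +-cong (*-congʳ (reflexive (insertAt-lookup _ k _)))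
                 (sum-cong-≋ λ i → ≈-trans (*-congʳ (reflexive (c-other i))) (*-assoc p _ _)) ⟩
          - S c′ zero * A k j + sum (λ i → p * (c′ i * A (punchIn k i) j))
            ≈⟨ +-congˡ (≈-sym (*-distribˡ-sum p (λ i → c′ i * A (punchIn k i) j))) ⟩
          - S c′ zero * A k j + p * S c′ j
            ≈⟨ +-comm _ _ ⟩
          p * S c′ j + - S c′ zero * A k j ∎
        rel : Relation A c
        rel zero    = ≈-trans (total zero) (≈-trans
          (+-congˡ (≈-trans (≈-sym (-‿distribˡ-* _ p)) (-‿cong (*-comm _ p)))) (-‿inverseʳ _))
        rel (suc j) = ≈-trans (total (suc j)) (≈-trans (≈-sym (reduced c′ j)) (rel′ j))

    -- A column of zeros is dropped; otherwise a pivot removes one row and one column. Counting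
    -- these removals gives the bound on `s` in the independent case.
    eliminate : ∀ s N (A : Fin s → Fin N → ∣K∣) → (RowsIndependent A × s ℕ.≤ N) ⊎ RowsDependent A
    eliminate zero    N       A = inj₁ ((λ _ _ ()) , z≤n)
    eliminate (suc s) zero    A = inj₂ ((λ _ → 1#) , (zero , 1≉0) , λ ())
    eliminate (suc s) (suc N) A with Finₚ.any? (λ i → ¬? (zero? (A i zero)))
    ... | yes (k , p≉0) = [ (λ (ind , s≤N) → inj₁ (Pivot.independent A k p≉0 ind , s≤s s≤N))
                          , (λ dep → inj₂ (Pivot.dependent A k p≉0 dep)) ]′ (eliminate s N (Pivot.A′ A k))
    ... | no none = [ (λ (ind , s≤N) → inj₁ ((λ c rel → ind c (rel ∘ suc)) , ℕₚ.m≤n⇒m≤1+n s≤N))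
                    , (λ (c , nz , rel) → inj₂ (c , nz , λ
                        { zero → sum-0 λ i → ≈-trans (*-congˡ (decidable-stable (zero? (A i zero)) λ ≉ → none (i , ≉))) (zeroʳ (c i))
                        ; (suc j) → rel j })) ]′ (eliminate (suc s) N (λ i j → A i (suc j)))

    module Families (M : LeftModule ring 0ℓ 0ℓ) where

      open LeftModule M
      open FiniteSums +ᴹ-commutativeMonoid
        renaming (sum to ∑; sum-cong-≋ to ∑-cong; ∑-distrib-+ to ∑-+; ∑-comm to ∑-swap; sum-ε to ∑-0; sum-↑ to ∑-↑)
        using ()
      open import Relation.Binary.Reasoning.Setoid ≈ᴹ-setoid

      Family : ℕ → Set
      Family r = Fin r → Carrierᴹ

      combination : ∀ {r} → (Fin r → ∣K∣) → Family r → Carrierᴹ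
      combination c v = ∑ λ i → c i *ₗ v i

      *ₗ-∑ : ∀ r c (v : Family r) → c *ₗ ∑ v ≈ᴹ ∑ λ i → c *ₗ v i
      *ₗ-∑ zero    c v = *ₗ-zeroʳ c
      *ₗ-∑ (suc r) c v = ≈ᴹ-trans (*ₗ-distribˡ c _ _) (+ᴹ-congˡ (*ₗ-∑ r c (v ∘ suc)))

      ∑-*ₗ : ∀ r (c : Fin r → ∣K∣) v → sum c *ₗ v ≈ᴹ ∑ λ i → c i *ₗ v
      ∑-*ₗ zero    c v = *ₗ-zeroˡ v
      ∑-*ₗ (suc r) c v = ≈ᴹ-trans (*ₗ-distribʳ v _ _) (+ᴹ-congˡ (∑-*ₗ r (c ∘ suc) v))

      combination-+ : ∀ {r} a b (v : Family r) → combination (λ i → a i + b i) v ≈ᴹ combination a v +ᴹ combination b v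
      combination-+ {r} a b v = ≈ᴹ-trans (∑-cong {r} λ i → *ₗ-distribʳ (v i) (a i) (b i)) (∑-+ {r} _ _)

      combination-* : ∀ {r} d a (v : Family r) → combination (λ i → d * a i) v ≈ᴹ d *ₗ combination a v
      combination-* {r} d a v = ≈ᴹ-trans (∑-cong {r} λ i → *ₗ-assoc d (a i) (v i)) (≈ᴹ-sym (*ₗ-∑ r d λ i → a i *ₗ v i))

      combination-0 : ∀ {r} {c} (v : Family r) → (∀ i → c i ≈ 0#) → combination c v ≈ᴹ 0ᴹ
      combination-0 {r} v e = ∑-0 {r} λ i → ≈ᴹ-trans (*ₗ-congʳ (e i)) (*ₗ-zeroˡ (v i))

      combination-++ : ∀ {q r} (c : Fin (q ℕ.+ r) → ∣K∣) (v : Family q) (w : Family r) →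
        combination c (v ++ w) ≈ᴹ combination (c ∘ (_↑ˡ r)) v +ᴹ combination (c ∘ (q ↑ʳ_)) w
      combination-++ {q} {r} c v w = ≈ᴹ-trans (∑-↑ q _) (+ᴹ-cong
        (∑-cong {q} λ i → ≈ᴹ-reflexive (cong (c (i ↑ˡ r) *ₗ_) (lookup-++ˡ v w i)))
        (∑-cong {r} λ i → ≈ᴹ-reflexive (cong (c (q ↑ʳ i) *ₗ_) (lookup-++ʳ v w i))))

      -- Some nonzero multiple of v is a linear combination of F.
      Span : ∀ {r} → Family r → Carrierᴹ → Set
      Span F v = ∃₂ λ d a → ¬ d ≈ 0# × d *ₗ v ≈ᴹ combination a F

      module _ {r : ℕ} {F : Family r} where

        span-cong : ∀ {v w} → v ≈ᴹ w → Span F v → Span F w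
        span-cong e (d , a , d≉0 , p) = d , a , d≉0 , ≈ᴹ-trans (*ₗ-congˡ (≈ᴹ-sym e)) p

        span-combination : ∀ a → Span F (combination a F)
        span-combination a = 1# , a , 1≉0 , *ₗ-identityˡ _

        span-0 : Span F 0ᴹ
        span-0 = span-cong (combination-0 F λ _ → ≈-refl) (span-combination λ _ → 0#)

        span-+ : ∀ {v w} → Span F v → Span F w → Span F (v +ᴹ w)
        span-+ {v} {w} (d , a , d≉0 , p) (e , b , e≉0 , q) =
          d * e , (λ i → e * a i + d * b i) , nonzero-* d≉0 e≉0 , (begin
            (d * e) *ₗ (v +ᴹ w)
              ≈⟨ *ₗ-distribˡ (d * e) v w ⟩
            (d * e) *ₗ v +ᴹ (d * e) *ₗ w
              ≈⟨ +ᴹ-cong (≈ᴹ-trans (*ₗ-congʳ (*-comm d e)) (*ₗ-assoc e d v)) (*ₗ-assoc d e w) ⟩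
            e *ₗ (d *ₗ v) +ᴹ d *ₗ (e *ₗ w)
              ≈⟨ +ᴹ-cong (*ₗ-congˡ p) (*ₗ-congˡ q) ⟩
            e *ₗ combination a F +ᴹ d *ₗ combination b F
              ≈⟨ +ᴹ-cong (combination-* e a F) (combination-* d b F) ⟨
            combination (λ i → e * a i) F +ᴹ combination (λ i → d * b i) F
              ≈⟨ combination-+ (λ i → e * a i) (λ i → d * b i) F ⟨
            combination (λ i → e * a i + d * b i) F ∎)

        span-* : ∀ c {v} → Span F v → Span F (c *ₗ v)
        span-* c {v} (d , a , d≉0 , p) = d , (λ i → c * a i) , d≉0 , (begin
          d *ₗ (c *ₗ v)                 ≈⟨ *ₗ-assoc d c v ⟨
          (d * c) *ₗ v                  ≈⟨ *ₗ-congʳ (*-comm d c) ⟩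
          (c * d) *ₗ v                  ≈⟨ *ₗ-assoc c d v ⟩
          c *ₗ (d *ₗ v)                 ≈⟨ *ₗ-congˡ p ⟩
          c *ₗ combination a F          ≈⟨ combination-* c a F ⟨
          combination (λ i → c * a i) F ∎)

        span-divide : ∀ {d v} → ¬ d ≈ 0# → Span F (d *ₗ v) → Span F v
        span-divide {d} {v} d≉0 (e , a , e≉0 , p) = e * d , a , nonzero-* e≉0 d≉0 , ≈ᴹ-trans (*ₗ-assoc e d v) p

        span-of-combination : ∀ {s} c (w : Family s) → (∀ i → Span F (w i)) → Span F (combination c w)
        span-of-combination {zero}  c w e = span-0
        span-of-combination {suc s} c w e = span-+ (span-* (c zero) (e zero)) (span-of-combination (c ∘ suc) (w ∘ suc) (e ∘ suc))

      Independent : ∀ {r} → Family r → Set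
      Independent = LinearlyIndependent M

      -- The coefficients of multiples of the `w i` in terms of `F` form a matrix with `s` rows and
      -- `r` columns. A dependence of its rows, scaled by the denominators `d`, would be a
      -- nontrivial relation among the `w i`.
      steinitz : ∀ {s r} (w : Family s) (F : Family r) → Independent w → (∀ i → Span F (w i)) → s ℕ.≤ r
      steinitz {s} {r} w F ind span with eliminate s r (λ i → proj₁ (proj₂ (span i)))
      ... | inj₁ (_ , s≤r) = s≤r
      ... | inj₂ (c , (i , ci≉0) , rel) = contradiction (ind (λ i → c i * d i) vanishes i) (nonzero-* ci≉0 (d≉0 i))
        where
        d : Fin s → ∣K∣
        d i = proj₁ (span i)
        a : Fin s → Fin r → ∣K∣
        a i = proj₁ (proj₂ (span i))
        d≉0 : ∀ i → ¬ d i ≈ 0#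
        d≉0 i = proj₁ (proj₂ (proj₂ (span i)))
        vanishes : combination (λ i → c i * d i) w ≈ᴹ 0ᴹ
        vanishes = begin
          combination (λ i → c i * d i) w
            ≈⟨ ∑-cong {s} (λ i → ≈ᴹ-trans (*ₗ-assoc (c i) (d i) (w i)) (*ₗ-congˡ (proj₂ (proj₂ (proj₂ (span i)))))) ⟩
          ∑ (λ i → c i *ₗ combination (a i) F)
            ≈⟨ ∑-cong {s} (λ i → ≈ᴹ-trans (*ₗ-∑ r (c i) _) (∑-cong {r} λ j → ≈ᴹ-sym (*ₗ-assoc (c i) (a i j) (F j)))) ⟩
          ∑ (λ i → ∑ λ j → (c i * a i j) *ₗ F j)
            ≈⟨ ∑-swap {s} {r} (λ i j → (c i * a i j) *ₗ F j) ⟩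
          ∑ (λ j → ∑ λ i → (c i * a i j) *ₗ F j)
            ≈⟨ ∑-0 {r} (λ j → ≈ᴹ-trans (≈ᴹ-sym (∑-*ₗ s (λ i → c i * a i j) (F j)))
                 (≈ᴹ-trans (*ₗ-congʳ (rel j)) (*ₗ-zeroˡ (F j)))) ⟩
          0ᴹ ∎

      ++-elim : ∀ {q r} (P : Carrierᴹ → Set) (v : Family q) (w : Family r) →
        (∀ i → P (v i)) → (∀ j → P (w j)) → ∀ k → P ((v ++ w) k)
      ++-elim {q} P v w p p′ k with splitAt q k
      ... | inj₁ i = p i
      ... | inj₂ j = p′ j

      span-member : ∀ {r} (F : Family r) i → Span F (F i)
      span-member {r} F i = 1# , unit , 1≉0 , ≈ᴹ-trans (≈ᴹ-sym at-i) (≈ᴹ-sym (∑-single i off-i))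
        where
        open FiniteSums +ᴹ-commutativeMonoid using () renaming (sum-single to ∑-single)
        open FiniteSums +-commutativeMonoid using (only; only-at; only-off)
        unit : Fin r → ∣K∣
        unit = only i λ _ → 1#
        at-i : unit i *ₗ F i ≈ᴹ 1# *ₗ F i
        at-i = *ₗ-congʳ (reflexive (only-at i λ _ → 1#))
        off-i : ∀ k → k ≢ i → unit k *ₗ F k ≈ᴹ 0ᴹ
        off-i k k≢i = ≈ᴹ-trans (*ₗ-congʳ (reflexive (only-off (λ _ → 1#) k≢i))) (*ₗ-zeroˡ (F k))

      span-++ˡ : ∀ {q r} (v : Family q) (w : Family r) i → Span (v ++ w) (v i)
      span-++ˡ {r = r} v w i = subst (Span (v ++ w)) (lookup-++ˡ v w i) (span-member (v ++ w) (i ↑ˡ r))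

      span-++ʳ : ∀ {q r} (v : Family q) (w : Family r) j → Span (v ++ w) (w j)
      span-++ʳ {q} v w j = subst (Span (v ++ w)) (lookup-++ʳ v w j) (span-member (v ++ w) (q ↑ʳ j))

      span-trans : ∀ {q r} {F : Family q} {G : Family r} → (∀ i → Span G (F i)) → ∀ {v} → Span F v → Span G v
      span-trans {F = F} F⊆G (d , a , d≉0 , p) =
        span-divide d≉0 (span-cong (≈ᴹ-sym p) (span-of-combination a F F⊆G))

      -- Finitely many faithful coordinates reduce dependence in the module to a matrix, so that
      -- `eliminate` decides it and supplies a relation.
      record Coordinates : Set where
        field
          dimension : ℕ
          coord     : Fin dimension → Carrierᴹ → ∣K∣
          coord-cong : ∀ j {v w} → v ≈ᴹ w → coord j v ≈ coord j w
          coord-+   : ∀ j v w → coord j (v +ᴹ w) ≈ coord j v + coord j w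
          coord-*   : ∀ j c v → coord j (c *ₗ v) ≈ c * coord j v
          faithful  : ∀ v → (∀ j → coord j v ≈ 0#) → v ≈ᴹ 0ᴹ

        coord-0 : ∀ j → coord j 0ᴹ ≈ 0#
        coord-0 j = ≈-trans (coord-cong j (≈ᴹ-sym (*ₗ-zeroˡ 0ᴹ))) (≈-trans (coord-* j 0# 0ᴹ) (zeroˡ _))

        coord-combination : ∀ j r (c : Fin r → ∣K∣) v → coord j (combination c v) ≈ sum λ i → c i * coord j (v i)
        coord-combination j zero    c v = coord-0 j
        coord-combination j (suc r) c v = ≈-trans (coord-+ j _ _)
          (+-cong (coord-* j _ _) (coord-combination j r (c ∘ suc) (v ∘ suc)))

        decide : ∀ {s} (v : Family s) →
          Independent v ⊎ ∃ λ c → (∃ λ i → ¬ c i ≈ 0#) × combination c v ≈ᴹ 0ᴹ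
        decide {s} v with eliminate s dimension (λ i j → coord j (v i))
        ... | inj₁ (ind , _) = inj₁ λ c e → ind c λ j →
          ≈-trans (≈-sym (coord-combination j s c v)) (≈-trans (coord-cong j e) (coord-0 j))
        ... | inj₂ (c , nonzero , rel) = inj₂ (c , nonzero , faithful _ λ j →
          ≈-trans (coord-combination j s c v) (rel j))

      module _ (coordinates : Coordinates) (f : Carrierᴹ → Carrierᴹ) {r : ℕ} (F : Family r) (F-independent : Independent F) where

        open Coordinates coordinates

        -- Independence of `f ∘ us` modulo the span of `F`; the coefficients on `F` then vanish
        -- because `F` is independent.
        Fresh : ∀ {u} → Family u → Set
        Fresh us = ∀ a b → combination a (f ∘ us) +ᴹ combination b F ≈ᴹ 0ᴹ → ∀ i → a i ≈ 0#

        fresh-independent : ∀ {u} (us : Family u) → Fresh us → Independent ((f ∘ us) ++ F)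
        fresh-independent {u} us fresh c e k = subst (λ k → c k ≈ 0#) (Finₚ.join-splitAt u r k)
          (both (splitAt u k))
          where
          e′ : combination (c ∘ (_↑ˡ r)) (f ∘ us) +ᴹ combination (c ∘ (u ↑ʳ_)) F ≈ᴹ 0ᴹ
          e′ = ≈ᴹ-trans (≈ᴹ-sym (combination-++ c (f ∘ us) F)) e
          left : ∀ i → c (i ↑ˡ r) ≈ 0#
          left = fresh (c ∘ (_↑ˡ r)) (c ∘ (u ↑ʳ_)) e′
          right : ∀ j → c (u ↑ʳ j) ≈ 0#
          right = F-independent (c ∘ (u ↑ʳ_)) (≈ᴹ-trans (≈ᴹ-sym (+ᴹ-identityˡ _))
            (≈ᴹ-trans (+ᴹ-congʳ (≈ᴹ-sym (combination-0 (f ∘ us) left))) e′))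
          both : ∀ x → c (Fin.join u r x) ≈ 0#
          both (inj₁ i) = left i
          both (inj₂ j) = right j

        fresh-◃ : ∀ {u} g (us : Family u) → Independent (f g ◃ ((f ∘ us) ++ F)) → Fresh (g ◃ us)
        fresh-◃ {u} g us ind a b e = λ { zero → c≈0 zero
          ; (suc i) → ≈-trans (reflexive (≡.sym (lookup-++ˡ (a ∘ suc) b i))) (c≈0 (suc (i ↑ˡ r))) }
          where
          c : Fin (suc (u ℕ.+ r)) → ∣K∣
          c = a zero ◃ ((a ∘ suc) ++ b)
          c≈0 : ∀ k → c k ≈ 0#
          c≈0 = ind c (≈ᴹ-trans (+ᴹ-congˡ (≈ᴹ-trans (combination-++ ((a ∘ suc) ++ b) (f ∘ us) F) (+ᴹ-cong
              (∑-cong {u} λ i → *ₗ-congʳ (reflexive (lookup-++ˡ (a ∘ suc) b i)))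
              (∑-cong {r} λ j → *ₗ-congʳ (reflexive (lookup-++ʳ (a ∘ suc) b j))))))
            (≈ᴹ-trans (≈ᴹ-sym (+ᴹ-assoc _ _ _)) e))

        -- The coefficient of `f g` cannot vanish, since the relation would otherwise be one within
        -- an independent family. It serves as the denominator.
        dependent-span : ∀ {u} g (us : Family u) → Fresh us → ∀ c → (∃ λ i → ¬ c i ≈ 0#) →
          combination c (f g ◃ ((f ∘ us) ++ F)) ≈ᴹ 0ᴹ → Span ((f ∘ us) ++ F) (f g)
        dependent-span g us fresh c (i , ci≉0) e = c zero , (λ i → - 1# * c (suc i)) , c₀≉0 , (begin
            c zero *ₗ f g
              ≈⟨ inverseˡ-unique _ _ e ⟩
            -ᴹ combination (c ∘ suc) ((f ∘ us) ++ F)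
              ≈⟨ inverseˡ-unique _ _ (≈ᴹ-trans (+ᴹ-congˡ (≈ᴹ-sym (*ₗ-identityˡ _)))
                   (≈ᴹ-trans (≈ᴹ-sym (*ₗ-distribʳ _ (- 1#) 1#)) (≈ᴹ-trans (*ₗ-congʳ (-‿inverseˡ 1#)) (*ₗ-zeroˡ _)))) ⟨
            - 1# *ₗ combination (c ∘ suc) ((f ∘ us) ++ F)
              ≈⟨ combination-* (- 1#) (c ∘ suc) ((f ∘ us) ++ F) ⟨
            combination (λ i → - 1# * c (suc i)) ((f ∘ us) ++ F) ∎)
          where
          open import Algebra.Properties.AbelianGroup +ᴹ-abelianGroup using (inverseˡ-unique)
          c₀≉0 : ¬ c zero ≈ 0#
          c₀≉0 c₀≈0 = ci≉0 (all i)
            where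
            rest : ∀ i → c (suc i) ≈ 0#
            rest = fresh-independent us fresh (c ∘ suc) (≈ᴹ-trans (≈ᴹ-sym (≈ᴹ-trans
              (+ᴹ-congʳ (≈ᴹ-trans (*ₗ-congʳ c₀≈0) (*ₗ-zeroˡ _))) (+ᴹ-identityˡ _))) e)
            all : ∀ i → c i ≈ 0#
            all zero    = c₀≈0
            all (suc i) = rest i

        -- A greedy choice directed by `decide`, used twice. With the differential as `f` and `F`
        -- empty it selects preimages of a maximal independent family of boundaries; with the
        -- identity as `f` it enlarges `F` by closed vectors.
        extend : ∀ g (G : Family g) (Good : Carrierᴹ → Set) → (∀ i → Good (G i)) →
          ∃₂ λ u (us : Family u) → (∀ i → Good (us i)) × Fresh us × (∀ i → Span ((f ∘ us) ++ F) (f (G i)))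
        extend zero    G Good good = 0 , (λ ()) , (λ ()) , (λ _ _ _ ()) , λ ()
        extend (suc g) G Good good with extend g (G ∘ suc) Good (good ∘ suc)
        ... | u , us , us-good , fresh , spans with decide (f (G zero) ◃ ((f ∘ us) ++ F))
        ... | inj₁ ind = suc u , G zero ◃ us , (λ { zero → good zero ; (suc i) → us-good i }) ,
          fresh-◃ (G zero) us ind , λ
            { zero    → span-++ˡ (f ∘ (G zero ◃ us)) F zero
            ; (suc i) → span-trans {F = (f ∘ us) ++ F} {G = (f ∘ (G zero ◃ us)) ++ F}
                (++-elim (Span ((f ∘ (G zero ◃ us)) ++ F)) (f ∘ us) F
                  (λ i → span-++ˡ (f ∘ (G zero ◃ us)) F (suc i)) (span-++ʳ (f ∘ (G zero ◃ us)) F)) (spans i) }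
        ... | inj₂ (c , nonzero , e) = u , us , us-good , fresh , λ
            { zero    → dependent-span (G zero) us fresh c nonzero e
            ; (suc i) → spans i }

      record Basis (C : Submodule M) : Set where
        open Submodule C
        field
          size        : ℕ
          element     : Family size
          member      : ∀ i → Member (element i)
          independent : Independent element
          spans       : ∀ {v} → Member v → ∃ λ a → v ≈ᴹ combination a element

      module Differential (coordinates : Coordinates) {∂ : Carrierᴹ → Carrierᴹ} (∂-linear : IsLinear M ∂) where

        open Morphism.LeftModuleMorphisms.IsLeftModuleHomomorphism ∂-linear

        ∂-combination : ∀ r (a : Fin r → ∣K∣) (v : Family r) → ∂ (combination a v) ≈ᴹ combination a (∂ ∘ v)
        ∂-combination zero    a v = 0ᴹ-homo
        ∂-combination (suc r) a v = ≈ᴹ-trans (+ᴹ-homo _ _)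
          (+ᴹ-cong (*ₗ-homo (a zero) (v zero)) (∂-combination r (a ∘ suc) (v ∘ suc)))

        -- Vectors whose images form a maximal independent family in ∂ C
        record ImageBasis (Member : Carrierᴹ → Set) : Set where
          field
            rank        : ℕ
            preimage    : Family rank
            member      : ∀ i → Member (preimage i)
            independent : Independent (∂ ∘ preimage)
            spans       : ∀ {v} → Member v → Span (∂ ∘ preimage) (∂ v)

        imageBasis : ∀ {C} → Basis C → ImageBasis (Submodule.Member C)
        imageBasis {C} basis with extend coordinates ∂ {0} (λ ()) (λ _ _ ())
          (Basis.size basis) (Basis.element basis) (Submodule.Member C) (Basis.member basis)
        ... | u , us , us-member , fresh , spans = record
          { rank = u ; preimage = us ; member = us-member
          ; independent = λ a e → fresh a (λ ()) (≈ᴹ-trans (+ᴹ-identityʳ _) e)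
          ; spans = λ {v} v∈C → let (a , v≈) = Basis.spans basis v∈C in
              span-cong (≈ᴹ-sym (≈ᴹ-trans (⟦⟧-cong v≈) (∂-combination (Basis.size basis) a (Basis.element basis))))
                (span-of-combination a (∂ ∘ Basis.element basis) λ i → span-trans {F = (∂ ∘ us) ++ (λ ())}
                  (++-elim (Span (∂ ∘ us)) (∂ ∘ us) (λ ()) (span-member (∂ ∘ us)) (λ ())) (spans i))
          }

        module HomologyRank (∂∂≈0 : ∀ v → ∂ (∂ v) ≈ᴹ 0ᴹ) {C₁ C₀ : Submodule M}
          (∂-member : ∀ {v} → Submodule.Member C₀ v → Submodule.Member C₁ (∂ v))
          (basis : Basis C₁) (image₁ : ImageBasis (Submodule.Member C₁)) (image₀ : ImageBasis (Submodule.Member C₀)) where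

          private
            module C₁ = Submodule C₁
            module C₀ = Submodule C₀
            module B = Basis basis
            module J₁ = ImageBasis image₁
            module J₀ = ImageBasis image₀
            H : LeftModule ring 0ℓ 0ℓ
            H = homology M C₁ C₀ ∂-linear
            Cyc : Set
            Cyc = Cycle M C₁ C₀ ∂-linear
            chain : Cyc → Carrierᴹ
            chain = Cycle.chain

          -- The part of C₁ that homology does not see: vectors with independent boundaries, and
          -- boundaries coming from C₀. The number of closed vectors needed to complete `F` will be
          -- the rank of the homology.
          F : Family (J₁.rank ℕ.+ J₀.rank)
          F = J₁.preimage ++ (∂ ∘ J₀.preimage)

          -- Applying ∂ kills b and leaves a combination of the independent
          -- family ∂ ∘ J₁.preimage.
          coefficients-vanish : ∀ w → ∂ w ≈ᴹ 0ᴹ → ∀ a b →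
            w +ᴹ (combination a J₁.preimage +ᴹ combination b (∂ ∘ J₀.preimage)) ≈ᴹ 0ᴹ → ∀ i → a i ≈ 0#
          coefficients-vanish w ∂w≈0 a b e = J₁.independent a (begin
            combination a (∂ ∘ J₁.preimage)
              ≈⟨ ∂-combination J₁.rank a J₁.preimage ⟨
            ∂ (combination a J₁.preimage)
              ≈⟨ +ᴹ-identityʳ _ ⟨
            ∂ (combination a J₁.preimage) +ᴹ 0ᴹ
              ≈⟨ +ᴹ-congˡ (≈ᴹ-trans (⟦⟧-cong (≈ᴹ-sym (∂-combination J₀.rank b J₀.preimage))) (∂∂≈0 _)) ⟨
            ∂ (combination a J₁.preimage) +ᴹ ∂ (combination b (∂ ∘ J₀.preimage))
              ≈⟨ +ᴹ-homo _ _ ⟨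
            ∂ (combination a J₁.preimage +ᴹ combination b (∂ ∘ J₀.preimage))
              ≈⟨ +ᴹ-identityˡ _ ⟨
            0ᴹ +ᴹ ∂ (combination a J₁.preimage +ᴹ combination b (∂ ∘ J₀.preimage))
              ≈⟨ +ᴹ-congʳ ∂w≈0 ⟨
            ∂ w +ᴹ ∂ (combination a J₁.preimage +ᴹ combination b (∂ ∘ J₀.preimage))
              ≈⟨ +ᴹ-homo _ _ ⟨
            ∂ (w +ᴹ (combination a J₁.preimage +ᴹ combination b (∂ ∘ J₀.preimage)))
              ≈⟨ ⟦⟧-cong e ⟩
            ∂ 0ᴹ
              ≈⟨ 0ᴹ-homo ⟩
            0ᴹ ∎)

          F-independent : Independent F
          F-independent c e k = subst (λ k → c k ≈ 0#) (Finₚ.join-splitAt J₁.rank J₀.rank k) (both (splitAt J₁.rank k))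
            where
            a = c ∘ (_↑ˡ J₀.rank)
            b = c ∘ (J₁.rank ↑ʳ_)
            e′ : combination a J₁.preimage +ᴹ combination b (∂ ∘ J₀.preimage) ≈ᴹ 0ᴹ
            e′ = ≈ᴹ-trans (≈ᴹ-sym (combination-++ c J₁.preimage (∂ ∘ J₀.preimage))) e
            a≈0 : ∀ i → a i ≈ 0#
            a≈0 = coefficients-vanish 0ᴹ 0ᴹ-homo a b (≈ᴹ-trans (+ᴹ-identityˡ _) e′)
            b≈0 : ∀ j → b j ≈ 0#
            b≈0 = J₀.independent b (≈ᴹ-trans (≈ᴹ-sym (+ᴹ-identityˡ _))
              (≈ᴹ-trans (+ᴹ-congʳ (≈ᴹ-sym (combination-0 J₁.preimage a≈0))) e′))
            both : ∀ x → c (Fin.join J₁.rank J₀.rank x) ≈ 0#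
            both (inj₁ i) = a≈0 i
            both (inj₂ j) = b≈0 j

          Closed : Carrierᴹ → Set
          Closed v = C₁.Member v × ∂ v ≈ᴹ 0ᴹ

          C₁-combination : ∀ r (a : Fin r → ∣K∣) (v : Family r) → (∀ i → C₁.Member (v i)) → C₁.Member (combination a v)
          C₁-combination zero    a v m = C₁.0-mem
          C₁-combination (suc r) a v m = C₁.+-mem (C₁.*-mem (a zero) (m zero)) (C₁-combination r (a ∘ suc) (v ∘ suc) (m ∘ suc))

          -- A closed multiple of a basis element, corrected by the preimages
          module Corrected (k : Fin B.size) where

            spanning : Span (∂ ∘ J₁.preimage) (∂ (B.element k))
            spanning = J₁.spans (B.member k)

            d : ∣K∣
            d = proj₁ spanning

            a : Fin J₁.rank → ∣K∣
            a = proj₁ (proj₂ spanning)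

            d≉0 : ¬ d ≈ 0#
            d≉0 = proj₁ (proj₂ (proj₂ spanning))

            vector : Carrierᴹ
            vector = d *ₗ B.element k +ᴹ -ᴹ combination a J₁.preimage

            closed : Closed vector
            closed = C₁.+-mem (C₁.*-mem d (B.member k)) (C₁.neg-mem (C₁-combination J₁.rank a J₁.preimage J₁.member)) ,
              (begin
                ∂ vector
                  ≈⟨ +ᴹ-homo _ _ ⟩
                ∂ (d *ₗ B.element k) +ᴹ ∂ (-ᴹ combination a J₁.preimage)
                  ≈⟨ +ᴹ-cong (≈ᴹ-trans (*ₗ-homo d (B.element k)) (proj₂ (proj₂ (proj₂ spanning))))
                       (≈ᴹ-trans (-ᴹ-homo _) (-ᴹ‿cong (∂-combination J₁.rank a J₁.preimage))) ⟩
                combination a (∂ ∘ J₁.preimage) +ᴹ -ᴹ combination a (∂ ∘ J₁.preimage)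
                  ≈⟨ -ᴹ‿inverseʳ _ ⟩
                0ᴹ ∎)

            restore : vector +ᴹ combination a J₁.preimage ≈ᴹ d *ₗ B.element k
            restore = ≈ᴹ-trans (+ᴹ-assoc _ _ _) (≈ᴹ-trans (+ᴹ-congˡ (-ᴹ‿inverseˡ _)) (+ᴹ-identityʳ _))

          extension : ∃₂ λ u (us : Family u) → (∀ i → Closed (us i)) × Fresh coordinates (λ v → v) F F-independent us ×
            (∀ k → Span (us ++ F) (Corrected.vector k))
          extension = extend coordinates (λ v → v) F F-independent B.size Corrected.vector Closed Corrected.closed

          h : ℕ
          h = proj₁ extension

          us : Family h
          us = proj₁ (proj₂ extension)

          us-closed : ∀ i → Closed (us i)
          us-closed = proj₁ (proj₂ (proj₂ extension))

          us-fresh : Fresh coordinates (λ v → v) F F-independent us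
          us-fresh = proj₁ (proj₂ (proj₂ (proj₂ extension)))

          vector-span : ∀ k → Span (us ++ F) (Corrected.vector k)
          vector-span = proj₂ (proj₂ (proj₂ (proj₂ extension)))

          F-member : ∀ j → C₁.Member (F j)
          F-member = ++-elim C₁.Member J₁.preimage (∂ ∘ J₀.preimage) J₁.member (∂-member ∘ J₀.member)

          C₁-span : ∀ {v} → C₁.Member v → Span B.element v
          C₁-span v∈ = let (a , v≈) = B.spans v∈ in span-cong (≈ᴹ-sym v≈) (span-combination a)

          element-span : ∀ k → Span (us ++ F) (B.element k)
          element-span k = span-divide (Corrected.d≉0 k) (span-cong (Corrected.restore k) (span-+ (vector-span k)
            (span-of-combination (Corrected.a k) J₁.preimage λ i → span-trans {F = F} {G = us ++ F}
              (span-++ʳ us F) (span-++ˡ J₁.preimage (∂ ∘ J₀.preimage) i))))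

          size-≤ : ∀ {s} (w : Family s) → (∀ i → C₁.Member (w i)) → Independent (w ++ F) →
            s ℕ.+ (J₁.rank ℕ.+ J₀.rank) ℕ.≤ B.size
          size-≤ w w∈ ind = steinitz (w ++ F) B.element ind (++-elim (Span B.element) w F (C₁-span ∘ w∈) (C₁-span ∘ F-member))

          -- `us ++ F` is independent. It also spans up to multiples, because a multiple of each
          -- basis element is its corrected closed vector plus a combination of preimages. The
          -- exchange lemma then applies in both directions.
          h+ranks : h ℕ.+ (J₁.rank ℕ.+ J₀.rank) ≡ B.size
          h+ranks = ℕₚ.≤-antisym
            (size-≤ us (proj₁ ∘ us-closed) (fresh-independent coordinates (λ v → v) F F-independent us us-fresh))
            (steinitz B.element (us ++ F) B.independent element-span)

          chain-combination : ∀ r (c : Fin r → ∣K∣) (v : Fin r → Cyc) →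
            chain (MonoidSum.sum (LeftModule.+ᴹ-commutativeMonoid H) (λ i → LeftModule._*ₗ_ H (c i) (v i))) ≡
            combination c (chain ∘ v)
          chain-combination zero    c v = refl
          chain-combination (suc r) c v = cong (c zero *ₗ chain (v zero) +ᴹ_) (chain-combination r (c ∘ suc) (v ∘ suc))

          cycles : Fin h → Cyc
          cycles i = cycle (us i) (proj₁ (us-closed i)) (proj₂ (us-closed i))

          -- A relation in homology makes a combination of `us` equal to some ∂ z. Multiplied by the
          -- denominator `d`, this is a combination of `∂ ∘ J₀.preimage` and hence of `F`, so
          -- freshness applies and `d` cancels.
          cycles-independent : LinearlyIndependent H cycles
          cycles-independent c (by z z∈ e) with J₀.spans z∈
          ... | d , a , d≉0 , p = λ i → cancelˡ d≉0 (us-fresh (λ i → d * c i) b relation i)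
            where
            b : Fin (J₁.rank ℕ.+ J₀.rank) → ∣K∣
            b = (λ _ → 0#) ++ λ j → - 1# * a j
            b-combination : combination b F ≈ᴹ -ᴹ combination a (∂ ∘ J₀.preimage)
            b-combination = begin
              combination b F
                ≈⟨ combination-++ b J₁.preimage (∂ ∘ J₀.preimage) ⟩
              combination (b ∘ (_↑ˡ J₀.rank)) J₁.preimage +ᴹ combination (b ∘ (J₁.rank ↑ʳ_)) (∂ ∘ J₀.preimage)
                ≈⟨ +ᴹ-cong
                     (combination-0 J₁.preimage λ i → reflexive (lookup-++ˡ (λ _ → 0#) (λ j → - 1# * a j) i))
                     (∑-cong {J₀.rank} λ j → *ₗ-congʳ (reflexive (lookup-++ʳ {m = J₁.rank} (λ _ → 0#) (λ j → - 1# * a j) j))) ⟩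
              0ᴹ +ᴹ combination (λ j → - 1# * a j) (∂ ∘ J₀.preimage)
                ≈⟨ ≈ᴹ-trans (+ᴹ-identityˡ _) (combination-* (- 1#) a (∂ ∘ J₀.preimage)) ⟩
              - 1# *ₗ combination a (∂ ∘ J₀.preimage)
                ≈⟨ inverseˡ-unique _ _ (≈ᴹ-trans (+ᴹ-congˡ (≈ᴹ-sym (*ₗ-identityˡ _)))
                     (≈ᴹ-trans (≈ᴹ-sym (*ₗ-distribʳ _ (- 1#) 1#)) (≈ᴹ-trans (*ₗ-congʳ (-‿inverseˡ 1#)) (*ₗ-zeroˡ _)))) ⟩
              -ᴹ combination a (∂ ∘ J₀.preimage) ∎
              where open import Algebra.Properties.AbelianGroup +ᴹ-abelianGroup using (inverseˡ-unique)
            relation : combination (λ i → d * c i) us +ᴹ combination b F ≈ᴹ 0ᴹ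
            relation = begin
              combination (λ i → d * c i) us +ᴹ combination b F
                ≈⟨ +ᴹ-cong (combination-* d c us) b-combination ⟩
              d *ₗ combination c us +ᴹ -ᴹ combination a (∂ ∘ J₀.preimage)
                ≈⟨ +ᴹ-congʳ (*ₗ-congˡ (≈ᴹ-trans (≈ᴹ-reflexive (≡.sym (chain-combination h c cycles)))
                     (≈ᴹ-trans e (+ᴹ-identityˡ _)))) ⟩
              d *ₗ ∂ z +ᴹ -ᴹ combination a (∂ ∘ J₀.preimage)
                ≈⟨ +ᴹ-congʳ p ⟩
              combination a (∂ ∘ J₀.preimage) +ᴹ -ᴹ combination a (∂ ∘ J₀.preimage)
                ≈⟨ -ᴹ‿inverseʳ _ ⟩
              0ᴹ ∎

          -- The representing chains are fresh over `F`: in a relation the coefficients on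
          -- `J₁.preimage` vanish, so the remaining terms show the combination of cycles to be a
          -- boundary. The size of the basis of C₁ then gives the bound.
          maximal : ∀ {s} (w : Fin s → Cyc) → LinearlyIndependent H w → s ℕ.≤ h
          maximal {s} w ind = ℕₚ.+-cancelʳ-≤ (J₁.rank ℕ.+ J₀.rank) s h
            (ℕₚ.≤-trans (size-≤ (chain ∘ w) (Cycle.member ∘ w)
              (fresh-independent coordinates (λ v → v) F F-independent (chain ∘ w) w-fresh)) (ℕₚ.≤-reflexive (≡.sym h+ranks)))
            where
            w-fresh : Fresh coordinates (λ v → v) F F-independent (chain ∘ w)
            w-fresh c b e = ind c (by bounding bounding-member (begin
                chain (MonoidSum.sum (LeftModule.+ᴹ-commutativeMonoid H) (λ i → LeftModule._*ₗ_ H (c i) (w i)))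
                  ≈⟨ ≈ᴹ-reflexive (chain-combination s c w) ⟩
                combination c (chain ∘ w)
                  ≈⟨ inverseˡ-unique _ _ (≈ᴹ-trans (+ᴹ-congˡ (≈ᴹ-sym second)) e′) ⟩
                -ᴹ ∂ (combination β J₀.preimage)
                  ≈⟨ -ᴹ-homo _ ⟨
                ∂ bounding
                  ≈⟨ +ᴹ-identityˡ _ ⟨
                0ᴹ +ᴹ ∂ bounding ∎))
              where
              open import Algebra.Properties.AbelianGroup +ᴹ-abelianGroup using (inverseˡ-unique)
              α = b ∘ (_↑ˡ J₀.rank)
              β = b ∘ (J₁.rank ↑ʳ_)
              e′ : combination c (chain ∘ w) +ᴹ (combination α J₁.preimage +ᴹ combination β (∂ ∘ J₀.preimage)) ≈ᴹ 0ᴹ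
              e′ = ≈ᴹ-trans (+ᴹ-congˡ (≈ᴹ-sym (combination-++ b J₁.preimage (∂ ∘ J₀.preimage)))) e
              closed : ∂ (combination c (chain ∘ w)) ≈ᴹ 0ᴹ
              closed = ≈ᴹ-trans (∂-combination s c (chain ∘ w))
                (∑-0 {s} λ i → ≈ᴹ-trans (*ₗ-congˡ (Cycle.closed (w i))) (*ₗ-zeroʳ (c i)))
              second : combination α J₁.preimage +ᴹ combination β (∂ ∘ J₀.preimage) ≈ᴹ ∂ (combination β J₀.preimage)
              second = ≈ᴹ-trans (+ᴹ-cong
                (combination-0 J₁.preimage (coefficients-vanish (combination c (chain ∘ w)) closed α β e′))
                (≈ᴹ-sym (∂-combination J₀.rank β J₀.preimage))) (+ᴹ-identityˡ _)
              bounding : Carrierᴹ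
              bounding = -ᴹ combination β J₀.preimage
              C₀-combination : ∀ r (a : Fin r → ∣K∣) (v : Family r) → (∀ i → C₀.Member (v i)) → C₀.Member (combination a v)
              C₀-combination zero    a v m = C₀.0-mem
              C₀-combination (suc r) a v m =
                C₀.+-mem (C₀.*-mem (a zero) (m zero)) (C₀-combination r (a ∘ suc) (v ∘ suc) (m ∘ suc))
              bounding-member : C₀.Member bounding
              bounding-member = C₀.neg-mem (C₀-combination J₀.rank β J₀.preimage J₀.member)

          hasRank : HasRank H h
          hasRank = (cycles , cycles-independent) , maximal

-- Euler characteristics, state sums and graded ranks

module Count where

  open import Algebra.Bundles using (CommutativeRing)
  open import Data.Bool.Base using (Bool; true; false; if_then_else_; _∧_)
  open import Data.Fin.Base as Fin using (Fin; zero; suc; toℕ)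
  open import Data.Fin.Subset using (∣_∣)
  open import Data.Integer.Base as ℤ using (ℤ; +_)
  import Data.Integer.Properties as ℤₚ
  open import Algebra.Properties.AbelianGroup ℤₚ.+-0-abelianGroup using (∙-cancelˡ)
  open import Data.Integer.Tactic.RingSolver using (solve-∀)
  open import Data.List.Base as List using (List; []; _∷_; _++_; length; filter; allFin)
  open import Data.Nat.Base as ℕ using (ℕ; zero; suc; NonZero; parity; ⌊_/2⌋; s≤s)
  open import Data.Nat.DivMod using (_mod_)
  open import Data.Nat.Tactic.RingSolver using () renaming (solve-∀ to ℕ-solve-∀)
  import Data.Nat.Properties as ℕₚ
  open import Data.Parity.Base using (0ℙ; 1ℙ)
  open import Data.Product.Base using (_×_; _,_; proj₁; proj₂)
  open import Data.Vec.Base using (Vec; []; _∷_)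
  open import Function.Base using (_∘_; id)
  open import Level using (0ℓ)
  open import Relation.Binary.PropositionalEquality as ≡ using (_≡_; _≢_; refl; sym; trans; cong; cong₂)
  open import Relation.Nullary using (Dec; does)
  open import Relation.Nullary.Decidable using (dec-true; dec-false)
  open import Defs
  open Sums
  open Tensor using (double-half; half-odd; if-even-elim)
  open Grading using (mod-shift; bOrder-2)

  open FiniteSums ℤₚ.+-0-commutativeMonoid
  open ≡.≡-Reasoning

  infixr 7 _⟨_⟩
  _⟨_⟩ : Bool → ℤ → ℤ
  b ⟨ x ⟩ = if b then x else + 0

  module _ {X : Set} where

    total : (X → ℤ) → List X → ℤ
    total f []       = + 0
    total f (x ∷ xs) = f x ℤ.+ total f xs

    total-cong : ∀ {f g} → (∀ x → f x ≡ g x) → ∀ xs → total f xs ≡ total g xs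
    total-cong e []       = refl
    total-cong e (x ∷ xs) = cong₂ ℤ._+_ (e x) (total-cong e xs)

    total-++ : ∀ f xs ys → total f (xs ++ ys) ≡ total f xs ℤ.+ total f ys
    total-++ f []       ys = sym (ℤₚ.+-identityˡ _)
    total-++ f (x ∷ xs) ys = trans (cong (λ z → f x ℤ.+ z) (total-++ f xs ys)) (sym (ℤₚ.+-assoc (f x) _ _))

    total-* : ∀ c f xs → total (λ x → c ℤ.* f x) xs ≡ c ℤ.* total f xs
    total-* c f []       = sym (ℤₚ.*-zeroʳ c)
    total-* c f (x ∷ xs) = trans (cong (λ z → c ℤ.* f x ℤ.+ z) (total-* c f xs)) (sym (ℤₚ.*-distribˡ-+ c (f x) _))

  total-map : ∀ {X Y : Set} (h : X → Y) f xs → total f (List.map h xs) ≡ total (f ∘ h) xs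
  total-map h f []       = refl
  total-map h f (x ∷ xs) = cong (λ z → f (h x) ℤ.+ z) (total-map h f xs)

  total-cartesianProductWith : ∀ {X Y Z : Set} (h : X → Y → Z) f xs ys →
    total f (List.cartesianProductWith h xs ys) ≡ total (λ x → total (λ y → f (h x y)) ys) xs
  total-cartesianProductWith h f []       ys = refl
  total-cartesianProductWith h f (x ∷ xs) ys = trans (total-++ f (List.map (h x) ys) _)
    (cong₂ ℤ._+_ (total-map (h x) f ys) (total-cartesianProductWith h f xs ys))

  total-concatMap : ∀ {X Y : Set} (h : X → List Y) f xs → total f (List.concatMap h xs) ≡ total (λ x → total f (h x)) xs
  total-concatMap h f []       = refl
  total-concatMap h f (x ∷ xs) = trans (total-++ f (h x) (List.concatMap h xs))
    (cong (λ z → total f (h x) ℤ.+ z) (total-concatMap h f xs))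

  total-tabulate : ∀ {X : Set} k (h : Fin k → X) f → total f (List.tabulate h) ≡ sum λ i → f (h i)
  total-tabulate zero    h f = refl
  total-tabulate (suc k) h f = cong (λ z → f (h zero) ℤ.+ z) (total-tabulate k (h ∘ suc) f)

  alternating : ℕ → (ℕ → ℤ) → ℤ
  alternating zero    f = + 0
  alternating (suc m) f = f 0 ℤ.- alternating m (f ∘ suc)

  sign : ℕ → ℤ
  sign zero    = + 1
  sign (suc k) = ℤ.- sign k

  alternating-cong : ∀ m {f g} → (∀ i → f i ≡ g i) → alternating m f ≡ alternating m g
  alternating-cong zero    e = refl
  alternating-cong (suc m) e = cong₂ ℤ._-_ (e 0) (alternating-cong m (e ∘ suc))

  alternating-+ : ∀ m f g → alternating m (λ i → f i ℤ.+ g i) ≡ alternating m f ℤ.+ alternating m g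
  alternating-+ zero    f g = refl
  alternating-+ (suc m) f g = trans (cong (λ x → f 0 ℤ.+ g 0 ℤ.- x) (alternating-+ m (f ∘ suc) (g ∘ suc)))
    (rearrange (f 0) (g 0) (alternating m (f ∘ suc)) (alternating m (g ∘ suc)))
    where
    rearrange : ∀ a b c d → a ℤ.+ b ℤ.- (c ℤ.+ d) ≡ a ℤ.- c ℤ.+ (b ℤ.- d)
    rearrange = solve-∀

  alternating-0 : ∀ m → alternating m (λ _ → + 0) ≡ + 0
  alternating-0 zero    = refl
  alternating-0 (suc m) = cong (λ z → + 0 ℤ.- z) (alternating-0 m)

  alternating-at : ∀ m w → w ℕ.< m → alternating m (λ i → does (w ℕₚ.≟ i) ⟨ + 1 ⟩) ≡ sign w
  alternating-at (suc m) zero    _         = cong (λ x → + 1 ℤ.- x) (alternating-0 m)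
  alternating-at (suc m) (suc w) (s≤s w<m) = trans (cong (λ z → + 0 ℤ.- z) (alternating-at m w w<m)) (ℤₚ.+-identityˡ _)

  length-filter : ∀ {X : Set} {P : X → Set} (P? : ∀ x → Dec (P x)) xs → + length (filter P? xs) ≡ total (λ x → does (P? x) ⟨ + 1 ⟩) xs
  length-filter P? []       = refl
  length-filter P? (x ∷ xs) with does (P? x)
  ... | true  = trans (ℤₚ.pos-+ 1 (length (filter P? xs))) (cong (λ z → + 1 ℤ.+ z) (length-filter P? xs))
  ... | false = trans (length-filter P? xs) (sym (ℤₚ.+-identityˡ _))

  alternating-count : ∀ {X : Set} m (w : X → ℕ) (q : X → Bool) xs → (∀ x → w x ℕ.< m) →
    alternating m (λ i → total (λ x → (does (w x ℕₚ.≟ i) ∧ q x) ⟨ + 1 ⟩) xs) ≡ total (λ x → q x ⟨ sign (w x) ⟩) xs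
  alternating-count m w q []       w<m = alternating-0 m
  alternating-count m w q (x ∷ xs) w<m = trans
    (alternating-+ m (λ i → (does (w x ℕₚ.≟ i) ∧ q x) ⟨ + 1 ⟩) (λ i → total (λ x → (does (w x ℕₚ.≟ i) ∧ q x) ⟨ + 1 ⟩) xs))
    (cong₂ ℤ._+_ (at (q x)) (alternating-count m w q xs w<m))
    where
    at : ∀ b → alternating m (λ i → (does (w x ℕₚ.≟ i) ∧ b) ⟨ + 1 ⟩) ≡ b ⟨ sign (w x) ⟩
    at true  = trans (alternating-cong m λ i → cong (_⟨ + 1 ⟩) (∧-true (does (w x ℕₚ.≟ i)))) (alternating-at m (w x) (w<m x))
      where
      ∧-true : ∀ b → b ∧ true ≡ b
      ∧-true true  = refl
      ∧-true false = refl
    at false = trans (alternating-cong m λ i → cong (_⟨ + 1 ⟩) (∧-false (does (w x ℕₚ.≟ i)))) (alternating-0 m)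
      where
      ∧-false : ∀ b → b ∧ false ≡ false
      ∧-false true  = refl
      ∧-false false = refl

  states : ∀ ℓ → List (State ℓ)
  states zero    = [] ∷ []
  states (suc ℓ) = List.map (false ∷_) (states ℓ) ++ List.map (true ∷_) (states ℓ)

  -- Each 1-smoothing contributes one minus sign, so the skein recursion unfolds to a signed sum
  -- over states, the shape in which an Euler characteristic can be recognised.
  resolve-total : ∀ n .{{_ : NonZero n}} ℓ value g →
    resolve n ℓ value g ≡ total (λ α → sign ∣ α ∣ ℤ.* value α g) (states ℓ)
  resolve-total n zero    value g = sym (trans (ℤₚ.+-identityʳ _) (ℤₚ.*-identityˡ (value [] g)))
  resolve-total n (suc ℓ) value g = begin
    resolve n ℓ (λ α → value (false ∷ α)) g ℤ.- resolve n ℓ (λ α → value (true ∷ α)) g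
      ≡⟨ cong₂ ℤ._-_ (resolve-total n ℓ _ g) (resolve-total n ℓ _ g) ⟩
    total (λ α → sign ∣ α ∣ ℤ.* value (false ∷ α) g) (states ℓ) ℤ.- total (λ α → sign ∣ α ∣ ℤ.* value (true ∷ α) g) (states ℓ)
      ≡⟨ cong₂ ℤ._+_ (sym (total-map (false ∷_) _ (states ℓ))) (trans negate (sym (total-map (true ∷_) _ (states ℓ)))) ⟩
    total (λ α → sign ∣ α ∣ ℤ.* value α g) (List.map (false ∷_) (states ℓ)) ℤ.+
      total (λ α → sign ∣ α ∣ ℤ.* value α g) (List.map (true ∷_) (states ℓ))
      ≡⟨ total-++ _ (List.map (false ∷_) (states ℓ)) _ ⟨
    total (λ α → sign ∣ α ∣ ℤ.* value α g) (states (suc ℓ)) ∎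
    where
    negate : ℤ.- total (λ α → sign ∣ α ∣ ℤ.* value (true ∷ α) g) (states ℓ) ≡
      total (λ α → ℤ.- sign ∣ α ∣ ℤ.* value (true ∷ α) g) (states ℓ)
    negate = trans (sym (ℤₚ.-1*i≡-i _)) (trans (sym (total-* (ℤ.- + 1) _ (states ℓ)))
      (total-cong (λ α → trans (ℤₚ.-1*i≡-i (sign ∣ α ∣ ℤ.* value (true ∷ α) g))
        (ℤₚ.neg-distribˡ-* (sign ∣ α ∣) (value (true ∷ α) g))) (states ℓ)))

  -- Telescoping: the ranks r cancel in the Euler characteristic.
  telescope : ∀ m (h c r : ℕ → ℕ) ρ → r m ≡ 0 → h 0 ℕ.+ (r 0 ℕ.+ ρ) ≡ c 0 →
    (∀ i → h (suc i) ℕ.+ (r (suc i) ℕ.+ r i) ≡ c (suc i)) →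
    alternating (suc m) (+_ ∘ c) ≡ alternating (suc m) (+_ ∘ h) ℤ.+ + ρ
  telescope zero h c r ρ r≡0 e₀ e = begin
    + c 0 ℤ.- + 0                    ≡⟨ cong (λ x → + x ℤ.- + 0) (trans (sym e₀) (cong (λ x → h 0 ℕ.+ (x ℕ.+ ρ)) r≡0)) ⟩
    + (h 0 ℕ.+ ρ) ℤ.- + 0            ≡⟨ cong (ℤ._- + 0) (ℤₚ.pos-+ (h 0) ρ) ⟩
    + h 0 ℤ.+ + ρ ℤ.- + 0            ≡⟨ rearrange (+ h 0) (+ ρ) ⟩
    + h 0 ℤ.- + 0 ℤ.+ + ρ            ∎
    where
    rearrange : ∀ a b → a ℤ.+ b ℤ.- + 0 ≡ a ℤ.- + 0 ℤ.+ b
    rearrange = solve-∀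
  telescope (suc m) h c r ρ r≡0 e₀ e = begin
    + c 0 ℤ.- alternating (suc m) (+_ ∘ c ∘ suc)
      -- The rank of the differential leaving one degree becomes the incoming rank `ρ` of the next.
      ≡⟨ cong₂ (λ x y → + x ℤ.- y) (sym e₀) (telescope m (h ∘ suc) (c ∘ suc) (r ∘ suc) (r 0) r≡0 (e 0) (e ∘ suc)) ⟩
    + (h 0 ℕ.+ (r 0 ℕ.+ ρ)) ℤ.- (alternating (suc m) (+_ ∘ h ∘ suc) ℤ.+ + r 0)
      ≡⟨ cong (λ x → x ℤ.- (alternating (suc m) (+_ ∘ h ∘ suc) ℤ.+ + r 0)) (trans (ℤₚ.pos-+ (h 0) (r 0 ℕ.+ ρ)) (cong (λ z → + h 0 ℤ.+ z) (ℤₚ.pos-+ (r 0) ρ))) ⟩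
    + h 0 ℤ.+ (+ r 0 ℤ.+ + ρ) ℤ.- (alternating (suc m) (+_ ∘ h ∘ suc) ℤ.+ + r 0)
      ≡⟨ rearrange (+ h 0) (+ r 0) (+ ρ) (alternating (suc m) (+_ ∘ h ∘ suc)) ⟩
    + h 0 ℤ.- alternating (suc m) (+_ ∘ h ∘ suc) ℤ.+ + ρ ∎
    where
    rearrange : ∀ a b c d → a ℤ.+ (b ℤ.+ c) ℤ.- (d ℤ.+ b) ≡ a ℤ.- d ℤ.+ c
    rearrange = solve-∀

  range : ℕ → (ℕ → ℤ) → ℤ
  range k f = ∑[ i < k ] f (toℕ i)

  range-cong : ∀ k {f g} → (∀ i → f i ≡ g i) → range k f ≡ range k g
  range-cong k e = sum-cong-≗ {k} λ i → e (toℕ i)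

  range-+ : ∀ p q f → range (p ℕ.+ q) f ≡ range p f ℤ.+ range q (λ i → f (p ℕ.+ i))
  range-+ zero    q f = sym (ℤₚ.+-identityˡ _)
  range-+ (suc p) q f = trans (cong (λ z → f 0 ℤ.+ z) (range-+ p q (f ∘ suc))) (sym (ℤₚ.+-assoc (f 0) _ _))

  range-last : ∀ k f → range (suc k) f ≡ range k f ℤ.+ f k
  range-last k f = trans (cong (λ m → range m f) (ℕₚ.+-comm 1 k)) (trans (range-+ k 1 f)
    (cong (λ z → range k f ℤ.+ z) (trans (ℤₚ.+-identityʳ _) (cong f (ℕₚ.+-identityʳ k)))))

  range-rotate : ∀ k f → f k ≡ f 0 → range k (f ∘ suc) ≡ range k f
  range-rotate k f e = ∙-cancelˡ (f 0) _ _ (trans (range-last k f)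
    (trans (cong (λ z → range k f ℤ.+ z) e) (ℤₚ.+-comm (range k f) (f 0))))

  range-interleave : ∀ h f → range (h ℕ.+ h) f ≡ range h (λ i → f (2 ℕ.* i)) ℤ.+ range h (λ i → f (suc (2 ℕ.* i)))
  range-interleave zero    f = refl
  range-interleave (suc h) f = begin
    f 0 ℤ.+ range (h ℕ.+ suc h) (λ i → f (suc i))
      ≡⟨ cong (λ k → f 0 ℤ.+ range k (λ i → f (suc i))) (ℕₚ.+-suc h h) ⟩
    f 0 ℤ.+ (f 1 ℤ.+ range (h ℕ.+ h) (λ i → f (suc (suc i))))
      ≡⟨ cong (λ x → f 0 ℤ.+ (f 1 ℤ.+ x)) (range-interleave h (λ i → f (suc (suc i)))) ⟩
    f 0 ℤ.+ (f 1 ℤ.+ (range h (λ i → f (2 ℕ.+ 2 ℕ.* i)) ℤ.+ range h (λ i → f (3 ℕ.+ 2 ℕ.* i))))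
      ≡⟨ rearrange (f 0) (f 1) (range h (λ i → f (2 ℕ.+ 2 ℕ.* i))) (range h (λ i → f (3 ℕ.+ 2 ℕ.* i))) ⟩
    (f 0 ℤ.+ range h (λ i → f (2 ℕ.+ 2 ℕ.* i))) ℤ.+ (f 1 ℤ.+ range h (λ i → f (3 ℕ.+ 2 ℕ.* i)))
      ≡⟨ cong₂ (λ x y → (f 0 ℤ.+ x) ℤ.+ (f 1 ℤ.+ y))
           (range-cong h λ i → cong f (twice i)) (range-cong h λ i → cong (λ a → f (suc a)) (twice i)) ⟨
    range (suc h) (λ i → f (2 ℕ.* i)) ℤ.+ range (suc h) (λ i → f (suc (2 ℕ.* i))) ∎
    where
    rearrange : ∀ a b c d → a ℤ.+ (b ℤ.+ (c ℤ.+ d)) ≡ (a ℤ.+ c) ℤ.+ (b ℤ.+ d)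
    rearrange = solve-∀
    twice : ∀ i → 2 ℕ.* suc i ≡ 2 ℕ.+ 2 ℕ.* i
    twice i = cong suc (ℕₚ.+-suc i (i ℕ.+ 0))

  module _ (n : ℕ) .{{_ : NonZero n}} where

    private
      B : ℕ
      B = bOrder (parity n)

    ∑ᴰ : (Degree n → ℤ) → ℤ
    ∑ᴰ f = ∑[ a < n ] ∑[ ε < B ] f (a , ε)

    ∑ᴰ-cong : ∀ {f g} → (∀ h → f h ≡ g h) → ∑ᴰ f ≡ ∑ᴰ g
    ∑ᴰ-cong e = sum-cong-≗ {n} λ a → sum-cong-≗ {B} λ ε → e (a , ε)

    ∑ᴰ-+ : ∀ f g → ∑ᴰ (λ h → f h ℤ.+ g h) ≡ ∑ᴰ f ℤ.+ ∑ᴰ g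
    ∑ᴰ-+ f g = trans (sum-cong-≗ {n} λ a → ∑-distrib-+ {B} (λ ε → f (a , ε)) (λ ε → g (a , ε)))
      (∑-distrib-+ {n} (λ a → ∑[ ε < B ] f (a , ε)) (λ a → ∑[ ε < B ] g (a , ε)))

    ∑ᴰ-0 : ∀ {f} → (∀ h → f h ≡ + 0) → ∑ᴰ f ≡ + 0
    ∑ᴰ-0 e = sum-ε {n} λ a → sum-ε {B} λ ε → e (a , ε)

    ∑ᴰ-single : ∀ h {f} → (∀ h′ → h′ ≢ h → f h′ ≡ + 0) → ∑ᴰ f ≡ f h
    ∑ᴰ-single (a , ε) {f} e = trans
      (sum-single {n} a λ a′ a′≢a → sum-ε {B} λ ε′ → e (a′ , ε′) (a′≢a ∘ cong proj₁))
      (sum-single {B} ε λ ε′ ε′≢ε → e (a , ε′) (ε′≢ε ∘ cong proj₂))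

    indicator : Degree n → Degree n → ℤ
    indicator g h = does (g ≟ᵈ h) ⟨ + 1 ⟩

    ∑ᴰ-indicator : ∀ d (f : Degree n → ℤ → ℤ) → (∀ h → f h (+ 0) ≡ + 0) → ∑ᴰ (λ h → f h (indicator d h)) ≡ f d (+ 1)
    ∑ᴰ-indicator d f f0 = trans (∑ᴰ-single d λ h h≢d → trans
        (cong (λ b → f h (b ⟨ + 1 ⟩)) (dec-false (d ≟ᵈ h) (h≢d ∘ sym))) (f0 h))
      (cong (λ b → f d (b ⟨ + 1 ⟩)) (dec-true (d ≟ᵈ d) refl))

    ⊛-cong : ∀ {f f′ k k′ : ℤ[𝒢] n} → (∀ h → f h ≡ f′ h) → (∀ h → k h ≡ k′ h) → ∀ g → (f ⊛ k) g ≡ (f′ ⊛ k′) g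
    ⊛-cong e e′ g = ∑ᴰ-cong λ h → ∑ᴰ-cong λ h′ → cong (λ x → does ((h ⊕ h′) ≟ᵈ g) ⟨ x ⟩) (cong₂ ℤ._*_ (e h) (e′ h′))

    ⟨⟩-+ : ∀ b x y → b ⟨ x ℤ.+ y ⟩ ≡ b ⟨ x ⟩ ℤ.+ b ⟨ y ⟩
    ⟨⟩-+ true  x y = refl
    ⟨⟩-+ false x y = refl

    ⟨⟩-0 : ∀ b → b ⟨ + 0 ⟩ ≡ + 0
    ⟨⟩-0 true  = refl
    ⟨⟩-0 false = refl

    module _ {X : Set} (φ : X → Degree n) where

      -- The graded rank of a free module whose basis `xs` has degrees given by `φ`.
      degrees : List X → ℤ[𝒢] n
      degrees xs h = total (λ x → indicator (φ x) h) xs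

      degrees-⊛ : ∀ xs (f : ℤ[𝒢] n) g →
        (degrees xs ⊛ f) g ≡ total (λ x → ∑ᴰ λ h → does ((φ x ⊕ h) ≟ᵈ g) ⟨ f h ⟩) xs
      degrees-⊛ xs f g = go xs
        where
        row : Degree n → ℤ → ℤ
        row h c = ∑ᴰ λ h′ → does ((h ⊕ h′) ≟ᵈ g) ⟨ c ℤ.* f h′ ⟩
        row-+ : ∀ h c d → row h (c ℤ.+ d) ≡ row h c ℤ.+ row h d
        row-+ h c d = trans (∑ᴰ-cong λ h′ → trans (cong (does ((h ⊕ h′) ≟ᵈ g) ⟨_⟩) (ℤₚ.*-distribʳ-+ (f h′) c d))
          (⟨⟩-+ (does ((h ⊕ h′) ≟ᵈ g)) (c ℤ.* f h′) (d ℤ.* f h′))) (∑ᴰ-+ _ _)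
        row-0 : ∀ h → row h (+ 0) ≡ + 0
        row-0 h = ∑ᴰ-0 λ h′ → trans (cong (does ((h ⊕ h′) ≟ᵈ g) ⟨_⟩) (ℤₚ.*-zeroˡ (f h′))) (⟨⟩-0 (does ((h ⊕ h′) ≟ᵈ g)))
        go : ∀ xs → ∑ᴰ (λ h → row h (degrees xs h)) ≡ total (λ x → ∑ᴰ λ h → does ((φ x ⊕ h) ≟ᵈ g) ⟨ f h ⟩) xs
        go []       = ∑ᴰ-0 row-0
        go (x ∷ xs) = trans (∑ᴰ-cong λ h → row-+ h (indicator (φ x) h) (degrees xs h))
          (trans (∑ᴰ-+ (λ h → row h (indicator (φ x) h)) (λ h → row h (degrees xs h)))
            (cong₂ ℤ._+_ (trans (∑ᴰ-indicator (φ x) row row-0)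
              (∑ᴰ-cong λ h → cong (does ((φ x ⊕ h) ≟ᵈ g) ⟨_⟩) (ℤₚ.*-identityˡ (f h)))) (go xs)))

      ∑ᴰ-degrees : ∀ (q : Degree n → Bool) xs → ∑ᴰ (λ h → q h ⟨ degrees xs h ⟩) ≡ total (λ x → q (φ x) ⟨ + 1 ⟩) xs
      ∑ᴰ-degrees q []       = ∑ᴰ-0 λ h → ⟨⟩-0 (q h)
      ∑ᴰ-degrees q (x ∷ xs) = trans (∑ᴰ-cong λ h → ⟨⟩-+ (q h) (indicator (φ x) h) (degrees xs h))
        (trans (∑ᴰ-+ (λ h → q h ⟨ indicator (φ x) h ⟩) (λ h → q h ⟨ degrees xs h ⟩))
          (cong₂ ℤ._+_ (∑ᴰ-indicator (φ x) (λ h c → q h ⟨ c ⟩) (⟨⟩-0 ∘ q)) (∑ᴰ-degrees q xs)))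

    module _ (g : Degree n) where

      private
        F : ℕ → ℕ → ℤ
        F a ε = (q^ a b^ ε) g

        F-period : ∀ a ε → F (a ℕ.+ n) ε ≡ F a ε
        F-period a ε = cong (λ x → does ((x , ε mod B) ≟ᵈ g) ⟨ + 1 ⟩)
          (trans (cong (λ m → (a ℕ.+ m) mod n) (sym (ℕₚ.*-identityˡ n))) (mod-shift 1 a n))

        F-2 : ∀ a → F a 2 ≡ F a 0
        F-2 a = cong (λ x → does ((a mod n , x) ≟ᵈ g) ⟨ + 1 ⟩) (bOrder-2 (parity n) 0)

        F-1 : parity n ≡ 1ℙ → ∀ a → F a 1 ≡ F a 0
        F-1 e a = cong (λ x → does ((a mod n , x) ≟ᵈ g) ⟨ + 1 ⟩) (bOrder-1 e)
          where open Grading using (bOrder-1)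

        -- The coefficient at `g` of the graded rank of V, arranged by the power of y.
        monomials : ℤ
        monomials = range n (λ i → F (2 ℕ.* i ℕ.+ 0) 0) ℤ.+ (range n (λ i → F (2 ℕ.* i ℕ.+ 1) 1) ℤ.+ range n (λ i → F (2 ℕ.* i ℕ.+ 2) 2))

        -- For i below n the number 2i runs twice through the even residues. The powers y⁰ and y²
        -- both yield 2X, the latter after a cyclic shift and b² = 1, and y yields 2Y.
        even : parity n ≡ 0ℙ → monomials ≡
          + 2 ℤ.* (∑[ i < ⌊ n /2⌋ ] (+ 2 ℤ.* F (2 ℕ.* toℕ i) 0 ℤ.+ F (suc (2 ℕ.* toℕ i)) 1))
        even e = begin
          monomials
            ≡⟨ cong₂ ℤ._+_ x⁰ (cong₂ ℤ._+_ x¹ x²) ⟩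
          (X ℤ.+ X) ℤ.+ ((Y ℤ.+ Y) ℤ.+ (X ℤ.+ X))
            ≡⟨ rearrange X Y ⟩
          + 2 ℤ.* (+ 2 ℤ.* X ℤ.+ Y)
            ≡⟨ cong (λ z → + 2 ℤ.* z) (trans (∑-distrib-+ {h} (λ i → + 2 ℤ.* F (2 ℕ.* toℕ i) 0) _)
                 (cong (λ z → z ℤ.+ Y) (sym (*-distribˡ-sum (+ 2) λ (i : Fin h) → F (2 ℕ.* toℕ i) 0)))) ⟨
          + 2 ℤ.* (∑[ i < h ] (+ 2 ℤ.* F (2 ℕ.* toℕ i) 0 ℤ.+ F (suc (2 ℕ.* toℕ i)) 1)) ∎
          where
          open import Algebra.Properties.Semiring.Sum ℤₚ.+-*-semiring using (*-distribˡ-sum)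
          h : ℕ
          h = ⌊ n /2⌋
          X Y : ℤ
          X = range h λ i → F (2 ℕ.* i) 0
          Y = range h λ i → F (suc (2 ℕ.* i)) 1
          rearrange : ∀ x y → (x ℤ.+ x) ℤ.+ ((y ℤ.+ y) ℤ.+ (x ℤ.+ x)) ≡ + 2 ℤ.* (+ 2 ℤ.* x ℤ.+ y)
          rearrange = solve-∀
          halves : ∀ f → (∀ i → f (h ℕ.+ i) ≡ f i) → range n f ≡ range h f ℤ.+ range h f
          halves f e′ = trans (cong (λ m → range m f) (sym (double-half n e)))
            (trans (range-+ h h f) (cong (λ z → range h f ℤ.+ z) (range-cong h e′)))
          period : ∀ i j ε → F (2 ℕ.* (h ℕ.+ i) ℕ.+ j) ε ≡ F (2 ℕ.* i ℕ.+ j) ε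
          period i j ε = trans (cong (λ a → F a ε) (trans (double h i j) (cong (2 ℕ.* i ℕ.+ j ℕ.+_) (double-half n e))))
            (F-period (2 ℕ.* i ℕ.+ j) ε)
            where
            double : ∀ h i j → 2 ℕ.* (h ℕ.+ i) ℕ.+ j ≡ 2 ℕ.* i ℕ.+ j ℕ.+ (h ℕ.+ h)
            double = ℕ-solve-∀
          x⁰ : range n (λ i → F (2 ℕ.* i ℕ.+ 0) 0) ≡ X ℤ.+ X
          x⁰ = trans (halves _ λ i → period i 0 0) (cong₂ ℤ._+_ simplify simplify)
            where
            simplify : range h (λ i → F (2 ℕ.* i ℕ.+ 0) 0) ≡ X
            simplify = range-cong h λ i → cong (λ a → F a 0) (ℕₚ.+-identityʳ (2 ℕ.* i))
          x¹ : range n (λ i → F (2 ℕ.* i ℕ.+ 1) 1) ≡ Y ℤ.+ Y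
          x¹ = trans (halves _ λ i → period i 1 1) (cong₂ ℤ._+_ simplify simplify)
            where
            simplify : range h (λ i → F (2 ℕ.* i ℕ.+ 1) 1) ≡ Y
            simplify = range-cong h λ i → cong (λ a → F a 1) (ℕₚ.+-comm (2 ℕ.* i) 1)
          x² : range n (λ i → F (2 ℕ.* i ℕ.+ 2) 2) ≡ X ℤ.+ X
          x² = trans (range-cong n λ i → trans (F-2 (2 ℕ.* i ℕ.+ 2)) (cong (λ a → F a 0) (next i)))
            (trans (range-rotate n (λ i → F (2 ℕ.* i ℕ.+ 0) 0) wrap) x⁰)
            where
            next : ∀ i → 2 ℕ.* i ℕ.+ 2 ≡ 2 ℕ.* suc i ℕ.+ 0
            next = ℕ-solve-∀
            wrap : F (2 ℕ.* n ℕ.+ 0) 0 ≡ F 0 0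
            wrap = trans (cong (λ a → F a 0) (twice n)) (trans (F-period n 0) (F-period 0 0))
              where
              twice : ∀ n → 2 ℕ.* n ℕ.+ 0 ≡ n ℕ.+ n
              twice = ℕ-solve-∀

        -- Doubling permutes the residues modulo an odd n: the first half gives the even ones and
        -- the second half wraps around to the odd ones. With b trivial, the three powers of y
        -- contribute equally.
        odd : parity n ≡ 1ℙ → monomials ≡ + 3 ℤ.* (∑[ i < n ] F (toℕ i) 0)
        odd e = begin
          monomials
            ≡⟨ cong₂ ℤ._+_ (shifted 0) (cong₂ ℤ._+_
                 (trans (range-cong n λ i → F-1 e (2 ℕ.* i ℕ.+ 1)) (shifted 1))
                 (trans (range-cong n λ i → F-2 (2 ℕ.* i ℕ.+ 2)) (shifted 2))) ⟩
          X ℤ.+ (X ℤ.+ X)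
            ≡⟨ rearrange X ⟩
          + 3 ℤ.* X ∎
          where
          X : ℤ
          X = range n λ i → F i 0
          rearrange : ∀ x → x ℤ.+ (x ℤ.+ x) ≡ + 3 ℤ.* x
          rearrange = solve-∀
          h : ℕ
          h = ⌊ n ℕ.∸ 1 /2⌋
          n≡ : n ≡ suc (h ℕ.+ h)
          n≡ = trans (sym (ℕₚ.m+[n∸m]≡n (ℕ.>-nonZero⁻¹ n))) (cong suc (sym (half-odd n e)))
          doubled : ∀ (G : ℕ → ℤ) → (∀ a → G (a ℕ.+ n) ≡ G a) → range n (λ i → G (2 ℕ.* i)) ≡ range n G
          doubled G period = begin
            range n (λ i → G (2 ℕ.* i))
              ≡⟨ cong (λ m → range m (λ i → G (2 ℕ.* i))) n≡ ⟩
            range (suc h ℕ.+ h) (λ i → G (2 ℕ.* i))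
              ≡⟨ range-+ (suc h) h (λ i → G (2 ℕ.* i)) ⟩
            (G 0 ℤ.+ range h (λ i → G (2 ℕ.* suc i))) ℤ.+ range h (λ i → G (2 ℕ.* (suc h ℕ.+ i)))
              ≡⟨ cong₂ (λ x y → (G 0 ℤ.+ x) ℤ.+ y) (range-cong h λ i → cong G (twice i))
                   (range-cong h λ i → trans (cong G (trans (wrap h i) (cong (suc (2 ℕ.* i) ℕ.+_) (sym n≡)))) (period (suc (2 ℕ.* i)))) ⟩
            (G 0 ℤ.+ range h (λ i → G (suc (suc (2 ℕ.* i))))) ℤ.+ range h (λ i → G (suc (2 ℕ.* i)))
              ≡⟨ swap (G 0) _ _ ⟩
            G 0 ℤ.+ (range h (λ i → G (suc (2 ℕ.* i))) ℤ.+ range h (λ i → G (suc (suc (2 ℕ.* i)))))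
              ≡⟨ cong (λ z → G 0 ℤ.+ z) (sym (range-interleave h (G ∘ suc))) ⟩
            range (suc (h ℕ.+ h)) G
              ≡⟨ cong (λ m → range m G) (sym n≡) ⟩
            range n G ∎
            where
            twice : ∀ i → 2 ℕ.* suc i ≡ suc (suc (2 ℕ.* i))
            twice = ℕ-solve-∀
            wrap : ∀ h i → 2 ℕ.* (suc h ℕ.+ i) ≡ suc (2 ℕ.* i) ℕ.+ suc (h ℕ.+ h)
            wrap = ℕ-solve-∀
            swap : ∀ a b c → (a ℤ.+ b) ℤ.+ c ≡ a ℤ.+ (c ℤ.+ b)
            swap = solve-∀
          rotated : ∀ j → range n (λ i → F (i ℕ.+ j) 0) ≡ X
          rotated zero    = range-cong n λ i → cong (λ a → F a 0) (ℕₚ.+-identityʳ i)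
          rotated (suc j) = trans (range-cong n λ i → cong (λ a → F a 0) (ℕₚ.+-suc i j))
            (trans (range-rotate n (λ i → F (i ℕ.+ j) 0) (trans (cong (λ a → F a 0) (ℕₚ.+-comm n j)) (F-period j 0))) (rotated j))
          shifted : ∀ j → range n (λ i → F (2 ℕ.* i ℕ.+ j) 0) ≡ X
          shifted j = trans (doubled (λ a → F (a ℕ.+ j) 0) λ a → trans (cong (λ a → F a 0) (commute a n j)) (F-period (a ℕ.+ j) 0)) (rotated j)
            where
            commute : ∀ a n j → a ℕ.+ n ℕ.+ j ≡ a ℕ.+ j ℕ.+ n
            commute = ℕ-solve-∀

      circleValue-monomials : circleValue g ≡ monomials
      circleValue-monomials = if-even-elim (_≡ monomials) n (sym ∘ even) (sym ∘ odd)

    monomialDegree : Fin n × Fin 3 → Degree n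
    monomialDegree (i , j) = degree (2 ℕ.* toℕ i ℕ.+ toℕ j) (toℕ j)

    monomialList : List (Fin n × Fin 3)
    monomialList = List.cartesianProduct (allFin n) (allFin 3)

    circleValue-degrees : ∀ g → circleValue g ≡ degrees monomialDegree monomialList g
    circleValue-degrees g = trans (circleValue-monomials g) (sym (begin
      degrees monomialDegree monomialList g
        ≡⟨ trans (total-cartesianProductWith _,_ (λ x → indicator (monomialDegree x) g) (allFin n) (allFin 3))
             (total-tabulate n id _) ⟩
      ∑[ i < n ] (c 0 i ℤ.+ (c 1 i ℤ.+ (c 2 i ℤ.+ + 0)))
        ≡⟨ sum-cong-≗ {n} (λ i → cong (λ z → c 0 i ℤ.+ (c 1 i ℤ.+ z)) (ℤₚ.+-identityʳ (c 2 i))) ⟩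
      ∑[ i < n ] (c 0 i ℤ.+ (c 1 i ℤ.+ c 2 i))
        ≡⟨ trans (∑-distrib-+ {n} (c 0) (λ i → c 1 i ℤ.+ c 2 i)) (cong (λ z → sum (c 0) ℤ.+ z) (∑-distrib-+ {n} (c 1) (c 2))) ⟩
      sum (c 0) ℤ.+ (sum (c 1) ℤ.+ sum (c 2)) ∎))
      where
      c : ℕ → Fin n → ℤ
      c j i = (q^ 2 ℕ.* toℕ i ℕ.+ j b^ j) g

    module _ (R : CommutativeRing 0ℓ 0ℓ) (1/3n : CommutativeRing.Carrier R) where

      open Complex n R 1/3n using (Tensor; tensorDegree)

      tensors : ∀ k → List (Tensor k)
      tensors zero    = [] ∷ []
      tensors (suc k) = List.cartesianProductWith _∷_ monomialList (tensors k)

      -- Graded ranks multiply under tensor products, because the degree of a basis tensor is the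
      -- sum of the degrees of its factors.
      circleValue-tensors : ∀ k g → (circleValue ^⊛ k) g ≡ degrees tensorDegree (tensors k) g
      circleValue-tensors zero    g = sym (ℤₚ.+-identityʳ _)
      circleValue-tensors (suc k) g = begin
        (circleValue ⊛ (circleValue ^⊛ k)) g
          ≡⟨ ⊛-cong circleValue-degrees (circleValue-tensors k) g ⟩
        (degrees monomialDegree monomialList ⊛ degrees tensorDegree (tensors k)) g
          ≡⟨ degrees-⊛ monomialDegree monomialList (degrees tensorDegree (tensors k)) g ⟩
        total (λ v → ∑ᴰ λ h → does ((monomialDegree v ⊕ h) ≟ᵈ g) ⟨ degrees tensorDegree (tensors k) h ⟩) monomialList
          ≡⟨ total-cong (λ v → ∑ᴰ-degrees tensorDegree (λ h → does ((monomialDegree v ⊕ h) ≟ᵈ g)) (tensors k)) monomialList ⟩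
        total (λ v → total (λ s → does ((monomialDegree v ⊕ tensorDegree s) ≟ᵈ g) ⟨ + 1 ⟩) (tensors k)) monomialList
          ≡⟨ total-cartesianProductWith _∷_ (λ s → indicator (tensorDegree s) g) monomialList (tensors k) ⟨
        degrees tensorDegree (tensors (suc k)) g ∎

-- Ranks of Möbius homology and the bracket

module Homology where

  open import Algebra.Bundles using (CommutativeRing; CommutativeMonoid)
  open import Data.Bool.Base using (Bool; true; false; if_then_else_)
  open import Data.Fin.Base as Fin using (Fin; zero; suc)
  import Data.Fin.Properties as Finₚ
  open import Data.Fin.Subset using (∣_∣)
  open import Data.Fin.Subset.Properties using (∣p∣≤n)
  open import Data.Integer.Base as ℤ using (ℤ; +_)
  import Data.Integer.Properties as ℤₚ
  open import Data.List.Base as List using (List; []; _∷_; length; filter)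
  open import Data.List.Membership.Propositional using (_∈_; find)
  open import Data.List.Membership.Propositional.Properties
  open import Data.List.Relation.Unary.All as All using ([]; _∷_)
  open import Data.List.Relation.Unary.AllPairs using ([]; _∷_)
  open import Data.List.Relation.Unary.Any as Any using (here)
  open import Data.List.Relation.Unary.Any.Properties using (lookup-index)
  open import Data.List.Relation.Unary.Unique.Propositional using (Unique)
  import Data.List.Relation.Unary.Unique.Propositional.Properties as Uniqueₚ
  open import Data.Nat.Base as ℕ using (ℕ; zero; suc; NonZero; s≤s; z≤n)
  import Data.Nat.Properties as ℕₚ
  open import Data.Product.Base using (Σ; _×_; _,_; proj₁; proj₂)
  import Data.Product.Properties as Productₚ
  open import Data.Sum.Base using (_⊎_; inj₁; inj₂)
  open import Data.Vec.Base as Vec using (Vec; []; _∷_; lookup; _[_]≔_)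
  import Data.Vec.Properties as Vecₚ
  open import Data.Bool.Properties using () renaming (_≟_ to _≟ᴮ_)
  open import Function.Base using (_∘_)
  open import Level using (0ℓ)
  open import Relation.Binary.Definitions using (DecidableEquality; tri<; tri≈; tri>)
  open import Relation.Binary.PropositionalEquality as ≡ using (_≡_; _≢_; refl; cong; cong₂; subst)
  open import Relation.Nullary using (Dec; yes; no; does; ¬_; contradiction)
  open import Relation.Nullary.Decidable using (dec-true; dec-false; _×-dec_)
  open import Defs
  open Sums
  open Corners using (unique-lookup)
  open Tensor
  open Edge
  open Square
  open Grading
  open LinearAlgebra
  open Count hiding (sign)

  ∈-states : ∀ {ℓ} (α : State ℓ) → α ∈ states ℓ
  ∈-states []                  = here refl
  ∈-states {suc ℓ} (false ∷ α) = ∈-++⁺ˡ (∈-map⁺ (false ∷_) (∈-states α))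
  ∈-states {suc ℓ} (true ∷ α)  = ∈-++⁺ʳ (List.map (false ∷_) (states ℓ)) (∈-map⁺ (true ∷_) (∈-states α))

  states-unique : ∀ ℓ → Unique (states ℓ)
  states-unique zero    = [] ∷ []
  states-unique (suc ℓ) = Uniqueₚ.++⁺
    (Uniqueₚ.map⁺ (cong Vec.tail) (states-unique ℓ)) (Uniqueₚ.map⁺ (cong Vec.tail) (states-unique ℓ)) disjoint
    where
    disjoint : ∀ {α} → ¬ (α ∈ List.map (false ∷_) (states ℓ) × α ∈ List.map (true ∷_) (states ℓ))
    disjoint (p , q) with ∈-map⁻ (false ∷_) p | ∈-map⁻ (true ∷_) q
    ... | _ , _ , refl | _ , _ , ()

  ∣∣-lower : ∀ {ℓ} (γ : State ℓ) i → lookup γ i ≡ true → ∣ γ ∣ ≡ suc ∣ γ [ i ]≔ false ∣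
  ∣∣-lower (true ∷ γ)  zero    _ = refl
  ∣∣-lower (false ∷ γ) (suc i) e = ∣∣-lower γ i e
  ∣∣-lower (true ∷ γ)  (suc i) e = cong suc (∣∣-lower γ i e)

  polynomial : ∀ {n} → ℕ → (ℕ → Degree n → ℕ) → Poly n
  polynomial zero    f = []
  polynomial (suc m) f = f 0 ∷ polynomial m (f ∘ suc)

  coeff-polynomial : ∀ {n} m (f : ℕ → Degree n → ℕ) → (∀ i g → m ℕ.≤ i → f i g ≡ 0) → ∀ i g →
    coeff (polynomial m f) i g ≡ f i g
  coeff-polynomial zero    f e i       g = ≡.sym (e i g z≤n)
  coeff-polynomial (suc m) f e zero    g = refl
  coeff-polynomial (suc m) f e (suc i) g = coeff-polynomial m (f ∘ suc) (λ j h m≤j → e (suc j) h (s≤s m≤j)) i g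

  polynomial-[t=-1] : ∀ {n} m (f : ℕ → Degree n → ℕ) g → (polynomial m f [t=-1]) g ≡ alternating m λ i → + f i g
  polynomial-[t=-1] zero    f g = refl
  polynomial-[t=-1] (suc m) f g = cong (λ x → + f 0 g ℤ.- x) (polynomial-[t=-1] m (f ∘ suc) g)

  [t=-1]-zero : ∀ {n} (P : Poly n) g → (∀ i → coeff P i g ≡ 0) → (P [t=-1]) g ≡ + 0
  [t=-1]-zero []      g e = refl
  [t=-1]-zero (c ∷ P) g e = cong₂ (λ x y → + x ℤ.- y) (e 0) ([t=-1]-zero P g (e ∘ suc))

  -- The lists may differ in length by trailing zero coefficients, which the alternating sum
  -- ignores.
  [t=-1]-cong : ∀ {n} (P Q : Poly n) → P ≋ Q → (P [t=-1]) ≐ (Q [t=-1])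
  [t=-1]-cong []      Q       e g = ≡.sym ([t=-1]-zero Q g λ i → ≡.sym (e i g))
  [t=-1]-cong (c ∷ P) []      e g = [t=-1]-zero (c ∷ P) g λ i → e i g
  [t=-1]-cong (c ∷ P) (d ∷ Q) e g = cong₂ (λ x y → + x ℤ.- y) (e 0 g) ([t=-1]-cong P Q (e ∘ suc) g)

  lookup-injective : ∀ {A : Set} {xs : List A} → Unique xs → ∀ {j k} → j ≢ k → List.lookup xs j ≢ List.lookup xs k
  lookup-injective u {j} {k} j≢k e with Finₚ.<-cmp j k
  ... | tri< j<k _ _ = unique-lookup u j<k e
  ... | tri≈ _ j≡k _ = j≢k j≡k
  ... | tri> _ _ k<j = unique-lookup u k<j (≡.sym e)

  module ChainRanks (n : ℕ) .{{_ : NonZero n}} (R : CommutativeRing 0ℓ 0ℓ) (1/3n : CommutativeRing.Carrier R)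
    (inverse : Calculus.Inverse n R 1/3n)
    (zero? : ∀ x → Dec (CommutativeRing._≈_ R x (CommutativeRing.0# R)))
    (integral : ∀ x y → CommutativeRing._≈_ R (CommutativeRing._*_ R x y) (CommutativeRing.0# R) →
      CommutativeRing._≈_ R x (CommutativeRing.0# R) ⊎ CommutativeRing._≈_ R y (CommutativeRing.0# R))
    (1≉0 : ¬ CommutativeRing._≈_ R (CommutativeRing.1# R) (CommutativeRing.0# R))
    (Γ : PerfectMatchingGraph) (trivalent : PerfectMatchingGraph.Trivalent Γ) where

    open PerfectMatchingGraph Γ using (ℓ)
    open CommutativeRing R hiding (zero) renaming (Carrier to ∣R∣; refl to ≈-refl; sym to ≈-sym; trans to ≈-trans)
    open Complex n R 1/3n hiding (Basis)
    open EdgeMaps n R 1/3n using (∑⊗-linear)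
    open Calculus n R 1/3n using (module Linear)
    open Squares n R 1/3n inverse using (∂∂≈0)
    open GradedMaps n R 1/3n inverse using (coefficient-degree)
    open OverDomain R zero? integral 1≉0
    open Families (chains Γ)
    open FiniteSums +-commutativeMonoid using (sum; sum-single) renaming (sum-ε to sum-0)

    Index : Set
    Index = Σ (State ℓ) λ α → Tensor (#circles Γ α)

    _≟ᴵ_ : DecidableEquality Index
    _≟ᴵ_ = Productₚ.≡-dec (Vecₚ.≡-dec _≟ᴮ_) (Vecₚ.≡-dec (Productₚ.≡-dec Finₚ._≟_ Finₚ._≟_))

    indices : List Index
    indices = List.concatMap (λ α → List.map (α ,_) (tensors n R 1/3n (#circles Γ α))) (states ℓ)

    ∈-tensors : ∀ k (s : Tensor k) → s ∈ tensors n R 1/3n k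
    ∈-tensors zero    []            = here refl
    ∈-tensors (suc k) ((i , j) ∷ s) = ∈-cartesianProductWith⁺ _∷_
      (∈-cartesianProduct⁺ (∈-allFin i) (∈-allFin j)) (∈-tensors k s)

    tensors-unique : ∀ k → Unique (tensors n R 1/3n k)
    tensors-unique zero    = [] ∷ []
    tensors-unique (suc k) = Uniqueₚ.cartesianProductWith⁺ _∷_ (λ { refl → refl , refl })
      (Uniqueₚ.cartesianProduct⁺ (Uniqueₚ.allFin⁺ n) (Uniqueₚ.allFin⁺ 3)) (tensors-unique k)

    ∈-indices : ∀ x → x ∈ indices
    ∈-indices (α , s) = ∈-concatMap⁺ (λ α → List.map (α ,_) (tensors n R 1/3n (#circles Γ α)))
      (Any.map (λ { refl → ∈-map⁺ (α ,_) (∈-tensors _ s) }) (∈-states α))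

    indices-unique : Unique indices
    indices-unique = go (states ℓ) (states-unique ℓ)
      where
      fibre : State ℓ → List Index
      fibre α = List.map (α ,_) (tensors n R 1/3n (#circles Γ α))
      fibre-state : ∀ {α x} → x ∈ fibre α → proj₁ x ≡ α
      fibre-state x∈ with ∈-map⁻ _ x∈
      ... | _ , _ , refl = refl
      go : ∀ αs → Unique αs → Unique (List.concatMap fibre αs)
      go []       []       = []
      go (α ∷ αs) (α∉ ∷ u) = Uniqueₚ.++⁺ (Uniqueₚ.map⁺ (λ { refl → refl }) (tensors-unique _)) (go αs u)
        λ (p , q) → let (β , β∈ , x∈) = find (∈-concatMap⁻ fibre q) in
          All.lookup α∉ β∈ (≡.trans (≡.sym (fibre-state p)) (fibre-state x∈))

    eval-combination : ∀ r c (v : Family r) α s → combination c v α s ≡ sum λ i → c i * v i α s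
    eval-combination zero    c v α s = refl
    eval-combination (suc r) c v α s = cong (λ z → c zero * v zero α s + z) (eval-combination r (c ∘ suc) (v ∘ suc) α s)

    coordinates : Coordinates
    coordinates = record
      { dimension  = length indices
      ; coord      = λ j v → v (proj₁ (List.lookup indices j)) (proj₂ (List.lookup indices j))
      ; coord-cong = λ j e → e _ _
      ; coord-+    = λ _ _ _ → ≈-refl
      ; coord-*    = λ _ _ _ → ≈-refl
      ; faithful   = λ v e α s → subst (λ x → v (proj₁ x) (proj₂ x) ≈ 0#)
          (≡.sym (lookup-index (∈-indices (α , s)))) (e (Any.index (∈-indices (α , s))))
      }

    guard-0 : ∀ b {x} → (b ≡ true → x ≈ 0#) → (if b then x else 0#) ≈ 0#
    guard-0 true  e = e refl
    guard-0 false e = ≈-refl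

    weighted-0 : ∀ k (a : ∣R∣) (c v : Tensor k → ∣R∣) → (∀ s → c s ≈ 0# ⊎ v s ≈ 0#) →
      a * ∑⊗ k (λ s → c s * v s) ≈ 0#
    weighted-0 k a c v e = ≈-trans (*-congˡ (Linear.T-0 (∑⊗-linear k) λ s → product-0 (c s) (v s) (e s))) (zeroʳ a)
      where
      product-0 : ∀ x y → x ≈ 0# ⊎ y ≈ 0# → x * y ≈ 0#
      product-0 x y (inj₁ e) = ≈-trans (*-congʳ e) (zeroˡ y)
      product-0 x y (inj₂ e) = ≈-trans (*-congˡ e) (zeroʳ x)

    summand-0 : ∀ v γ t k → (lookup γ k ≡ true → ∀ s →
        coefficient Γ (γ [ k ]≔ false) γ k s t ≈ 0# ⊎ v (γ [ k ]≔ false) s ≈ 0#) → ∂-summand Γ v γ t k ≈ 0#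
    summand-0 v γ t k e = guard-0 (lookup γ k) λ p → weighted-0 (#circles Γ (γ [ k ]≔ false)) _
      (λ s → coefficient Γ (γ [ k ]≔ false) γ k s t) (v (γ [ k ]≔ false)) (e p)

    δ : Index → Chain Γ
    δ x α s = if does (x ≟ᴵ (α , s)) then 1# else 0#

    δ-≡ : ∀ x α s → x ≡ (α , s) → δ x α s ≡ 1#
    δ-≡ x α s e = cong (λ b → if b then 1# else 0#) (dec-true (x ≟ᴵ (α , s)) e)

    δ-≢ : ∀ x α s → x ≢ (α , s) → δ x α s ≡ 0#
    δ-≢ x α s ≢ = cong (λ b → if b then 1# else 0#) (dec-false (x ≟ᴵ (α , s)) ≢)

    module _ (g : Degree n) where

      Cochains : ℕ → Submodule (chains Γ)
      Cochains i = homogeneous Γ (λ α → ∣ α ∣ ≡ i) g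

      InDegree : ℕ → Index → Set
      InDegree i (α , s) = ∣ α ∣ ≡ i × tensorDegree s ≡ g

      inDegree? : ∀ i x → Dec (InDegree i x)
      inDegree? i (α , s) = (∣ α ∣ ℕₚ.≟ i) ×-dec (tensorDegree s ≟ᵈ g)

      support : ℕ → List Index
      support i = filter (inDegree? i) indices

      item : ∀ i → Fin (length (support i)) → Index
      item i = List.lookup (support i)

      support-unique : ∀ i {j k} → j ≢ k → item i j ≢ item i k
      support-unique i = lookup-injective (Uniqueₚ.filter⁺ (inDegree? i) indices-unique)

      support-degree : ∀ i j → InDegree i (item i j)
      support-degree i j = proj₂ (∈-filter⁻ (inDegree? i) {xs = indices} (∈-lookup j))

      basis : ∀ i → Basis (Cochains i)
      basis i = record
        { size = length (support i)
        ; element = λ j → δ (item i j)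
        ; member = λ j α s ∉ → reflexive (δ-≢ (item i j) α s λ e → ∉ (subst (InDegree i) e (support-degree i j)))
        ; independent = λ c e j → let (α , s) = item i j in
            ≈-trans (≈-sym (at c j)) (≈-trans (reflexive (≡.sym (eval-combination (length (support i)) c (λ k → δ (item i k)) α s))) (e α s))
        ; spans = λ {v} v∈ → (λ j → entry v (item i j)) ,
            λ α s → ≈-sym (≈-trans (reflexive (eval-combination (length (support i)) (λ j → entry v (item i j)) (λ k → δ (item i k)) α s)) (expand v v∈ α s (inDegree? i (α , s))))
        }
        where
        at : ∀ c j → sum (λ k → c k * δ (item i k) (proj₁ (item i j)) (proj₂ (item i j))) ≈ c j
        at c j = ≈-trans
          (sum-single j λ k k≢j → ≈-trans (*-congˡ (reflexive (δ-≢ (item i k) (proj₁ (item i j)) (proj₂ (item i j)) (support-unique i k≢j)))) (zeroʳ (c k)))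
          (≈-trans (*-congˡ (reflexive (δ-≡ (item i j) (proj₁ (item i j)) (proj₂ (item i j)) refl))) (*-identityʳ (c j)))
        entry : Chain Γ → Index → ∣R∣
        entry v x = v (proj₁ x) (proj₂ x)
        term : Chain Γ → ∀ α → Tensor (#circles Γ α) → Fin (length (support i)) → ∣R∣
        term v α s k = entry v (item i k) * δ (item i k) α s
        expand-in : ∀ v α s k → (α , s) ≡ item i k → sum (term v α s) ≈ v α s
        expand-in v α s k x≡ = ≈-trans
          (sum-single k λ k′ k′≢k → ≈-trans
            (*-congˡ (reflexive (δ-≢ (item i k′) α s λ e → support-unique i k′≢k (≡.trans e x≡)))) (zeroʳ (entry v (item i k′))))
          (≈-trans (*-congˡ (reflexive (δ-≡ (item i k) α s (≡.sym x≡))))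
            (≈-trans (*-identityʳ (entry v (item i k))) (reflexive (cong (entry v) (≡.sym x≡)))))
        expand-out : ∀ v α s → ¬ InDegree i (α , s) → sum (term v α s) ≈ 0#
        expand-out v α s ∉ = sum-0 {length (support i)} λ k → ≈-trans
          (*-congˡ (reflexive (δ-≢ (item i k) α s λ e → ∉ (subst (InDegree i) e (support-degree i k))))) (zeroʳ (entry v (item i k)))
        expand : ∀ v → Submodule.Member (Cochains i) v → ∀ α s → Dec (InDegree i (α , s)) → sum (term v α s) ≈ v α s
        expand v v∈ α s (no ∉) = ≈-trans (expand-out v α s ∉) (≈-sym (v∈ α s ∉))
        expand v v∈ α s (yes d) = let x∈ = ∈-filter⁺ (inDegree? i) (∈-indices (α , s)) d in
          expand-in v α s (Any.index x∈) (lookup-index x∈)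

      -- The source of the differential into Cochains i
      Cochains⁻ : ℕ → Submodule (chains Γ)
      Cochains⁻ i = homogeneous Γ (λ α → suc ∣ α ∣ ≡ i) g

      -- Lowering an entry changes the number of ones by exactly one, and entries between different
      -- degrees vanish. So at an index outside the target, each product has a zero factor.
      ∂-member : ∀ i {v} → Submodule.Member (Cochains⁻ i) v → Submodule.Member (Cochains i) (∂ Γ v)
      ∂-member i {v} v∈ γ t ∉ = sum-0 {ℓ} λ k → summand-0 v γ t k λ e s → vanish k e s (tensorDegree s ≟ᵈ tensorDegree t)
        where
        vanish : ∀ k → lookup γ k ≡ true → ∀ s → Dec (tensorDegree s ≡ tensorDegree t) →
          coefficient Γ (γ [ k ]≔ false) γ k s t ≈ 0# ⊎ v (γ [ k ]≔ false) s ≈ 0#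
        vanish k e s (yes d) = inj₂ (v∈ (γ [ k ]≔ false) s λ (p , q) → ∉ (≡.trans (∣∣-lower γ k e) (p) , ≡.trans (≡.sym d) q))
        vanish k e s (no ≢)  = inj₁ (coefficient-degree Γ (γ [ k ]≔ false) γ k
          (λ j j≢k → Vecₚ.lookup∘update′ j≢k γ false) s t ≢)

      open Differential coordinates (∂-linear Γ)

      image : ∀ i → ImageBasis (Submodule.Member (Cochains i))
      image i = imageBasis (basis i)

      rank⁻ : ℕ → ℕ
      rank⁻ zero    = 0
      rank⁻ (suc i) = ImageBasis.rank (image i)

      -- Nothing maps into degree `zero`, since no state satisfies `suc ∣ α ∣ ≡ 0`. In degree
      -- `suc i` the source is `Cochains i`, so the preimages already chosen there are reused; only
      -- this makes the ranks telescope.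
      image⁻ : ∀ i → ImageBasis (Submodule.Member (Cochains⁻ i))
      image⁻ zero = record
        { rank = 0 ; preimage = empty ; member = λ () ; independent = λ _ _ ()
        ; spans = λ {v} v∈ → span-cong {F = ∂ Γ ∘ empty} {λ _ _ → 0#} {∂ Γ v}
            (λ γ t → ≈-sym (boundary-0 v v∈ γ t)) (span-0 {F = ∂ Γ ∘ empty})
        }
        where
        empty : Family 0
        empty ()
        boundary-0 : ∀ v → Submodule.Member (Cochains⁻ 0) v → ∀ γ t → ∂ Γ v γ t ≈ 0#
        boundary-0 v v∈ γ t = sum-0 {ℓ} λ k → summand-0 v γ t k λ _ s → inj₂ (v∈ (γ [ k ]≔ false) s λ ())
      image⁻ (suc i) = record
        { rank = ImageBasis.rank (image i)
        ; preimage = ImageBasis.preimage (image i)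
        ; member = λ j α s ∉ → ImageBasis.member (image i) j α s λ (p , q) → ∉ (cong suc p , q)
        ; independent = ImageBasis.independent (image i)
        ; spans = λ v∈ → ImageBasis.spans (image i) λ α s ∉ → v∈ α s λ (p , q) → ∉ (ℕₚ.suc-injective p , q)
        }

      module Rank (i : ℕ) = HomologyRank (λ v → ∂∂≈0 Γ trivalent v) {Cochains i} {Cochains⁻ i} (∂-member i) (basis i) (image i) (image⁻ i)

      rank⁻-image⁻ : ∀ i → ImageBasis.rank (image⁻ i) ≡ rank⁻ i
      rank⁻-image⁻ zero    = refl
      rank⁻-image⁻ (suc i) = refl

      homologyRank : ℕ → ℕ
      homologyRank i = Rank.h i

      chainRank : ℕ → ℕ
      chainRank i = length (support i)

      hasHomologyRank : ∀ i → HasRank (MH Γ i g) (homologyRank i)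
      hasHomologyRank i = Rank.hasRank i

      rank-sum : ∀ i → homologyRank i ℕ.+ (ImageBasis.rank (image i) ℕ.+ rank⁻ i) ≡ chainRank i
      rank-sum i = ≡.trans (cong (λ r → homologyRank i ℕ.+ (ImageBasis.rank (image i) ℕ.+ r)) (≡.sym (rank⁻-image⁻ i))) (Rank.h+ranks i)

      chainRank-0 : ∀ i → ℓ ℕ.< i → chainRank i ≡ 0
      chainRank-0 i ℓ<i = none (chainRank i) (item i) (support-degree i)
        where
        none : ∀ m (A : Fin m → Index) → (∀ j → InDegree i (A j)) → m ≡ 0
        none zero    A _ = refl
        none (suc m) A d = contradiction (ℕₚ.≤-trans ℓ<i (ℕₚ.≤-trans (ℕₚ.≤-reflexive (≡.sym (proj₁ (d zero))))
          (∣p∣≤n (proj₁ (A zero))))) (ℕₚ.<-irrefl refl)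

      homologyRank-0 : ∀ i → ℓ ℕ.< i → homologyRank i ≡ 0
      homologyRank-0 i ℓ<i = ℕₚ.m+n≡0⇒m≡0 _ (≡.trans (rank-sum i) (chainRank-0 i ℓ<i))

      private
        weight : Index → ℤ
        weight (α , s) = does (tensorDegree s ≟ᵈ g) ⟨ Count.sign ∣ α ∣ ⟩

        fibre-weight : ∀ α → total weight (List.map (α ,_) (tensors n R 1/3n (#circles Γ α))) ≡
          Count.sign ∣ α ∣ ℤ.* (circleValue ^⊛ #circles Γ α) g
        fibre-weight α = ≡.trans (total-map (α ,_) weight (tensors n R 1/3n k)) (≡.trans
          (total-cong {f = λ s → weight (α , s)} (λ s → scale (does (tensorDegree s ≟ᵈ g))) (tensors n R 1/3n k)) (≡.trans
          (total-* (Count.sign ∣ α ∣) (λ s → does (tensorDegree s ≟ᵈ g) ⟨ + 1 ⟩) (tensors n R 1/3n k))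
          (cong (λ z → Count.sign ∣ α ∣ ℤ.* z) (≡.sym (circleValue-tensors n R 1/3n k g)))))
          where
          k : ℕ
          k = #circles Γ α
          scale : ∀ b → b ⟨ Count.sign ∣ α ∣ ⟩ ≡ Count.sign ∣ α ∣ ℤ.* (b ⟨ + 1 ⟩)
          scale true  = ≡.sym (ℤₚ.*-identityʳ (Count.sign ∣ α ∣))
          scale false = ≡.sym (ℤₚ.*-zeroʳ (Count.sign ∣ α ∣))

      alternating-chainRank : alternating (suc (suc ℓ)) (λ i → + chainRank i) ≡ bracket n Γ g
      alternating-chainRank = ≡.trans (alternating-cong (suc (suc ℓ)) λ i → length-filter (inDegree? i) indices) (≡.trans
        (alternating-count (suc (suc ℓ)) (λ x → ∣ proj₁ x ∣) (λ x → does (tensorDegree (proj₂ x) ≟ᵈ g)) indices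
          λ x → s≤s (ℕₚ.≤-trans (∣p∣≤n (proj₁ x)) (ℕₚ.n≤1+n ℓ)))
        (≡.trans (total-concatMap (λ α → List.map (α ,_) (tensors n R 1/3n (#circles Γ α))) weight (states ℓ))
          (≡.trans (total-cong fibre-weight (states ℓ))
            (≡.sym (resolve-total n ℓ (λ α → circleValue ^⊛ #circles Γ α) g)))))

      -- The sum runs to degree `suc ℓ`, one beyond the last state. There are no chains there, so
      -- the image rank vanishes and the telescoping sum has no remainder.
      alternating-homologyRank : alternating (suc (suc ℓ)) (λ i → + homologyRank i) ≡ bracket n Γ g
      alternating-homologyRank = ≡.trans (≡.sym (ℤₚ.+-identityʳ _)) (≡.trans (≡.sym
        (telescope (suc ℓ) homologyRank chainRank (λ i → ImageBasis.rank (image i)) 0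
          (ℕₚ.m+n≡0⇒m≡0 _ (ℕₚ.m+n≡0⇒n≡0 (homologyRank (suc ℓ)) (≡.trans (rank-sum (suc ℓ)) (chainRank-0 (suc ℓ) ℕₚ.≤-refl))))
          (rank-sum 0) (λ i → rank-sum (suc i)))) alternating-chainRank)

    poincaré : Poly n
    poincaré = polynomial (suc (suc ℓ)) λ i g → homologyRank g i

    poincaré-coeff : ∀ i g → coeff poincaré i g ≡ homologyRank g i
    poincaré-coeff = coeff-polynomial (suc (suc ℓ)) (λ i g → homologyRank g i) λ i g ℓ<i → homologyRank-0 g i (ℕₚ.<⇒≤ ℓ<i)

    poincaré-rank : ∀ i g → HasRank (MH Γ i g) (coeff poincaré i g)
    poincaré-rank i g = subst (HasRank (MH Γ i g)) (≡.sym (poincaré-coeff i g)) (hasHomologyRank g i)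

    poincaré-bracket : ∀ P → (∀ i g → HasRank (MH Γ i g) (coeff P i g)) → (P [t=-1]) ≐ bracket n Γ
    poincaré-bracket P P-rank g = ≡.trans
      ([t=-1]-cong P poincaré (λ i h → rank-unique (MH Γ i h) (P-rank i h) (poincaré-rank i h)) g)
      (≡.trans (polynomial-[t=-1] (suc (suc ℓ)) (λ i g → homologyRank g i) g) (alternating-homologyRank g))

-- The ring ℤ[1/3n] as a domain in which 3n is invertible

module Localization where

  open import Algebra.Bundles using (CommutativeRing)
  open import Data.Fin.Base using (Fin)
  open import Data.Integer.Base using (+_)
  open import Data.Nat.Base as ℕ using (ℕ; zero; suc; NonZero)
  import Data.Nat.Properties as ℕₚ
  open import Data.Product.Base using (proj₁; proj₂)
  open import Data.Rational.Base as ℚ using (ℚ)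
  import Data.Rational.Properties as ℚₚ
  open import Data.Sum.Base using (_⊎_; inj₁; inj₂)
  open import Relation.Binary.PropositionalEquality as ≡ using (_≡_; refl; sym; trans; cong)
  open import Relation.Nullary using (Dec; yes; no; ¬_)
  open import Defs
  open Sums
  open Tensor

  ℚ-integral : ∀ p q → p ℚ.* q ≡ ℚ.0ℚ → p ≡ ℚ.0ℚ ⊎ q ≡ ℚ.0ℚ
  ℚ-integral p q e with p ℚₚ.≟ ℚ.0ℚ
  ... | yes p≡0 = inj₁ p≡0
  ... | no p≢0  = inj₂ (begin
    q                        ≡⟨ ℚₚ.*-identityˡ q ⟨
    ℚ.1ℚ ℚ.* q               ≡⟨ cong (ℚ._* q) (ℚₚ.*-inverseˡ p) ⟨
    ((ℚ.1/ p) ℚ.* p) ℚ.* q   ≡⟨ ℚₚ.*-assoc (ℚ.1/ p) p q ⟩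
    (ℚ.1/ p) ℚ.* (p ℚ.* q)   ≡⟨ cong ((ℚ.1/ p) ℚ.*_) e ⟩
    (ℚ.1/ p) ℚ.* ℚ.0ℚ        ≡⟨ ℚₚ.*-zeroʳ (ℚ.1/ p) ⟩
    ℚ.0ℚ                     ∎)
    where
    open ≡.≡-Reasoning
    instance
      p-nonZero : ℚ.NonZero p
      p-nonZero = ℚ.≢-nonZero p≢0

  -- The membership proof `∈-1/`, which clears the denominator with exponent one, is this equation
  -- up to `m ^ 1`.
  1/m*m : ∀ m .{{_ : NonZero m}} → (+ 1 ℚ./ m) ℚ.* ℤ⇒ℚ (+ m) ≡ ℤ⇒ℚ (+ 1)
  1/m*m m@(suc k) = trans (cong (λ j → (+ 1 ℚ./ m) ℚ.* ℤ⇒ℚ (+ j)) (sym (ℕₚ.*-identityʳ m))) (proj₂ (proj₂ (∈-1/ m)))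

  module _ (m : ℕ) .{{_ : NonZero m}} where

    open CommutativeRing ℤ[1/ m ] using (_≈_; _*_; 0#; 1#)

    localized-zero? : ∀ x → Dec (x ≈ 0#)
    localized-zero? x = proj₁ x ℚₚ.≟ ℤ⇒ℚ (+ 0)

    localized-integral : ∀ x y → x * y ≈ 0# → x ≈ 0# ⊎ y ≈ 0#
    localized-integral x y = ℚ-integral (proj₁ x) (proj₁ y)

    localized-1≉0 : ¬ 1# ≈ 0#
    localized-1≉0 ()

  module _ (n : ℕ) .{{_ : NonZero n}} .{{nonZero : NonZero (3 ℕ.* n)}} where

    open CommutativeRing ℤ[1/ 3 ℕ.* n ] using (_+_; 1#; +-commutativeMonoid)
    open FiniteSums +-commutativeMonoid using (sum)

    sum-3 : ∀ k → proj₁ (sum {k} λ _ → 1# + 1# + 1#) ≡ ℤ⇒ℚ (+ (k ℕ.* 3))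
    sum-3 zero    = refl
    sum-3 (suc k) = trans (cong (ℤ⇒ℚ (+ 3) ℚ.+_) (sum-3 k)) (ℤ⇒ℚ-+ (+ 3) (+ (k ℕ.* 3)))

    localized-inverse : Calculus.Inverse n ℤ[1/ 3 ℕ.* n ] (reciprocal (3 ℕ.* n))
    localized-inverse = trans (cong ((+ 1 ℚ./ (3 ℕ.* n)) ℚ.*_) (trans (sum-3 n) (cong (λ k → ℤ⇒ℚ (+ k)) (ℕₚ.*-comm n 3))))
      (1/m*m (3 ℕ.* n))

-- Two graphs all of whose states are single circles

module Examples where

  open import Data.Bool.Base using (Bool; true; false)
  open import Data.Fin.Base as Fin using (Fin; suc)
  open import Data.Fin.Patterns
  import Data.Fin.Permutation as Perm
  import Data.Fin.Properties as Finₚ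
  open import Data.Nat.Base using (ℕ)
  open import Data.Product.Base using (∃; _×_; _,_)
  open import Data.Sum.Base using (_⊎_; inj₁; inj₂)
  open import Data.Vec.Base as Vec using (Vec; []; _∷_; lookup)
  open import Relation.Binary.Construct.Closure.ReflexiveTransitive using (Star; ε; _◅_; _◅◅_)
  open import Relation.Binary.PropositionalEquality as ≡ using (_≡_; refl)
  open import Relation.Nullary.Decidable using (True; toWitness; _→-dec_; _⊎-dec_; ¬?)
  open import Defs hiding (degree)

  module Table {v h : ℕ} (vertices : Vec (Fin v) h) (opposites nexts prevs : Vec (Fin h) h) where

    vertex : Fin h → Fin v
    vertex = lookup vertices
    opposite next prev : Fin h → Fin h
    opposite = lookup opposites
    next = lookup nexts
    prev = lookup prevs

    -- At a vertex of degree three, at most two applications of `next` reach every half-edge, which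
    -- makes transitivity a finite check.
    Around : Fin h → Fin h → Set
    Around a b = a ≡ b ⊎ next a ≡ b ⊎ next (next a) ≡ b

    around-star : ∀ {a b} → Around a b → Star (λ a b → next a ≡ b) a b
    around-star (inj₁ refl)        = ε
    around-star (inj₂ (inj₁ e))    = e ◅ ε
    around-star (inj₂ (inj₂ e))    = refl ◅ e ◅ ε

    graph : True (Finₚ.all? λ a → next (prev a) Finₚ.≟ a) → True (Finₚ.all? λ a → prev (next a) Finₚ.≟ a) →
      True (Finₚ.all? λ a → opposite (opposite a) Finₚ.≟ a) → True (Finₚ.all? λ a → ¬? (opposite a Finₚ.≟ a)) →
      True (Finₚ.all? λ a → vertex (next a) Finₚ.≟ vertex a) →
      True (Finₚ.all? λ a → Finₚ.all? λ b → (vertex a Finₚ.≟ vertex b) →-dec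
        ((a Finₚ.≟ b) ⊎-dec ((next a Finₚ.≟ b) ⊎-dec (next (next a) Finₚ.≟ b)))) →
      Fin h → (∀ a b → Star (λ a b → ∃ λ k → vertex k ≡ a × vertex (opposite k) ≡ b) a b) → RibbonGraph
    graph np pn oo o≢ nv around root connected = record
      { #vertices = v ; #half-edges = h ; vertex = vertex ; opposite = opposite
      ; rotation = Perm.permutation next prev (toWitness np) (toWitness pn)
      ; opposite-involutive = toWitness oo
      ; opposite-distinct = toWitness o≢
      ; next-vertex = toWitness nv
      ; next-transitive = λ a b e → around-star (toWitness around a b e)
      ; nonempty = root
      ; connected = connected
      }

  -- One loop joins the two upper corners of the matching edge and the other the two lower ones.
  -- Hence both the straight and the crossed smoothing close up to one circle.
  dumbbell : PerfectMatchingGraph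
  dumbbell = record
    { ribbonGraph = Table.graph vertices opposites nexts prevs _ _ _ _ _ _ 0F connected
    ; ℓ = 1
    ; top = λ _ → 0F
    ; perfect = λ
      { 0F → (0F , true) , refl , λ { {0F , true} _ → refl ; {0F , false} () }
      ; 1F → (0F , false) , refl , λ { {0F , false} _ → refl ; {0F , true} () } }
    }
    where
    vertices : Vec (Fin 2) 6
    vertices  = 0F ∷ 1F ∷ 0F ∷ 0F ∷ 1F ∷ 1F ∷ []
    opposites nexts prevs : Vec (Fin 6) 6
    opposites = 1F ∷ 0F ∷ 3F ∷ 2F ∷ 5F ∷ 4F ∷ []
    nexts     = 2F ∷ 4F ∷ 3F ∷ 0F ∷ 5F ∷ 1F ∷ []
    prevs     = 3F ∷ 5F ∷ 0F ∷ 2F ∷ 1F ∷ 4F ∷ []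
    connected : ∀ a b → Star (λ a b → ∃ λ k → lookup vertices k ≡ a × lookup vertices (lookup opposites k) ≡ b) a b
    connected 0F 0F = ε
    connected 0F 1F = (0F , refl , refl) ◅ ε
    connected 1F 0F = (1F , refl , refl) ◅ ε
    connected 1F 1F = ε

  -- Two matching edges in a row: a loop, the edge e₀, a digon, the edge e₁ and
  -- another loop
  chain : PerfectMatchingGraph
  chain = record
    { ribbonGraph = Table.graph vertices opposites nexts prevs _ _ _ _ _ _ 0F
        (λ a b → to-0 a ◅◅ from-0 b)
    ; ℓ = 2
    ; top = λ { 0F → 0F ; 1F → 2F }
    ; perfect = λ
      { 0F → (0F , true) , refl , λ { {0F , true} _ → refl ; {0F , false} () ; {1F , true} () ; {1F , false} () }
      ; 1F → (0F , false) , refl , λ { {0F , true} () ; {0F , false} _ → refl ; {1F , true} () ; {1F , false} () }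
      ; 2F → (1F , true) , refl , λ { {0F , true} () ; {0F , false} () ; {1F , true} _ → refl ; {1F , false} () }
      ; 3F → (1F , false) , refl , λ { {0F , true} () ; {0F , false} () ; {1F , true} () ; {1F , false} _ → refl } }
    }
    where
    ⑩ ⑪ : Fin 12
    ⑩ = Fin.suc 9F
    ⑪ = Fin.suc (Fin.suc 9F)
    vertices : Vec (Fin 4) 12
    vertices  = 0F ∷ 1F ∷ 2F ∷ 3F ∷ 0F ∷ 0F ∷ 1F ∷ 1F ∷ 2F ∷ 2F ∷ 3F ∷ 3F ∷ []
    opposites nexts prevs : Vec (Fin 12) 12
    opposites = 1F ∷ 0F ∷ 3F ∷ 2F ∷ 5F ∷ 4F ∷ 8F ∷ 9F ∷ 6F ∷ 7F ∷ ⑪ ∷ ⑩ ∷ []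
    nexts     = 5F ∷ 6F ∷ 9F ∷ ⑩ ∷ 0F ∷ 4F ∷ 7F ∷ 1F ∷ 2F ∷ 8F ∷ ⑪ ∷ 3F ∷ []
    prevs     = 4F ∷ 7F ∷ 8F ∷ ⑪ ∷ 5F ∷ 0F ∷ 1F ∷ 6F ∷ 9F ∷ 2F ∷ 3F ∷ ⑩ ∷ []
    Step : Fin 4 → Fin 4 → Set
    Step a b = ∃ λ k → lookup vertices k ≡ a × lookup vertices (lookup opposites k) ≡ b
    to-0 : ∀ a → Star Step a 0F
    to-0 0F = ε
    to-0 1F = (1F , refl , refl) ◅ ε
    to-0 2F = (8F , refl , refl) ◅ (1F , refl , refl) ◅ ε
    to-0 3F = (3F , refl , refl) ◅ (8F , refl , refl) ◅ (1F , refl , refl) ◅ ε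
    from-0 : ∀ a → Star Step 0F a
    from-0 0F = ε
    from-0 1F = (0F , refl , refl) ◅ ε
    from-0 2F = (0F , refl , refl) ◅ (6F , refl , refl) ◅ ε
    from-0 3F = (0F , refl , refl) ◅ (6F , refl , refl) ◅ (2F , refl , refl) ◅ ε

  dumbbell-trivalent : PerfectMatchingGraph.Trivalent dumbbell
  dumbbell-trivalent 0F = refl
  dumbbell-trivalent 1F = refl

  chain-trivalent : PerfectMatchingGraph.Trivalent chain
  chain-trivalent 0F = refl
  chain-trivalent 1F = refl
  chain-trivalent 2F = refl
  chain-trivalent 3F = refl

  dumbbell-circles : ∀ α → #circles dumbbell α ≡ 1
  dumbbell-circles (false ∷ []) = refl
  dumbbell-circles (true ∷ [])  = refl

  -- Two strands run from one loop to the other, and the smoothings decide only whether they cross,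
  -- so they always close up to one circle.
  chain-circles : ∀ α → #circles chain α ≡ 1
  chain-circles (false ∷ false ∷ []) = refl
  chain-circles (false ∷ true ∷ [])  = refl
  chain-circles (true ∷ false ∷ [])  = refl
  chain-circles (true ∷ true ∷ [])   = refl

-- A nonzero class in the top degree

module Nonvanishing where

  open import Algebra.Bundles using (CommutativeRing)
  open import Data.Bool.Base using (Bool; true; false)
  open import Data.Fin.Base as Fin using (Fin; zero; suc; toℕ; combine)
  open import Data.Fin.Patterns
  import Data.Fin.Properties as Finₚ
  open import Data.Fin.Subset using (∣_∣)
  open import Data.Fin.Subset.Properties using (∣p∣≤n)
  open import Data.Nat.Base as ℕ using (ℕ; zero; suc; NonZero)
  import Data.Nat.Properties as ℕₚ
  open import Data.Product.Base using (∃; _×_; _,_; proj₁; proj₂)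
  open import Data.Sum.Base using (_⊎_; inj₁)
  open import Data.Vec.Base as Vec using ([]; lookup; _[_]≔_)
  import Data.Vec.Properties as Vecₚ
  open import Level using (0ℓ)
  open import Relation.Binary.PropositionalEquality as ≡ using (_≡_; _≢_; refl; cong; cong₂)
  open import Relation.Nullary using (Dec; ¬_; does)
  open import Defs
  open Sums
  open Topology using (circle)
  open Tensor
  open Edge
  open Square
  open Grading
  open LinearAlgebra
  open Homology

  allOnes : ∀ ℓ → State ℓ
  allOnes ℓ = Vec.replicate ℓ true

  ∣allOnes∣ : ∀ ℓ → ∣ allOnes ℓ ∣ ≡ ℓ
  ∣allOnes∣ zero    = refl
  ∣allOnes∣ (suc ℓ) = cong suc (∣allOnes∣ ℓ)

  Fin-unique : ∀ {k} → k ≡ 1 → (a b : Fin k) → a ≡ b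
  Fin-unique refl 0F 0F = refl

  -- When every state is a single circle, ∂ into the last state is
  -- multiplication by ± θ, whose image does not contain 1.
  module SingleCircles (n : ℕ) .{{_ : NonZero n}} (R : CommutativeRing 0ℓ 0ℓ) (1/3n : CommutativeRing.Carrier R)
    (inverse : Calculus.Inverse n R 1/3n)
    (zero? : ∀ x → Dec (CommutativeRing._≈_ R x (CommutativeRing.0# R)))
    (integral : ∀ x y → CommutativeRing._≈_ R (CommutativeRing._*_ R x y) (CommutativeRing.0# R) →
      CommutativeRing._≈_ R x (CommutativeRing.0# R) ⊎ CommutativeRing._≈_ R y (CommutativeRing.0# R))
    (1≉0 : ¬ CommutativeRing._≈_ R (CommutativeRing.1# R) (CommutativeRing.0# R))
    (Γ : PerfectMatchingGraph) (trivalent : PerfectMatchingGraph.Trivalent Γ)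
    (single : ∀ α → #circles Γ α ≡ 1) where

    open PerfectMatchingGraph Γ using (ℓ)
    open CommutativeRing R hiding (zero) renaming (Carrier to ∣R∣; refl to ≈-refl; sym to ≈-sym; trans to ≈-trans)
    open Complex n R 1/3n
    open Calculus n R 1/3n
    open EdgeMaps n R 1/3n
    open Degrees n
    open ChainRanks n R 1/3n inverse zero? integral 1≉0 Γ trivalent hiding (δ; δ-≡; δ-≢)
    module Indicator = ChainRanks n R 1/3n inverse zero? integral 1≉0 Γ trivalent
    open FiniteSums +-commutativeMonoid using () renaming (sum-ε to sum-0)

    one : Basis
    one = Fin.fromℕ< (ℕ.>-nonZero⁻¹ n) , 0F

    toℕ-one : toℕ (proj₁ one) ≡ 0
    toℕ-one = Finₚ.toℕ-fromℕ< (ℕ.>-nonZero⁻¹ n)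

    ones : ∀ k → Tensor k
    ones k = Vec.replicate k one

    tensorDegree-ones : ∀ k → tensorDegree (ones k) ≡ degree 0 0
    tensorDegree-ones zero    = refl
    tensorDegree-ones (suc k) = ≡.trans
      (cong₂ _⊕_ (cong (λ a → degree (2 ℕ.* a ℕ.+ 0) 0) toℕ-one) (tensorDegree-ones k)) (⊕-identityˡ (degree 0 0))

    -- The relation y³ = xy never removes the last y, so multiples of y have no component along 1; θ
    -- is such a multiple.
    reduce-y : ∀ a b → proj₂ (reduce a (suc b)) ≢ 0F
    reduce-y a (suc (suc b)) = reduce-y (suc a) b

    m-one : ∀ v → m v one ≡ 0#
    m-one v = ≡.trans (m-θ v one) (X-≢ (expo v ⊹ θ) λ e → positive (≡.trans (cong proj₂ (≡.sym (cong (reduce _) y-exponent))) (cong proj₂ e)))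
      where
      θ-positive : ∃ λ b → proj₂ θ ≡ suc b
      θ-positive = if-even-elim (λ z → ∃ λ b → proj₂ z ≡ suc b) n (λ _ → 1 , refl) (λ _ → 0 , refl)
      y-exponent : toℕ (proj₂ v) ℕ.+ proj₂ θ ≡ suc (toℕ (proj₂ v) ℕ.+ proj₁ θ-positive)
      y-exponent = ≡.trans (cong (toℕ (proj₂ v) ℕ.+_) (proj₂ θ-positive)) (ℕₚ.+-suc _ _)
      positive : proj₂ (reduce (toℕ (proj₁ v) ℕ.+ proj₁ θ) (suc (toℕ (proj₂ v) ℕ.+ proj₁ θ-positive))) ≢ 0F
      positive = reduce-y (toℕ (proj₁ v) ℕ.+ proj₁ θ) (toℕ (proj₂ v) ℕ.+ proj₁ θ-positive)

    top : State ℓ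
    top = allOnes ℓ

    top-ones : Tensor (#circles Γ top)
    top-ones = ones (#circles Γ top)

    coefficient-0 : ∀ i s → coefficient Γ (top [ i ]≔ false) top i s top-ones ≈ 0#
    coefficient-0 i s = guard-0 (does (agreeElsewhere? Γ below top i s top-ones)) λ _ → reflexive (≡.trans
      (local-twisting Γ below top i (λ j j≢i → Vecₚ.lookup∘update′ j≢i top false) top-ones [] s
        (Fin-unique (single below) _ _) (Fin-unique (single top) _ _))
      (≡.trans (cong (m factor) (Vecₚ.lookup-replicate (circle Γ top (combine i UL)) one)) (m-one factor)))
      where
      open import Data.List.Base using ([])
      below : State ℓ
      below = top [ i ]≔ false
      factor : Basis
      factor = lookup s (circle Γ below (combine i UL))

    boundary-0 : ∀ b → ∂ Γ b top top-ones ≈ 0#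
    boundary-0 b = sum-0 {ℓ} λ k → summand-0 b top top-ones k λ _ s → inj₁ (coefficient-0 k s)

    fundamental : Chain Γ
    fundamental = Indicator.δ (top , top-ones)

    fundamental-member : ∀ {P : State ℓ → Set} → P top → ∀ α s → ¬ (P α × tensorDegree s ≡ degree 0 0) → fundamental α s ≈ 0#
    fundamental-member {P} p α s ∉ = reflexive (Indicator.δ-≢ (top , top-ones) α s λ { refl → ∉ (p , tensorDegree-ones (#circles Γ top)) })

    fundamental-closed : ∀ α s → ∂ Γ fundamental α s ≈ 0#
    -- Regarded as an element of the source for degree `suc ℓ`, the chain has its boundary in that
    -- degree, where there are no states.
    fundamental-closed α s = ∂-member (degree 0 0) (suc ℓ) {fundamental}
      (fundamental-member {λ α → suc ∣ α ∣ ≡ suc ℓ} (cong suc (∣allOnes∣ ℓ))) α s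
      λ (p , _) → ℕₚ.<⇒≢ (ℕ.s≤s (∣p∣≤n α)) p

    class : Cycle (chains Γ) (homogeneous Γ (λ α → ∣ α ∣ ≡ ℓ) (degree 0 0)) (homogeneous Γ (λ α → suc ∣ α ∣ ≡ ℓ) (degree 0 0)) (∂-linear Γ)
    class = cycle fundamental (fundamental-member {λ α → ∣ α ∣ ≡ ℓ} (∣allOnes∣ ℓ)) fundamental-closed

    -- A relation is evaluated at the coordinate `(top , top-ones)`: the class contributes `c 0F`,
    -- the boundary contributes zero.
    class-independent : LinearlyIndependent (MH Γ ℓ (degree 0 0)) {1} (λ _ → class)
    class-independent c (by b _ e) 0F = ≈-trans (≈-sym (≈-trans (+-identityʳ _)
      (≈-trans (*-congˡ (reflexive (Indicator.δ-≡ (top , top-ones) top top-ones refl))) (*-identityʳ (c 0F)))))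
      (≈-trans (e top top-ones) (≈-trans (+-identityˡ _) (boundary-0 b)))

    rank-positive : ∀ {r} → HasRank (MH Γ ℓ (degree 0 0)) r → 1 ℕ.≤ r
    rank-positive (_ , maximal) = maximal (λ _ → class) class-independent

-- Comparison of the homology with the bracket

open import Algebra.Bundles using (CommutativeRing)
open import Data.Bool.Base using (true; false)
open import Data.Fin.Base using (Fin)
open import Data.Integer.Base as ℤ using (+_)
import Data.Integer.Properties as ℤₚ
open import Data.Nat.Base as ℕ using (ℕ; NonZero; s≤s; z≤n)
import Data.Nat.Properties as ℕₚ
open import Data.Product.Base using (∃; ∃₂; _×_; _,_)
open import Data.Sum.Base using (_⊎_)
open import Data.Vec.Base using (Vec; []; _∷_)
open import Level using (0ℓ)
open import Relation.Binary.PropositionalEquality as ≡ using (_≡_; cong; cong₂)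
open import Relation.Nullary using (Dec; ¬_)
open import Defs
open Tensor
open Localization
open Examples
open Homology
open Nonvanishing

-- The two smoothings at an edge have equal values, which the skein relation subtracts; this
-- requires at least one edge.
resolve-constant : ∀ {n} .{{_ : NonZero n}} ℓ (value : State ℓ → ℤ[𝒢] n) g c → (∀ α → value α g ≡ c) → 1 ℕ.≤ ℓ →
  resolve n ℓ value g ≡ + 0
resolve-constant (ℕ.suc ℕ.zero)      value g c e _ = ≡.trans (cong₂ ℤ._-_ (e (false ∷ [])) (e (true ∷ []))) (ℤₚ.+-inverseʳ c)
resolve-constant (ℕ.suc (ℕ.suc ℓ)) value g c e _ = cong₂ ℤ._-_
  (resolve-constant (ℕ.suc ℓ) (λ α → value (false ∷ α)) g c (λ α → e (false ∷ α)) (s≤s z≤n))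
  (resolve-constant (ℕ.suc ℓ) (λ α → value (true ∷ α)) g c (λ α → e (true ∷ α)) (s≤s z≤n))

single-bracket : ∀ {n} .{{_ : NonZero n}} Γ → (∀ α → #circles Γ α ≡ 1) → 1 ℕ.≤ PerfectMatchingGraph.ℓ Γ → ∀ g →
  bracket n Γ g ≡ + 0
single-bracket Γ single 1≤ℓ g = resolve-constant (PerfectMatchingGraph.ℓ Γ) (λ α → circleValue ^⊛ #circles Γ α) g
  ((circleValue ^⊛ 1) g) (λ α → cong (λ k → (circleValue ^⊛ k) g) (single α)) 1≤ℓ

module _ (n : ℕ) .{{_ : NonZero n}} (R : CommutativeRing 0ℓ 0ℓ) (1/3n : CommutativeRing.Carrier R) where

  IsMhOver : PerfectMatchingGraph → Poly n → Set
  IsMhOver Γ P = ∀ i g → HasRank (Complex.MH n R 1/3n Γ i g) (coeff P i g)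

  -- Formulated for an arbitrary coefficient ring: the argument runs over a domain with decidable
  -- zero in which 3n is invertible, and ℤ[1/3n] is substituted at the end.
  MoreInformativeOver : Set
  MoreInformativeOver =
    (∀ Γ → PerfectMatchingGraph.Trivalent Γ →
      (∃ λ P → IsMhOver Γ P) × (∀ P → IsMhOver Γ P → (P [t=-1]) ≐ bracket n Γ)) ×
    (∃₂ λ Γ Γ′ →
      PerfectMatchingGraph.Trivalent Γ × PerfectMatchingGraph.Trivalent Γ′ ×
      (bracket n Γ ≐ bracket n Γ′) × (∃₂ λ P P′ → IsMhOver Γ P × IsMhOver Γ′ P′ × ¬ (P ≋ P′)))

module Comparison (n : ℕ) .{{_ : NonZero n}} (R : CommutativeRing 0ℓ 0ℓ) (1/3n : CommutativeRing.Carrier R)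
  (inverse : Calculus.Inverse n R 1/3n)
  (zero? : ∀ x → Dec (CommutativeRing._≈_ R x (CommutativeRing.0# R)))
  (integral : ∀ x y → CommutativeRing._≈_ R (CommutativeRing._*_ R x y) (CommutativeRing.0# R) →
    CommutativeRing._≈_ R x (CommutativeRing.0# R) ⊎ CommutativeRing._≈_ R y (CommutativeRing.0# R))
  (1≉0 : ¬ CommutativeRing._≈_ R (CommutativeRing.1# R) (CommutativeRing.0# R)) where

  module Ranks = ChainRanks n R 1/3n inverse zero? integral 1≉0

  module _ (Γ Γ′ : PerfectMatchingGraph)
    (trivalent : PerfectMatchingGraph.Trivalent Γ) (trivalent′ : PerfectMatchingGraph.Trivalent Γ′)
    (single : ∀ α → #circles Γ α ≡ 1) (single′ : ∀ α → #circles Γ′ α ≡ 1)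
    (1≤ℓ : 1 ℕ.≤ PerfectMatchingGraph.ℓ Γ) (ℓ<ℓ′ : PerfectMatchingGraph.ℓ Γ ℕ.< PerfectMatchingGraph.ℓ Γ′) where

    open PerfectMatchingGraph Γ using (ℓ)
    open PerfectMatchingGraph Γ′ using () renaming (ℓ to ℓ′)

    private
      module Single′ = SingleCircles n R 1/3n inverse zero? integral 1≉0 Γ′ trivalent′ single′

    -- In homological degree ℓ′ the complex of Γ has ended, while that of Γ′ carries the class of 1
    -- in its last summand.
    Mh-≢ : ∀ P P′ → IsMhOver n R 1/3n Γ P → IsMhOver n R 1/3n Γ′ P′ → ¬ (P ≋ P′)
    Mh-≢ P P′ Mh Mh′ P≋P′ = ℕₚ.<⇒≢ (Single′.rank-positive (Mh′ ℓ′ (degree 0 0))) (≡.trans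
      (≡.trans (≡.sym (Ranks.homologyRank-0 Γ trivalent (degree 0 0) ℓ′ ℓ<ℓ′))
        (rank-unique (Complex.MH n R 1/3n Γ ℓ′ (degree 0 0))
          (Ranks.hasHomologyRank Γ trivalent (degree 0 0) ℓ′) (Mh ℓ′ (degree 0 0))))
      (P≋P′ ℓ′ (degree 0 0)))

    same-bracket-different-Mh : (bracket n Γ ≐ bracket n Γ′) ×
      (∃₂ λ P P′ → IsMhOver n R 1/3n Γ P × IsMhOver n R 1/3n Γ′ P′ × ¬ (P ≋ P′))
    same-bracket-different-Mh =
      (λ g → ≡.trans (single-bracket Γ single 1≤ℓ g)
        (≡.sym (single-bracket Γ′ single′ (ℕₚ.≤-trans 1≤ℓ (ℕₚ.<⇒≤ ℓ<ℓ′)) g))) ,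
      P , P′ , Ranks.poincaré-rank Γ trivalent , Ranks.poincaré-rank Γ′ trivalent′ ,
      Mh-≢ P P′ (Ranks.poincaré-rank Γ trivalent) (Ranks.poincaré-rank Γ′ trivalent′)
      where
      P P′ : Poly n
      P  = Ranks.poincaré Γ trivalent
      P′ = Ranks.poincaré Γ′ trivalent′

  dumbbell-chain : ∃₂ λ Γ Γ′ →
    PerfectMatchingGraph.Trivalent Γ × PerfectMatchingGraph.Trivalent Γ′ ×
    (bracket n Γ ≐ bracket n Γ′) × (∃₂ λ P P′ → IsMhOver n R 1/3n Γ P × IsMhOver n R 1/3n Γ′ P′ × ¬ (P ≋ P′))
  dumbbell-chain = dumbbell , chain , dumbbell-trivalent , chain-trivalent ,
    same-bracket-different-Mh dumbbell chain dumbbell-trivalent chain-trivalent dumbbell-circles chain-circles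
      ℕₚ.≤-refl ℕₚ.≤-refl

  Mh-bracket : ∀ Γ → PerfectMatchingGraph.Trivalent Γ →
    (∃ λ P → IsMhOver n R 1/3n Γ P) × (∀ P → IsMhOver n R 1/3n Γ P → (P [t=-1]) ≐ bracket n Γ)
  Mh-bracket Γ trivalent = (Ranks.poincaré Γ trivalent , Ranks.poincaré-rank Γ trivalent) ,
    Ranks.poincaré-bracket Γ trivalent

  comparison : MoreInformativeOver n R 1/3n
  comparison = Mh-bracket , dumbbell-chain

-- The instance of NonZero (3 ℕ.* n) in the definition of Möbius cannot be named;
-- unification with the neutral term tensorDegree s recovers it. Any other
-- instance would be judgementally equal, but too costly to compare.
comparison-ℤ[1/3n] : ∀ n .{{_ : NonZero n}} .{nonZero : NonZero (3 ℕ.* n)} →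
  (∀ {k} (s : Vec (Fin n × Fin 3) k) →
    Möbius.tensorDegree n s ≡ Complex.tensorDegree n (ℤ[1/_] (3 ℕ.* n) {{nonZero}}) (reciprocal (3 ℕ.* n) {{nonZero}}) s) →
  MoreInformativeOver n (ℤ[1/_] (3 ℕ.* n) {{nonZero}}) (reciprocal (3 ℕ.* n) {{nonZero}})
comparison-ℤ[1/3n] n {nonZero} _ = Comparison.comparison n (ℤ[1/_] (3 ℕ.* n) {{nonZero}}) (reciprocal (3 ℕ.* n) {{nonZero}})
  (localized-inverse n {{nonZero = nonZero}}) (localized-zero? (3 ℕ.* n) {{nonZero}})
  (localized-integral (3 ℕ.* n) {{nonZero}}) (localized-1≉0 (3 ℕ.* n) {{nonZero}})

module _ (n : ℕ) .{{_ : NonZero n}} where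

  comparison-Möbius = comparison-ℤ[1/3n] n (λ s → ≡.refl)

proposition6p1p4 : ∀ (n : ℕ) .{{_ : NonZero n}} →
    (∀ Γ → PerfectMatchingGraph.Trivalent Γ →
    (∃ λ P → IsMh n Γ P) ×
    (∀ P → IsMh n Γ P → (P [t=-1]) ≐ bracket n Γ)) ×
    (∃₂ λ Γ Γ′ →
    PerfectMatchingGraph.Trivalent Γ × PerfectMatchingGraph.Trivalent Γ′ ×
    (bracket n Γ ≐ bracket n Γ′) ×
    (∃₂ λ P P′ → IsMh n Γ P × IsMh n Γ′ P′ × ¬ (P ≋ P′)))
proposition6p1p4 n = comparison-Möbius n
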